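{- Let $H$ be a hexagonal system, let $M$ be a perfect matching of $H$ with $af(H,M)=Af(H)$ or $af(H,M)=Af(H)-1$, and let $\mathcal{A}$ be a non-crossing compatible $M$-alternating set of $H$ of maximum cardinality among all non-crossing compatible $M$-alternating sets of $H$. Then (1) any two members of $\mathcal{A}$ have disjoint interiors, and (2) for every $C\in\mathcal{A}$, the subgraph $I[C]$ is a linear chain.
   Context: A hexagonal system is a 2-connected finite plane graph in which every interior face is bounded by a regular hexagon of side length one; its interior faces are called hexagons. For a cycle $C$ of $H$, $I[C]$ denotes the subgraph of $H$ consisting of $C$ together with its interior. A linear chain is a hexagonal system in which every vertex lies on the outer boundary, no hexagon is adjacent to three others, and the centers of all hexagons lie on a straight line (a single hexagon is a linear chain). For a perfect matching $M$ of a graph $G$, a cycle is $M$-alternating if its edges alternate between $M$ and $E(G)\setminus M$. Two $M$-alternating cycles are compatible if they are disjoint or intersect only in edges of $M$; a compatible $M$-alternating set is a set of pairwise compatible $M$-alternating cycles. Such a set is non-crossing if for any two of its members, their interiors are either disjoint or one contains the other. A set $S\subseteq E(G)\setminus M$ is an anti-forcing set of $M$ if $G-S$ has $M$ as its unique perfect matching; $af(G,M)$ is the minimum size of an anti-forcing set of $M$, and $Af(G)$ is the maximum of $af(G,M)$ over all perfect matchings $M$ of $G$. -}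

module Defs where

open import Data.Bool using (Bool; true; false; _∧_; _∨_)
open import Data.Integer as ℤ using (ℤ; +_; _≟_; _≤?_)
open import Data.Nat as ℕ using (ℕ; zero; suc; _%_; _≤_; _∸_)
open import Data.Fin using (Fin)
open import Data.List using (List; []; _∷_; _++_; [_]; zip; length; lookup)
open import Data.List.Membership.Propositional using (_∈_)
open import Data.List.Relation.Unary.All using (All)
open import Data.List.Relation.Unary.Unique.Propositional using (Unique)
open import Data.Product using (_×_; _,_; Σ; ∃; ∃-syntax)
open import Data.Sum using (_⊎_)
open import Data.Empty using (⊥)
open import Relation.Nullary using (¬_)
open import Relation.Nullary.Decidable using (⌊_⌋)
open import Relation.Binary.PropositionalEquality using (_≡_; _≢_)

-- The hexagonal (honeycomb) lattice in "brick-wall" coordinates.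
-- Vertices are points of ℤ²; horizontal edges (x,y)-(x+1,y) always,
-- vertical edges (x,y)-(x,y+1) exactly when x+y is even.
-- A hexagon (cell) is indexed by (p,q) ∈ ℤ²; its lower-left corner is
-- (2p-q, q) and it has vertices (x0+i, y0+j), i ∈ {0,1,2}, j ∈ {0,1}.
-- Two cells (p,q),(p',q') share an edge iff their difference is one of
-- ±(1,0), ±(0,1), ±(1,1); the map (p,q) ↦ hexagon centre is affine,
-- so collinearity of centres can be tested in (p,q)-coordinates.

V : Set
V = ℤ × ℤ

Cell : Set
Cell = ℤ × ℤ

origin : Cell → V
origin (p , q) = (+ 2 ℤ.* p ℤ.- q , q)

cellVerts : Cell → List V
cellVerts c with origin c
... | (x , y) = (x , y) ∷ (x ℤ.+ + 1 , y) ∷ (x ℤ.+ + 2 , y)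
              ∷ (x , y ℤ.+ + 1) ∷ (x ℤ.+ + 1 , y ℤ.+ + 1) ∷ (x ℤ.+ + 2 , y ℤ.+ + 1) ∷ []

cellEdges : Cell → List (V × V)
cellEdges c with origin c
... | (x , y) =
  ((x , y) , (x ℤ.+ + 1 , y)) ∷ ((x ℤ.+ + 1 , y) , (x ℤ.+ + 2 , y))
  ∷ ((x , y ℤ.+ + 1) , (x ℤ.+ + 1 , y ℤ.+ + 1))
  ∷ ((x ℤ.+ + 1 , y ℤ.+ + 1) , (x ℤ.+ + 2 , y ℤ.+ + 1))
  ∷ ((x , y) , (x , y ℤ.+ + 1)) ∷ ((x ℤ.+ + 2 , y) , (x ℤ.+ + 2 , y ℤ.+ + 1)) ∷ []

CellVertex : Cell → V → Set
CellVertex c v = v ∈ cellVerts c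

CellEdge : Cell → V → V → Set
CellEdge c u v = ((u , v) ∈ cellEdges c) ⊎ ((v , u) ∈ cellEdges c)

LatEdge : V → V → Set
LatEdge u v = ∃[ c ] CellEdge c u v

AdjCell : Cell → Cell → Set
AdjCell c d = c ≢ d × (∃[ u ] ∃[ v ] (CellEdge c u v × CellEdge d u v))

cycPairs : {A : Set} → List A → List (A × A)
cycPairs []       = []
cycPairs (a ∷ as) = zip (a ∷ as) (as ++ [ a ])

cycEdges : List V → List (V × V)
cycEdges = cycPairs

OnCycle : List V → V → V → Set
OnCycle C u v = ((u , v) ∈ cycEdges C) ⊎ ((v , u) ∈ cycEdges C)

IsCycleIn : (V → V → Set) → List V → Set
IsCycleIn E C = (3 ≤ length C) × Unique C × All (λ e → E (Data.Product.proj₁ e) (Data.Product.proj₂ e)) (cycPairs C)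

LatCycle : List V → Set
LatCycle = IsCycleIn LatEdge

-- Interior of a lattice cycle (Jordan curve, ray casting): a hexagon
-- is inside C iff the horizontal ray from its centre to the right
-- crosses an odd number of edges of C.  The centre of the cell with
-- lower-left corner (x0,y0) is (x0+1, y0+1/2); the ray meets exactly
-- the vertical edges {(a,y0),(a,y0+1)} with a ≥ x0+2.

crosses : V → V × V → Bool
crosses (x0 , y0) ((a , b) , (c , d)) =
  ⌊ a ≟ c ⌋ ∧ ⌊ x0 ℤ.+ + 2 ≤? a ⌋ ∧
  ((⌊ b ≟ y0 ⌋ ∧ ⌊ d ≟ y0 ℤ.+ + 1 ⌋) ∨ (⌊ d ≟ y0 ⌋ ∧ ⌊ b ≟ y0 ℤ.+ + 1 ⌋))

countT : {A : Set} → (A → Bool) → List A → ℕ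
countT f [] = 0
countT f (a ∷ as) with f a
... | true  = suc (countT f as)
... | false = countT f as

Inside : List V → Cell → Set
Inside C c = countT (crosses (origin c)) (cycEdges C) % 2 ≡ 1

-- A hexagonal system H is given by its outer boundary B, a lattice
-- cycle; H = I[B]: hexagons are the cells inside B, vertices and edges
-- are those of its hexagons.

HexSystem : Set
HexSystem = Σ (List V) LatCycle

bd : HexSystem → List V
bd (B , _) = B

HVert : HexSystem → V → Set
HVert H v = ∃[ c ] (Inside (bd H) c × CellVertex c v)

HEdge : HexSystem → V → V → Set
HEdge H u v = ∃[ c ] (Inside (bd H) c × CellEdge c u v)

EdgeSet : Set
EdgeSet = List (V × V)

InE : EdgeSet → V → V → Set
InE M u v = ((u , v) ∈ M) ⊎ ((v , u) ∈ M)

-- no unordered edge is listed twice (so length = cardinality)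
DistinctEdges : EdgeSet → Set
DistinctEdges S = (i j : Fin (length S)) → i ≢ j →
  ¬ InE [ lookup S i ] (Data.Product.proj₁ (lookup S j)) (Data.Product.proj₂ (lookup S j))

IsPM : (V → Set) → (V → V → Set) → EdgeSet → Set
IsPM Vt E M =
  All (λ e → E (Data.Product.proj₁ e) (Data.Product.proj₂ e)) M ×
  (∀ v → Vt v → ∃[ u ] InE M v u) ×
  (∀ v u w → InE M v u → InE M v w → u ≡ w)

PerfectMatching : HexSystem → EdgeSet → Set
PerfectMatching H = IsPM (HVert H) (HEdge H)

AntiForcing : HexSystem → EdgeSet → EdgeSet → Set
AntiForcing H M S =
  All (λ e → HEdge H (Data.Product.proj₁ e) (Data.Product.proj₂ e) ×
             ¬ InE M (Data.Product.proj₁ e) (Data.Product.proj₂ e)) S ×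
  IsPM (HVert H) (λ u v → HEdge H u v × ¬ InE S u v) M ×
  (∀ M' → IsPM (HVert H) (λ u v → HEdge H u v × ¬ InE S u v) M' →
          ∀ u v → (InE M' u v → InE M u v) × (InE M u v → InE M' u v))

AfValue : HexSystem → EdgeSet → ℕ → Set
AfValue H M k =
  (∃[ S ] (AntiForcing H M S × DistinctEdges S × length S ≡ k)) ×
  (∀ S → AntiForcing H M S → DistinctEdges S → k ≤ length S)

AfMax : HexSystem → ℕ → Set
AfMax H K =
  (∃[ M ] (PerfectMatching H M × AfValue H M K)) ×
  (∀ M k → PerfectMatching H M → AfValue H M k → k ≤ K)

ExactlyOne : EdgeSet → (V × V) × (V × V) → Set
ExactlyOne M ((a , b) , (c , d)) =
  (InE M a b → ¬ InE M c d) × (¬ InE M a b → InE M c d)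

MAltCycle : HexSystem → EdgeSet → List V → Set
MAltCycle H M C = IsCycleIn (HEdge H) C × All (ExactlyOne M) (cycPairs (cycEdges C))

Compatible : EdgeSet → List V → List V → Set
Compatible M C D =
  (∀ v → v ∈ C → v ∈ D → ⊥) ⊎
  ((∀ u v → OnCycle C u v → OnCycle D u v → InE M u v) ×
   (∀ v → v ∈ C → v ∈ D → ∃[ u ] (OnCycle C v u × OnCycle D v u)))

NonCrossingPair : List V → List V → Set
NonCrossingPair C D =
  (∀ c → Inside C c → Inside D c → ⊥) ⊎
  (∀ c → Inside C c → Inside D c) ⊎
  (∀ c → Inside D c → Inside C c)

NCCompatibleAltSet : HexSystem → EdgeSet → List (List V) → Set
NCCompatibleAltSet H M A =
  All (MAltCycle H M) A ×
  ((i j : Fin (length A)) → i ≢ j →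
     Compatible M (lookup A i) (lookup A j) × NonCrossingPair (lookup A i) (lookup A j))

DisjointInteriors : List V → List V → Set
DisjointInteriors C D = ∀ c → Inside C c → Inside D c → ⊥

Collinear : Cell → Cell → Cell → Set
Collinear (p₁ , q₁) (p₂ , q₂) (p₃ , q₃) =
  (p₂ ℤ.- p₁) ℤ.* (q₃ ℤ.- q₁) ℤ.- (q₂ ℤ.- q₁) ℤ.* (p₃ ℤ.- p₁) ≡ + 0

LinearChainI : List V → Set
LinearChainI C =
  (∀ c v → Inside C c → CellVertex c v → v ∈ C) ×
  (∀ c → Inside C c → ¬ (∃[ d₁ ] ∃[ d₂ ] ∃[ d₃ ]
       (Inside C d₁ × Inside C d₂ × Inside C d₃ ×
        AdjCell c d₁ × AdjCell c d₂ × AdjCell c d₃ ×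
        d₁ ≢ d₂ × d₁ ≢ d₃ × d₂ ≢ d₃))) ×
  (∀ c₁ c₂ c₃ → Inside C c₁ → Inside C c₂ → Inside C c₃ → Collinear c₁ c₂ c₃)

{-# OPTIONS --safe #-}
-- Crossing an edge from one cell to the next along u₀, u₁ or u₂ is given the increment 1 if the edge is outside
-- M, and -2 if it is in M; around a vertex the increments sum to 0.  An alternating cycle becomes the boundary of a
-- cut: a region all of whose boundary edges outside M are crossed in the same sense, and compatible cycles
-- become cuts sharing no edge outside M.  Anti-forcing sets are the sets of edges meeting every cut.  So the
-- Lucchesi–Younger theorem together with an uncrossing argument gives af(H,M) = |A|, and for any perfect
-- matching no more than |A| + 1 disjoint cuts exist.
-- The interior X of a member of A carries a height function with these increments.  Rotating all alternating
-- hexagons of X on a lowest level, and replacing the members inside X by the hexagons which become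
-- alternating, produces |A| + 2 disjoint cuts of another perfect matching, unless the cells of X form a
-- straight chain with its only alternating hexagon of the sign of X at one end.  Two nested chains would
-- share either this hexagon and an edge leaving it sideways, or force three cells of the outer one out of line.

module Submission where

open import Defs
open import Data.Bool using (Bool; true; false; not; _∧_; _∨_; _xor_; if_then_else_)
import Data.Bool.Properties as Boolₚ
open import Data.Empty using (⊥; ⊥-elim)
open import Data.Fin as Fin using (Fin; zero; suc; toℕ; fromℕ<; splitAt)
import Data.Fin.Properties as Finₚ
open import Data.Integer as ℤ using (ℤ; +_; -[1+_])
import Data.Integer.Properties as ℤₚ
open import Data.Integer.Solver using (module +-*-Solver)
open import Data.List using (List; []; _∷_; _++_; [_]; length; lookup; map; zip; tabulate; concatMap; applyUpTo; filter; deduplicate)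
open import Data.List.Properties using (length-map; map-++; length-++; map-∘; map-id-local; length-tabulate)
import Data.List.Membership.DecPropositional as DecMembership
open import Data.List.Membership.Propositional using (_∈_; _∉_)
open import Data.List.Membership.Propositional.Properties using (∈-map⁺; ∈-map⁻; ∈-++⁻; ∈-concat⁺′; ∈-applyUpTo⁺; ∈-filter⁺; ∈-filter⁻; ∈-lookup; ∈-deduplicate⁺; ∈-deduplicate⁻)
open import Data.List.Relation.Binary.Permutation.Propositional using (_↭_; prep; ↭-trans) renaming (swap to ↭-swap)
import Data.List.Relation.Binary.Permutation.Propositional.Properties as Permₚ
open import Data.List.Relation.Unary.All as All using (All; []; _∷_)
import Data.List.Relation.Unary.All.Properties as Allₚ
open import Data.List.Relation.Unary.AllPairs as AllPairs using (AllPairs; []; _∷_)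
import Data.List.Relation.Unary.AllPairs.Properties as AllPairsₚ
open import Data.List.Relation.Unary.Any as Any using (Any; here; there; index)
open import Data.List.Relation.Unary.Any.Properties using (lookup-index)
import Data.List.Relation.Unary.Unique.DecPropositional.Properties as DecUniqueₚ
open import Data.List.Relation.Unary.Unique.Propositional using (Unique)
import Data.List.Relation.Unary.Unique.Propositional.Properties as Uniqueₚ
open import Data.Nat as ℕ using (ℕ; zero; suc; z≤n; s≤s; _+_; _*_; _≤_; _<_; _∸_; _%_; ⌊_/2⌋; ⌈_/2⌉)
open import Data.Nat.DivMod using ([m+n]%n≡m%n)
open import Data.Nat.ListAction using (sum)
open import Data.Nat.ListAction.Properties using (sum-↭)
import Data.Nat.Properties as ℕₚ
import Data.Nat.Solver as ℕ-Solver
open import Data.Product as Product using (_×_; _,_; proj₁; proj₂; Σ; ∃; ∃-syntax)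
import Data.Product.Properties as Prodₚ
open import Data.Sum using (_⊎_; inj₁; inj₂; [_,_]′)
open import Function using (_∘_; id; case_of_)
open import Relation.Binary using (tri<; tri≈; tri>)
open import Relation.Binary.PropositionalEquality hiding ([_]; J)
open import Relation.Nullary using (¬_; Dec; yes; no; contradiction)
open import Relation.Nullary.Decidable using (⌊_⌋; ¬¬-excluded-middle; decidable-stable; _→-dec_; _⊎-dec_; _×-dec_; ¬?)

-- Least elements and undecided alternatives are used under double negation. This is harmless: the
-- conclusions amount to memberships, equations of integers and absurdities, which are stable.
--
-- The bound |A| + 1 is where the hypothesis on af enters: af(H,M) ≤ |A| gives Af(H) ≤ |A| + 1, and
-- the cuts of a packing use up different edges of every anti-forcing set.
--
-- To gain two cuts, three new hexagons are needed, because X itself is given up. The obstacle is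
-- that a rotation also destroys hexagons of the opposite sign which may be members. Each of these
-- is replaced by the cell two steps away in a fixed direction, and the new hexagons are taken next
-- to an extremal rotated cell, where no replacement lands. A hexagon of the sign of X which is a
-- member has all three ways up inside X; at most one such hexagon is not a member, and the chain
-- grows from it.
--
-- Heights exist because X has no holes. This is expressed by half-lines: a closed walk in X crosses
-- the half-line from a vertex zero times on balance, unless that vertex is interior.

module Classical where

  ¬¬-∀∈ : ∀ {a p} {A : Set a} {P : A → Set p} (xs : List A) →
    (∀ x → x ∈ xs → ¬ ¬ P x) → ¬ ¬ (∀ x → x ∈ xs → P x)
  ¬¬-∀∈ []       f k = k (λ _ ())
  ¬¬-∀∈ (y ∷ ys) f k =
    f y (here refl) λ py → ¬¬-∀∈ ys (λ x i → f x (there i)) λ ps →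
    k λ { x (here refl) → py ; x (there i) → ps x i }

  ¬¬-least : ∀ {p} {P : ℕ → Set p} n → P n → ¬ ¬ (∃[ m ] (P m × (∀ k → P k → m ≤ k)))
  ¬¬-least {P = P} n pn k = go n n ℕₚ.≤-refl pn
    where
    mutual
      go : ∀ fuel m → m ≤ fuel → P m → ⊥
      go fuel m m≤ pm = ¬¬-excluded-middle {A = ∃[ j ] (P j × j < m)} λ
        { (no ¬j) → k (m , pm , λ j pj → ℕₚ.≮⇒≥ (λ j<m → ¬j (j , pj , j<m)))
        ; (yes (j , pj , j<m)) → step fuel j m pj j<m m≤ }
      step : ∀ fuel j m → P j → j < m → m ≤ fuel → ⊥
      step zero j m pj j<m m≤ = ℕₚ.n≮0 (ℕₚ.<-≤-trans j<m m≤)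
      step (suc fuel) j m pj j<m m≤ = go fuel j (ℕₚ.≤-pred (ℕₚ.<-≤-trans j<m m≤)) pj

  ¬¬-argmin : ∀ {a p} {A : Set a} {P : A → Set p} (f : A → ℕ) (x : A) → P x →
    ¬ ¬ (∃[ m ] (P m × (∀ y → P y → f m ≤ f y)))
  ¬¬-argmin {P = P} f x px k =
    ¬¬-least {P = λ n → ∃[ y ] (P y × f y ≡ n)} (f x) (x , px , refl)
      λ { (_ , (m , pm , refl) , min) → k (m , pm , λ y py → min (f y) (y , py , refl)) }
  ¬¬-decide : ∀ {a p} {A : Set a} (P : A → Set p) (xs : List A) → ¬ ¬ (∀ x → x ∈ xs → Dec (P x))
  ¬¬-decide P xs = ¬¬-∀∈ xs (λ _ _ → ¬¬-excluded-middle)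

open Classical public

-- Directions, edges and matchings on the triangular lattice of cells

data Dir : Set where
  d0 d1 d2 : Dir

_≟ᵈ_ : (i j : Dir) → Dec (i ≡ j)
d0 ≟ᵈ d0 = yes refl
d0 ≟ᵈ d1 = no λ ()
d0 ≟ᵈ d2 = no λ ()
d1 ≟ᵈ d0 = no λ ()
d1 ≟ᵈ d1 = yes refl
d1 ≟ᵈ d2 = no λ ()
d2 ≟ᵈ d0 = no λ ()
d2 ≟ᵈ d1 = no λ ()
d2 ≟ᵈ d2 = yes refl

data Perm : Dir → Dir → Dir → Set where
  p012 : Perm d0 d1 d2
  p120 : Perm d1 d2 d0
  p201 : Perm d2 d0 d1
  p102 : Perm d1 d0 d2
  p021 : Perm d0 d2 d1
  p210 : Perm d2 d1 d0

-- fw true translates by u₀ = (-1,0), u₁ = (0,-1), u₂ = (1,1), and fw false by -uₖ; u₀ + u₁ + u₂ = 0.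
fw : Bool → Dir → Cell → Cell
fw true  d0 (p , q) = ℤ.pred p , q
fw true  d1 (p , q) = p , ℤ.pred q
fw true  d2 (p , q) = ℤ.suc p , ℤ.suc q
fw false d0 (p , q) = ℤ.suc p , q
fw false d1 (p , q) = p , ℤ.suc q
fw false d2 (p , q) = ℤ.pred p , ℤ.pred q

fw-inv : ∀ s k c → fw s k (fw (not s) k c) ≡ c
fw-inv true  d0 (p , q) = cong (_, q) (ℤₚ.pred-suc p)
fw-inv true  d1 (p , q) = cong (p ,_) (ℤₚ.pred-suc q)
fw-inv true  d2 (p , q) = cong₂ _,_ (ℤₚ.suc-pred p) (ℤₚ.suc-pred q)
fw-inv false d0 (p , q) = cong (_, q) (ℤₚ.suc-pred p)
fw-inv false d1 (p , q) = cong (p ,_) (ℤₚ.suc-pred q)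
fw-inv false d2 (p , q) = cong₂ _,_ (ℤₚ.pred-suc p) (ℤₚ.pred-suc q)

not-not : ∀ s → not (not s) ≡ s
not-not true  = refl
not-not false = refl

fw-inv′ : ∀ s k c → fw (not s) k (fw s k c) ≡ c
fw-inv′ s k c = trans (cong (λ t → fw (not s) k (fw t k c)) (sym (not-not s))) (fw-inv (not s) k c)

fw-injective : ∀ s k {c d} → fw s k c ≡ fw s k d → c ≡ d
fw-injective s k {c} {d} eq = trans (sym (fw-inv′ s k c)) (trans (cong (fw (not s) k) eq) (fw-inv′ s k d))

-- Since uᵢ + uⱼ = -uₗ, two steps in different directions close up to a triangle of cells; these
-- triangles are the vertices of the hexagonal lattice.
fw-fw : ∀ s {i j l} → Perm i j l → ∀ c → fw s j (fw s i c) ≡ fw (not s) l c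
fw-fw true  p012 c = refl
fw-fw true  p120 (p , q) = cong (ℤ.suc p ,_) (ℤₚ.suc-pred q)
fw-fw true  p201 (p , q) = cong (_, ℤ.suc q) (ℤₚ.pred-suc p)
fw-fw true  p102 c = refl
fw-fw true  p021 (p , q) = cong (_, ℤ.suc q) (ℤₚ.suc-pred p)
fw-fw true  p210 (p , q) = cong (ℤ.suc p ,_) (ℤₚ.pred-suc q)
fw-fw false p012 c = refl
fw-fw false p120 (p , q) = cong (ℤ.pred p ,_) (ℤₚ.pred-suc q)
fw-fw false p201 (p , q) = cong (_, ℤ.pred q) (ℤₚ.suc-pred p)
fw-fw false p102 c = refl
fw-fw false p021 (p , q) = cong (_, ℤ.pred q) (ℤₚ.pred-suc p)
fw-fw false p210 (p , q) = cong (ℤ.pred p ,_) (ℤₚ.suc-pred q)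

rot : ∀ {i j l} → Perm i j l → Perm j l i
rot p012 = p120
rot p120 = p201
rot p201 = p012
rot p102 = p021
rot p021 = p210
rot p210 = p102

rev : ∀ {i j l} → Perm i j l → Perm l j i
rev p012 = p210
rev p120 = p021
rev p201 = p102
rev p102 = p201
rev p021 = p120
rev p210 = p012

swapˡ : ∀ {i j l} → Perm i j l → Perm j i l
swapˡ = rot ∘ rev

complete : ∀ {i j} → i ≢ j → ∃[ l ] Perm i j l
complete {d0} {d0} ne = ⊥-elim (ne refl)
complete {d0} {d1} ne = d2 , p012
complete {d0} {d2} ne = d1 , p021
complete {d1} {d0} ne = d2 , p102
complete {d1} {d1} ne = ⊥-elim (ne refl)
complete {d1} {d2} ne = d0 , p120
complete {d2} {d0} ne = d1 , p201
complete {d2} {d1} ne = d0 , p210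
complete {d2} {d2} ne = ⊥-elim (ne refl)

others : ∀ k → ∃[ i ] ∃[ j ] Perm k i j
others d0 = d1 , d2 , p012
others d1 = d2 , d0 , p120
others d2 = d0 , d1 , p201

perm-≢ : ∀ {i j l} → Perm i j l → i ≢ j
perm-≢ p012 ()
perm-≢ p120 ()
perm-≢ p201 ()
perm-≢ p102 ()
perm-≢ p021 ()
perm-≢ p210 ()

data One : Bool → Bool → Bool → Set where
  one₁ : One true false false
  one₂ : One false true false
  one₃ : One false false true

One-rot : ∀ {a b c} → One a b c → One b c a
One-rot one₁ = one₃
One-rot one₂ = one₁
One-rot one₃ = one₂

One-rev : ∀ {a b c} → One a b c → One c b a
One-rev one₁ = one₃
One-rev one₂ = one₂
One-rev one₃ = one₁

-- The edge (c , k) separates the cells c and fw true k c.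
Edges : Set
Edges = Cell → Dir → Bool
-- Edges are stored at their tail for `fw true`, so a step along `fw false` looks its edge up at the
-- target.
across : Edges → Bool → Cell → Dir → Bool
across μ true  c k = μ c k
across μ false c k = μ (fw false k c) k

across-fw : ∀ μ s c k → across μ (not s) (fw s k c) k ≡ across μ s c k
across-fw μ true  c k = cong (λ d → μ d k) (fw-inv′ true k c)
across-fw μ false c k = refl

across-back : ∀ μ s c k → across μ s (fw (not s) k c) k ≡ across μ (not s) c k
across-back μ true  c k = refl
across-back μ false c k = cong (λ d → μ d k) (fw-inv′ true k c)

-- The three cells are those around one vertex; the vertex belongs to the system if one of them
-- does.
Touched : (Cell → Bool) → Bool → Dir → Dir → Cell → Set
Touched Hc s i l c = (Hc c ≡ true) ⊎ (Hc (fw s i c) ≡ true) ⊎ (Hc (fw (not s) l c) ≡ true)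

record IsMatching (Hc : Cell → Bool) (μ : Edges) : Set where
  field
    white   : ∀ c → Touched Hc true d0 d2 c → One (μ c d0) (μ (fw true d0 c) d1) (μ (fw false d2 c) d2)
    black   : ∀ c → Touched Hc true d1 d2 c → One (μ c d1) (μ (fw true d1 c) d0) (μ (fw false d2 c) d2)
    support : ∀ c k → μ c k ≡ true → Hc c ≡ true ⊎ Hc (fw true k c) ≡ true

module _ {Hc : Cell → Bool} {μ : Edges} where

  Law : Bool → Dir → Dir → Dir → Set
  Law s i j l = ∀ c → Touched Hc s i l c → One (across μ s c i) (across μ s (fw s i c) j) (across μ (not s) c l)

  law-rot : ∀ s {i j l} → Perm i j l → Law s i j l → Law s j l i
  law-rot s {i} {j} {l} π L c t =
    subst (λ x → One x y z) e₁ (subst (λ x → One w x z) e₂ (subst (One w y′) e₃ (One-rot (L c′ t′))))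
    where
    c′ = fw (not s) i c
    w  = across μ s (fw s i c′) j
    y′ = across μ (not s) c′ l
    y  = across μ s (fw s j c) l
    z  = across μ (not s) c i
    back : fw (not s) l c′ ≡ fw s j c
    back = trans (sym (fw-fw s π c′)) (cong (fw s j) (fw-inv s i c))
    e₁ : w ≡ across μ s c j
    e₁ = cong (λ d → across μ s d j) (fw-inv s i c)
    e₂ : y′ ≡ y
    e₂ = trans (sym (across-back μ s c′ l)) (cong (λ d → across μ s d l) back)
    e₃ : across μ s c′ i ≡ z
    e₃ = across-back μ s c i
    t′ : Touched Hc s i l c′
    t′ = case t of λ where
      (inj₁ h)        → inj₂ (inj₁ (subst (λ d → Hc d ≡ true) (sym (fw-inv s i c)) h))
      (inj₂ (inj₁ h)) → inj₂ (inj₂ (subst (λ d → Hc d ≡ true) (sym back) h))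
      (inj₂ (inj₂ h)) → inj₁ h

  law-flip : ∀ {i j l} → Perm i j l → Law true l j i → Law false i j l
  law-flip {i} {j} {l} π L c t = subst (λ x → One (μ (fw false i c) i) x (μ c l)) e (One-rev (L c t′))
    where
    e : across μ true (fw true l c) j ≡ across μ false (fw false i c) j
    e = sym (cong (λ d → μ d j) (fw-fw false π c))
    t′ : Touched Hc true l i c
    t′ = case t of λ where
      (inj₁ h)        → inj₁ h
      (inj₂ (inj₁ h)) → inj₂ (inj₂ h)
      (inj₂ (inj₂ h)) → inj₂ (inj₁ h)

  law⁺ : IsMatching Hc μ → ∀ {i j l} → Perm i j l → Law true i j l
  law⁺ pm p012 = IsMatching.white pm
  law⁺ pm p120 = law-rot true p012 (IsMatching.white pm)
  law⁺ pm p201 = law-rot true p120 (law-rot true p012 (IsMatching.white pm))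
  law⁺ pm p102 = IsMatching.black pm
  law⁺ pm p021 = law-rot true p102 (IsMatching.black pm)
  law⁺ pm p210 = law-rot true p021 (law-rot true p102 (IsMatching.black pm))

  -- White and black vertices are triangles run through in the cyclic orders 0, 1, 2 and 1, 0, 2.
  -- Changing the first cell and reversing the sense reduce every order to these two.
  law : IsMatching Hc μ → ∀ s {i j l} → Perm i j l → Law s i j l
  law pm true  π = law⁺ pm π
  law pm false π = law-flip π (law⁺ pm (rev π))

-- Counting

b2n : Bool → ℕ
b2n true  = 1
b2n false = 0

bool-ext : ∀ {a b : Bool} → (a ≡ true → b ≡ true) → (b ≡ true → a ≡ true) → a ≡ b
bool-ext {true}  {true}  f g = refl
bool-ext {true}  {false} f g = sym (f refl)
bool-ext {false} {true}  f g = g refl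
bool-ext {false} {false} f g = refl

bool-cases : ∀ b → (b ≡ true) ⊎ (b ≡ false)
bool-cases true  = inj₁ refl
bool-cases false = inj₂ refl

true≢false : ∀ {b} → b ≡ true → b ≡ false → ⊥
true≢false refl ()

≢true : ∀ {b} → ¬ b ≡ true → b ≡ false
≢true {true}  f = ⊥-elim (f refl)
≢true {false} f = refl

≢false : ∀ {b} → ¬ b ≡ false → b ≡ true
≢false {true}  f = refl
≢false {false} f = ⊥-elim (f refl)

∧-true : ∀ {a b} → a ≡ true → b ≡ true → a ∧ b ≡ true
∧-true refl refl = refl

∧-fst : ∀ {a b} → a ∧ b ≡ true → a ≡ true
∧-fst {true} _ = refl

∧-snd : ∀ {a b} → a ∧ b ≡ true → b ≡ true
∧-snd {true} e = e

not-true : ∀ {a} → not a ≡ true → a ≡ false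
not-true {false} _ = refl

not-false : ∀ {a} → a ≡ false → not a ≡ true
not-false refl = refl

⌊⌋-true : ∀ {p} {P : Set p} (d : Dec P) → ⌊ d ⌋ ≡ true → P
⌊⌋-true (yes p) _ = p

true-⌊⌋ : ∀ {p} {P : Set p} (d : Dec P) → P → ⌊ d ⌋ ≡ true
true-⌊⌋ (yes _) _ = refl
true-⌊⌋ (no ¬p) p = ⊥-elim (¬p p)

false-⌊⌋ : ∀ {p} {P : Set p} (d : Dec P) → ¬ P → ⌊ d ⌋ ≡ false
false-⌊⌋ (yes p) ¬p = ⊥-elim (¬p p)
false-⌊⌋ (no _) _ = refl

⌊⌋-false : ∀ {p} {P : Set p} (d : Dec P) → ⌊ d ⌋ ≡ false → ¬ P
⌊⌋-false (no ¬p) _ = ¬p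

count : ∀ {n} → (Fin n → Bool) → ℕ
count {zero}  f = 0
count {suc n} f = b2n (f zero) + count (f ∘ suc)

count-cong : ∀ {n} {f g : Fin n → Bool} → (∀ i → f i ≡ g i) → count f ≡ count g
count-cong {zero}  h = refl
count-cong {suc n} h = cong₂ _+_ (cong b2n (h zero)) (count-cong (h ∘ suc))

count-split : ∀ {n} (f g : Fin n → Bool) →
  count f ≡ count (λ i → f i ∧ g i) + count (λ i → f i ∧ not (g i))
count-split {zero}  f g = refl
count-split {suc n} f g = trans (cong₂ _+_ (one (f zero) (g zero)) (count-split (f ∘ suc) (g ∘ suc)))
  (solve 4 (λ a b c d → (a :+ b) :+ (c :+ d) := (a :+ c) :+ (b :+ d)) refl
    (b2n (f zero ∧ g zero)) (b2n (f zero ∧ not (g zero))) _ _)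
  where
  open ℕ-Solver.+-*-Solver
  one : ∀ a b → b2n a ≡ b2n (a ∧ b) + b2n (a ∧ not b)
  one true  true  = refl
  one true  false = refl
  one false b     = refl

b2n-mono : ∀ {a b} → (a ≡ true → b ≡ true) → b2n a ≤ b2n b
b2n-mono {true}  {true}  f = s≤s z≤n
b2n-mono {true}  {false} f = case f refl of λ ()
b2n-mono {false} {b}     f = z≤n

count-mono : ∀ {n} {f g : Fin n → Bool} → (∀ i → f i ≡ true → g i ≡ true) → count f ≤ count g
count-mono {zero}  h = z≤n
count-mono {suc n} h = ℕₚ.+-mono-≤ (b2n-mono (h zero)) (count-mono (h ∘ suc))

count-pos : ∀ {n} {f : Fin n → Bool} i → f i ≡ true → 0 < count f
count-pos {f = f} zero    e rewrite e = s≤s z≤n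
count-pos {f = f} (suc i) e = ℕₚ.≤-trans (count-pos {f = f ∘ suc} i e) (ℕₚ.m≤n+m _ _)

count-strict : ∀ {n} {f g : Fin n → Bool} → (∀ i → f i ≡ true → g i ≡ true) →
  ∀ i → f i ≡ false → g i ≡ true → count f < count g
count-strict {suc n} {f} {g} h zero    e₁ e₂ rewrite e₁ | e₂ = s≤s (count-mono (h ∘ suc))
count-strict {suc n} {f} {g} h (suc i) e₁ e₂ = ℕₚ.+-mono-≤-< (b2n-mono (h zero)) (count-strict (h ∘ suc) i e₁ e₂)
enum : ∀ {n} (f : Fin n → Bool) → Fin (count f) → Fin n
enum {suc n} f i with f zero
... | false = suc (enum (f ∘ suc) i)
enum {suc n} f zero    | true = zero
enum {suc n} f (suc i) | true = suc (enum (f ∘ suc) i)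

enum-true : ∀ {n} (f : Fin n → Bool) i → f (enum f i) ≡ true
enum-true {suc n} f i with f zero in eq
... | false = enum-true (f ∘ suc) i
enum-true {suc n} f zero    | true = eq
enum-true {suc n} f (suc i) | true = enum-true (f ∘ suc) i

enum-injective : ∀ {n} (f : Fin n → Bool) {i j} → enum f i ≡ enum f j → i ≡ j
enum-injective {suc n} f {i} {j} e with f zero
... | false = enum-injective (f ∘ suc) (Finₚ.suc-injective e)
enum-injective {suc n} f {zero}  {zero}  e | true = refl
enum-injective {suc n} f {suc i} {suc j} e | true = cong suc (enum-injective (f ∘ suc) (Finₚ.suc-injective e))

count-≤ : ∀ {n k} (f : Fin n → Bool) (g : Fin n → ℕ) → (∀ i → f i ≡ true → g i < k) →
  (∀ i j → f i ≡ true → f j ≡ true → g i ≡ g j → i ≡ j) → count f ≤ k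
count-≤ {k = k} f g b inj = Finₚ.injective⇒≤ {f = h} λ {i} {j} e →
  enum-injective f (inj _ _ (enum-true f i) (enum-true f j)
    (trans (sym (Finₚ.toℕ-fromℕ< _)) (trans (cong toℕ e) (Finₚ.toℕ-fromℕ< _))))
  where
  h : Fin (count f) → Fin k
  h i = fromℕ< (b (enum f i) (enum-true f i))

even? : ℕ → Bool
even? zero    = true
even? (suc n) = not (even? n)

even?-+ : ∀ k m n → even? (k + m) ≡ even? (k + n) → even? m ≡ even? n
even?-+ zero    m n e = e
even?-+ (suc k) m n e = even?-+ k m n (Boolₚ.not-injective e)

halves : ∀ m n → even? m ≡ even? n → ⌊ m /2⌋ ≡ ⌊ n /2⌋ → m ≡ n
halves zero          zero          p e = refl
halves zero          (suc (suc n)) p ()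
halves (suc zero)    (suc zero)    p e = refl
halves (suc zero)    (suc (suc n)) p ()
halves (suc (suc m)) (suc (suc n)) p e =
  cong (λ x → ℕ.suc (ℕ.suc x)) (halves m n (trans (sym (not-not _)) (trans p (not-not _))) (ℕₚ.suc-injective e))
halves zero (suc zero) () e
halves (suc zero) zero () e
halves (suc (suc m)) zero p ()
halves (suc (suc m)) (suc zero) p ()

-- A set of n totally ordered indices is ranked 1, ..., n; those of fixed rank parity make up at most half.
module Ranks {n : ℕ} (I : Fin n → Bool) (rel : Fin n → Fin n → Bool)
  (rel-refl : ∀ i → rel i i ≡ true)
  (rel-trans : ∀ i j k → I i ≡ true → I j ≡ true → I k ≡ true → rel i j ≡ true → rel j k ≡ true → rel i k ≡ true)
  (rel-total : ∀ i j → I i ≡ true → I j ≡ true → i ≢ j →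
               (rel i j ≡ true × rel j i ≡ false) ⊎ (rel j i ≡ true × rel i j ≡ false)) where

  rank : Fin n → ℕ
  rank i = count (λ j → I j ∧ rel i j)

  rank-< : ∀ i j → I i ≡ true → I j ≡ true → rel i j ≡ true → rel j i ≡ false → rank j < rank i
  rank-< i j Ii Ij r r′ = count-strict
    (λ k e → ∧-true (∧-fst e) (rel-trans i j k Ii Ij (∧-fst e) r (∧-snd {I k} e)))
    i (trans (cong (I i ∧_) r′) (Boolₚ.∧-zeroʳ (I i))) (∧-true Ii (rel-refl i))

  rank-injective : ∀ i j → I i ≡ true → I j ≡ true → rank i ≡ rank j → i ≡ j
  rank-injective i j Ii Ij e with i Finₚ.≟ j
  ... | yes p = p
  ... | no ne with rel-total i j Ii Ij ne
  ... | inj₁ (r , r′) = ⊥-elim (ℕₚ.<-irrefl (sym e) (rank-< i j Ii Ij r r′))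
  ... | inj₂ (r , r′) = ⊥-elim (ℕₚ.<-irrefl e (rank-< j i Ij Ii r r′))

  parity-class : ∀ k b → count (λ i → I i ∧ (if b then even? (k + rank i) else not (even? (k + rank i)))) ≤ ⌈ count I /2⌉
  parity-class k b = count-≤ _ (λ i → ⌊ rank i ∸ 1 /2⌋) bound inj
    where
    colour : Fin n → Bool
    colour i = if b then even? (k + rank i) else not (even? (k + rank i))
    pos : ∀ i → I i ≡ true → 0 < rank i
    pos i Ii = count-pos i (∧-true Ii (rel-refl i))
    half< : ∀ r c → 0 < r → r ≤ c → ⌊ r ∸ 1 /2⌋ < ⌈ c /2⌉
    half< (suc zero)    (suc c)       _ _        = s≤s z≤n
    half< (suc (suc r)) (suc (suc c)) _ (s≤s le) = s≤s (ℕₚ.⌊n/2⌋-mono le)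
    half< (suc (suc r)) (suc zero) _ (s≤s ())
    bound : ∀ i → I i ∧ colour i ≡ true → ⌊ rank i ∸ 1 /2⌋ < ⌈ count I /2⌉
    bound i e = half< (rank i) (count I) (pos i (∧-fst e)) (count-mono (λ j → ∧-fst {I j} {rel i j}))
    same : ∀ b x y → (if b then x else not x) ≡ true → (if b then y else not y) ≡ true → x ≡ y
    same true  true  true  _ _ = refl
    same false false false _ _ = refl
    pred-even : ∀ m n → 0 < m → 0 < n → even? m ≡ even? n → even? (m ∸ 1) ≡ even? (n ∸ 1)
    pred-even (suc m) (suc n) _ _ e = Boolₚ.not-injective e
    pred-inj : ∀ m n → 0 < m → 0 < n → m ∸ 1 ≡ n ∸ 1 → m ≡ n
    pred-inj (suc m) (suc n) _ _ = cong suc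
    inj : ∀ i j → I i ∧ colour i ≡ true → I j ∧ colour j ≡ true → ⌊ rank i ∸ 1 /2⌋ ≡ ⌊ rank j ∸ 1 /2⌋ → i ≡ j
    inj i j ei ej e = rank-injective i j Ii Ij (pred-inj _ _ (pos i Ii) (pos j Ij)
      (halves _ _ (pred-even (rank i) (rank j) (pos i Ii) (pos j Ij)
        (even?-+ k _ _ (same b _ _ (∧-snd {I i} ei) (∧-snd {I j} ej)))) e))
      where Ii = ∧-fst ei
            Ij = ∧-fst ej

-- The Lucchesi–Younger theorem

module Cuts {N m : ℕ} (tl hd : Fin m → Fin N) where

  Cut : Set
  Cut = Fin N → Bool

  -- No arc enters a closed set, so every arc on its boundary leaves it; a directed cut is
  -- represented by this shore.
  Closed Nontrivial Dicut : Cut → Set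
  Closed Z = ∀ e → Z (hd e) ≡ true → Z (tl e) ≡ true
  Nontrivial Z = (∃[ i ] Z i ≡ true) × (∃[ i ] Z i ≡ false)
  Dicut Z = Closed Z × Nontrivial Z

  cross : Cut → Fin m → Bool
  cross Z e = Z (tl e) ∧ not (Z (hd e))

  load : Fin m → List Cut → ℕ
  load e F = sum (map (λ Z → b2n (cross Z e)) F)

  _⊑_ Disjoint Cover CrossFree : Cut → Cut → Set
  Z ⊑ W = ∀ i → Z i ≡ true → W i ≡ true
  Disjoint Z W = ∀ i → Z i ≡ true → W i ≡ false
  Cover Z W = ∀ i → Z i ≡ false → W i ≡ true
  CrossFree Z W = (Z ⊑ W ⊎ W ⊑ Z) ⊎ (Disjoint Z W ⊎ Cover Z W)

  _⊑?_ : ∀ Z W → Dec (Z ⊑ W)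
  Z ⊑? W = Finₚ.all? (λ i → (Z i Boolₚ.≟ true) →-dec (W i Boolₚ.≟ true))

  cover? : ∀ Z W → Dec (Cover Z W)
  cover? Z W = Finₚ.all? (λ i → (Z i Boolₚ.≟ false) →-dec (W i Boolₚ.≟ true))

  disjoint? : ∀ Z W → Dec (Disjoint Z W)
  disjoint? Z W = Finₚ.all? (λ i → (Z i Boolₚ.≟ true) →-dec (W i Boolₚ.≟ false))

  crossFree? : ∀ Z W → Dec (CrossFree Z W)
  crossFree? Z W = ((Z ⊑? W) ⊎-dec (W ⊑? Z)) ⊎-dec (disjoint? Z W ⊎-dec cover? Z W)

  crossFree-sym : ∀ {Z W} → CrossFree Z W → CrossFree W Z
  crossFree-sym (inj₁ (inj₁ x)) = inj₁ (inj₂ x)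
  crossFree-sym (inj₁ (inj₂ x)) = inj₁ (inj₁ x)
  crossFree-sym (inj₂ (inj₁ d)) = inj₂ (inj₁ λ i e → ≢true (λ t → true≢false e (d i t)))
  crossFree-sym (inj₂ (inj₂ d)) = inj₂ (inj₂ λ i e → ≢false (λ t → true≢false (d i t) e))

  private
    witness : ∀ {Z W : Cut} {a b} → ¬ (∀ i → Z i ≡ a → W i ≡ b) → ∃[ i ] (Z i ≡ a × W i ≢ b)
    witness {Z} {W} {a} {b} ¬h
      with Finₚ.¬∀⟶∃¬ _ _ (λ i → (Z i Boolₚ.≟ a) →-dec (W i Boolₚ.≟ b)) ¬h
    ... | i , f with Z i Boolₚ.≟ a
    ... | yes p = i , p , λ q → f (λ _ → q)
    ... | no ¬p = ⊥-elim (f (λ p → ⊥-elim (¬p p)))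

  record Crossing (Z W : Cut) : Set where
    field
      both    : ∃[ i ] (Z i ≡ true × W i ≡ true)
      left    : ∃[ i ] (Z i ≡ true × W i ≡ false)
      right   : ∃[ i ] (Z i ≡ false × W i ≡ true)
      neither : ∃[ i ] (Z i ≡ false × W i ≡ false)

  crossing : ∀ {Z W} → ¬ CrossFree Z W → Crossing Z W
  crossing {Z} {W} ¬cf = record
    { both    = let i , p , q = witness {Z} {W} (¬cf ∘ inj₂ ∘ inj₁) in i , p , ≢false q
    ; left    = let i , p , q = witness {Z} {W} (¬cf ∘ inj₁ ∘ inj₁) in i , p , ≢true q
    ; right   = let i , p , q = witness {W} {Z} (¬cf ∘ inj₁ ∘ inj₂) in i , ≢true q , p
    ; neither = let i , p , q = witness {Z} {W} (¬cf ∘ inj₂ ∘ inj₂) in i , p , ≢true q }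

  _∩_ _∪_ : Cut → Cut → Cut
  (Z ∩ W) i = Z i ∧ W i
  (Z ∪ W) i = Z i ∨ W i

  ∩-dicut : ∀ {Z W} → Dicut Z → Dicut W → Crossing Z W → Dicut (Z ∩ W)
  ∩-dicut {Z} {W} (cZ , _) (cW , _) x =
    (λ e h → ∧-true (cZ e (∧-fst h)) (cW e (∧-snd {Z (hd e)} h))) ,
    (let i , p , q = Crossing.both x in i , ∧-true p q) ,
    (let i , p , q = Crossing.neither x in i , cong (_∧ W i) p)

  ∪-dicut : ∀ {Z W} → Dicut Z → Dicut W → Crossing Z W → Dicut (Z ∪ W)
  ∪-dicut {Z} {W} (cZ , _) (cW , _) x = closed ,
    (let i , p , q = Crossing.both x in i , cong (_∨ W i) p) ,
    (let i , p , q = Crossing.neither x in i , cong₂ _∨_ p q)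
    where
    closed : Closed (Z ∪ W)
    closed e h with Z (hd e) in eq
    ... | true  = cong (_∨ W (tl e)) (cZ e eq)
    ... | false = trans (cong (Z (tl e) ∨_) (cW e h)) (Boolₚ.∨-zeroʳ (Z (tl e)))

  -- Arcs between the two set differences would make this an inequality; closedness of both sets
  -- excludes them.
  cross-modular : ∀ Z W → Closed Z → Closed W → ∀ e →
    b2n (cross (Z ∩ W) e) + b2n (cross (Z ∪ W) e) ≡ b2n (cross Z e) + b2n (cross W e)
  cross-modular Z W cZ cW e = table (Z (tl e)) (Z (hd e)) (W (tl e)) (W (hd e)) (cZ e) (cW e)
    where
    table : ∀ a b c d → (b ≡ true → a ≡ true) → (d ≡ true → c ≡ true) →
      b2n ((a ∧ c) ∧ not (b ∧ d)) + b2n ((a ∨ c) ∧ not (b ∨ d)) ≡ b2n (a ∧ not b) + b2n (c ∧ not d)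
    table false true  c d f g = case f refl of λ ()
    table a b false true  f g = case g refl of λ ()
    table true  true  true  true  f g = refl
    table true  true  true  false f g = refl
    table true  true  false false f g = refl
    table true  false true  true  f g = refl
    table true  false true  false f g = refl
    table true  false false false f g = refl
    table false false true  true  f g = refl
    table false false true  false f g = refl
    table false false false false f g = refl

  energy : Cut → ℕ
  energy Z = count Z * count (not ∘ Z)

  -- With `a` points only in `Z` and `b` only in `W`, the two sides differ by 2ab, which is positive
  -- for a crossing pair.
  energy-decreases : ∀ Z W → Crossing Z W → energy (Z ∩ W) + energy (Z ∪ W) < energy Z + energy W
  energy-decreases Z W x = subst₂ _<_ (sym lhs) (sym rhs) (arith p a b r pos-a pos-b)
    where
    open ℕ-Solver.+-*-Solver
    p = count (λ i → Z i ∧ W i)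
    a = count (λ i → Z i ∧ not (W i))
    b = count (λ i → not (Z i) ∧ W i)
    r = count (λ i → not (Z i) ∧ not (W i))
    pos-a : 0 < a
    pos-a = let i , u , v = Crossing.left x in count-pos i (∧-true u (not-false v))
    pos-b : 0 < b
    pos-b = let i , u , v = Crossing.right x in count-pos i (∧-true (not-false u) v)
    comm′ : ∀ (x y : Bool) → x ∧ y ≡ y ∧ x
    comm′ = Boolₚ.∧-comm
    cZ : count Z ≡ p + a
    cZ = count-split Z W
    cZ′ : count (not ∘ Z) ≡ b + r
    cZ′ = count-split (not ∘ Z) W
    cW : count W ≡ p + b
    cW = trans (count-split W Z) (cong₂ _+_ (count-cong λ i → comm′ (W i) (Z i)) (count-cong λ i → comm′ (W i) (not (Z i))))
    cW′ : count (not ∘ W) ≡ a + r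
    cW′ = trans (count-split (not ∘ W) Z) (cong₂ _+_ (count-cong λ i → comm′ (not (W i)) (Z i)) (count-cong λ i → comm′ (not (W i)) (not (Z i))))
    c∩′ : count (not ∘ (Z ∩ W)) ≡ a + (b + r)
    c∩′ = trans (count-split (not ∘ (Z ∩ W)) Z) (cong₂ _+_
      (count-cong λ i → t₁ (Z i) (W i)) (trans (count-cong λ i → t₂ (Z i) (W i)) cZ′))
      where
      t₁ : ∀ u v → not (u ∧ v) ∧ u ≡ u ∧ not v
      t₁ true true = refl
      t₁ true false = refl
      t₁ false v = refl
      t₂ : ∀ u v → not (u ∧ v) ∧ not u ≡ not u
      t₂ true true = refl
      t₂ true false = refl
      t₂ false v = refl
    c∪ : count (Z ∪ W) ≡ (p + a) + b
    c∪ = trans (count-split (Z ∪ W) Z) (cong₂ _+_ (trans (count-cong λ i → t₁ (Z i) (W i)) cZ) (count-cong λ i → t₂ (Z i) (W i)))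
      where
      t₁ : ∀ u v → (u ∨ v) ∧ u ≡ u
      t₁ true v = refl
      t₁ false true = refl
      t₁ false false = refl
      t₂ : ∀ u v → (u ∨ v) ∧ not u ≡ not u ∧ v
      t₂ true v = refl
      t₂ false true = refl
      t₂ false false = refl
    c∪′ : count (not ∘ (Z ∪ W)) ≡ r
    c∪′ = count-cong λ i → t (Z i) (W i)
      where
      t : ∀ u v → not (u ∨ v) ≡ not u ∧ not v
      t true v = refl
      t false v = refl
    lhs : energy (Z ∩ W) + energy (Z ∪ W) ≡ p * (a + (b + r)) + ((p + a) + b) * r
    lhs = cong₂ _+_ (cong (p *_) c∩′) (cong₂ _*_ c∪ c∪′)
    rhs : energy Z + energy W ≡ (p + a) * (b + r) + (p + b) * (a + r)
    rhs = cong₂ _+_ (cong₂ _*_ cZ cZ′) (cong₂ _*_ cW cW′)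
    arith : ∀ p a b r → 0 < a → 0 < b →
      p * (a + (b + r)) + ((p + a) + b) * r < (p + a) * (b + r) + (p + b) * (a + r)
    arith p (suc a) (suc b) r _ _ = subst (p * (suc a + (suc b + r)) + ((p + suc a) + suc b) * r <_)
      (solve 4 (λ p a b r →
        (con 1 :+ (p :* ((con 1 :+ a) :+ ((con 1 :+ b) :+ r)) :+ ((p :+ (con 1 :+ a)) :+ (con 1 :+ b)) :* r))
          :+ (con 1 :+ con 2 :* a :+ con 2 :* b :+ con 2 :* a :* b)
        := (p :+ (con 1 :+ a)) :* ((con 1 :+ b) :+ r) :+ (p :+ (con 1 :+ b)) :* ((con 1 :+ a) :+ r)) refl p a b r)
      (ℕₚ.m≤m+n _ _)

  totalEnergy : List Cut → ℕ
  totalEnergy F = sum (map energy F)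

  findCrossing : ∀ F → AllPairs CrossFree F ⊎
    (∃[ Z ] ∃[ W ] ∃[ G ] (F ↭ Z ∷ W ∷ G × ¬ CrossFree Z W))
  findCrossing [] = inj₁ []
  findCrossing (Z ∷ F) with All.all? (crossFree? Z) F
  ... | no ¬all with search F ¬all
    where
    search : ∀ F → ¬ All (CrossFree Z) F → ∃[ W ] ∃[ G ] (F ↭ W ∷ G × ¬ CrossFree Z W)
    search [] ¬all = ⊥-elim (¬all [])
    search (W ∷ F) ¬all with crossFree? Z W
    ... | no ¬cf = W , F , _↭_.refl , ¬cf
    ... | yes cf with search F (λ al → ¬all (cf ∷ al))
    ... | V , G , p , ¬cf = V , W ∷ G , ↭-trans (prep W p) (↭-swap W V _↭_.refl) , ¬cf
  ... | W , G , p , ¬cf = inj₂ (Z , W , G , prep Z p , ¬cf)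
  findCrossing (Z ∷ F) | yes al with findCrossing F
  ... | inj₁ ap = inj₁ (al ∷ ap)
  ... | inj₂ (V , W , G , p , ¬cf) = inj₂ (V , W , Z ∷ G ,
          ↭-trans (prep Z p) (↭-trans (↭-swap Z V _↭_.refl) (prep V (↭-swap Z W _↭_.refl))) , ¬cf)

  load-↭ : ∀ e {F G} → F ↭ G → load e F ≡ load e G
  load-↭ e p = sum-↭ (Permₚ.map⁺ (λ Z → b2n (cross Z e)) p)

  -- Replacing a crossing pair by its intersection and union keeps all loads and lowers the energy.
  uncross : ∀ F → All Dicut F → ∃[ G ] (All Dicut G × AllPairs CrossFree G ×
    (∀ e → load e G ≡ load e F) × length G ≡ length F)
  uncross F all = go (totalEnergy F) F ℕₚ.≤-refl all
    where
    Goal : List Cut → Set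
    Goal F = ∃[ G ] (All Dicut G × AllPairs CrossFree G × (∀ e → load e G ≡ load e F) × length G ≡ length F)
    go : ∀ fuel F → totalEnergy F ≤ fuel → All Dicut F → Goal F
    go fuel F le all with findCrossing F
    ... | inj₁ ap = F , all , ap , (λ _ → refl) , refl
    ... | inj₂ (Z , W , G , p , ¬cf) with Permₚ.All-resp-↭ p all
    ... | dZ ∷ dW ∷ dG = step fuel le
      where
      F′ = (Z ∩ W) ∷ (Z ∪ W) ∷ G
      x = crossing ¬cf
      less : totalEnergy F′ < totalEnergy F
      less = subst₂ _<_ (ℕₚ.+-assoc (energy (Z ∩ W)) (energy (Z ∪ W)) _)
        (sym (trans (sum-↭ (Permₚ.map⁺ energy p)) (sym (ℕₚ.+-assoc (energy Z) (energy W) _))))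
        (ℕₚ.+-monoˡ-< (totalEnergy G) (energy-decreases Z W x))
      loads : ∀ e → load e F′ ≡ load e F
      loads e = trans (sym (ℕₚ.+-assoc (b2n (cross (Z ∩ W) e)) _ _))
        (trans (cong (_+ load e G) (cross-modular Z W (proj₁ dZ) (proj₁ dW) e))
        (trans (ℕₚ.+-assoc (b2n (cross Z e)) _ _) (sym (load-↭ e p))))
      step : ∀ fuel → totalEnergy F ≤ fuel → Goal F
      step zero le = ⊥-elim (ℕₚ.n≮0 (ℕₚ.<-≤-trans less le))
      step (suc fuel) le
        with go fuel F′ (ℕₚ.≤-pred (ℕₚ.<-≤-trans less le)) (∩-dicut dZ dW x ∷ ∪-dicut dZ dW x ∷ dG)
      ... | H , a , b , c , d = H , a , b , (λ e → trans (c e) (loads e)) , trans d (sym (Permₚ.↭-length p))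

  pick : (G : List Cut) → (Fin (length G) → Bool) → List Cut
  pick []      c = []
  pick (Z ∷ G) c = if c zero then Z ∷ pick G (c ∘ suc) else pick G (c ∘ suc)

  pick-all : ∀ {P : Cut → Set} G c → All P G → All P (pick G c)
  pick-all []      c [] = []
  pick-all (Z ∷ G) c (p ∷ ps) with c zero
  ... | true  = p ∷ pick-all G (c ∘ suc) ps
  ... | false = pick-all G (c ∘ suc) ps

  pick-length : ∀ G c → length (pick G c) ≡ count c
  pick-length []      c = refl
  pick-length (Z ∷ G) c with c zero
  ... | true  = cong suc (pick-length G (c ∘ suc))
  ... | false = pick-length G (c ∘ suc)

  pick-load : ∀ e G c → load e (pick G c) ≡ count (λ i → cross (lookup G i) e ∧ c i)
  pick-load e []      c = refl
  pick-load e (Z ∷ G) c with c zero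
  ... | true  = cong₂ _+_ (cong b2n (sym (Boolₚ.∧-identityʳ (cross Z e)))) (pick-load e G (c ∘ suc))
  ... | false = cong₂ _+_ (cong b2n (sym (Boolₚ.∧-zeroʳ (cross Z e)))) (pick-load e G (c ∘ suc))

  load-count : ∀ e G → load e G ≡ count (λ i → cross (lookup G i) e)
  load-count e []      = refl
  load-count e (Z ∷ G) = cong (b2n (cross Z e) ℕ.+_) (load-count e G)

  crossFree-lookup : ∀ {G} → AllPairs CrossFree G → ∀ i j → CrossFree (lookup G i) (lookup G j)
  crossFree-lookup (h ∷ ap) zero    zero    = inj₁ (inj₁ λ _ e → e)
  crossFree-lookup (h ∷ ap) zero    (suc j) = All.lookup h (∈-lookup j)
  crossFree-lookup (h ∷ ap) (suc i) zero    = crossFree-sym (All.lookup h (∈-lookup i))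
  crossFree-lookup (h ∷ ap) (suc i) (suc j) = crossFree-lookup ap i j

  -- A cross-free family is a tree whose edges are the cuts; an arc crosses the cuts on a directed path of
  -- the tree.  Colouring the cuts by the parity of the depth of their tails alternates along such paths.
  module Split (G : List Cut) (dG : All Dicut G) (cf : AllPairs CrossFree G) where

    Z : Fin (length G) → Cut
    Z = lookup G

    dicut : ∀ i → Dicut (Z i)
    dicut i = All.lookup dG (∈-lookup i)

    -- In the tree of cuts this says that the edge `i` lies on the shore `Z j` of the edge `j`:
    -- `Z j` contains one of the two shores of `i`. Equal cuts are ordered by index, which makes the
    -- cuts crossed by one arc a chain.
    below? : ∀ i j → Dec (Cover (Z i) (Z j) ⊎ (Z i ⊑ Z j × (¬ Z j ⊑ Z i ⊎ i Fin.≤ j)))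
    below? i j = cover? (Z i) (Z j) ⊎-dec ((Z i ⊑? Z j) ×-dec (¬? (Z j ⊑? Z i) ⊎-dec (i Finₚ.≤? j)))

    below : Fin (length G) → Fin (length G) → Bool
    below i j = ⌊ below? i j ⌋

    depth : Fin (length G) → ℕ
    depth i = count (below i)

    colour : Fin (length G) → Bool
    colour i = even? (depth i)

    module _ (e : Fin m) where

      I : Fin (length G) → Bool
      I i = cross (Z i) e

      private
        tail∈ : ∀ {i} → I i ≡ true → Z i (tl e) ≡ true
        tail∈ h = ∧-fst h
        head∉ : ∀ {i} → I i ≡ true → Z i (hd e) ≡ false
        head∉ {i} h = not-true (∧-snd {Z i (tl e)} h)

        ¬cover : ∀ {i j} → I i ≡ true → I j ≡ true → ¬ Cover (Z i) (Z j)
        ¬cover {i} {j} Ii Ij c = true≢false (c (hd e) (head∉ {i} Ii)) (head∉ {j} Ij)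

        comparable : ∀ {i j} → I i ≡ true → I j ≡ true → Z i ⊑ Z j ⊎ Z j ⊑ Z i
        comparable {i} {j} Ii Ij with crossFree-lookup cf i j
        ... | inj₁ x = x
        ... | inj₂ (inj₁ d) = ⊥-elim (true≢false (tail∈ {j} Ij) (d _ (tail∈ {i} Ii)))
        ... | inj₂ (inj₂ c) = ⊥-elim (¬cover {i} {j} Ii Ij c)

        rel-refl : ∀ i → below i i ≡ true
        rel-refl i = true-⌊⌋ (below? i i) (inj₂ ((λ _ h → h) , inj₂ (Finₚ.≤-refl)))

        sub : ∀ {i j} → I i ≡ true → I j ≡ true → below i j ≡ true → Z i ⊑ Z j × (¬ Z j ⊑ Z i ⊎ i Fin.≤ j)
        sub {i} {j} Ii Ij b with ⌊⌋-true (below? i j) b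
        ... | inj₁ c = ⊥-elim (¬cover {i} {j} Ii Ij c)
        ... | inj₂ s = s

        rel-trans : ∀ i j k → I i ≡ true → I j ≡ true → I k ≡ true →
          below i j ≡ true → below j k ≡ true → below i k ≡ true
        rel-trans i j k Ii Ij Ik b₁ b₂ with sub {i} {j} Ii Ij b₁ | sub {j} {k} Ij Ik b₂
        ... | s₁ , t₁ | s₂ , t₂ = true-⌊⌋ (below? i k) (inj₂ ((λ x h → s₂ x (s₁ x h)) , tie t₁ t₂))
          where
          tie : (¬ Z j ⊑ Z i ⊎ i Fin.≤ j) → (¬ Z k ⊑ Z j ⊎ j Fin.≤ k) → ¬ Z k ⊑ Z i ⊎ i Fin.≤ k
          tie (inj₁ n) _ = inj₁ λ h → n (λ x z → h x (s₂ x z))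
          tie (inj₂ _) (inj₁ n) = inj₁ λ h → n (λ x z → s₁ x (h x z))
          tie (inj₂ p) (inj₂ q) = inj₂ (Finₚ.≤-trans p q)

        rel-total : ∀ i j → I i ≡ true → I j ≡ true → i ≢ j →
          (below i j ≡ true × below j i ≡ false) ⊎ (below j i ≡ true × below i j ≡ false)
        rel-total i j Ii Ij ne = go (Z i ⊑? Z j) (Z j ⊑? Z i)
          where
          go : Dec (Z i ⊑ Z j) → Dec (Z j ⊑ Z i) →
            (below i j ≡ true × below j i ≡ false) ⊎ (below j i ≡ true × below i j ≡ false)
          go (yes p) (no q)  = inj₁ (true-⌊⌋ (below? i j) (inj₂ (p , inj₁ q)) ,
                                     ≢true λ b → q (proj₁ (sub {j} {i} Ij Ii b)))
          go (no p)  (yes q) = inj₂ (true-⌊⌋ (below? j i) (inj₂ (q , inj₁ p)) ,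
                                     ≢true λ b → p (proj₁ (sub {i} {j} Ii Ij b)))
          go (no p)  (no q)  = ⊥-elim ([ p , q ]′ (comparable {i} {j} Ii Ij))
          go (yes p) (yes q) with Finₚ.≤-total i j
          ... | inj₁ le = inj₁ (true-⌊⌋ (below? i j) (inj₂ (p , inj₂ le)) ,
                                ≢true λ b → [ (λ n → n p) , (λ ge → ne (Finₚ.≤-antisym le ge)) ]′ (proj₂ (sub {j} {i} Ij Ii b)))
          ... | inj₂ ge = inj₂ (true-⌊⌋ (below? j i) (inj₂ (q , inj₂ ge)) ,
                                ≢true λ b → [ (λ n → n q) , (λ le → ne (Finₚ.≤-antisym le ge)) ]′ (proj₂ (sub {i} {j} Ii Ij b)))

      module R = Ranks I below rel-refl rel-trans rel-total

      base : ℕ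
      base = count (λ j → Z j (hd e))

      -- Among the cuts counted by `depth i`, those not crossed by `e` are exactly the cuts
      -- containing the head of `e`. Their number `base` is the same for all `i`, so the parity of
      -- the depth alternates along the chain crossed by `e`.
      depth-rank : ∀ i → I i ≡ true → depth i ≡ base + R.rank i
      depth-rank i Ii = trans (count-split (below i) I) (trans (ℕₚ.+-comm (count (λ j → below i j ∧ I j)) _)
        (cong₂ _+_ (count-cong outer) (count-cong λ j → Boolₚ.∧-comm (below i j) (I j))))
        where
        outer : ∀ j → below i j ∧ not (I j) ≡ Z j (hd e)
        outer j = bool-ext to from
          where
          to : below i j ∧ not (I j) ≡ true → Z j (hd e) ≡ true
          to h with ⌊⌋-true (below? i j) (∧-fst h)
          ... | inj₁ c = c (hd e) (head∉ {i} Ii)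
          ... | inj₂ (s , _) = ≢false λ f → true≢false
                  (∧-true (s _ (tail∈ {i} Ii)) (not-false f)) (not-true (∧-snd {below i j} h))
          from : Z j (hd e) ≡ true → below i j ∧ not (I j) ≡ true
          from h = ∧-true bij (not-false (trans (cong (λ b → Z j (tl e) ∧ not b) h) (Boolₚ.∧-zeroʳ _)))
            where
            bij : below i j ≡ true
            bij with crossFree-lookup cf i j
            ... | inj₁ (inj₁ s) = true-⌊⌋ (below? i j) (inj₂ (s , inj₁ λ s′ → true≢false (s′ _ h) (head∉ {i} Ii)))
            ... | inj₁ (inj₂ s) = ⊥-elim (true≢false (s _ h) (head∉ {i} Ii))
            ... | inj₂ (inj₁ d) = ⊥-elim (true≢false (proj₁ (dicut j) e h) (d _ (tail∈ {i} Ii)))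
            ... | inj₂ (inj₂ c) = true-⌊⌋ (below? i j) (inj₁ c)

      half : ∀ b → load e (pick G (λ i → if b then colour i else not (colour i))) ≤ ⌈ load e G /2⌉
      half b = subst₂ _≤_ (sym (trans (pick-load e G _) (count-cong same))) (cong ⌈_/2⌉ (sym (load-count e G)))
                 (R.parity-class base b)
        where
        same : ∀ i → I i ∧ (if b then colour i else not (colour i)) ≡
                     I i ∧ (if b then even? (base + R.rank i) else not (even? (base + R.rank i)))
        same i with I i in eq
        ... | false = refl
        ... | true  = cong (λ n → if b then even? n else not (even? n)) (depth-rank i eq)

    lengths : ∀ ν → length G ≡ suc (ν + ν) → ∃[ b ] suc ν ≤ length (pick G (λ i → if b then colour i else not (colour i)))
    lengths ν eq with suc ν ℕₚ.≤? count colour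
    ... | yes le = true , subst (suc ν ≤_) (sym (pick-length G _)) le
    ... | no  gt = false , subst (suc ν ≤_) (sym (pick-length G _))
          (ℕₚ.+-cancelˡ-≤ ν _ _ (ℕₚ.≤-trans (ℕₚ.≤-reflexive (ℕₚ.+-suc ν ν))
            (ℕₚ.≤-trans (ℕₚ.≤-reflexive (trans (sym eq) total)) (ℕₚ.+-monoˡ-≤ _ (ℕₚ.≤-pred (ℕₚ.≰⇒> gt))))))
      where
      all-true : ∀ n → count {n} (λ _ → true) ≡ n
      all-true zero = refl
      all-true (suc n) = cong suc (all-true n)
      total : length G ≡ count colour + count (not ∘ colour)
      total = trans (sym (all-true _)) (count-split (λ _ → true) colour)

  HasPacking : (Fin m → ℕ) → ℕ → Set
  HasPacking w n = ∃[ F ] (All Dicut F × (∀ e → load e F ≤ w e) × n ≤ length F)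

  ⌈half⌉≤ : ∀ {a b} → a ≤ b + b → ⌈ a /2⌉ ≤ b
  ⌈half⌉≤ {a} {b} le = ℕₚ.≤-trans (ℕₚ.⌈n/2⌉-mono le) (ℕₚ.≤-reflexive (dbl b))
    where
    dbl : ∀ b → ⌈ b + b /2⌉ ≡ b
    dbl zero = refl
    dbl (suc b) = trans (cong (λ x → ⌈ suc x /2⌉) (ℕₚ.+-suc b b)) (cong suc (dbl b))

  -- After uncrossing, the larger colour class is kept. Rounding helps on both sides: it has at
  -- least ν + 1 of the 2ν + 1 cuts, while a load of at most 2w drops to at most w even when rounded
  -- up.
  halve : ∀ (w : Fin m → ℕ) ν F → All Dicut F → (∀ e → load e F ≤ w e + w e) → length F ≡ suc (ν + ν) →
    HasPacking w (suc ν)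
  halve w ν F dF le len with uncross F dF
  ... | G , dG , cf , loads , lenG with Split.lengths G dG cf ν (trans lenG len)
  ... | b , big = _ , pick-all G _ dG , (λ e → ℕₚ.≤-trans (Split.half G dG cf e b)
                    (⌈half⌉≤ (subst (_≤ w e + w e) (sym (loads e)) (le e)))) , big

  HasPacking-mono : ∀ {w w′ n n′} → (∀ e → w e ≤ w′ e) → n′ ≤ n → HasPacking w n → HasPacking w′ n′
  HasPacking-mono h g (F , dF , le , len) = F , dF , (λ e → ℕₚ.≤-trans (le e) (h e)) , ℕₚ.≤-trans g len

  load-++ : ∀ e F G → load e (F ++ G) ≡ load e F + load e G
  load-++ e []      G = refl
  load-++ e (Z ∷ F) G = trans (cong (b2n (cross Z e) ℕ.+_) (load-++ e F G)) (sym (ℕₚ.+-assoc (b2n (cross Z e)) _ _))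

  truncate : ∀ {w} n → HasPacking w n → ∃[ F ] (All Dicut F × (∀ e → load e F ≤ w e) × length F ≡ n)
  truncate {w} n (F , dF , le , len) = go n F dF len λ F′ d l h → F′ , d , (λ e → ℕₚ.≤-trans (h e) (le e)) , l
    where
    go : ∀ {R : Set} n F → All Dicut F → n ≤ length F →
      (∀ F′ → All Dicut F′ → length F′ ≡ n → (∀ e → load e F′ ≤ load e F) → R) → R
    go zero    F       dF       le k = k [] [] refl (λ e → z≤n)
    go (suc n) (Z ∷ F) (d ∷ dF) (s≤s le) k = go n F dF le λ F′ dF′ l h →
      k (Z ∷ F′) (d ∷ dF′) (cong suc l) (λ e → ℕₚ.+-monoʳ-≤ (b2n (cross Z e)) (h e))

  first-true : ∀ (P : ℕ → Set) n → ¬ P 0 → P n → ¬ ¬ (∃[ t ] (t < n × ¬ P t × P (suc t)))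
  first-true P zero    ¬p0 pn k = ¬p0 pn
  first-true P (suc n) ¬p0 pn k = ¬¬-excluded-middle {A = P n} λ
    { (yes q) → first-true P n ¬p0 q (λ { (t , lt , r) → k (t , ℕₚ.m≤n⇒m≤1+n lt , r) })
    ; (no ¬q) → k (n , ℕₚ.≤-refl , ¬q , pn) }

  Transversal : (Fin m → Bool) → ℕ → Set
  Transversal supp ν = ∃[ S ] (Unique S × length S ≤ ν × (∀ e → e ∈ S → supp e ≡ true) ×
    (∀ Z → Dicut Z → (∀ e → cross Z e ≡ true → supp e ≡ true) → ∃[ e ] (e ∈ S × cross Z e ≡ true)))

  -- Lovász' proof.  If deleting any arc of the support keeps ν cuts packable, double capacities one arc at a
  -- time until ν + 1 cuts fit for the first time, at b say.  Together with ν cuts avoiding b these are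
  -- 2ν + 1 cuts within twice the capacity before b was doubled; half of them already fit there.
  module LucchesiYounger (conn : ∀ Z → Dicut Z → ∃[ e ] cross Z e ≡ true) where

    cap : (Fin m → Bool) → Fin m → ℕ
    cap supp e = b2n (supp e)

    remove : Fin m → (Fin m → Bool) → Fin m → Bool
    remove b supp e = supp e ∧ not ⌊ e Finₚ.≟ b ⌋

    stage : (Fin m → Bool) → ℕ → Fin m → ℕ
    stage supp t e = b2n (supp e) + b2n (supp e ∧ ⌊ toℕ e ℕₚ.<? t ⌋)

    private
      remove-self : ∀ b supp → remove b supp b ≡ false
      remove-self b supp = trans (cong (λ x → supp b ∧ not x) (true-⌊⌋ (b Finₚ.≟ b) refl)) (Boolₚ.∧-zeroʳ _)

      remove⊆ : ∀ b supp e → remove b supp e ≡ true → supp e ≡ true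
      remove⊆ b supp e = ∧-fst {supp e}

      remove-≢ : ∀ b supp e → supp e ≡ true → e ≢ b → remove b supp e ≡ true
      remove-≢ b supp e s ne = ∧-true s (not-false (false-⌊⌋ (e Finₚ.≟ b) ne))

    contradiction-case : ∀ supp ν → ¬ HasPacking (cap supp) (suc (suc ν)) → (∃[ e ] supp e ≡ true) →
      (∀ b → supp b ≡ true → ¬ ¬ HasPacking (cap (remove b supp)) (suc ν)) → ⊥
    contradiction-case supp ν ¬p (e₀ , s₀) all =
      all e₀ s₀ λ P₀ → first-true (λ t → HasPacking (stage supp t) (suc (suc ν))) m start (end P₀)
        λ { (t , lt , ¬pt , pt) → at (fromℕ< lt) t (Finₚ.toℕ-fromℕ< lt) ¬pt pt }
      where
      start : ¬ HasPacking (stage supp 0) (suc (suc ν))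
      start = ¬p ∘ HasPacking-mono (λ e → ℕₚ.≤-reflexive (trans (cong (λ b → b2n (supp e) + b2n b) (Boolₚ.∧-zeroʳ (supp e))) (ℕₚ.+-identityʳ _))) ℕₚ.≤-refl
      -- Taking the packing that avoids `e₀` twice gives 2(ν + 1) cuts, which is at least ν + 2.
      end : HasPacking (cap (remove e₀ supp)) (suc ν) → HasPacking (stage supp m) (suc (suc ν))
      end (F , dF , le , len) = F ++ F , Allₚ.++⁺ dF dF ,
        (λ e → ℕₚ.≤-trans (ℕₚ.≤-reflexive (load-++ e F F)) (ℕₚ.+-mono-≤
          (ℕₚ.≤-trans (le e) (b2n-mono (remove⊆ e₀ supp e)))
          (ℕₚ.≤-trans (le e) (b2n-mono {remove e₀ supp e} λ h →
            ∧-true (remove⊆ e₀ supp e h) (true-⌊⌋ (toℕ e ℕₚ.<? m) (Finₚ.toℕ<n e)))))) ,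
        ℕₚ.≤-trans (s≤s (s≤s (ℕₚ.m≤m+n ν ν))) (ℕₚ.≤-trans (ℕₚ.≤-reflexive (cong suc (sym (ℕₚ.+-suc ν ν))))
          (ℕₚ.≤-trans (ℕₚ.+-mono-≤ len len) (ℕₚ.≤-reflexive (sym (length-++ F)))))
      at : ∀ b t → toℕ b ≡ t → ¬ HasPacking (stage supp t) (suc (suc ν)) → HasPacking (stage supp (suc t)) (suc (suc ν)) → ⊥
      at b t refl ¬pt pt with bool-cases (supp b)
      ... | inj₂ sb = ¬pt (HasPacking-mono (λ e → ℕₚ.+-monoʳ-≤ (b2n (supp e)) (b2n-mono (λ h →
              ∧-true (∧-fst h) (true-⌊⌋ (toℕ e ℕₚ.<? toℕ b) (ℕₚ.≤∧≢⇒< (ℕₚ.≤-pred (⌊⌋-true (toℕ e ℕₚ.<? suc (toℕ b)) (∧-snd {supp e} h)))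
                (λ q → true≢false (∧-fst h) (subst (λ z → supp z ≡ false) (sym (Finₚ.toℕ-injective q)) sb))))))) ℕₚ.≤-refl pt)
      ... | inj₁ sb = all b sb λ pb → use (truncate _ pt) (truncate _ pb)
        where
        loads : ∀ e → stage supp (suc (toℕ b)) e + cap (remove b supp) e ≤ stage supp (toℕ b) e + stage supp (toℕ b) e
        loads e = go (e Finₚ.≟ b)
          where
          w = b2n (supp e)
          w′ = b2n (supp e ∧ ⌊ toℕ e ℕₚ.<? toℕ b ⌋)
          go : Dec (e ≡ b) → stage supp (suc (toℕ b)) e + cap (remove b supp) e ≤ (w + w′) + (w + w′)
          go (yes e≡b) = ℕₚ.≤-trans (ℕₚ.+-mono-≤ (ℕₚ.+-monoʳ-≤ w (b2n-mono {supp e ∧ ⌊ toℕ e ℕₚ.<? suc (toℕ b) ⌋} ∧-fst))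
              (ℕₚ.≤-reflexive (cong b2n (subst (λ z → remove b supp z ≡ false) (sym e≡b) (remove-self b supp)))))
            (ℕₚ.≤-trans (ℕₚ.≤-reflexive (ℕₚ.+-identityʳ (w + w))) (ℕₚ.+-mono-≤ (ℕₚ.m≤m+n w w′) (ℕₚ.m≤m+n w w′)))
          go (no ne) = ℕₚ.+-mono-≤ (ℕₚ.+-monoʳ-≤ w (b2n-mono {supp e ∧ ⌊ toℕ e ℕₚ.<? suc (toℕ b) ⌋} λ h →
                ∧-true (∧-fst h) (true-⌊⌋ (toℕ e ℕₚ.<? toℕ b) (ℕₚ.≤∧≢⇒< (ℕₚ.≤-pred (⌊⌋-true (toℕ e ℕₚ.<? suc (toℕ b)) (∧-snd {supp e} h)))
                  (ne ∘ Finₚ.toℕ-injective)))))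
                (ℕₚ.≤-trans (b2n-mono (remove⊆ b supp e)) (ℕₚ.m≤m+n w w′))
        use : (∃[ F ] (All Dicut F × (∀ e → load e F ≤ stage supp (suc (toℕ b)) e) × length F ≡ suc (suc ν))) →
              (∃[ F ] (All Dicut F × (∀ e → load e F ≤ cap (remove b supp) e) × length F ≡ suc ν)) → ⊥
        use (F , dF , lF , nF) (G , dG , lG , nG) = ¬pt (halve _ (suc ν) (F ++ G) (Allₚ.++⁺ dF dG)
          (λ e → ℕₚ.≤-trans (ℕₚ.≤-reflexive (load-++ e F G)) (ℕₚ.≤-trans (ℕₚ.+-mono-≤ (lF e) (lG e)) (loads e)))
          (trans (length-++ F) (cong₂ _+_ nF nG)))

    -- Induction on ν. An arc whose deletion lowers the packing number joins the transversal, and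
    -- the cuts avoiding it are met by induction; `contradiction-case` shows that a nonempty support
    -- has such an arc. `fuel` bounds the support.
    transversal : ∀ fuel supp → count supp ≤ fuel → ∀ ν → ¬ HasPacking (cap supp) (suc ν) → ¬ ¬ Transversal supp ν
    transversal fuel supp le zero ¬p k = k ([] , [] , z≤n , (λ _ ()) , λ Z dZ sub →
      ⊥-elim (¬p (Z ∷ [] , dZ ∷ [] , (λ e → ℕₚ.≤-trans (ℕₚ.≤-reflexive (ℕₚ.+-identityʳ _)) (b2n-mono (sub e))) , s≤s z≤n)))
    transversal fuel supp le (suc ν) ¬p k =
      ¬¬-excluded-middle {A = ∃[ e ] supp e ≡ true} λ
        { (no none) → k ([] , [] , z≤n , (λ _ ()) , λ Z dZ sub →
            let e , c = conn Z dZ in ⊥-elim (none (e , sub e c)))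
        ; (yes some) → ¬¬-excluded-middle {A = ∃[ b ] (supp b ≡ true × ¬ HasPacking (cap (remove b supp)) (suc ν))} λ
          { (no ¬b) → contradiction-case supp ν ¬p some (λ b s ¬q → ¬b (b , s , ¬q))
          ; (yes (b , s , ¬q)) → descend fuel le b s ¬q } }
      where
      descend : ∀ fuel → count supp ≤ fuel → ∀ b → supp b ≡ true → ¬ HasPacking (cap (remove b supp)) (suc ν) → ⊥
      descend zero le b s ¬q = ℕₚ.n≮0 (ℕₚ.<-≤-trans (count-pos b s) le)
      descend (suc fuel) le b s ¬q = transversal fuel (remove b supp)
        (ℕₚ.≤-pred (ℕₚ.<-≤-trans (count-strict (remove⊆ b supp) b (remove-self b supp) s) le)) ν ¬q
        λ { (S , uS , lS , inS , hit) → k (b ∷ S ,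
              (All.tabulate (λ {x} x∈ b≡x → true≢false (inS x x∈) (subst (λ z → remove b supp z ≡ false) b≡x (remove-self b supp))) ∷ uS) ,
              s≤s lS ,
              (λ { e (here refl) → s ; e (there i) → remove⊆ b supp e (inS e i) }) ,
              λ Z dZ sub → hits Z dZ sub hit) }
        where
        hits : ∀ {S} Z → Dicut Z → (∀ e → cross Z e ≡ true → supp e ≡ true) →
          (∀ Z → Dicut Z → (∀ e → cross Z e ≡ true → remove b supp e ≡ true) → ∃[ e ] (e ∈ S × cross Z e ≡ true)) →
          ∃[ e ] (e ∈ (b ∷ S) × cross Z e ≡ true)
        hits Z dZ sub hit with bool-cases (cross Z b)
        ... | inj₁ c = b , here refl , c
        ... | inj₂ c = let e , i , x = hit Z dZ (λ e x → remove-≢ b supp e (sub e x) (λ { refl → true≢false x c })) in e , there i , x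

-- Alternating hexagons

_≟ᶜ_ : (c d : Cell) → Dec (c ≡ d)
_≟ᶜ_ = Prodₚ.≡-dec ℤ._≟_ ℤ._≟_

pred≢ : ∀ {p} → ℤ.pred p ≢ p
pred≢ {p} e = ℤₚ.i≢suc[i] {p} (sym (trans (cong ℤ.suc (sym e)) (ℤₚ.suc-pred p)))

suc≢ : ∀ {p} → ℤ.suc p ≢ p
suc≢ {p} e = ℤₚ.i≢suc[i] {p} (sym e)

fw-≢ : ∀ s k c → fw s k c ≢ c
fw-≢ true  d0 (p , q) e = pred≢ (cong proj₁ e)
fw-≢ true  d1 (p , q) e = pred≢ (cong proj₂ e)
fw-≢ true  d2 (p , q) e = suc≢ (cong proj₁ e)
fw-≢ false d0 (p , q) e = suc≢ (cong proj₁ e)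
fw-≢ false d1 (p , q) e = suc≢ (cong proj₂ e)
fw-≢ false d2 (p , q) e = pred≢ (cong proj₁ e)

Region : Set
Region = Cell → Bool

-- A region with its sign: for sign true (false) all edges of its boundary outside the matching
-- lead from the inside to the outside along fw true (fw false).
Member : Set
Member = Bool × Region

record IsCut (Hc : Region) (μ : Edges) (Y : Member) : Set where
  field
    inside    : ∀ c → proj₂ Y c ≡ true → Hc c ≡ true
    closed    : ∀ c k → across μ (proj₁ Y) c k ≡ false → proj₂ Y (fw (proj₁ Y) k c) ≡ true → proj₂ Y c ≡ true
    inhabited : ∃[ c ] proj₂ Y c ≡ true

NoConflict : Edges → Region → Region → Set
NoConflict μ Y Z = ∀ c k → μ c k ≡ false → Y c ≢ Y (fw true k c) → Z c ≢ Z (fw true k c) → ⊥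

noConflict : ∀ {μ Y Z} → NoConflict μ Y Z → ∀ s c k → across μ s c k ≡ false →
  Y c ≢ Y (fw s k c) → Z c ≢ Z (fw s k c) → ⊥
noConflict nc true  c k e y z = nc c k e y z
noConflict {Y = Y} {Z} nc false c k e y z = nc (fw false k c) k e
  (λ q → y (trans (cong Y (sym (fw-inv true k c))) (sym q)))
  (λ q → z (trans (cong Z (sym (fw-inv true k c))) (sym q)))

NoConflict-sym : ∀ {μ Y Z} → NoConflict μ Y Z → NoConflict μ Z Y
NoConflict-sym nc c k e z y = nc c k e y z

record Packing (Hc : Region) (μ : Edges) {n : ℕ} (F : Fin n → Member) : Set where
  field
    cut      : ∀ i → IsCut Hc μ (F i)
    disjoint : ∀ i j → i ≢ j → NoConflict μ (proj₂ (F i)) (proj₂ (F j))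

Laminar : Region → Region → Set
Laminar Y Z = (∀ c → Y c ≡ true → Z c ≡ true) ⊎ (∀ c → Z c ≡ true → Y c ≡ true) ⊎ (∀ c → Y c ≡ true → Z c ≡ false)

single : Cell → Region
single b c = ⌊ c ≟ᶜ b ⌋

single-self : ∀ b → single b b ≡ true
single-self b = true-⌊⌋ (b ≟ᶜ b) refl

single-≡ : ∀ {b c} → single b c ≡ true → c ≡ b
single-≡ {b} {c} = ⌊⌋-true (c ≟ᶜ b)

single-≢ : ∀ {b c} → c ≢ b → single b c ≡ false
single-≢ {b} {c} = false-⌊⌋ (c ≟ᶜ b)

sep-single : ∀ {c x y} → single c x ≢ single c y → x ≡ c ⊎ y ≡ c
sep-single {c} {x} {y} ne with x ≟ᶜ c | y ≟ᶜ c
... | yes e | _     = inj₁ e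
... | no _  | yes e = inj₂ e
... | no n  | no n′ = ⊥-elim (ne refl)

One-₁ : ∀ {a b c} → One a b c → a ≡ true → b ≡ false × c ≡ false
One-₁ one₁ e = refl , refl

One-₂ : ∀ {a b c} → One a b c → b ≡ true → a ≡ false × c ≡ false
One-₂ one₂ e = refl , refl

One-₃ : ∀ {a b c} → One a b c → c ≡ true → a ≡ false × b ≡ false
One-₃ one₃ e = refl , refl

One-flip : ∀ {a b c} → One a b c → b ≡ false → One (not a) b (not c)
One-flip one₁ e = one₃
One-flip one₃ e = one₁

sgn : ∀ r s → r ≡ s ⊎ r ≡ not s
sgn true  true  = inj₁ refl
sgn true  false = inj₂ refl
sgn false true  = inj₂ refl
sgn false false = inj₁ refl

-- The hexagon c is alternating; its sign is that of the cut it bounds.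
Hex : Edges → Bool → Cell → Set
Hex μ s b = ∀ k → across μ (not s) b k ≡ true

module Hexes {Hc : Region} {μ : Edges} (pm : IsMatching Hc μ) where

  hex-fwd : ∀ {s b} → Hc b ≡ true → Hex μ s b → ∀ k → across μ s b k ≡ false
  hex-fwd {s} {b} Hb h k = let i , j , π = others k in proj₁ (One-₃ (law pm s π b (inj₁ Hb)) (h j))

  -- These are the edges which end at a corner of the hexagon without being a side; the corner is
  -- already covered by a matched side.
  hex-opp : ∀ {s b} → Hc b ≡ true → Hex μ s b → ∀ r {i j l} → Perm i j l → across μ r (fw r i b) j ≡ false
  hex-opp {s} {b} Hb h r {i} {j} {l} π with sgn r s
  ... | inj₁ refl = proj₂ (One-₃ (law pm r π b (inj₁ Hb)) (h l))
  ... | inj₂ refl = proj₁ (One-₁ (law pm r π b (inj₁ Hb)) (h i))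

  -- At an end of an unmatched common side, each of the two hexagons would contribute its own
  -- matched edge.
  hex-adjacent : ∀ {t t′ c} → Hc c ≡ true → Hex μ t c → ∀ s k → Hex μ t′ (fw s k c) → across μ s c k ≡ false → ⊥
  hex-adjacent {t} {t′} {c} Hc₁ h s k h′ e with sgn t s | sgn t′ s
  ... | inj₂ refl | _         = true≢false (subst (λ r → across μ r c k ≡ true) (not-not s) (h k)) e
  ... | inj₁ refl | inj₁ refl = true≢false (trans (sym (across-fw μ s c k)) (h′ k)) e
  ... | inj₁ refl | inj₂ refl =
        let j , l , π = others k
            o = law pm s π c (inj₁ Hc₁)
        in true≢false (subst (λ r → across μ r (fw s k c) j ≡ true) (not-not s) (h′ j)) (proj₂ (One-₃ o (h l)))

  hex-noConflict : ∀ {t t′ c d} → Hc c ≡ true → Hex μ t c → Hex μ t′ d → c ≢ d → NoConflict μ (single c) (single d)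
  hex-noConflict {t} {t′} {c} {d} Hc₁ h h′ ne x k e sc sd with sep-single sc | sep-single sd
  ... | inj₁ p | inj₁ q = ne (trans (sym p) q)
  ... | inj₂ p | inj₂ q = ne (trans (sym p) q)
  ... | inj₁ refl | inj₂ refl = hex-adjacent {t} {t′} Hc₁ h true k h′ e
  ... | inj₂ refl | inj₁ refl = hex-adjacent {t} {t′} Hc₁ h false k
          (subst (Hex μ t′) (sym (fw-inv′ true k d)) h′) (trans (cong (λ z → μ z k) (fw-inv′ true k d)) e)

  hex-cut : ∀ {t c} → Hc c ≡ true → Hex μ t c → IsCut Hc μ (t , single c)
  hex-cut {t} {c} Hc₁ h = record
    { inside    = λ d e → subst (λ z → Hc z ≡ true) (sym (single-≡ e)) Hc₁
    ; closed    = λ d k e i → ⊥-elim (true≢false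
        (trans (sym (across-fw μ t d k)) (trans (cong (λ z → across μ (not t) z k) (single-≡ i)) (h k))) e)
    ; inhabited = c , single-self c }

  hex-signs : ∀ {s c} → Hc c ≡ true → Hex μ s c → Hex μ (not s) c → ⊥
  hex-signs {s} {c} Hc₁ h h′ = true≢false (subst (λ r → across μ r c d0 ≡ true) (not-not s) (h′ d0)) (hex-fwd {s} Hc₁ h d0)

  cut-hex : ∀ {t Z c} → IsCut Hc μ (t , Z) → (∀ d → Z d ≡ single c d) → Hex μ t c
  cut-hex {t} {Z} {c} cut eq k = ≢false λ e → fw-≢ (not t) k c (single-≡ (trans (sym (eq _))
    (IsCut.closed cut (fw (not t) k c) k (trans (across-back μ t c k) e)
      (trans (cong Z (fw-inv t k c)) (trans (eq c) (single-self c))))))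

-- Rotating a set of alternating hexagons of one sign

module Raise {Hc : Region} {μ : Edges} (pm : IsMatching Hc μ)
  {a : ℕ} (F : Fin a → Member) (packF : Packing Hc μ F) (i₀ : Fin a)
  (T : Region)
  (T⊆Y : ∀ c → T c ≡ true → proj₂ (F i₀) c ≡ true)
  (T-hex : ∀ c → T c ≡ true → Hex μ (proj₁ (F i₀)) c)
  (T-nbr : ∀ c → T c ≡ true → ∀ k → ∃[ j ] ∃[ l ] (Perm j l k × proj₂ (F i₀) (fw (proj₁ (F i₀)) j c) ≡ true))
  where

  open Hexes pm
  s = proj₁ (F i₀)
  Y = proj₂ (F i₀)
  cutY = Packing.cut packF i₀

  Y⊆H : ∀ c → Y c ≡ true → Hc c ≡ true
  Y⊆H = IsCut.inside cutY
  μ′ : Edges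
  μ′ c k = if T c ∨ T (fw true k c) then not (μ c k) else μ c k

  across-flip : ∀ r c k → T c ≡ true ⊎ T (fw r k c) ≡ true → across μ′ r c k ≡ not (across μ r c k)
  across-flip true  c k h = cong (if_then not (μ c k) else μ c k) (∨-true h)
    where
    ∨-true : ∀ {x y} → x ≡ true ⊎ y ≡ true → x ∨ y ≡ true
    ∨-true (inj₁ refl) = refl
    ∨-true {x} (inj₂ refl) = Boolₚ.∨-zeroʳ x
  across-flip false c k h = across-flip true (fw false k c) k
    ([ (λ e → inj₂ (trans (cong T (fw-inv true k c)) e)) , inj₁ ]′ h)

  across-keep : ∀ r c k → T c ≡ false → T (fw r k c) ≡ false → across μ′ r c k ≡ across μ r c k
  across-keep true  c k e₁ e₂ = cong (if_then not (μ c k) else μ c k) (cong₂ _∨_ e₁ e₂)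
  across-keep false c k e₁ e₂ = across-keep true (fw false k c) k e₂ (trans (cong T (fw-inv true k c)) e₁)

  -- A common side is a forward side for one of the cells and a backward side for the other, so for
  -- equal signs it would have to be both unmatched and matched.
  T-adjacent : ∀ r k c → T c ≡ true → T (fw r k c) ≡ true → ⊥
  T-adjacent r k c h h′ with sgn r s
  ... | inj₁ refl = true≢false (trans (sym (across-fw μ r c k)) (T-hex _ h′ k)) (hex-fwd {s} (Y⊆H c (T⊆Y c h)) (T-hex c h) k)
  ... | inj₂ refl = true≢false (trans (across-fw μ r c k) (T-hex _ h k))
          (subst (λ t → across μ t (fw r k c) k ≡ false) (sym (not-not s)) (hex-fwd {s} (Y⊆H _ (T⊆Y _ h′)) (T-hex _ h′) k))

  private
    One-keep₁ : ∀ {a b c} → One a b c → a ≡ false → One a (not b) (not c)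
    One-keep₁ one₂ e = one₃
    One-keep₁ one₃ e = one₂
    One-keep₃ : ∀ {a b c} → One a b c → c ≡ false → One (not a) (not b) c
    One-keep₃ one₁ e = one₂
    One-keep₃ one₂ e = one₁

  -- At most one of the three cells is in `T`. Of its two sides at this vertex one is matched, since
  -- the third edge is not by `hex-opp`, and the rotation exchanges them.
  triangle : ∀ {i j l} → Perm i j l → ∀ x → One (μ x i) (μ (fw true i x) j) (μ (fw false l x) l) →
    One (μ′ x i) (μ′ (fw true i x) j) (μ′ (fw false l x) l)
  triangle {i} {j} {l} π x o = subst₂ (One (μ′ x i)) (sym e₂) (sym e₃) (go (T x) (T y) (T z) refl refl refl)
    where
    y = fw true i x
    z = fw false l x
    yz : fw true j y ≡ z
    yz = fw-fw true π x
    zx : fw true l z ≡ x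
    zx = fw-inv true l x
    b′ = if T y ∨ T z then not (μ y j) else μ y j
    c′ = if T z ∨ T x then not (μ z l) else μ z l
    e₂ : μ′ y j ≡ b′
    e₂ = cong (λ w → if T y ∨ T w then not (μ y j) else μ y j) yz
    e₃ : μ′ z l ≡ c′
    e₃ = cong (λ w → if T z ∨ T w then not (μ z l) else μ z l) zx
    go : ∀ tx ty tz → T x ≡ tx → T y ≡ ty → T z ≡ tz →
      One (if tx ∨ ty then not (μ x i) else μ x i) (if ty ∨ tz then not (μ y j) else μ y j) (if tz ∨ tx then not (μ z l) else μ z l)
    go true  true  tz    p q r = ⊥-elim (T-adjacent true i x p q)
    go true  false true  p q r = ⊥-elim (T-adjacent false l x p r)
    go false true  true  p q r = ⊥-elim (T-adjacent true j y q (trans (cong T yz) r))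
    go true  false false p q r = One-flip o (hex-opp {s} (Y⊆H x (T⊆Y x p)) (T-hex x p) true π)
    go false true  false p q r = One-keep₃ o (trans (cong (λ w → μ w l) (sym yz)) (hex-opp {s} (Y⊆H y (T⊆Y y q)) (T-hex y q) true (rot π)))
    go false false true  p q r = One-keep₁ o (trans (cong (λ w → μ w i) (sym zx)) (hex-opp {s} (Y⊆H z (T⊆Y z r)) (T-hex z r) true (rot (rot π))))
    go false false false p q r = o

  matching′ : IsMatching Hc μ′
  matching′ = record
    { white   = λ c t → triangle p012 c (IsMatching.white pm c t)
    ; black   = λ c t → triangle p102 c (IsMatching.black pm c t)
    ; support = supp }
    where
    supp : ∀ c k → μ′ c k ≡ true → Hc c ≡ true ⊎ Hc (fw true k c) ≡ true
    supp c k e with T c in p | T (fw true k c) in q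
    ... | true  | _     = inj₁ (Y⊆H c (T⊆Y c p))
    ... | false | true  = inj₂ (Y⊆H _ (T⊆Y _ q))
    ... | false | false = IsMatching.support pm c k e

  Outer : Fin a → Set
  Outer i = i ≢ i₀ × ∃[ v ] (∀ c → Y c ≡ true → proj₂ (F i) c ≡ v)

  module _ {i : Fin a} (out : Outer i) where
    private
      Z = proj₂ (F i)
      v = proj₁ (proj₂ out)
      onY : ∀ c → Y c ≡ true → Z c ≡ v
      onY = proj₂ (proj₂ out)
      nc : NoConflict μ Y Z
      nc = Packing.disjoint packF i₀ i (λ e → proj₁ out (sym e))

    -- A change of `Z` next to `T` would show at an unmatched edge where `Y` changes too. For a
    -- forward neighbour this edge is the common side. A backward neighbour lies behind a matched
    -- side, which the rotation makes unmatched; it is compared with the forward neighbour in `Y`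
    -- supplied by `T-nbr`, across an unmatched edge ending at a corner of `b`.
    outer-const : ∀ b → T b ≡ true → ∀ r k → Z (fw r k b) ≡ Z b
    outer-const b Tb r k with Z (fw r k b) Boolₚ.≟ Z b
    ... | yes e = e
    ... | no ne with sgn r s
    ... | inj₁ refl = ⊥-elim (noConflict {Y = Y} {Z} nc s b k (hex-fwd {s} (Y⊆H b (T⊆Y b Tb)) (T-hex b Tb) k)
            (λ e → ne (trans (onY _ (trans (sym e) (T⊆Y b Tb))) (sym (onY b (T⊆Y b Tb))))) (λ e → ne (sym e)))
    ... | inj₂ refl with T-nbr b Tb k
    ... | j , l , π , Yf = ⊥-elim (noConflict {Y = Y} {Z} nc s (fw s j b) l
            (hex-opp {s} (Y⊆H b (T⊆Y b Tb)) (T-hex b Tb) s π)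
            (λ e → ne (trans (onY _ (trans (cong Y (sym (fw-fw s π b))) (trans (sym e) Yf))) (sym (onY b (T⊆Y b Tb)))))
            (λ e → ne (trans (cong Z (sym (fw-fw s π b))) (trans (sym e) (trans (onY _ Yf) (sym (onY b (T⊆Y b Tb)))))))) 

    outer-sep : ∀ t c k → across μ′ t c k ≡ false → Z c ≢ Z (fw t k c) → across μ t c k ≡ false
    outer-sep t c k e ne with T c in p | T (fw t k c) in q
    ... | true  | _     = ⊥-elim (ne (sym (outer-const c p t k)))
    ... | false | true  = ⊥-elim (ne (trans (cong Z (sym (fw-inv′ t k c))) (outer-const _ q (not t) k)))
    ... | false | false = trans (sym (across-keep t c k p q)) e

    outer-cut : IsCut Hc μ′ (F i)
    outer-cut = record
      { inside = IsCut.inside cut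
      ; closed = λ c k e h → case (Z c Boolₚ.≟ Z (fw (proj₁ (F i)) k c)) of λ
          { (yes q) → trans q h
          ; (no ne) → IsCut.closed cut c k (outer-sep (proj₁ (F i)) c k e ne) h }
      ; inhabited = IsCut.inhabited cut }
      where cut = Packing.cut packF i

    outer-hex : ∀ c → Y c ≡ true → NoConflict μ′ (single c) Z
    outer-hex c Yc x k e sc sZ = far (sep-single sc)
      where
      nonM : ∀ t y → across μ t y k ≡ false → Z y ≢ Z (fw t k y) → Y y ≡ true → ⊥
      nonM t y e′ ne Yy = noConflict {Y = Y} {Z} nc t y k e′
        (λ q → ne (trans (onY y Yy) (sym (onY _ (trans (sym q) Yy))))) ne
      far : x ≡ c ⊎ fw true k x ≡ c → ⊥
      far (inj₁ refl) = nonM true x (outer-sep true x k e sZ) sZ Yc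
      far (inj₂ refl) = nonM false (fw true k x) (trans (across-fw μ true x k) (outer-sep true x k e sZ))
        (λ q → sZ (sym (trans q (cong Z (fw-inv′ true k x))))) Yc

  -- A member of the new packing is either a hexagon alternating after the rotation or an old member
  -- which is kept.
  Slot : Set
  Slot = Cell ⊎ Fin a

  module _ {n : ℕ} (slot : Fin n → Slot) (inj : ∀ i j → slot i ≡ slot j → i ≡ j)
    (hexes : ∀ i c → slot i ≡ inj₁ c → Y c ≡ true × ∃[ t ] Hex μ′ t c)
    (outers : ∀ i j → slot i ≡ inj₂ j → Outer j) where

    private
      module H′ = Hexes matching′

      build : ∀ i x → slot i ≡ x → Member
      build i (inj₁ c) e = proj₁ (proj₂ (hexes i c e)) , single c
      build i (inj₂ j) e = F j

    repacked : Fin n → Member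
    repacked i = build i (slot i) refl

    repack : Packing Hc μ′ repacked
    repack = record { cut = λ i → cut i (slot i) refl ; disjoint = λ i j ne → disj i j (slot i) (slot j) refl refl ne }
      where
      cut : ∀ i x (e : slot i ≡ x) → IsCut Hc μ′ (build i x e)
      cut i (inj₁ c) e = H′.hex-cut {proj₁ (proj₂ (hexes i c e))} (Y⊆H c (proj₁ (hexes i c e))) (proj₂ (proj₂ (hexes i c e)))
      cut i (inj₂ j) e = outer-cut (outers i j e)
      disj : ∀ i j x y (e : slot i ≡ x) (e′ : slot j ≡ y) → i ≢ j → NoConflict μ′ (proj₂ (build i x e)) (proj₂ (build j y e′))
      disj i j (inj₁ c) (inj₁ d) e e′ ne = H′.hex-noConflict
        {proj₁ (proj₂ (hexes i c e))} {proj₁ (proj₂ (hexes j d e′))}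
        (Y⊆H c (proj₁ (hexes i c e))) (proj₂ (proj₂ (hexes i c e))) (proj₂ (proj₂ (hexes j d e′)))
        λ { refl → ne (inj i j (trans e (sym e′))) }
      disj i j (inj₁ c) (inj₂ k) e e′ ne = outer-hex (outers j k e′) c (proj₁ (hexes i c e))
      disj i j (inj₂ k) (inj₁ d) e e′ ne =
        NoConflict-sym {μ′} {single d} {proj₂ (F k)} (outer-hex (outers i k e) d (proj₁ (hexes j d e′)))
      disj i j (inj₂ k) (inj₂ m) e e′ ne x r q s₁ s₂ =
        Packing.disjoint packF k m (λ { refl → ne (inj i j (trans e (sym e′))) }) x r
          (outer-sep (outers i k e) true x r q s₁) s₁ s₂

swapʳ : ∀ {i j l} → Perm i j l → Perm i l j
swapʳ = rot ∘ rot ∘ rev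

fw-dir : ∀ s {i j} c → fw s i c ≡ fw s j c → i ≡ j
fw-dir true  {d0} {d0} c e = refl
fw-dir true  {d0} {d1} c e = ⊥-elim (pred≢ (cong proj₁ e))
fw-dir true  {d0} {d2} c e = ⊥-elim (suc≢ (sym (cong proj₂ e)))
fw-dir true  {d1} {d0} c e = ⊥-elim (pred≢ (cong proj₂ e))
fw-dir true  {d1} {d1} c e = refl
fw-dir true  {d1} {d2} c e = ⊥-elim (suc≢ (sym (cong proj₁ e)))
fw-dir true  {d2} {d0} c e = ⊥-elim (suc≢ (cong proj₂ e))
fw-dir true  {d2} {d1} c e = ⊥-elim (suc≢ (cong proj₁ e))
fw-dir true  {d2} {d2} c e = refl
fw-dir false {d0} {d0} c e = refl
fw-dir false {d0} {d1} c e = ⊥-elim (suc≢ (cong proj₁ e))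
fw-dir false {d0} {d2} c e = ⊥-elim (pred≢ (sym (cong proj₂ e)))
fw-dir false {d1} {d0} c e = ⊥-elim (suc≢ (cong proj₂ e))
fw-dir false {d1} {d1} c e = refl
fw-dir false {d1} {d2} c e = ⊥-elim (pred≢ (sym (cong proj₁ e)))
fw-dir false {d2} {d0} c e = ⊥-elim (pred≢ (cong proj₂ e))
fw-dir false {d2} {d1} c e = ⊥-elim (pred≢ (cong proj₁ e))
fw-dir false {d2} {d2} c e = refl

-- Linear functionals on the cells and extremal choices

neg-pred : ∀ p → ℤ.- ℤ.pred p ≡ ℤ.suc (ℤ.- p)
neg-pred p = ℤₚ.neg-distrib-+ (ℤ.- + 1) p

neg-suc′ : ∀ p → ℤ.- ℤ.suc p ≡ ℤ.pred (ℤ.- p)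
neg-suc′ p = ℤₚ.neg-distrib-+ (+ 1) p

-- A linear functional which increases by 1 along u_k and decreases by 1 along u_(slope k).
slope : Dir → Dir
slope d0 = d2
slope d1 = d2
slope d2 = d0

level : Bool → Dir → Cell → ℤ
level true  d0 (p , q) = ℤ.- p
level true  d1 (p , q) = ℤ.- q
level true  d2 (p , q) = p
level false d0 (p , q) = p
level false d1 (p , q) = q
level false d2 (p , q) = ℤ.- p

level-up : ∀ s k c → level s k (fw s k c) ≡ ℤ.suc (level s k c)
level-up true  d0 (p , q) = neg-pred p
level-up true  d1 (p , q) = neg-pred q
level-up true  d2 (p , q) = refl
level-up false d0 (p , q) = refl
level-up false d1 (p , q) = refl
level-up false d2 (p , q) = neg-pred p

level-down : ∀ s k c → level s k (fw s (slope k) c) ≡ ℤ.pred (level s k c)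
level-down true  d0 (p , q) = neg-suc′ p
level-down true  d1 (p , q) = neg-suc′ q
level-down true  d2 (p , q) = refl
level-down false d0 (p , q) = refl
level-down false d1 (p , q) = refl
level-down false d2 (p , q) = neg-suc′ p

pred≤suc : ∀ i → ℤ.pred i ℤ.≤ ℤ.suc i
pred≤suc i = ℤₚ.≤-trans (ℤₚ.i≤j⇒pred[i]≤j (ℤₚ.≤-refl {i})) (ℤₚ.i≤suc[i] i)

level-≤ : ∀ s k i c → level s k (fw s i c) ℤ.≤ ℤ.suc (level s k c)
level-≤ true  d0 d0 (p , q) = ℤₚ.≤-reflexive (neg-pred p)
level-≤ true  d0 d1 (p , q) = ℤₚ.i≤suc[i] _
level-≤ true  d0 d2 (p , q) = ℤₚ.≤-trans (ℤₚ.≤-reflexive (neg-suc′ p)) (pred≤suc (ℤ.- p))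
level-≤ true  d1 d0 (p , q) = ℤₚ.i≤suc[i] _
level-≤ true  d1 d1 (p , q) = ℤₚ.≤-reflexive (neg-pred q)
level-≤ true  d1 d2 (p , q) = ℤₚ.≤-trans (ℤₚ.≤-reflexive (neg-suc′ q)) (pred≤suc (ℤ.- q))
level-≤ true  d2 d0 (p , q) = pred≤suc p
level-≤ true  d2 d1 (p , q) = ℤₚ.i≤suc[i] _
level-≤ true  d2 d2 (p , q) = ℤₚ.≤-refl
level-≤ false d0 d0 (p , q) = ℤₚ.≤-refl
level-≤ false d0 d1 (p , q) = ℤₚ.i≤suc[i] _
level-≤ false d0 d2 (p , q) = pred≤suc p
level-≤ false d1 d0 (p , q) = ℤₚ.i≤suc[i] _
level-≤ false d1 d1 (p , q) = ℤₚ.≤-refl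
level-≤ false d1 d2 (p , q) = pred≤suc q
level-≤ false d2 d0 (p , q) = ℤₚ.≤-trans (ℤₚ.≤-reflexive (neg-suc′ p)) (pred≤suc (ℤ.- p))
level-≤ false d2 d1 (p , q) = ℤₚ.i≤suc[i] _
level-≤ false d2 d2 (p , q) = ℤₚ.≤-reflexive (neg-pred p)

lowerBound : ∀ {a} {A : Set a} (g : A → ℤ) (xs : List A) → ∃[ m ] (∀ x → x ∈ xs → m ℤ.≤ g x)
lowerBound g []       = + 0 , λ _ ()
lowerBound g (x ∷ xs) with lowerBound g xs
... | m , h = m ℤ.⊓ g x , λ
  { y (here refl) → ℤₚ.i⊓j≤j m (g x)
  ; y (there i)   → ℤₚ.≤-trans (ℤₚ.i⊓j≤i m (g x)) (h y i) }

¬¬-argminℤ : ∀ {a p} {A : Set a} {P : A → Set p} (g : A → ℤ) (xs : List A) → (∀ x → P x → x ∈ xs) →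
  ∀ x → P x → ¬ ¬ (∃[ m ] (P m × (∀ y → P y → g m ℤ.≤ g y)))
¬¬-argminℤ {P = P} g xs fin x px k with lowerBound g xs
... | m , lb = ¬¬-argmin (λ y → ℤ.∣ g y ℤ.- m ∣) x px λ { (z , pz , min) → k (z , pz , λ y py →
    ℤₚ.≤-trans (ℤₚ.≤-reflexive (sym (back z pz))) (ℤₚ.≤-trans (ℤₚ.+-monoˡ-≤ m (ℤ.+≤+ (min y py))) (ℤₚ.≤-reflexive (back y py)))) }
  where
  back : ∀ y → P y → + ℤ.∣ g y ℤ.- m ∣ ℤ.+ m ≡ g y
  back y py = trans (cong (λ z → z ℤ.+ m) (ℤₚ.0≤i⇒+∣i∣≡i (ℤₚ.i≤j⇒0≤j-i (lb y (fin y py)))))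
    (trans (ℤₚ.+-assoc (g y) (ℤ.- m) m) (trans (cong (λ z → g y ℤ.+ z) (ℤₚ.+-inverseˡ m)) (ℤₚ.+-identityʳ (g y))))

Hex? : ∀ μ s b → Dec (Hex μ s b)
Hex? μ s b with across μ (not s) b d0 Boolₚ.≟ true | across μ (not s) b d1 Boolₚ.≟ true | across μ (not s) b d2 Boolₚ.≟ true
... | yes x | yes y | yes z = yes λ { d0 → x ; d1 → y ; d2 → z }
... | no n  | _     | _     = no λ h → n (h d0)
... | yes _ | no n  | _     = no λ h → n (h d1)
... | yes _ | yes _ | no n  = no λ h → n (h d2)

¬Hex : ∀ {μ s b} → ¬ Hex μ s b → ∃[ k ] across μ (not s) b k ≡ false
¬Hex {μ} {s} {b} ¬h with across μ (not s) b d0 in x | across μ (not s) b d1 in y | across μ (not s) b d2 in z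
... | false | _     | _     = d0 , x
... | true  | false | _     = d1 , y
... | true  | true  | false = d2 , z
... | true  | true  | true  = ⊥-elim (¬h λ { d0 → x ; d1 → y ; d2 → z })

-- Exchanging the members of a packing after a rotation

module Focus {Hc : Region} {μ : Edges} (pm : IsMatching Hc μ) {a : ℕ}
  (max₀ : ∀ n (G : Fin n → Member) → Packing Hc μ G → n ≤ a)
  (max₁ : ∀ μ′ → IsMatching Hc μ′ → ∀ n (G : Fin n → Member) → Packing Hc μ′ G → n ≤ suc a)
  (F : Fin a → Member) (packF : Packing Hc μ F) (i₀ : Fin a)
  (inner : ∀ i → i ≢ i₀ →
    (∃[ v ] (∀ c → proj₂ (F i₀) c ≡ true → proj₂ (F i) c ≡ v)) ⊎
    (∃[ e ] (proj₂ (F i₀) e ≡ true × (∀ d → proj₂ (F i) d ≡ single e d))))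
  where

  open Hexes pm
  s = proj₁ (F i₀)
  Y = proj₂ (F i₀)
  cutY = Packing.cut packF i₀

  Y⊆H : ∀ c → Y c ≡ true → Hc c ≡ true
  Y⊆H = IsCut.inside cutY

  Listed : Cell → Set
  Listed e = ∃[ i ] (i ≢ i₀ × (∀ d → proj₂ (F i) d ≡ single e d))

  listed-hex : ∀ {i e} → (∀ d → proj₂ (F i) d ≡ single e d) → Hex μ (proj₁ (F i)) e
  listed-hex {i} = cut-hex (Packing.cut packF i)

  listed-unique : ∀ {i j e} → Hc e ≡ true → (∀ d → proj₂ (F i) d ≡ single e d) → (∀ d → proj₂ (F j) d ≡ single e d) → i ≡ j
  listed-unique {i} {j} {e} He p q with i Finₚ.≟ j
  ... | yes r = r
  ... | no ne = ⊥-elim (noConflict {Y = proj₂ (F i)} {proj₂ (F j)} (Packing.disjoint packF i j ne) t e d0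
                  (hex-fwd {t} He (listed-hex p) d0) (sep (proj₂ (F i)) p) (sep (proj₂ (F j)) q))
    where
    t = proj₁ (F i)
    sep : ∀ (Z : Region) → (∀ d → Z d ≡ single e d) → Z e ≢ Z (fw t d0 e)
    sep Z h q = true≢false (trans (sym (trans q (h _))) (trans (h e) (single-self e))) (single-≢ (fw-≢ t d0 e))

  -- A forward side of `c` is unmatched and bounds the member `single c`, so it cannot bound `Y` as
  -- well.
  listed-nbr : ∀ {c} → Y c ≡ true → Hex μ s c → Listed c → ∀ k → Y (fw s k c) ≡ true
  listed-nbr {c} Yc h (i , ne , eq) k = ≢false λ q → noConflict {Y = Y} {proj₂ (F i)}
    (Packing.disjoint packF i₀ i (λ e → ne (sym e))) s c k (hex-fwd {s} (Y⊆H c Yc) h k)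
    (λ e → true≢false (trans (sym e) Yc) q)
    (λ e → true≢false (trans (sym (trans e (eq _))) (trans (eq c) (single-self c))) (single-≢ (fw-≢ s k c)))

  module Gain (T : Region)
    (T⊆Y : ∀ c → T c ≡ true → Y c ≡ true)
    (T-hex : ∀ c → T c ≡ true → Hex μ s c)
    (T-nbr : ∀ c → T c ≡ true → ∀ k → ∃[ j ] ∃[ l ] (Perm j l k × Y (fw s j c) ≡ true))
    (k₀ : Dir)
    (spread : ∀ e → Y e ≡ true → Hex μ (not s) e → ∀ k → T (fw s k e) ≡ true → ∀ j → T (fw s j e) ≡ true)
    where

    open Raise pm F packF i₀ T T⊆Y T-hex T-nbr using (μ′; matching′; across-flip; across-keep; T-adjacent; Slot; repacked; repack; Outer) public
    -- These cells become alternating hexagons of sign `s`: after the rotation all their backward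
    -- sides are matched.
    L : Cell → Set
    L f = Y f ≡ true × (∃[ k ] T (fw (not s) k f) ≡ true) × (∀ k → T (fw (not s) k f) ≡ true ⊎ across μ (not s) f k ≡ true)

    -- The substitute for a hexagon `e` of opposite sign, which is destroyed when its three forward
    -- neighbours are rotated.
    φ : Cell → Cell
    φ e = fw s k₀ (fw s k₀ e)

    T-fwd : ∀ k f → T (fw (not s) k f) ≡ true → across μ (not s) f k ≡ false
    T-fwd k f h = trans (sym (across-back μ s f k)) (hex-fwd {s} (Y⊆H _ (T⊆Y _ h)) (T-hex _ h) k)

    L-∉T : ∀ {f} → L f → T f ≡ false
    L-∉T {f} (_ , (k , h) , _) = ≢true λ t → T-adjacent (not s) k f t h

    L-¬hex : ∀ {f} → L f → ∀ t → Hex μ t f → ⊥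
    L-¬hex {f} (_ , (k , h) , _) t hx = hex-adjacent {s} {t} (Y⊆H _ (T⊆Y _ h)) (T-hex _ h) s k
      (subst (Hex μ t) (sym (fw-inv s k f)) hx) (hex-fwd {s} (Y⊆H _ (T⊆Y _ h)) (T-hex _ h) k)

    L-hex′ : ∀ {f} → L f → Hex μ′ s f
    L-hex′ {f} l@(_ , _ , all) k with bool-cases (T (fw (not s) k f)) | all k
    ... | inj₁ h | _ = trans (across-flip (not s) f k (inj₂ h)) (not-false (T-fwd k f h))
    ... | inj₂ n | inj₁ h = ⊥-elim (true≢false h n)
    ... | inj₂ n | inj₂ h = trans (across-keep (not s) f k (L-∉T l) n) h

    Moved : Cell → Set
    Moved e = Y e ≡ true × Hex μ (not s) e × (∀ j → T (fw s j e) ≡ true)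

    -- The cells available as additional members: alternating after the rotation, and claimed
    -- neither by an old hexagon nor by a substitute.
    record Good (x : Cell) : Set where
      field
        inY      : Y x ≡ true
        hex      : ∃[ t ] Hex μ′ t x
        unlisted : ¬ Listed x
        unmoved  : ∀ e → Moved e → φ e ≢ x

    L-good : ∀ {x} → L x → (∀ e → Moved e → φ e ≢ x) → Good x
    L-good l un = record
      { inY = proj₁ l ; hex = s , L-hex′ l ; unmoved = un
      ; unlisted = λ { (i , _ , eq) → L-¬hex l (proj₁ (F i)) (listed-hex eq) } }

    pull : ∀ {e k} → Hex μ (not s) e → across μ s e k ≡ true
    pull {e} {k} h = subst (λ r → across μ r e k ≡ true) (not-not s) (h k)

    rotated-hex : ∀ {e} → T e ≡ true → Hex μ′ (not s) e
    rotated-hex {e} h k = subst (λ r → across μ′ r e k ≡ true) (sym (not-not s))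
      (trans (across-flip s e k (inj₁ h)) (not-false (hex-fwd {s} (Y⊆H e (T⊆Y e h)) (T-hex e h) k)))

    kept-hex : ∀ {e} → Y e ≡ true → Hex μ s e → ∃[ t ] Hex μ′ t e
    kept-hex {e} Ye h with bool-cases (T e)
    ... | inj₁ t = not s , rotated-hex t
    ... | inj₂ n = s , λ k → trans (across-keep (not s) e k n (≢true λ t →
            hex-adjacent {s} {s} (Y⊆H _ (T⊆Y _ t)) (T-hex _ t) s k (subst (Hex μ s) (sym (fw-inv s k e)) h)
              (hex-fwd {s} (Y⊆H _ (T⊆Y _ t)) (T-hex _ t) k))) (h k)

    -- The fate of each old member: one that is constant on `Y` stays, a hexagon inside `Y` stays or
    -- moves to its substitute, and the focus gives way to `x₀`.
    data Kind (x₀ : Cell) (i : Fin a) : Slot → Set where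
      outer : Outer i → Kind x₀ i (inj₂ i)
      kept  : ∀ e → i ≢ i₀ → (∀ d → proj₂ (F i) d ≡ single e d) → Y e ≡ true → ∃[ t ] Hex μ′ t e → Kind x₀ i (inj₁ e)
      moved : ∀ e → i ≢ i₀ → (∀ d → proj₂ (F i) d ≡ single e d) → Moved e → Kind x₀ i (inj₁ (φ e))
      focus : i ≡ i₀ → Kind x₀ i (inj₁ x₀)

    kind : ∀ x₀ i → ∃[ x ] Kind x₀ i x
    kind x₀ i with i Finₚ.≟ i₀
    ... | yes e = _ , focus e
    ... | no ne with inner i ne
    ... | inj₁ out = _ , outer (ne , out)
    ... | inj₂ (e , Ye , eq) with sgn (proj₁ (F i)) s
    ... | inj₁ q = _ , kept e ne eq Ye (kept-hex Ye (subst (λ t → Hex μ t e) q (listed-hex eq)))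
    ... | inj₂ q with bool-cases (T (fw s d0 e))
    ... | inj₁ t = _ , moved e ne eq (Ye , h , spread e Ye h d0 t)
      where h = subst (λ t → Hex μ t e) q (listed-hex eq)
    -- By `spread`, one forward neighbour outside `T` means that all three are, so the three matched
    -- sides of `e` are not flipped.
    ... | inj₂ n = _ , kept e ne eq Ye (not s , λ k → subst (λ r → across μ′ r e k ≡ true) (sym (not-not s))
            (trans (across-keep s e k (≢true λ t → hex-signs {s} (Y⊆H e Ye) (T-hex e t) h)
              (≢true λ t → true≢false (spread e Ye h k t d0) n)) (pull h)))
      where h = subst (λ t → Hex μ t e) q (listed-hex eq)

    module _ (L-moved : ∀ e → Moved e → L (φ e)) {m : ℕ} (x : Fin (suc m) → Cell)
      (x-inj : ∀ i j → x i ≡ x j → i ≡ j) (good : ∀ i → Good (x i)) where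

      private
        sl : Fin a → Slot
        sl i = proj₁ (kind (x zero) i)

        slot : Fin (m + a) → Slot
        slot i = [ inj₁ ∘ x ∘ suc , sl ]′ (splitAt m i)

        inj₁-inj : ∀ {u v : Cell} → inj₁ {B = Fin a} u ≡ inj₁ v → u ≡ v
        inj₁-inj refl = refl

        same : ∀ {i j y z} → Kind (x zero) i y → Kind (x zero) j z → y ≡ z → i ≡ j
        same (outer _) (outer _) refl = refl
        same (kept e ne eq Ye _) (kept _ _ eq′ _ _) refl = listed-unique (Y⊆H e Ye) eq eq′
        same {i} (kept e ne eq Ye _) (moved e′ _ eq′ mv) q =
          ⊥-elim (L-¬hex (subst L (sym (inj₁-inj q)) (L-moved e′ mv)) (proj₁ (F i)) (listed-hex eq))
        same (kept e ne eq _ _) (focus p) refl = ⊥-elim (Good.unlisted (good zero) (_ , ne , eq))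
        same {j = j} (moved e ne eq mv) (kept e′ _ eq′ _ _) q =
          ⊥-elim (L-¬hex (subst L (inj₁-inj q) (L-moved e mv)) (proj₁ (F j)) (listed-hex eq′))
        same {i} (moved e ne eq mv) (moved e′ _ eq′ mv′) q = listed-unique (Y⊆H e′ (proj₁ mv′))
          (subst (λ z → ∀ d → proj₂ (F i) d ≡ single z d) (fw-injective s k₀ (fw-injective s k₀ (inj₁-inj q))) eq) eq′
        same (moved e ne eq mv) (focus _) q = ⊥-elim (Good.unmoved (good zero) e mv (inj₁-inj q))
        same (focus p) (kept e ne eq _ _) refl = ⊥-elim (Good.unlisted (good zero) (_ , ne , eq))
        same (focus _) (moved e ne eq mv) q = ⊥-elim (Good.unmoved (good zero) e mv (sym (inj₁-inj q)))
        same (focus p) (focus q) _ = trans p (sym q)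

        fresh : ∀ i {j z} → Kind (x zero) j z → z ≡ inj₁ (x (suc i)) → ⊥
        fresh i = go
          where
          go : ∀ {j y} → Kind (x zero) j y → y ≡ inj₁ (x (suc i)) → ⊥
          go (kept e ne eq _ _) refl = Good.unlisted (good (suc i)) (_ , ne , eq)
          go (moved e ne eq mv) q = Good.unmoved (good (suc i)) e mv (inj₁-inj q)
          go (focus _) q = case x-inj zero (suc i) (inj₁-inj q) of λ ()

        slot-inj : ∀ i j → slot i ≡ slot j → i ≡ j
        slot-inj i j e with splitAt m i in p | splitAt m j in q
        ... | inj₁ u | inj₁ v = trans (sym (Finₚ.splitAt⁻¹-↑ˡ p)) (trans (cong (Fin._↑ˡ a) (Finₚ.suc-injective (x-inj _ _ (inj₁-inj e)))) (Finₚ.splitAt⁻¹-↑ˡ q))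
        ... | inj₁ u | inj₂ v = ⊥-elim (fresh u (proj₂ (kind (x zero) v)) (sym e))
        ... | inj₂ u | inj₁ v = ⊥-elim (fresh v (proj₂ (kind (x zero) u)) e)
        ... | inj₂ u | inj₂ v = trans (sym (Finₚ.splitAt⁻¹-↑ʳ p)) (trans (cong (m Fin.↑ʳ_)
                (same (proj₂ (kind (x zero) u)) (proj₂ (kind (x zero) v)) e)) (Finₚ.splitAt⁻¹-↑ʳ q))

        hexes : ∀ i c → slot i ≡ inj₁ c → Y c ≡ true × ∃[ t ] Hex μ′ t c
        hexes i c e with splitAt m i
        hexes i c refl | inj₁ u = Good.inY (good (suc u)) , Good.hex (good (suc u))
        ... | inj₂ u = go (proj₂ (kind (x zero) u)) e
          where
          go : ∀ {j y} → Kind (x zero) j y → y ≡ inj₁ c → Y c ≡ true × ∃[ t ] Hex μ′ t c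
          go (kept e ne eq Ye h) refl = Ye , h
          go (moved e ne eq mv) refl = proj₁ (L-moved e mv) , s , L-hex′ (L-moved e mv)
          go (focus _) refl = Good.inY (good zero) , Good.hex (good zero)

        outers : ∀ i j → slot i ≡ inj₂ j → Outer j
        outers i j e with splitAt m i
        ... | inj₂ u = go (proj₂ (kind (x zero) u)) e
          where
          go : ∀ {i y} → Kind (x zero) i y → y ≡ inj₂ j → Outer j
          go (outer o) refl = o

      -- The old members keep their number, since `x zero` takes the place of the focus; the
      -- remaining `m` cells are the gain.
      gain : ∃[ G ] Packing Hc μ′ {m + a} G
      gain = repacked slot slot-inj hexes outers , repack slot slot-inj hexes outers

iter : ℕ → (Cell → Cell) → Cell → Cell
iter zero    f c = c
iter (suc n) f c = f (iter n f c)

record Chain (μ : Edges) (s : Bool) (Y : Region) : Set where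
  field
    start   : Cell
    dir     : Dir
    inY     : Y start ≡ true
    hex     : Hex μ s start
    flanks  : ∀ i → i ≢ dir → Y (fw s i start) ≡ false
    unique  : ∀ c → Y c ≡ true → Hex μ s c → c ≡ start
    line    : ∀ c → Y c ≡ true → ∃[ n ] c ≡ iter n (fw s dir) start

another : (i j : Dir) → ∃[ k ] (k ≢ i × k ≢ j)
another d0 d0 = d1 , (λ ()) , (λ ())
another d0 d1 = d2 , (λ ()) , (λ ())
another d0 d2 = d1 , (λ ()) , (λ ())
another d1 d0 = d2 , (λ ()) , (λ ())
another d1 d1 = d0 , (λ ()) , (λ ())
another d1 d2 = d0 , (λ ()) , (λ ())
another d2 d0 = d1 , (λ ()) , (λ ())
another d2 d1 = d0 , (λ ()) , (λ ())
another d2 d2 = d0 , (λ ()) , (λ ())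

-- Height levels and the growth of the chain

module Levels {Hc : Region} {μ : Edges} (pm : IsMatching Hc μ) {a : ℕ}
  (max₀ : ∀ n (G : Fin n → Member) → Packing Hc μ G → n ≤ a)
  (max₁ : ∀ μ′ → IsMatching Hc μ′ → ∀ n (G : Fin n → Member) → Packing Hc μ′ G → n ≤ suc a)
  (F : Fin a → Member) (packF : Packing Hc μ F) (i₀ : Fin a)
  (inner : ∀ i → i ≢ i₀ →
    (∃[ v ] (∀ c → proj₂ (F i₀) c ≡ true → proj₂ (F i) c ≡ v)) ⊎
    (∃[ e ] (proj₂ (F i₀) e ≡ true × (∀ d → proj₂ (F i) d ≡ single e d))))
  (Hl : List Cell) (fin : ∀ c → Hc c ≡ true → c ∈ Hl)
  (h : Cell → ℕ)
  (h-up   : ∀ c k → proj₂ (F i₀) c ≡ true → proj₂ (F i₀) (fw (proj₁ (F i₀)) k c) ≡ true →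
            across μ (proj₁ (F i₀)) c k ≡ false → h (fw (proj₁ (F i₀)) k c) ≡ suc (h c))
  (h-down : ∀ c k → proj₂ (F i₀) c ≡ true → proj₂ (F i₀) (fw (proj₁ (F i₀)) k c) ≡ true →
            across μ (proj₁ (F i₀)) c k ≡ true → suc (suc (h (fw (proj₁ (F i₀)) k c))) ≡ h c)
  where

  open Hexes pm
  open Focus pm max₀ max₁ F packF i₀ inner

  closedY : ∀ c k → across μ s c k ≡ false → Y (fw s k c) ≡ true → Y c ≡ true
  closedY = IsCut.closed cutY
  below-in : ∀ f k → Y f ≡ true → across μ (not s) f k ≡ false →
    Y (fw (not s) k f) ≡ true × h f ≡ suc (h (fw (not s) k f))
  below-in f k Yf e = Yc , trans (cong h (sym (fw-inv s k f))) (h-up c k Yc Y′ e′)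
    where
    c = fw (not s) k f
    e′ : across μ s c k ≡ false
    e′ = trans (across-back μ s f k) e
    Y′ : Y (fw s k c) ≡ true
    Y′ = trans (cong Y (fw-inv s k f)) Yf
    Yc : Y c ≡ true
    Yc = closedY c k e′ Y′

  -- The rotated set may miss cells of its level. `defect` confines these to cells of a chain, which
  -- lead up inside `Y` at most in the direction `k₀`; substitutes are therefore shifted along `k₀`.
  module Level (T : Region)
    (T⊆Y : ∀ c → T c ≡ true → Y c ≡ true)
    (T-hex : ∀ c → T c ≡ true → Hex μ s c)
    (ℓ : ℕ) (T-h : ∀ c → T c ≡ true → h c ≡ ℓ)
    (k₀ : Dir)
    (T-two : ∀ c → T c ≡ true → ∃[ i ] ∃[ j ] (i ≢ j × Y (fw s i c) ≡ true × Y (fw s j c) ≡ true))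
    (T-k₀ : ∀ c → T c ≡ true → Y (fw s k₀ c) ≡ true)
    (defect : ∀ c → Y c ≡ true → h c ≡ ℓ → T c ≡ true ⊎ (∀ i → i ≢ k₀ → Y (fw s i c) ≡ false))
    where

    private
      T-nbr : ∀ c → T c ≡ true → ∀ k → ∃[ j ] ∃[ l ] (Perm j l k × Y (fw s j c) ≡ true)
      T-nbr c t k with T-two c t
      ... | i , j , ne , yi , yj with i ≟ᵈ k
      ... | no i≢k = i , proj₁ (complete {i} {k} i≢k) , swapʳ (proj₂ (complete {i} {k} i≢k)) , yi
      ... | yes refl = j , proj₁ (complete {j} {i} (≢-sym ne)) , swapʳ (proj₂ (complete {j} {i} (≢-sym ne))) , yj

      spread : ∀ e → Y e ≡ true → Hex μ (not s) e → ∀ k → T (fw s k e) ≡ true → ∀ j → T (fw s j e) ≡ true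
      spread e Ye hx k t j = [ id , (λ fl → ⊥-elim (flank fl)) ]′ (defect (fw s j e) (Yj j) hj)
        where
        He = Y⊆H e Ye
        back : ∀ i → Y (fw (not s) i e) ≡ true
        back i = closedY (fw (not s) i e) i (trans (across-back μ s e i) (hex-fwd {not s} He hx i))
                   (trans (cong Y (fw-inv s i e)) Ye)
        Yj : ∀ j → Y (fw s j e) ≡ true
        Yj j = let i , l , π = others j in
          closedY (fw s j e) i (hex-opp {not s} He hx s π) (trans (cong Y (fw-fw s π e)) (back l))
        pull : ∀ i → across μ s e i ≡ true
        pull i = subst (λ r → across μ r e i ≡ true) (not-not s) (hx i)
        hj : h (fw s j e) ≡ ℓ
        hj = trans (ℕₚ.suc-injective (ℕₚ.suc-injective (trans (h-down e j Ye (Yj j) (pull j)) (sym (h-down e k Ye (Yj k) (pull k))))))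
               (T-h _ t)
        -- Going up from `fw s j e` in a direction other than `j` leads to a backward neighbour of
        -- `e`, which is in `Y`; one of these two directions differs from `k₀`.
        flank : (∀ i → i ≢ k₀ → Y (fw s i (fw s j e)) ≡ false) → ⊥
        flank fl with another k₀ j
        ... | i , i≢k₀ , i≢j with complete {j} {i} (≢-sym i≢j)
        ... | l , π = true≢false (trans (cong Y (fw-fw s π e)) (back l)) (fl i i≢k₀)

    open Gain T T⊆Y T-hex T-nbr k₀ spread public

    -- A cell just above `T` can fail to be in `L` only through an unmatched backward side towards a
    -- cell of the level outside `T`. By `defect` it is then the `k₀`-successor of that cell, which
    -- `avoid` excludes.
    nbr-L : ∀ z i → T z ≡ true → Y (fw s i z) ≡ true →
      (∀ c → Y c ≡ true → h c ≡ ℓ → T c ≡ false → fw s i z ≢ fw s k₀ c) → L (fw s i z)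
    nbr-L z i t y avoid = y , (i , trans (cong T (fw-inv′ s i z)) t) , all
      where
      f = fw s i z
      hf : h f ≡ suc ℓ
      hf = trans (h-up z i (T⊆Y z t) y (hex-fwd {s} (Y⊆H z (T⊆Y z t)) (T-hex z t) i)) (cong suc (T-h z t))
      all : ∀ k → T (fw (not s) k f) ≡ true ⊎ across μ (not s) f k ≡ true
      all k with bool-cases (across μ (not s) f k)
      ... | inj₁ e = inj₂ e
      ... | inj₂ e with below-in f k y e
      ... | Yc , hc with bool-cases (T (fw (not s) k f))
      ... | inj₁ tc = inj₁ tc
      ... | inj₂ ntc with defect (fw (not s) k f) Yc (ℕₚ.suc-injective (trans (sym hc) hf)) | k ≟ᵈ k₀
      ... | inj₁ tc | _ = inj₁ tc
      ... | inj₂ fl | no ne = ⊥-elim (true≢false (trans (cong Y (fw-inv s k f)) y) (fl k ne))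
      ... | inj₂ fl | yes refl = ⊥-elim (avoid _ Yc (ℕₚ.suc-injective (trans (sym hc) hf)) ntc (sym (fw-inv s k f)))

    L-moved : ∀ e → Moved e → L (φ e)
    L-moved e (Ye , hx , ts) = nbr-L (fw s k₀ e) k₀ (ts k₀) (T-k₀ _ (ts k₀))
      λ c _ _ n q → true≢false (ts k₀) (trans (cong T (fw-injective s k₀ q)) n)

    module _ (z : Cell) (Tz : T z ≡ true) (least : ∀ c → T c ≡ true → level s k₀ z ℤ.≤ level s k₀ c) where

      -- The forward neighbour of `e` in the direction `slope k₀` is in `T` and one lower than `e`
      -- for `level`. As `z` is least, a neighbour of `z` is not higher than `e`, whereas `φ e` is
      -- two higher.
      unmoved : ∀ i e → Moved e → φ e ≢ fw s i z
      unmoved i e (Ye , hx , ts) q = ℤₚ.<-irrefl refl (ℤₚ.<-≤-trans lt le)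
        where
        v = level s k₀ e
        e₁ : level s k₀ (φ e) ≡ ℤ.suc (ℤ.suc v)
        e₁ = trans (level-up s k₀ (fw s k₀ e)) (cong ℤ.suc (level-up s k₀ e))
        le : level s k₀ (φ e) ℤ.≤ v
        le = ℤₚ.≤-trans (ℤₚ.≤-reflexive (cong (level s k₀) q)) (ℤₚ.≤-trans (level-≤ s k₀ i z)
               (ℤₚ.≤-trans (ℤₚ.+-monoʳ-≤ (+ 1) (ℤₚ.≤-trans (least _ (ts (slope k₀))) (ℤₚ.≤-reflexive (level-down s k₀ e))))
                 (ℤₚ.≤-reflexive (ℤₚ.suc-pred v))))
        lt : v ℤ.< level s k₀ (φ e)
        lt = subst (v ℤ.<_) (sym e₁) (ℤₚ.≤-<-trans (ℤₚ.i≤suc[i] v) (ℤₚ.suc[i]≤j⇒i<j ℤₚ.≤-refl))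

      -- Of the three new hexagons one pays for the focus: there would be `a + 2` cuts of the
      -- rotated matching, against `max₁`.
      overfull : ∀ {i j} → i ≢ j → L (fw s i z) → L (fw s j z) →
        ∀ x → Good x → x ≢ fw s i z → x ≢ fw s j z → ⊥
      overfull {i} {j} ne li lj x gx n₁ n₂ = ℕₚ.1+n≰n (max₁ μ′ matching′ (2 + a) (proj₁ packed) (proj₂ packed))
        where
        xs : Fin 3 → Cell
        xs zero = x
        xs (suc zero) = fw s i z
        xs (suc (suc zero)) = fw s j z
        xs-inj : ∀ u v → xs u ≡ xs v → u ≡ v
        xs-inj zero zero e = refl
        xs-inj zero (suc zero) e = ⊥-elim (n₁ e)
        xs-inj zero (suc (suc zero)) e = ⊥-elim (n₂ e)
        xs-inj (suc zero) zero e = ⊥-elim (n₁ (sym e))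
        xs-inj (suc zero) (suc zero) e = refl
        xs-inj (suc zero) (suc (suc zero)) e = ⊥-elim (ne (fw-dir s z e))
        xs-inj (suc (suc zero)) zero e = ⊥-elim (n₂ (sym e))
        xs-inj (suc (suc zero)) (suc zero) e = ⊥-elim (ne (sym (fw-dir s z e)))
        xs-inj (suc (suc zero)) (suc (suc zero)) e = refl
        good : ∀ u → Good (xs u)
        good zero = gx
        good (suc zero) = L-good li (unmoved i)
        good (suc (suc zero)) = L-good lj (unmoved j)
        packed = gain L-moved {2} xs xs-inj good

  T-least : ∀ (T : Region) → (∀ c → T c ≡ true → Y c ≡ true) → ∀ k₀ b → T b ≡ true →
    ¬ ¬ (∃[ z ] (T z ≡ true × (∀ c → T c ≡ true → level s k₀ z ℤ.≤ level s k₀ c)))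
  T-least T T⊆Y k₀ = ¬¬-argminℤ {P = λ c → T c ≡ true} (level s k₀) Hl (λ c t → fin c (Y⊆H c (T⊆Y c t)))

  Lowest : Cell → Set
  Lowest b = Y b ≡ true × (∀ c → Y c ≡ true → h b ≤ h c)

  -- An unmatched backward side would lead one level down, and by closedness still inside `Y`.
  lowest-hex : ∀ {b} → Lowest b → Hex μ s b
  lowest-hex {b} (Yb , min) k = ≢false λ e → let Yc , hb = below-in b k Yb e in
    ℕₚ.<⇒≱ (ℕₚ.≤-reflexive (sym hb)) (min _ Yc)

  -- Nothing is rotated here: for empty `T` the two hexagons take the place of the focus and give
  -- `a + 1` cuts of `μ` itself, against `max₀`.
  two-unlisted : ∀ {b c} → Y b ≡ true → Y c ≡ true → Hex μ s b → Hex μ s c → ¬ Listed b → ¬ Listed c → b ≢ c → ⊥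
  two-unlisted {b} {c} Yb Yc hb hc nb nc ne = ℕₚ.1+n≰n (max₀ (1 + a) (proj₁ packed) (proj₂ packed))
    where
    open Gain (λ _ → false) (λ _ ()) (λ _ ()) (λ _ ()) d0 (λ _ _ _ _ ())
    xs : Fin 2 → Cell
    xs zero = b
    xs (suc zero) = c
    xs-inj : ∀ u v → xs u ≡ xs v → u ≡ v
    xs-inj zero zero e = refl
    xs-inj zero (suc zero) e = ⊥-elim (ne e)
    xs-inj (suc zero) zero e = ⊥-elim (ne (sym e))
    xs-inj (suc zero) (suc zero) e = refl
    unmv : ∀ {x} e → Moved e → φ e ≢ x
    unmv e (_ , _ , ts) = case ts d0 of λ ()
    good : ∀ u → Good (xs u)
    good zero = record { inY = Yb ; hex = s , hb ; unlisted = nb ; unmoved = unmv }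
    good (suc zero) = record { inY = Yc ; hex = s , hc ; unlisted = nc ; unmoved = unmv }
    packed = gain (λ e m → case proj₂ (proj₂ m) d0 of λ ()) {1} xs xs-inj good

  ¬¬listed-nbr : ∀ {c} → Y c ≡ true → Hex μ s c → ¬ ¬ Listed c → ∀ k → Y (fw s k c) ≡ true
  ¬¬listed-nbr Yc hx nn k = ≢false λ q → nn λ l → true≢false (listed-nbr Yc hx l k) q
  layer : Cell → Region
  layer b c = Y c ∧ ⌊ h c ℕ.≟ h b ⌋

  layer-h : ∀ b c → layer b c ≡ true → h c ≡ h b
  layer-h b c t = ⌊⌋-true (h c ℕ.≟ h b) (∧-snd {Y c} t)

  in-layer : ∀ b c → Y c ≡ true → h c ≡ h b → layer b c ≡ true
  in-layer b c Yc e = ∧-true Yc (true-⌊⌋ (h c ℕ.≟ h b) e)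

  layer-hex : ∀ {b} → Lowest b → ∀ c → layer b c ≡ true → Hex μ s c
  layer-hex {b} (Yb , min) c t = lowest-hex (∧-fst t , λ d Yd → ℕₚ.≤-trans (ℕₚ.≤-reflexive (layer-h b c t)) (min d Yd))

  -- Listed hexagons have all their forward neighbours in `Y`, so the whole lowest layer can be
  -- rotated, and the three cells above an extremal one overfill the packing.
  all-listed : ∀ {b} → Lowest b → (∀ c → Y c ≡ true → h c ≡ h b → ¬ ¬ Listed c) → ⊥
  all-listed {b} low all = T-least T (λ c → ∧-fst) d0 b (in-layer b b (proj₁ low) refl) λ { (z , Tz , least) →
      let open Level T (λ c → ∧-fst) (layer-hex low) (h b) (layer-h b) d0
                (λ c t → d0 , d1 , (λ ()) , nbr c t d0 , nbr c t d1) (λ c t → nbr c t d0) (λ c Yc e → inj₁ (in-layer b c Yc e))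
          l : ∀ i → L (fw s i z)
          l i = nbr-L z i Tz (nbr z Tz i) (λ c Yc e n → ⊥-elim (true≢false (in-layer b c Yc e) n))
      in overfull z Tz least {d1} {d2} (λ ()) (l d1) (l d2) (fw s d0 z) (L-good (l d0) (unmoved z Tz least d0))
           (λ e → case fw-dir s z e of λ ()) (λ e → case fw-dir s z e of λ ()) }
    where
    T = layer b
    nbr : ∀ c → T c ≡ true → ∀ k → Y (fw s k c) ≡ true
    nbr c t = ¬¬listed-nbr (∧-fst t) (layer-hex low c t) (all c (∧-fst t) (layer-h b c t))

  unlisted-lowest : ¬ ¬ (∃[ b ] (Lowest b × ¬ Listed b))
  unlisted-lowest k = ¬¬-argmin {P = λ c → Y c ≡ true} h (proj₁ (IsCut.inhabited cutY)) (proj₂ (IsCut.inhabited cutY))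
    λ { (b , Yb , min) → all-listed (Yb , min) λ c Yc e nl →
      k (c , (Yc , λ d Yd → ℕₚ.≤-trans (ℕₚ.≤-reflexive e) (min d Yd)) , nl) }

  module Unlisted (b : Cell) (low : Lowest b) (nb : ¬ Listed b) where

    Yb = proj₁ low
    hb = lowest-hex low

    other-listed : ∀ c → Y c ≡ true → Hex μ s c → c ≢ b → ¬ ¬ Listed c
    other-listed c Yc hx ne nl = two-unlisted Yc Yb hx hb nl nb ne

    other-nbr : ∀ c → Y c ≡ true → Hex μ s c → c ≢ b → ∀ k → Y (fw s k c) ≡ true
    other-nbr c Yc hx ne = ¬¬listed-nbr Yc hx (other-listed c Yc hx ne)

    -- The lowest layer is rotated. Besides two cells above an extremal one, the third hexagon is
    -- `b` itself, now of opposite sign; being unlisted, it is claimed by no member.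
    two-nbrs : ∀ i j → i ≢ j → Y (fw s i b) ≡ true → Y (fw s j b) ≡ true → ⊥
    two-nbrs i j i≢j yi yj = T-least T (λ c → ∧-fst) i b Tb λ { (z , Tz , least) → finish z Tz least }
      where
      T = layer b
      Tb = in-layer b b Yb refl
      nbr : ∀ c → T c ≡ true → c ≢ b → ∀ k → Y (fw s k c) ≡ true
      nbr c t ne = other-nbr c (∧-fst t) (layer-hex low c t) ne
      at : ∀ k → Y (fw s k b) ≡ true → ∀ c → T c ≡ true → Y (fw s k c) ≡ true
      at k y c t with c ≟ᶜ b
      ... | yes refl = y
      ... | no ne = nbr c t ne k
      open Level T (λ c → ∧-fst) (layer-hex low) (h b) (layer-h b) i
             (λ c t → i , j , i≢j , at i yi c t , at j yj c t) (at i yi) (λ c Yc e → inj₁ (in-layer b c Yc e))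
      finish : ∀ z → T z ≡ true → (∀ c → T c ≡ true → level s i z ℤ.≤ level s i c) → ⊥
      finish z Tz least = overfull z Tz least i≢j (l i (at i yi z Tz)) (l j (at j yj z Tz)) b
          (record { inY = Yb ; hex = not s , rotated-hex Tb ; unlisted = nb
                  ; unmoved = λ e m q → L-¬hex (L-moved e m) s (subst (Hex μ s) (sym q) hb) })
          (λ q → L-¬hex (l i (at i yi z Tz)) s (subst (Hex μ s) q hb))
          (λ q → L-¬hex (l j (at j yj z Tz)) s (subst (Hex μ s) q hb))
        where
        l : ∀ k → Y (fw s k z) ≡ true → L (fw s k z)
        l k y = nbr-L z k Tz y (λ c Yc e n → ⊥-elim (true≢false (in-layer b c Yc e) n))

    module Pendant (k : Dir) (flanks : ∀ i → i ≢ k → Y (fw s i b) ≡ false) where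

      -- Below the second lowest alternating hexagon of sign s, the cells of Y form a straight chain starting at b.
      straight : ∀ N → (∀ c → Y c ≡ true → Hex μ s c → c ≢ b → N + h b ≤ h c) →
        ∀ c → Y c ≡ true → h c ≡ N + h b → (Hex μ s c → c ≡ b) →
        c ≡ iter N (fw s k) b × (∀ i → i ≢ k → Y (fw s i c) ≡ false)
      straight zero bound c Yc e only with only (lowest-hex (Yc , λ d Yd → ℕₚ.≤-trans (ℕₚ.≤-reflexive e) (proj₂ low d Yd)))
      ... | refl = refl , flanks
      straight (suc N) bound c Yc e only with ¬Hex {μ} {s} {c} (λ hx → ℕₚ.1+n≰n (ℕₚ.≤-trans (s≤s (ℕₚ.m≤n+m (h b) N))
                                                  (ℕₚ.≤-reflexive (trans (sym e) (cong h (only hx))))))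
      ... | j , arc with below-in c j Yc arc
      ... | Yc′ , hc′ = go (straight N bound′ c′ Yc′ ec′ only′)
        where
        c′ = fw (not s) j c
        bound′ : ∀ d → Y d ≡ true → Hex μ s d → d ≢ b → N + h b ≤ h d
        bound′ d Yd hx ne = ℕₚ.≤-trans (ℕₚ.n≤1+n _) (bound d Yd hx ne)
        ec′ : h c′ ≡ N + h b
        ec′ = ℕₚ.suc-injective (trans (sym hc′) e)
        only-at : ∀ d → Y d ≡ true → h d ≤ N + h b → Hex μ s d → d ≡ b
        only-at d Yd le hx = decidable-stable (d ≟ᶜ b) λ ne → ℕₚ.1+n≰n (ℕₚ.≤-trans (bound d Yd hx ne) le)
        only′ : Hex μ s c′ → c′ ≡ b
        only′ = only-at c′ Yc′ (ℕₚ.≤-reflexive ec′)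
        c≡ : fw s j c′ ≡ c
        c≡ = fw-inv s j c
        go : c′ ≡ iter N (fw s k) b × (∀ i → i ≢ k → Y (fw s i c′) ≡ false) →
             c ≡ iter (suc N) (fw s k) b × (∀ i → i ≢ k → Y (fw s i c) ≡ false)
        go (c′≡ , fl) with j ≟ᵈ k
        ... | no ne = ⊥-elim (true≢false (trans (cong Y c≡) Yc) (fl j ne))
        ... | yes refl = trans (sym c≡) (cong (fw s k) c′≡) , λ i ne → ≢true (side i ne)
          where
          side : ∀ i → i ≢ k → Y (fw s i c) ≡ true → ⊥
          side i ne Yq = deep N refl
            where
            l  = proj₁ (complete {k} {i} (≢-sym ne))
            π  : Perm k i l
            π  = proj₂ (complete {k} {i} (≢-sym ne))
            q  = fw (not s) l c′
            q≡ : fw s i c ≡ q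
            q≡ = trans (cong (fw s i) (sym c≡)) (fw-fw s π c′)
            Yq′ : Y q ≡ true
            Yq′ = trans (cong Y (sym q≡)) Yq
            y  = fw s i c′
            -- If it were unmatched, closedness would put `y`, a flank of `c′`, into `Y`. Hence at
            -- the vertex of `c′`, `y` and `q` the edge between `q` and `c′` is unmatched.
            y→q : across μ s y k ≡ true
            y→q = ≢false λ f → true≢false (closedY y k f (trans (cong Y (fw-fw s (swapˡ π) c′)) Yq′)) (fl i ne)
            q→c′ : across μ (not s) c′ l ≡ false
            q→c′ = proj₂ (One-₂ (law pm s (swapˡ π) c′ (inj₁ (Y⊆H c′ Yc′))) y→q)
            c→q : across μ s c i ≡ true
            c→q = trans (cong (λ d → across μ s d i) (sym c≡)) (third (law pm s π c′ (inj₁ (Y⊆H c′ Yc′)))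
                    (trans (sym across-fw′) arc) q→c′)
              where
              across-fw′ : across μ (not s) c k ≡ across μ s c′ k
              across-fw′ = sym (across-back μ s c k)
              third : ∀ {x y z} → One x y z → x ≡ false → z ≡ false → y ≡ true
              third one₂ _ _ = refl
            hq : suc (suc (h q)) ≡ h c
            hq = trans (cong (λ z → ℕ.suc (ℕ.suc (h z))) (sym q≡)) (h-down c i Yc Yq c→q)
            hq′ : suc (h q) ≡ N + h b
            hq′ = ℕₚ.suc-injective (trans hq e)
            -- `q` is two levels below `c`. For `N = 0` this is below the lowest level; otherwise
            -- `q` is on the chain by induction, and its forward neighbour `c′` in the direction `l`
            -- contradicts its flanks.
            deep : ∀ M → M ≡ N → ⊥
            deep zero refl = ℕₚ.1+n≰n (ℕₚ.≤-trans (ℕₚ.≤-reflexive hq′) (proj₂ low q Yq′))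
            deep (suc M) refl = true≢false (trans (cong Y (fw-inv s l c′)) Yc′)
              (proj₂ (straight M (λ d Yd hx ne → ℕₚ.≤-trans (ℕₚ.n≤1+n _) (bound′ d Yd hx ne)) q Yq′ (ℕₚ.suc-injective hq′)
                (only-at q Yq′ (ℕₚ.≤-trans (ℕₚ.n≤1+n _) (ℕₚ.≤-reflexive hq′)))) l (perm-≢ (rot (rot π))))

      -- The lowest hexagons of sign `s` other than `b` are rotated. By `straight` the rest of their
      -- level is at most one chain cell, which spoils at most one of the three cells above the
      -- extremal one, namely `f*`. The third hexagon is `b`, which is not rotated.
      no-second : ∀ c → Y c ≡ true → Hex μ s c → c ≢ b → ⊥
      no-second c₀ Y₀ h₀ ne₀ =
        ¬¬-argmin {P = λ c → Y c ≡ true × Hex μ s c × c ≢ b} h c₀ (Y₀ , h₀ , ne₀) λ { (d , (Yd , hd , nd) , min) → at d Yd hd nd min }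
        where
        at : ∀ d → Y d ≡ true → Hex μ s d → d ≢ b → (∀ c → Y c ≡ true × Hex μ s c × c ≢ b → h d ≤ h c) → ⊥
        at d Yd hd nd min = T-least T T⊆Y k d (in-T d Yd hd nd refl) λ { (z , Tz , least) → finish z Tz least }
          where
          T : Region
          T c = Y c ∧ (⌊ Hex? μ s c ⌋ ∧ (not ⌊ c ≟ᶜ b ⌋ ∧ ⌊ h c ℕ.≟ h d ⌋))
          in-T : ∀ c → Y c ≡ true → Hex μ s c → c ≢ b → h c ≡ h d → T c ≡ true
          in-T c Yc hx ne e = ∧-true Yc (∧-true (true-⌊⌋ (Hex? μ s c) hx)
            (∧-true (not-false (false-⌊⌋ (c ≟ᶜ b) ne)) (true-⌊⌋ (h c ℕ.≟ h d) e)))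
          T⊆Y : ∀ c → T c ≡ true → Y c ≡ true
          T⊆Y c = ∧-fst
          T-hex : ∀ c → T c ≡ true → Hex μ s c
          T-hex c t = ⌊⌋-true (Hex? μ s c) (∧-fst (∧-snd {Y c} t))
          T-≢ : ∀ c → T c ≡ true → c ≢ b
          T-≢ c t = ⌊⌋-false (c ≟ᶜ b) (not-true (∧-fst (∧-snd {⌊ Hex? μ s c ⌋} (∧-snd {Y c} t))))
          T-h : ∀ c → T c ≡ true → h c ≡ h d
          T-h c t = ⌊⌋-true (h c ℕ.≟ h d) (∧-snd {not ⌊ c ≟ᶜ b ⌋} (∧-snd {⌊ Hex? μ s c ⌋} (∧-snd {Y c} t)))
          nbr : ∀ c → T c ≡ true → ∀ i → Y (fw s i c) ≡ true
          nbr c t = other-nbr c (T⊆Y c t) (T-hex c t) (T-≢ c t)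
          N = h d ∸ h b
          N+ : h d ≡ N + h b
          N+ = sym (ℕₚ.m∸n+n≡m (proj₂ low d Yd))
          outside-T : ∀ c → Y c ≡ true → h c ≡ h d → T c ≡ false →
            c ≡ iter N (fw s k) b × (∀ i → i ≢ k → Y (fw s i c) ≡ false)
          outside-T c Yc e n = straight N (λ x Yx hx nx → ℕₚ.≤-trans (ℕₚ.≤-reflexive (sym N+)) (min x (Yx , hx , nx)))
            c Yc (trans e N+) only
            where
            only : Hex μ s c → c ≡ b
            only hx = decidable-stable (c ≟ᶜ b) λ ne → true≢false (in-T c Yc hx ne e) n
          defect : ∀ c → Y c ≡ true → h c ≡ h d → T c ≡ true ⊎ (∀ i → i ≢ k → Y (fw s i c) ≡ false)
          defect c Yc e with bool-cases (T c)
          ... | inj₁ t = inj₁ t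
          ... | inj₂ n = inj₂ (proj₂ (outside-T c Yc e n))
          open Level T T⊆Y T-hex (h d) T-h k (λ c t → d0 , d1 , (λ ()) , nbr c t d0 , nbr c t d1) (λ c t → nbr c t k) defect
          f* : Cell
          f* = fw s k (iter N (fw s k) b)
          finish : ∀ z → T z ≡ true → (∀ c → T c ≡ true → level s k z ℤ.≤ level s k c) → ⊥
          finish z Tz least = choose (fw s d0 z ≟ᶜ f*) (fw s d1 z ≟ᶜ f*)
            where
            l : ∀ i → fw s i z ≢ f* → L (fw s i z)
            l i ne = nbr-L z i Tz (nbr z Tz i) (λ c Yc e n q → ne (trans q (cong (fw s k) (proj₁ (outside-T c Yc e n)))))
            use : ∀ i j → i ≢ j → fw s i z ≢ f* → fw s j z ≢ f* → ⊥
            use i j i≢j ni nj = overfull z Tz least i≢j (l i ni) (l j nj) b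
              (record { inY = Yb ; hex = kept-hex Yb hb ; unlisted = nb
                      ; unmoved = λ e m q → L-¬hex (L-moved e m) s (subst (Hex μ s) (sym q) hb) })
              (λ q → L-¬hex (l i ni) s (subst (Hex μ s) q hb))
              (λ q → L-¬hex (l j nj) s (subst (Hex μ s) q hb))
            apart : ∀ {i j} → i ≢ j → fw s i z ≡ f* → fw s j z ≢ f*
            apart ne p q = ne (fw-dir s z (trans p (sym q)))
            choose : Dec (fw s d0 z ≡ f*) → Dec (fw s d1 z ≡ f*) → ⊥
            choose (yes p) _       = use d1 d2 (λ ()) (apart {d0} (λ ()) p) (apart {d0} (λ ()) p)
            choose (no n) (yes p)  = use d0 d2 (λ ()) n (apart {d1} (λ ()) p)
            choose (no n) (no n′)  = use d0 d1 (λ ()) n n′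

      chain : Chain μ s Y
      chain = record
        { start = b ; dir = k ; inY = Yb ; hex = hb ; flanks = flanks
        ; unique = only
        ; line = λ c Yc → h c ∸ h b , proj₁ (straight (h c ∸ h b) (λ x Yx hx nx → ⊥-elim (no-second x Yx hx nx))
                   c Yc (sym (ℕₚ.m∸n+n≡m (proj₂ low c Yc))) (only c Yc)) }
        where
        only : ∀ c → Y c ≡ true → Hex μ s c → c ≡ b
        only c Yc hx = decidable-stable (c ≟ᶜ b) (no-second c Yc hx)

    chained : Chain μ s Y
    chained with bool-cases (Y (fw s d0 b)) | bool-cases (Y (fw s d1 b))
    ... | inj₁ y | _ = Pendant.chain d0 λ i ne → ≢true λ y′ → two-nbrs d0 i (≢-sym ne) y y′
    ... | inj₂ n | inj₁ y = Pendant.chain d1 λ i ne → ≢true λ y′ → two-nbrs d1 i (≢-sym ne) y y′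
    ... | inj₂ n | inj₂ n′ = Pendant.chain d2 λ { d0 _ → n ; d1 _ → n′ ; d2 ne → ⊥-elim (ne refl) }

  chain-exists : ¬ ¬ Chain μ s Y
  chain-exists k = unlisted-lowest λ { (b , low , nb) → k (Unlisted.chained b low nb) }

-- Finite regions and laminar packings

size : List Cell → Region → ℕ
size Hl Z = count (λ i → Z (lookup Hl i))

size-strict : ∀ {Hl Y Z} → (∀ c → Y c ≡ true → Z c ≡ true) → ∀ c → c ∈ Hl → Y c ≡ false → Z c ≡ true →
  size Hl Y < size Hl Z
size-strict {Hl} {Y} {Z} sub c i y z = count-strict (λ j → sub (lookup Hl j)) (index i)
  (trans (cong Y (sym (lookup-index i))) y) (trans (cong Z (sym (lookup-index i))) z)

Laminar-sym : ∀ {Y Z} → Laminar Y Z → Laminar Z Y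
Laminar-sym (inj₁ x)        = inj₂ (inj₁ x)
Laminar-sym (inj₂ (inj₁ x)) = inj₁ x
Laminar-sym (inj₂ (inj₂ x)) = inj₂ (inj₂ λ c z → ≢true λ y → true≢false z (x c y))

single-laminar : ∀ b Z → Laminar (single b) Z
single-laminar b Z with bool-cases (Z b)
... | inj₁ t = inj₁ λ c e → trans (cong Z (single-≡ e)) t
... | inj₂ f = inj₂ (inj₂ λ c e → trans (cong Z (single-≡ e)) f)

module Finite {Hc : Region} {μ : Edges} (pm : IsMatching Hc μ)
  (Hl : List Cell) (fin : ∀ c → Hc c ≡ true → c ∈ Hl) where

  -- A region without boundary edges outside the matching would be invariant under translation.
  boundary-edge : ∀ {Y : Region} → (∀ c → Y c ≡ true → Hc c ≡ true) → (∃[ c ] Y c ≡ true) →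
    ¬ ¬ (∃[ c ] ∃[ k ] (μ c k ≡ false × Y c ≢ Y (fw true k c)))
  boundary-edge {Y} Y⊆H (c₀ , y₀) none =
    ¬¬-argminℤ {P = λ c → Y c ≡ true} proj₁ Hl (λ c y → fin c (Y⊆H c y)) c₀ y₀ λ { ((p , q) , y , least) →
      ℤₚ.≤⇒≯ (least (ℤ.pred p , q) (left (p , q) y)) (ℤₚ.i≤pred[j]⇒i<j ℤₚ.≤-refl) }
    where
    stay : ∀ t c k → across μ t c k ≡ false → Y c ≡ true → Y (fw t k c) ≡ true
    stay true  c k e y = ≢false λ n → none (c , k , e , λ q → true≢false (trans (sym q) y) n)
    stay false c k e y = ≢false λ n → none (fw false k c , k , e , λ q →
      true≢false (trans q (trans (cong Y (fw-inv true k c)) y)) n)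
    left : ∀ c → Y c ≡ true → Y (fw true d0 c) ≡ true
    left c y with bool-cases (μ c d0)
    ... | inj₂ e = stay true c d0 e y
    -- A matched left side is bypassed through the third cell at its white end, across two unmatched
    -- edges.
    ... | inj₁ e with One-₁ (IsMatching.white pm c (inj₁ (Y⊆H c y))) e
    ... | e₁ , e₂ = trans (cong Y (sym (fw-fw false p210 c)))
          (stay false (fw false d2 c) d1
            (trans (cong (λ z → μ z d1) (fw-fw false p210 c)) e₁)
            (stay false c d2 e₂ y))

  -- Equal regions share their whole boundary, and some edge of it is unmatched.
  equal-conflict : ∀ {Y Z} → (∀ c → Y c ≡ true → Hc c ≡ true) → (∃[ c ] Y c ≡ true) → NoConflict μ Y Z →
    (∀ c → Y c ≡ true → Z c ≡ true) → (∀ c → Z c ≡ true → Y c ≡ true) → ⊥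
  equal-conflict {Y} {Z} Y⊆H ne nc s₁ s₂ = boundary-edge Y⊆H ne λ { (c , k , e , sep) →
      nc c k e sep λ q → sep (trans (eq c) (trans q (sym (eq _)))) }
    where
    eq : ∀ c → Y c ≡ Z c
    eq c = bool-ext (s₁ c) (s₂ c)

  IsHeight : Region → (Cell → ℤ) → Set
  IsHeight X g = ∀ c k → X c ≡ true → X (fw true k c) ≡ true →
    g (fw true k c) ≡ (if μ c k then ℤ.pred (ℤ.pred (g c)) else ℤ.suc (g c))

  signed : Bool → (Cell → ℤ) → Cell → ℤ
  signed true  g c = g c
  signed false g c = ℤ.- g c

  signed-up : ∀ {X g} → IsHeight X g → ∀ s c k → X c ≡ true → X (fw s k c) ≡ true → across μ s c k ≡ false →
    signed s g (fw s k c) ≡ ℤ.suc (signed s g c)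
  signed-up {g = g} ht true c k x y e = trans (ht c k x y) (cong (if_then ℤ.pred (ℤ.pred (g c)) else ℤ.suc (g c)) e)
  signed-up {X} {g} ht false c k x y e = trans (cong ℤ.-_ step) (neg-pred (g c))
    where
    c′ = fw false k c
    step : g c′ ≡ ℤ.pred (g c)
    step = trans (sym (ℤₚ.pred-suc (g c′))) (cong ℤ.pred (trans (sym (trans
      (ht c′ k y (trans (cong X (fw-inv true k c)) x)) (cong (if_then ℤ.pred (ℤ.pred (g c′)) else ℤ.suc (g c′)) e)))
      (cong g (fw-inv true k c))))

  signed-down : ∀ {X g} → IsHeight X g → ∀ s c k → X c ≡ true → X (fw s k c) ≡ true → across μ s c k ≡ true →
    ℤ.suc (ℤ.suc (signed s g (fw s k c))) ≡ signed s g c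
  signed-down {g = g} ht true c k x y e = trans (cong (λ z → ℤ.suc (ℤ.suc z))
    (trans (ht c k x y) (cong (if_then ℤ.pred (ℤ.pred (g c)) else ℤ.suc (g c)) e)))
    (trans (cong ℤ.suc (ℤₚ.suc-pred (ℤ.pred (g c)))) (ℤₚ.suc-pred (g c)))
  signed-down {X} {g} ht false c k x y e = sym (trans (cong ℤ.-_ step)
      (trans (neg-pred (ℤ.pred (g c′))) (cong ℤ.suc (neg-pred (g c′)))))
    where
    c′ = fw false k c
    step : g c ≡ ℤ.pred (ℤ.pred (g c′))
    step = trans (cong g (sym (fw-inv true k c))) (trans
      (ht c′ k y (trans (cong X (fw-inv true k c)) x)) (cong (if_then ℤ.pred (ℤ.pred (g c′)) else ℤ.suc (g c′)) e))

  module Shift (f : Cell → ℤ) where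
    m = proj₁ (lowerBound f Hl)

    shifted : Cell → ℕ
    shifted c = ℤ.∣ f c ℤ.- m ∣

    shifted-≡ : ∀ c → Hc c ≡ true → + shifted c ≡ f c ℤ.- m
    shifted-≡ c h = ℤₚ.0≤i⇒+∣i∣≡i (ℤₚ.i≤j⇒0≤j-i (proj₂ (lowerBound f Hl) c (fin c h)))

    shifted-suc : ∀ c d → Hc c ≡ true → Hc d ≡ true → f d ≡ ℤ.suc (f c) → shifted d ≡ suc (shifted c)
    shifted-suc c d hc hd e = ℤₚ.+-injective (trans (shifted-≡ d hd) (trans (cong (ℤ._- m) e)
      (trans (ℤₚ.+-assoc (+ 1) (f c) (ℤ.- m)) (cong ℤ.suc (sym (shifted-≡ c hc))))))

    shifted-suc² : ∀ c d → Hc c ≡ true → Hc d ≡ true → f d ≡ ℤ.suc (ℤ.suc (f c)) → shifted d ≡ suc (suc (shifted c))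
    shifted-suc² c d hc hd e = ℤₚ.+-injective (trans (shifted-≡ d hd) (trans (cong (ℤ._- m) e)
      (trans (ℤₚ.+-assoc (+ 1) (ℤ.suc (f c)) (ℤ.- m)) (trans (cong ℤ.suc (ℤₚ.+-assoc (+ 1) (f c) (ℤ.- m)))
        (cong (λ z → ℤ.suc (ℤ.suc z)) (sym (shifted-≡ c hc)))))))

  module Improvement {a : ℕ}
    (max₀ : ∀ n (G : Fin n → Member) → Packing Hc μ G → n ≤ a)
    (max₁ : ∀ μ′ → IsMatching Hc μ′ → ∀ n (G : Fin n → Member) → Packing Hc μ′ G → n ≤ suc a)
    (X : Member) (g : Cell → ℤ) (ht : IsHeight (proj₂ X) g) (i₀ : Fin a) where

    record State (F : Fin a → Member) (done : Fin a → Bool) : Set where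
      field
        packing : Packing Hc μ F
        laminar : ∀ i j → Laminar (proj₂ (F i)) (proj₂ (F j))
        focus   : F i₀ ≡ X
        singles : ∀ i → done i ≡ true → ∃[ e ] (∀ d → proj₂ (F i) d ≡ single e d)

    -- Members inside X are replaced, smallest first, by an alternating hexagon of lowest level.
    module Step (F : Fin a → Member) (done : Fin a → Bool) (st : State F done) where
      open State st

      R : Fin a → Region
      R i = proj₂ (F i)

      R⊆H : ∀ i c → R i c ≡ true → Hc c ≡ true
      R⊆H i = IsCut.inside (Packing.cut packing i)

      distinct : ∀ i j → i ≢ j → (∀ c → R i c ≡ true → R j c ≡ true) → (∀ c → R j c ≡ true → R i c ≡ true) → ⊥
      distinct i j ne = equal-conflict (R⊆H i) (IsCut.inhabited (Packing.cut packing i)) (Packing.disjoint packing i j ne)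

      module At (j : Fin a) (sub : ∀ c → R j c ≡ true → proj₂ X c ≡ true)
        (small : ∀ i → i ≢ j → (∀ c → R i c ≡ true → R j c ≡ true) → done i ≡ true) where

        inner : ∀ i → i ≢ j → (∃[ v ] (∀ c → R j c ≡ true → R i c ≡ v)) ⊎
          (∃[ e ] (R j e ≡ true × (∀ d → R i d ≡ single e d)))
        inner i ne with laminar j i
        ... | inj₁ s = inj₁ (true , s)
        ... | inj₂ (inj₂ d) = inj₁ (false , d)
        ... | inj₂ (inj₁ s) with singles i (small i ne s)
        ... | e , eq = inj₂ (e , s e (trans (eq e) (single-self e)) , eq)

        private
          sg = proj₁ (F j)
          open module Sh = Shift (signed sg g)

        module Lv = Levels pm max₀ max₁ F packing j inner Hl fin shifted
          (λ c k y y′ e → shifted-suc c (fw sg k c) (R⊆H j c y) (R⊆H j _ y′)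
            (signed-up {proj₂ X} {g} ht sg c k (sub c y) (sub _ y′) e))
          (λ c k y y′ e → sym (shifted-suc² (fw sg k c) c (R⊆H j _ y′) (R⊆H j c y)
            (sym (signed-down {proj₂ X} {g} ht sg c k (sub c y) (sub _ y′) e))))

      module Swap (j : Fin a) (j≢ : j ≢ i₀) (sub : ∀ c → R j c ≡ true → proj₂ X c ≡ true)
        (small : ∀ i → i ≢ j → (∀ c → R i c ≡ true → R j c ≡ true) → done i ≡ true)
        (b : Cell) (Yb : R j b ≡ true) (hb : Hex μ (proj₁ (F j)) b)
        (nl : ¬ Focus.Listed pm max₀ max₁ F packing j (At.inner j sub small) b) where

        F′ : Fin a → Member
        F′ i = if ⌊ i Finₚ.≟ j ⌋ then (proj₁ (F j) , single b) else F i

        done′ : Fin a → Bool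
        done′ i = if ⌊ i Finₚ.≟ j ⌋ then true else done i

        off-j : ∀ {i} → i ≢ j → F′ i ≡ F i
        off-j {i} ne = cong (if_then (proj₁ (F j) , single b) else F i) (false-⌊⌋ (i Finₚ.≟ j) ne)

        hex-free : ∀ i → i ≢ j → NoConflict μ (single b) (R i)
        hex-free i ne with At.inner j sub small i ne
        ... | inj₁ out = Raise.outer-hex pm F packing j (λ _ → false) (λ _ ()) (λ _ ()) (λ _ ()) {i} (ne , out) b Yb
        ... | inj₂ (e , Ye , eq) = λ c k q s₁ s₂ → Hexes.hex-noConflict pm {proj₁ (F j)} {proj₁ (F i)} {b} {e} (R⊆H j b Yb) hb
              (Hexes.cut-hex pm (Packing.cut packing i) eq)
              (λ { refl → nl (i , ne , eq) }) c k q s₁ (λ r → s₂ (trans (eq c) (trans r (sym (eq _)))))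

        state′ : State F′ done′
        state′ = record
          { packing = record { cut = cut ; disjoint = disj }
          ; laminar = lam
          ; focus = trans (off-j (≢-sym j≢)) focus
          ; singles = sing }
          where
          cut : ∀ i → IsCut Hc μ (F′ i)
          cut i with i Finₚ.≟ j
          ... | yes _ = Hexes.hex-cut pm {proj₁ (F j)} (R⊆H j b Yb) hb
          ... | no _ = Packing.cut packing i
          disj : ∀ i l → i ≢ l → NoConflict μ (proj₂ (F′ i)) (proj₂ (F′ l))
          disj i l ne with i Finₚ.≟ j | l Finₚ.≟ j
          ... | yes p | yes q = ⊥-elim (ne (trans p (sym q)))
          ... | yes p | no q  = hex-free l q
          ... | no p  | yes q = NoConflict-sym {μ} {single b} {R i} (hex-free i p)
          ... | no p  | no q  = Packing.disjoint packing i l ne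
          lam : ∀ i l → Laminar (proj₂ (F′ i)) (proj₂ (F′ l))
          lam i l with i Finₚ.≟ j | l Finₚ.≟ j
          ... | yes p | yes q = inj₁ (λ c e → e)
          ... | yes p | no q  = single-laminar b (R l)
          ... | no p  | yes q = Laminar-sym {single b} {R i} (single-laminar b (R i))
          ... | no p  | no q  = laminar i l
          sing : ∀ i → done′ i ≡ true → ∃[ e ] (∀ d → proj₂ (F′ i) d ≡ single e d)
          sing i e with i Finₚ.≟ j
          ... | yes _ = b , λ _ → refl
          ... | no _ = singles i e

        fewer : done j ≡ false → count (not ∘ done′) < count (not ∘ done)
        fewer nd = count-strict mono j
          (cong (λ x → not (if x then true else done j)) (true-⌊⌋ (j Finₚ.≟ j) refl)) (not-false nd)
          where
          mono : ∀ i → not (done′ i) ≡ true → not (done i) ≡ true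
          mono i e with i Finₚ.≟ j
          mono i () | yes _
          ... | no _ = e

    -- Every replacement marks one more member as done. When none inside `X` is left to replace,
    -- every other member is constant on `X` or a hexagon in it, and the level argument applies to
    -- `X` itself.
    reduce : ∀ fuel F done → count (not ∘ done) ≤ fuel → State F done → ¬ ¬ Chain μ (proj₁ X) (proj₂ X)
    reduce fuel F done le st k = ¬¬-excluded-middle {A = ∃[ j ] Pending j} λ
        { (no none) → final none
        ; (yes (j , pj)) → ¬¬-argmin {P = Pending} (λ i → size Hl (R i)) j pj λ { (j , p , least) → swap fuel le j p least } }
      where
      open State st
      open Step F done st
      Pending : Fin a → Set
      Pending j = j ≢ i₀ × done j ≡ false × (∀ c → R j c ≡ true → proj₂ X c ≡ true)
      X≡ : ∀ c → R i₀ c ≡ proj₂ X c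
      X≡ c = cong (λ m → proj₂ m c) focus
      final : ¬ (∃[ j ] Pending j) → ⊥
      final none = At.Lv.chain-exists i₀ (λ c e → trans (sym (X≡ c)) e)
        (λ i ne s → ≢false λ nd → none (i , ne , nd , λ c e → trans (sym (X≡ c)) (s c e)))
        λ ch → k (subst (λ m → Chain μ (proj₁ m) (proj₂ m)) focus ch)
      swap : ∀ fuel → count (not ∘ done) ≤ fuel → ∀ j → Pending j → (∀ i → Pending i → size Hl (R j) ≤ size Hl (R i)) → ⊥
      swap fuel le j (ne , nd , sub) least = At.Lv.unlisted-lowest j sub small λ { (b , low , nl) →
          go fuel le b (proj₁ low) (At.Lv.lowest-hex j sub small low) nl }
        where
        -- An unmarked member properly inside `R j` would be a smaller pending one; equality is
        -- excluded by `distinct`, which also shows that the member is not the focus.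
        small : ∀ i → i ≢ j → (∀ c → R i c ≡ true → R j c ≡ true) → done i ≡ true
        small i i≢j s = ≢false λ nd′ → distinct i j i≢j s λ c Rjc → ≢false λ Ric →
            ℕₚ.<⇒≱ (size-strict {Hl} {R i} {R j} s c (fin c (R⊆H j c Rjc)) Ric Rjc)
              (least i ((λ { refl → distinct i₀ j i≢j s (λ c e → trans (X≡ c) (sub c e)) }) , nd′ , λ c e → sub c (s c e)))
        go : ∀ fuel → count (not ∘ done) ≤ fuel → ∀ b → R j b ≡ true → Hex μ (proj₁ (F j)) b →
          ¬ Focus.Listed pm max₀ max₁ F packing j (At.inner j sub small) b → ⊥
        go zero le b Yb hb nl = ℕₚ.n≮0 (ℕₚ.<-≤-trans (Swap.fewer j ne sub small b Yb hb nl nd) le)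
        go (suc fuel) le b Yb hb nl = reduce fuel _ _ (ℕₚ.≤-pred (ℕₚ.<-≤-trans (Swap.fewer j ne sub small b Yb hb nl nd) le))
          (Swap.state′ j ne sub small b Yb hb nl) k

    improvement : ∀ F → Packing Hc μ F → (∀ i j → Laminar (proj₂ (F i)) (proj₂ (F j))) → F i₀ ≡ X →
      ¬ ¬ Chain μ (proj₁ X) (proj₂ X)
    improvement F pk lam eq = reduce _ F (λ _ → false) ℕₚ.≤-refl
      (record { packing = pk ; laminar = lam ; focus = eq ; singles = λ _ () })

-- Vertices of the lattice

-- The lattice vertices: W c is the lower left and B c the lower middle vertex of the cell c.
data Vtx : Set where
  W B : Cell → Vtx

pos : Vtx → V
pos (W c) = origin c
pos (B c) = proj₁ (origin c) ℤ.+ + 1 , proj₂ (origin c)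

-- Rounded-down half and parity. The coordinates add up to 2p at `W (p , q)` and to 2p + 1 at
-- `B (p , q)`, so this recovers the vertex from its position.
half : ℤ → ℤ × Bool
half (+ n)      = + ⌊ n /2⌋ , not (even? n)
half (-[1+ n ]) = -[1+ ⌊ n /2⌋ ] , even? n

half-2* : ∀ p → half (+ 2 ℤ.* p) ≡ (p , false)
half-2* (+ n) = trans (cong half (sym (ℤₚ.pos-* 2 n))) (cong₂ _,_ (cong +_ (dbl n)) (cong not (ev n)))
  where
  dbl : ∀ n → ⌊ 2 ℕ.* n /2⌋ ≡ n
  dbl zero = refl
  dbl (suc n) = trans (cong (λ m → ⌊ suc m /2⌋) (ℕₚ.+-suc n (n ℕ.+ 0))) (cong suc (dbl n))
  ev : ∀ n → even? (2 ℕ.* n) ≡ true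
  ev zero = refl
  ev (suc n) = trans (cong (λ m → not (even? m)) (ℕₚ.+-suc n (n ℕ.+ 0))) (trans (not-not _) (ev n))
half-2* (-[1+ n ]) = cong₂ _,_ (cong -[1+_] (dbl n)) (ev n)
  where
  dbl : ∀ n → ⌊ n ℕ.+ suc (n ℕ.+ 0) /2⌋ ≡ n
  dbl zero = refl
  dbl (suc n) = trans (cong (λ m → ⌊ suc m /2⌋) (ℕₚ.+-suc n (suc (n ℕ.+ 0)))) (cong suc (dbl n))
  ev : ∀ n → even? (n ℕ.+ suc (n ℕ.+ 0)) ≡ false
  ev zero = refl
  ev (suc n) = trans (cong (λ m → not (even? m)) (ℕₚ.+-suc n (suc (n ℕ.+ 0)))) (trans (not-not _) (ev n))

half-suc : ∀ z {p} → half z ≡ (p , false) → half (z ℤ.+ + 1) ≡ (p , true)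
half-suc (+ n) {p} e = subst (λ m → half (+ m) ≡ (p , true)) (sym (ℕₚ.+-comm n 1)) (go n e)
  where
  go : ∀ n {p} → half (+ n) ≡ (p , false) → half (+ suc n) ≡ (p , true)
  go zero refl = refl
  go (suc (suc n)) {p} e with go n {p ℤ.- + 1} (cong₂ _,_ (lem (cong proj₁ e)) (trans (cong not (sym (not-not _))) (cong proj₂ e)))
    where
    lem : ∀ {m} → + suc m ≡ p → + m ≡ p ℤ.- + 1
    lem {m} refl = refl
  ... | q = cong₂ _,_ (trans (cong ℤ.suc (cong proj₁ q)) (trans (ℤₚ.+-comm (+ 1) (p ℤ.- + 1)) (trans (ℤₚ.+-assoc p (ℤ.- + 1) (+ 1)) (ℤₚ.+-identityʳ p))))
                      (trans (cong not (not-not _)) (cong proj₂ q))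
half-suc (-[1+ zero ]) ()
half-suc (-[1+ suc n ]) e = cong₂ _,_ (trans (cong -[1+_] (fl n (trans (sym (not-not (even? n))) (cong not (cong proj₂ e))))) (cong proj₁ e))
                             (trans (sym (not-not _)) (cong not (cong proj₂ e)))
  where
  fl : ∀ n → even? n ≡ true → ⌊ n /2⌋ ≡ ⌊ suc n /2⌋
  fl zero _ = refl
  fl (suc (suc n)) h = cong suc (fl n (trans (sym (not-not _)) h))

decode : V → Vtx
decode (x , y) with half (x ℤ.+ y)
... | p , false = W (p , y)
... | p , true  = B (p , y)

decode-pos : ∀ t → decode (pos t) ≡ t
decode-pos (W (p , q)) with half (+ 2 ℤ.* p ℤ.- q ℤ.+ q) | trans (cong half eq) (half-2* p)
  where
  open +-*-Solver
  eq : + 2 ℤ.* p ℤ.- q ℤ.+ q ≡ + 2 ℤ.* p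
  eq = solve 2 (λ p q → con (+ 2) :* p :- q :+ q := con (+ 2) :* p) refl p q
... | _ | refl = refl
decode-pos (B (p , q)) with half (+ 2 ℤ.* p ℤ.- q ℤ.+ + 1 ℤ.+ q) | trans (cong half eq) (half-suc (+ 2 ℤ.* p) (half-2* p))
  where
  open +-*-Solver
  eq : + 2 ℤ.* p ℤ.- q ℤ.+ + 1 ℤ.+ q ≡ + 2 ℤ.* p ℤ.+ + 1
  eq = solve 2 (λ p q → con (+ 2) :* p :- q :+ con (+ 1) :+ q := con (+ 2) :* p :+ con (+ 1)) refl p q
... | _ | refl = refl

pos-injective : ∀ {t t′} → pos t ≡ pos t′ → t ≡ t′
pos-injective {t} {t′} e = trans (sym (decode-pos t)) (trans (cong decode e) (decode-pos t′))

W-injective : ∀ {c d} → W c ≡ W d → c ≡ d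
W-injective refl = refl

B-injective : ∀ {c d} → B c ≡ B d → c ≡ d
B-injective refl = refl

-- The edge `(c , k)` is the left side of `c` for `d0`, the right half of its bottom for `d1` and
-- the right half of its top for `d2`.
wEnd bEnd : Cell → Dir → Cell
wEnd c d0 = c
wEnd c d1 = fw false d0 c
wEnd c d2 = fw true d2 c
bEnd c d0 = fw false d1 c
bEnd c d1 = c
bEnd c d2 = fw true d2 c

-- Link t t′ c k: the vertices t and t′ are the ends of the edge (c , k).
data Link : Vtx → Vtx → Cell → Dir → Set where
  wb : ∀ c k → Link (W (wEnd c k)) (B (bEnd c k)) c k
  bw : ∀ c k → Link (B (bEnd c k)) (W (wEnd c k)) c k

link-sym : ∀ {t t′ c k} → Link t t′ c k → Link t′ t c k
link-sym (wb c k) = bw c k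
link-sym (bw c k) = wb c k

white-edge : ∀ {a} c k → wEnd c k ≡ a →
  (c , k) ≡ (a , d0) ⊎ (c , k) ≡ (fw true d0 a , d1) ⊎ (c , k) ≡ (fw false d2 a , d2)
white-edge c d0 refl = inj₁ refl
white-edge c d1 refl = inj₂ (inj₁ (cong (_, d1) (sym (fw-inv true d0 c))))
white-edge c d2 refl = inj₂ (inj₂ (cong (_, d2) (sym (fw-inv false d2 c))))

black-edge : ∀ {a} c k → bEnd c k ≡ a →
  (c , k) ≡ (a , d1) ⊎ (c , k) ≡ (fw true d1 a , d0) ⊎ (c , k) ≡ (fw false d2 a , d2)
black-edge c d0 refl = inj₂ (inj₁ (cong (_, d0) (sym (fw-inv true d1 c))))
black-edge c d1 refl = inj₁ refl
black-edge c d2 refl = inj₂ (inj₂ (cong (_, d2) (sym (fw-inv false d2 c))))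

data Around : Vtx → Cell → Set where
  w₀ : ∀ a → Around (W a) a
  w₁ : ∀ a → Around (W a) (fw true d0 a)
  w₂ : ∀ a → Around (W a) (fw false d2 a)
  b₀ : ∀ a → Around (B a) a
  b₁ : ∀ a → Around (B a) (fw true d1 a)
  b₂ : ∀ a → Around (B a) (fw false d2 a)

link-tail : ∀ {t t′ c k} → Link t t′ c k → Around t c
link-tail (wb c d0) = w₀ c
link-tail (wb c d1) = subst (Around (W (fw false d0 c))) (fw-inv true d0 c) (w₁ _)
link-tail (wb c d2) = subst (Around (W (fw true d2 c))) (fw-inv false d2 c) (w₂ _)
link-tail (bw c d0) = subst (Around (B (fw false d1 c))) (fw-inv true d1 c) (b₁ _)
link-tail (bw c d1) = b₀ c
link-tail (bw c d2) = subst (Around (B (fw true d2 c))) (fw-inv false d2 c) (b₂ _)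

link-head : ∀ {t t′ c k} → Link t t′ c k → Around t (fw true k c)
link-head (wb c d0) = w₁ c
link-head (wb c d1) = subst (Around (W (fw false d0 c))) (fw-fw false p021 c) (w₂ (fw false d0 c))
link-head (wb c d2) = w₀ _
link-head (bw c d0) = subst (Around (B (fw false d1 c))) (fw-fw false p120 c) (b₂ (fw false d1 c))
link-head (bw c d1) = b₁ c
link-head (bw c d2) = b₀ _

private
  open +-*-Solver
  suc-+ : ∀ q → ℤ.suc q ≡ q ℤ.+ + 1
  suc-+ q = ℤₚ.+-comm (+ 1) q

  pos-W↑ : ∀ p q → pos (W (ℤ.suc p , q)) ≡ (+ 2 ℤ.* p ℤ.- q ℤ.+ + 2 , q)
  pos-W↑ p q = cong (_, q) (solve 2 (λ p q → con (+ 2) :* (con (+ 1) :+ p) :- q := con (+ 2) :* p :- q :+ con (+ 2)) refl p q)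

  pos-B↓ : ∀ p q → pos (B (p , ℤ.suc q)) ≡ (+ 2 ℤ.* p ℤ.- q , q ℤ.+ + 1)
  pos-B↓ p q = cong₂ _,_ (solve 2 (λ p q → con (+ 2) :* p :- (con (+ 1) :+ q) :+ con (+ 1) := con (+ 2) :* p :- q) refl p q) (suc-+ q)

  pos-W↗ : ∀ p q → pos (W (ℤ.suc p , ℤ.suc q)) ≡ (+ 2 ℤ.* p ℤ.- q ℤ.+ + 1 , q ℤ.+ + 1)
  pos-W↗ p q = cong₂ _,_ (solve 2 (λ p q → con (+ 2) :* (con (+ 1) :+ p) :- (con (+ 1) :+ q) := con (+ 2) :* p :- q :+ con (+ 1)) refl p q) (suc-+ q)

  pos-B↗ : ∀ p q → pos (B (ℤ.suc p , ℤ.suc q)) ≡ (+ 2 ℤ.* p ℤ.- q ℤ.+ + 2 , q ℤ.+ + 1)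
  pos-B↗ p q = cong₂ _,_ (solve 2 (λ p q → con (+ 2) :* (con (+ 1) :+ p) :- (con (+ 1) :+ q) :+ con (+ 1) := con (+ 2) :* p :- q :+ con (+ 2)) refl p q) (suc-+ q)

record Linked (c : Cell) (u v : V) : Set where
  constructor linked
  field
    {t t′} : Vtx
    {cell} : Cell
    {dir}  : Dir
    link   : Link t t′ cell dir
    pos₁   : u ≡ pos t
    pos₂   : v ≡ pos t′
    side   : cell ≡ c ⊎ fw true dir cell ≡ c

linked-sym : ∀ {c u v} → Linked c u v → Linked c v u
linked-sym (linked l e₁ e₂ s) = linked (link-sym l) e₂ e₁ s

cellEdge⇒linked : ∀ c {u v} → (u , v) ∈ cellEdges c → Linked c u v
cellEdge⇒linked c@(p , q) (here refl) =
  linked (wb (fw false d2 c) d2) (cong (pos ∘ W) (sym (fw-inv true d2 c))) (cong (pos ∘ B) (sym (fw-inv true d2 c))) (inj₂ (fw-inv true d2 c))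
cellEdge⇒linked c@(p , q) (there (here refl)) = linked (bw c d1) refl (sym (pos-W↑ p q)) (inj₁ refl)
cellEdge⇒linked c@(p , q) (there (there (here refl))) =
  linked (bw (fw false d1 c) d1) (sym (pos-B↓ p q)) (sym (pos-W↗ p q)) (inj₂ (fw-inv true d1 c))
cellEdge⇒linked c@(p , q) (there (there (there (here refl)))) =
  linked (wb c d2) (sym (pos-W↗ p q)) (sym (pos-B↗ p q)) (inj₁ refl)
cellEdge⇒linked c@(p , q) (there (there (there (there (here refl))))) =
  linked (wb c d0) refl (sym (pos-B↓ p q)) (inj₁ refl)
cellEdge⇒linked c@(p , q) (there (there (there (there (there (here refl)))))) =
  linked (wb (fw false d0 c) d0) (sym (pos-W↑ p q)) (sym (pos-B↗ p q)) (inj₂ (fw-inv true d0 c))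

CellEdge⇒linked : ∀ {c u v} → CellEdge c u v → Linked c u v
CellEdge⇒linked {c} (inj₁ i) = cellEdge⇒linked c i
CellEdge⇒linked {c} (inj₂ i) = linked-sym (cellEdge⇒linked c i)

CellEdge-sym : ∀ {c u v} → CellEdge c u v → CellEdge c v u
CellEdge-sym (inj₁ i) = inj₂ i
CellEdge-sym (inj₂ i) = inj₁ i

private
  edge-tail : ∀ c k → CellEdge c (pos (W (wEnd c k))) (pos (B (bEnd c k)))
  edge-tail (p , q) d0 = inj₁ (there (there (there (there (here (cong₂ _,_ refl (pos-B↓ p q)))))))
  edge-tail (p , q) d1 = inj₂ (there (here (cong₂ _,_ refl (pos-W↑ p q))))
  edge-tail (p , q) d2 = inj₁ (there (there (there (here (cong₂ _,_ (pos-W↗ p q) (pos-B↗ p q))))))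

  edge-head : ∀ c k → CellEdge (fw true k c) (pos (W (wEnd c k))) (pos (B (bEnd c k)))
  edge-head c k = subst (λ d → CellEdge (fw true k c) (pos (W (wEnd d k))) (pos (B (bEnd d k)))) (fw-inv′ true k c) (go (fw true k c) k)
    where
    go : ∀ d k → CellEdge d (pos (W (wEnd (fw false k d) k))) (pos (B (bEnd (fw false k d) k)))
    go (p , q) d0 = inj₁ (there (there (there (there (there (here (cong₂ _,_ (pos-W↑ p q) (pos-B↗ p q))))))))
    go (p , q) d1 = inj₂ (there (there (here (cong₂ _,_ (pos-B↓ p q) (pos-W↗ p q)))))
    go c@(p , q) d2 = inj₁ (here (cong₂ _,_ (cong (pos ∘ W) (fw-inv true d2 c)) (cong (pos ∘ B) (fw-inv true d2 c))))

link⇒CellEdge : ∀ {t t′ d k} → Link t t′ d k → ∀ {c} → d ≡ c ⊎ fw true k d ≡ c → CellEdge c (pos t) (pos t′)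
link⇒CellEdge (wb d k) (inj₁ refl) = edge-tail d k
link⇒CellEdge (wb d k) (inj₂ refl) = edge-head d k
link⇒CellEdge (bw d k) (inj₁ refl) = CellEdge-sym {d} (edge-tail d k)
link⇒CellEdge (bw d k) (inj₂ refl) = CellEdge-sym {fw true k d} (edge-head d k)

cellVertex⇒around : ∀ c {v} → CellVertex c v → ∃[ t ] (v ≡ pos t × Around t c)
cellVertex⇒around c@(p , q) (here refl) = W c , refl , w₀ c
cellVertex⇒around c@(p , q) (there (here refl)) = B c , refl , b₀ c
cellVertex⇒around c@(p , q) (there (there (here refl))) =
  _ , sym (pos-W↑ p q) , subst (Around _) (fw-inv true d0 c) (w₁ (fw false d0 c))
cellVertex⇒around c@(p , q) (there (there (there (here refl)))) =
  _ , sym (pos-B↓ p q) , subst (Around _) (fw-inv true d1 c) (b₁ (fw false d1 c))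
cellVertex⇒around c@(p , q) (there (there (there (there (here refl))))) =
  _ , sym (pos-W↗ p q) , subst (Around _) (fw-inv false d2 c) (w₂ (fw true d2 c))
cellVertex⇒around c@(p , q) (there (there (there (there (there (here refl)))))) =
  _ , sym (pos-B↗ p q) , subst (Around _) (fw-inv false d2 c) (b₂ (fw true d2 c))

around⇒cellVertex : ∀ {t c} → Around t c → CellVertex c (pos t)
around⇒cellVertex (w₀ a) = here refl
around⇒cellVertex (w₁ a) = subst (λ d → CellVertex (fw true d0 a) (pos (W d))) (fw-inv false d0 a) (go (fw true d0 a))
  where
  go : ∀ c → CellVertex c (pos (W (fw false d0 c)))
  go (p , q) = there (there (here (pos-W↑ p q)))
around⇒cellVertex (w₂ a) = subst (λ d → CellVertex (fw false d2 a) (pos (W d))) (fw-inv true d2 a) (go (fw false d2 a))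
  where
  go : ∀ c → CellVertex c (pos (W (fw true d2 c)))
  go (p , q) = there (there (there (there (here (pos-W↗ p q)))))
around⇒cellVertex (b₀ a) = there (here refl)
around⇒cellVertex (b₁ a) = subst (λ d → CellVertex (fw true d1 a) (pos (B d))) (fw-inv false d1 a) (go (fw true d1 a))
  where
  go : ∀ c → CellVertex c (pos (B (fw false d1 c)))
  go (p , q) = there (there (there (here (pos-B↓ p q))))
around⇒cellVertex (b₂ a) = subst (λ d → CellVertex (fw false d2 a) (pos (B d))) (fw-inv true d2 a) (go (fw false d2 a))
  where
  go : ∀ c → CellVertex c (pos (B (fw true d2 c)))
  go (p , q) = there (there (there (there (there (here (pos-B↗ p q))))))

-- Cyclic lists and parity

_≟ᵛ_ : (t t′ : Vtx) → Dec (t ≡ t′)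
W c ≟ᵛ W d with c ≟ᶜ d
... | yes e = yes (cong W e)
... | no n  = no (n ∘ W-injective)
B c ≟ᵛ B d with c ≟ᶜ d
... | yes e = yes (cong B e)
... | no n  = no (n ∘ B-injective)
W c ≟ᵛ B d = no λ ()
B c ≟ᵛ W d = no λ ()

parity : ∀ {A : Set} → (A → Bool) → List A → Bool
parity f []       = false
parity f (x ∷ xs) = f x xor parity f xs

parity-cong : ∀ {A : Set} {f g : A → Bool} {xs} → All (λ x → f x ≡ g x) xs → parity f xs ≡ parity g xs
parity-cong []       = refl
parity-cong (e ∷ es) = cong₂ _xor_ e (parity-cong es)

interchange : ∀ a b c d → (a xor b) xor (c xor d) ≡ (a xor c) xor (b xor d)
interchange true  true  true  true  = refl
interchange true  true  true  false = refl
interchange true  true  false true  = refl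
interchange true  true  false false = refl
interchange true  false true  true  = refl
interchange true  false true  false = refl
interchange true  false false true  = refl
interchange true  false false false = refl
interchange false true  true  true  = refl
interchange false true  true  false = refl
interchange false true  false true  = refl
interchange false true  false false = refl
interchange false false true  true  = refl
interchange false false true  false = refl
interchange false false false true  = refl
interchange false false false false = refl

parity-xor : ∀ {A : Set} (f g : A → Bool) xs → parity (λ x → f x xor g x) xs ≡ parity f xs xor parity g xs
parity-xor f g []       = refl
parity-xor f g (x ∷ xs) = trans (cong ((f x xor g x) xor_) (parity-xor f g xs)) (interchange (f x) (g x) _ _)

≢⇒xor : ∀ {a b} → a ≢ b → a xor b ≡ true
≢⇒xor {true}  {true}  n = ⊥-elim (n refl)
≢⇒xor {true}  {false} n = refl
≢⇒xor {false} {true}  n = refl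
≢⇒xor {false} {false} n = ⊥-elim (n refl)

xor-self : ∀ a → a xor a ≡ false
xor-self true  = refl
xor-self false = refl

countT-parity : ∀ {A : Set} (f : A → Bool) xs → not (even? (countT f xs)) ≡ parity f xs
countT-parity f []       = refl
countT-parity f (x ∷ xs) with f x
... | true  = cong not (countT-parity f xs)
... | false = countT-parity f xs

odd⇒1 : ∀ n → not (even? n) ≡ true → n % 2 ≡ 1
odd⇒1 (suc zero)    e = refl
odd⇒1 (suc (suc n)) e = trans (cong (_% 2) (ℕₚ.+-comm 2 n)) (trans ([m+n]%n≡m%n n 2) (odd⇒1 n (trans (cong not (sym (not-not _))) e)))

1⇒odd : ∀ n → n % 2 ≡ 1 → not (even? n) ≡ true
1⇒odd (suc zero)    e = refl
1⇒odd (suc (suc n)) e = trans (cong not (not-not _)) (1⇒odd n (trans (sym ([m+n]%n≡m%n n 2)) (trans (cong (_% 2) (ℕₚ.+-comm n 2)) e)))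

parity-ends : ∀ {A : Set} (σ : A → Bool) a as z →
  parity (λ (x , y) → σ x xor σ y) (zip (a ∷ as) (as ++ [ z ])) ≡ σ a xor σ z
parity-ends σ a []       z = Boolₚ.xor-identityʳ (σ a xor σ z)
parity-ends σ a (b ∷ bs) z = trans (cong ((σ a xor σ b) xor_) (parity-ends σ b bs z)) (cancel (σ a) (σ b) (σ z))
  where
  cancel : ∀ x y z → (x xor y) xor (y xor z) ≡ x xor z
  cancel true  true  z = refl
  cancel true  false z = refl
  cancel false true  z = Boolₚ.not-involutive z
  cancel false false z = refl

parity-cycle : ∀ {A : Set} (σ : A → Bool) xs → parity (λ (x , y) → σ x xor σ y) (cycPairs xs) ≡ false
parity-cycle σ []       = refl
parity-cycle σ (a ∷ as) = trans (parity-ends σ a as a) (xor-self (σ a))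

Same : ∀ {A : Set} → A × A → A × A → Set
Same e f = (e ≡ f) ⊎ (e ≡ Product.swap f)

zip-fst : ∀ {A : Set} {x y : A} xs ys → (x , y) ∈ zip xs ys → x ∈ xs
zip-fst (a ∷ as) (b ∷ bs) (here refl) = here refl
zip-fst (a ∷ as) (b ∷ bs) (there i)   = there (zip-fst as bs i)

zip-snd : ∀ {A : Set} {x y : A} xs ys → (x , y) ∈ zip xs ys → y ∈ ys
zip-snd (a ∷ as) (b ∷ bs) (here refl) = here refl
zip-snd (a ∷ as) (b ∷ bs) (there i)   = there (zip-snd as bs i)

pair-in : ∀ {A : Set} (L : List A) {p q : A} → (p , q) ∈ cycPairs L → p ∈ L × q ∈ L
pair-in (a ∷ as) i = zip-fst (a ∷ as) (as ++ [ a ]) i ,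
  [ there , (λ { (here refl) → here refl }) ]′ (∈-++⁻ as (zip-snd (a ∷ as) (as ++ [ a ]) i))

∉-all : ∀ {A : Set} {x : A} {xs} → All (x ≢_) xs → x ∉ xs
∉-all = Allₚ.All¬⇒¬Any

path-distinct : ∀ {A : Set} (x : A) xs z → Unique (x ∷ xs) → z ∉ (x ∷ xs) →
  AllPairs (λ e f → ¬ Same e f) (zip (x ∷ xs) (xs ++ [ z ]))
path-distinct x []       z u n = [] ∷ []
path-distinct x (y ∷ ys) z (x∉ ∷ u) n =
  All.tabulate (λ { i (inj₁ refl) → ∉-all x∉ (zip-fst (y ∷ ys) (ys ++ [ z ]) i)
                  ; i (inj₂ refl) → [ (λ m → ∉-all x∉ (there m)) , (λ { (here refl) → n (here refl) }) ]′
                                      (∈-++⁻ ys (zip-snd (y ∷ ys) (ys ++ [ z ]) i)) })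
  ∷ path-distinct y ys z u (n ∘ there)

-- The length enters because the two pairs of a list of length two are one edge run through both
-- ways.
cycle-distinct : ∀ {A : Set} (xs : List A) → 3 ≤ length xs → Unique xs → AllPairs (λ e f → ¬ Same e f) (cycPairs xs)
cycle-distinct (a ∷ []) (s≤s ()) u
cycle-distinct (a ∷ b ∷ []) (s≤s (s≤s ())) u
cycle-distinct (a ∷ b ∷ c ∷ cs) le (a∉ ∷ b∉ ∷ u) =
  ((λ { (inj₁ refl) → ∉-all a∉ (here refl) ; (inj₂ refl) → ∉-all a∉ (there (here refl)) })
   ∷ All.tabulate (λ { i (inj₁ refl) → ∉-all a∉ (there (zip-fst (c ∷ cs) (cs ++ [ a ]) i))
                     ; i (inj₂ refl) → ∉-all b∉ (zip-fst (c ∷ cs) (cs ++ [ a ]) i) }))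
  ∷ path-distinct b (c ∷ cs) a (b∉ ∷ u) (∉-all a∉)

parity-any : ∀ {A : Set} (f : A → Bool) {xs} → AllPairs (λ x y → ¬ (f x ≡ true × f y ≡ true)) xs →
  ∀ {x} → x ∈ xs → f x ≡ true → parity f xs ≡ true
parity-any f {y ∷ ys} (n ∷ ns) (here refl) e = trans (cong (f y xor_) none) (trans (Boolₚ.xor-identityʳ (f y)) e)
  where
  zero′ : ∀ {zs} → All (λ z → ¬ (f y ≡ true × f z ≡ true)) zs → parity f zs ≡ false
  zero′ []       = refl
  zero′ (h ∷ hs) = cong₂ _xor_ (≢true λ t → h (e , t)) (zero′ hs)
  none : parity f ys ≡ false
  none = zero′ n
parity-any f {y ∷ ys} (n ∷ ns) (there i) e = trans (cong (_xor parity f ys) (≢true λ t → All.lookup n i (t , e))) (parity-any f ns i e)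

any-parity : ∀ {A : Set} (f : A → Bool) xs → parity f xs ≡ true → ∃[ x ] (x ∈ xs × f x ≡ true)
any-parity f (x ∷ xs) e with f x in eq
... | true  = x , here refl , eq
... | false = let y , i , h = any-parity f xs e in y , there i , h

lt : ℤ → ℤ → Bool
lt p p′ = ⌊ p ℤ.<? p′ ⌋

⌊⌋-⇔ : ∀ {P Q : Set} (d : Dec P) (e : Dec Q) → (P → Q) → (Q → P) → ⌊ d ⌋ ≡ ⌊ e ⌋
⌊⌋-⇔ d e f g = bool-ext (λ h → true-⌊⌋ e (f (⌊⌋-true d h))) (λ h → true-⌊⌋ d (g (⌊⌋-true e h)))

lt-ss : ∀ p p′ → lt (ℤ.suc p) (ℤ.suc p′) ≡ lt p p′
lt-ss p p′ = ⌊⌋-⇔ (ℤ.suc p ℤ.<? ℤ.suc p′) (p ℤ.<? p′)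
  (λ l → ℤₚ.≰⇒> (λ g → ℤₚ.<⇒≱ l (ℤₚ.+-monoʳ-≤ (+ 1) g))) (ℤₚ.+-monoʳ-< (+ 1))

lt-suc : ∀ p p′ → lt p (ℤ.suc p′) ≡ lt p p′ xor ⌊ p ℤ.≟ p′ ⌋
lt-suc p p′ with ℤₚ.<-cmp p p′
... | tri< l ne _ rewrite true-⌊⌋ (p ℤ.<? p′) l | false-⌊⌋ (p ℤ.≟ p′) ne =
  true-⌊⌋ (p ℤ.<? ℤ.suc p′) (ℤₚ.<-≤-trans l (ℤₚ.i≤suc[i] p′))

... | tri≈ nl e _ rewrite false-⌊⌋ (p ℤ.<? p′) nl | true-⌊⌋ (p ℤ.≟ p′) e =
  true-⌊⌋ (p ℤ.<? ℤ.suc p′) (ℤₚ.suc[i]≤j⇒i<j (ℤₚ.≤-reflexive (cong ℤ.suc e)))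
... | tri> nl ne g rewrite false-⌊⌋ (p ℤ.<? p′) nl | false-⌊⌋ (p ℤ.≟ p′) ne =
  false-⌊⌋ (p ℤ.<? ℤ.suc p′) (λ l → ℤₚ.<⇒≱ g (ℤₚ.≤-trans (ℤₚ.i<j⇒i≤pred[j] l) (ℤₚ.≤-reflexive (ℤₚ.pred-suc p′))))

lt-pred : ∀ p p′ → lt (ℤ.pred p) p′ ≡ lt p p′ xor ⌊ p ℤ.≟ p′ ⌋
lt-pred p p′ = trans (trans (sym (lt-ss (ℤ.pred p) p′)) (cong (λ x → lt x (ℤ.suc p′)) (ℤₚ.suc-pred p))) (lt-suc p p′)

-- The Jordan curve theorem

open +-*-Solver

+-cancel : ∀ x {a b} → x ℤ.+ a ≡ x ℤ.+ b → a ≡ b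
+-cancel x {a} {b} e = trans (sym (lem a)) (trans (cong (λ z → ℤ.- x ℤ.+ z) e) (lem b))
  where
  lem : ∀ a → ℤ.- x ℤ.+ (x ℤ.+ a) ≡ a
  lem a = solve 2 (λ x a → :- x :+ (x :+ a) := a) refl x a

isD0 : Dir → Bool
isD0 d0 = true
isD0 d1 = false
isD0 d2 = false

-- The vertical edge at the left of d lies to the right of the centre of c in the row of c.
right : Cell → Cell → Bool
right (p , q) (p′ , q′) = ⌊ q′ ℤ.≟ q ⌋ ∧ lt p p′

cr : Cell → Vtx × Vtx → Bool
cr c (t , t′) = crosses (origin c) (pos t , pos t′)

private
  +1≢ : ∀ {y} → y ℤ.+ + 1 ≢ y
  +1≢ {y} e = suc≢ {y} (trans (ℤₚ.+-comm (+ 1) y) e)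

  vertical : ∀ x₀ y₀ a b → crosses (x₀ , y₀) ((a , b) , (a , b ℤ.+ + 1)) ≡ ⌊ b ℤ.≟ y₀ ⌋ ∧ ⌊ x₀ ℤ.+ + 2 ℤ.≤? a ⌋
  vertical x₀ y₀ a b = bool-ext to from
    where
    A = ⌊ a ℤ.≟ a ⌋
    L = ⌊ x₀ ℤ.+ + 2 ℤ.≤? a ⌋
    P₁ = ⌊ b ℤ.≟ y₀ ⌋
    P₂ = ⌊ b ℤ.+ + 1 ℤ.≟ y₀ ℤ.+ + 1 ⌋
    P₃ = ⌊ b ℤ.+ + 1 ℤ.≟ y₀ ⌋
    P₄ = ⌊ b ℤ.≟ y₀ ℤ.+ + 1 ⌋
    to : A ∧ (L ∧ ((P₁ ∧ P₂) ∨ (P₃ ∧ P₄))) ≡ true → P₁ ∧ L ≡ true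
    to h = ∧-true y (∧-fst {L} (∧-snd {A} h))
      where
      y : P₁ ≡ true
      y with bool-cases P₁
      ... | inj₁ e = e
      ... | inj₂ e = ⊥-elim (+1≢ (+1≢′ (⌊⌋-true (b ℤ.+ + 1 ℤ.≟ y₀) (∧-fst {P₃} rest)) (⌊⌋-true (b ℤ.≟ y₀ ℤ.+ + 1) (∧-snd {P₃} rest))))
        where
        rest : P₃ ∧ P₄ ≡ true
        rest = trans (cong (λ z → (z ∧ P₂) ∨ (P₃ ∧ P₄)) (sym e)) (∧-snd {L} (∧-snd {A} h))
        +1≢′ : b ℤ.+ + 1 ≡ y₀ → b ≡ y₀ ℤ.+ + 1 → (b ℤ.+ + 1) ℤ.+ + 1 ≡ b ℤ.+ + 1
        +1≢′ e₁ e₂ = ⊥-elim (2≢ (trans (cong (ℤ._+ + 1) e₁) (sym e₂)))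
          where
          2≢ : b ℤ.+ + 1 ℤ.+ + 1 ≢ b
          2≢ e = case +-cancel b {+ 2} {+ 0} (trans (sym (ℤₚ.+-assoc b (+ 1) (+ 1))) (trans e (sym (ℤₚ.+-identityʳ b)))) of λ ()
    from : P₁ ∧ L ≡ true → A ∧ (L ∧ ((P₁ ∧ P₂) ∨ (P₃ ∧ P₄))) ≡ true
    from h = ∧-true (true-⌊⌋ (a ℤ.≟ a) refl) (∧-true (∧-snd {P₁} h)
      (cong (_∨ (P₃ ∧ P₄)) (∧-true {P₁} (∧-fst h) (true-⌊⌋ (b ℤ.+ + 1 ℤ.≟ y₀ ℤ.+ + 1) (cong (ℤ._+ + 1) (⌊⌋-true (b ℤ.≟ y₀) (∧-fst h)))))))

  crosses-sym : ∀ o u v → crosses o (u , v) ≡ crosses o (v , u)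
  crosses-sym (x₀ , y₀) (a , b) (a′ , b′) with a ℤ.≟ a′
  ... | yes refl = cong₂ _∧_ (sym (true-⌊⌋ (a ℤ.≟ a) refl)) (cong (⌊ x₀ ℤ.+ + 2 ℤ.≤? a ⌋ ∧_) (Boolₚ.∨-comm (⌊ b ℤ.≟ y₀ ⌋ ∧ _) _))
  ... | no ne = sym (cong (_∧ _) (false-⌊⌋ (a′ ℤ.≟ a) (ne ∘ sym)))

  horizontal : ∀ o u v → proj₁ u ≢ proj₁ v → crosses o (u , v) ≡ false
  horizontal (x₀ , y₀) (a , b) (a′ , b′) ne = cong
    (λ z → z ∧ (⌊ x₀ ℤ.+ + 2 ℤ.≤? a ⌋ ∧ ((⌊ b ℤ.≟ y₀ ⌋ ∧ ⌊ b′ ℤ.≟ y₀ ℤ.+ + 1 ⌋) ∨ (⌊ b′ ℤ.≟ y₀ ⌋ ∧ ⌊ b ℤ.≟ y₀ ℤ.+ + 1 ⌋))))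
    (false-⌊⌋ (a ℤ.≟ a′) ne)

  2* : ∀ p p′ q → p ℤ.< p′ → + 2 ℤ.* p ℤ.- q ℤ.+ + 2 ℤ.≤ + 2 ℤ.* p′ ℤ.- q
  2* p p′ q l = ℤₚ.≤-trans (ℤₚ.≤-reflexive (solve 2 (λ p q → con (+ 2) :* p :- q :+ con (+ 2) := con (+ 2) :* (con (+ 1) :+ p) :- q) refl p q))
    (ℤₚ.+-monoˡ-≤ (ℤ.- q) (ℤₚ.*-monoˡ-≤-nonNeg (+ 2) (ℤₚ.i<j⇒suc[i]≤j l)))

  2*⁻ : ∀ p p′ q → + 2 ℤ.* p ℤ.- q ℤ.+ + 2 ℤ.≤ + 2 ℤ.* p′ ℤ.- q → p ℤ.< p′
  2*⁻ p p′ q l = ℤₚ.≰⇒> λ g → ℤₚ.<-irrefl refl (ℤₚ.<-≤-trans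
    (ℤₚ.suc[i]≤j⇒i<j (ℤₚ.≤-trans (ℤₚ.≤-reflexive (ℤₚ.+-comm (+ 1) (+ 2 ℤ.* p ℤ.- q))) (ℤₚ.+-monoʳ-≤ (+ 2 ℤ.* p ℤ.- q) (ℤ.+≤+ (s≤s z≤n)))))
    (ℤₚ.≤-trans l (ℤₚ.+-monoˡ-≤ (ℤ.- q) (ℤₚ.*-monoˡ-≤-nonNeg (+ 2) g))))

  same-row : ∀ p q p′ q′ → ⌊ q′ ℤ.≟ q ⌋ ∧ ⌊ + 2 ℤ.* p ℤ.- q ℤ.+ + 2 ℤ.≤? + 2 ℤ.* p′ ℤ.- q′ ⌋ ≡ right (p , q) (p′ , q′)
  same-row p q p′ q′ = by (q′ ℤ.≟ q)
    where
    by : (d : Dec (q′ ≡ q)) → ⌊ d ⌋ ∧ ⌊ + 2 ℤ.* p ℤ.- q ℤ.+ + 2 ℤ.≤? + 2 ℤ.* p′ ℤ.- q′ ⌋ ≡ ⌊ d ⌋ ∧ lt p p′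
    by (no _) = refl
    by (yes refl) = ⌊⌋-⇔ (+ 2 ℤ.* p ℤ.- q ℤ.+ + 2 ℤ.≤? + 2 ℤ.* p′ ℤ.- q) (p ℤ.<? p′) (2*⁻ p p′ q) (2* p p′ q)

cr-wb : ∀ c d j → cr c (W (wEnd d j) , B (bEnd d j)) ≡ isD0 j ∧ right c d
cr-wb (p , q) (p′ , q′) d0 = trans (cong (λ v → crosses (origin (p , q)) (pos (W (p′ , q′)) , v)) (pos-B↓ p′ q′))
  (trans (vertical (+ 2 ℤ.* p ℤ.- q) q (+ 2 ℤ.* p′ ℤ.- q′) q′) (same-row p q p′ q′))
cr-wb c (p′ , q′) d1 = horizontal (origin c) (pos (W (ℤ.suc p′ , q′))) (pos (B (p′ , q′))) λ e →
  ⊥-elim (lem (+ 2 ℤ.* p′ ℤ.- q′) (trans (sym (cong proj₁ (pos-W↑ p′ q′))) e))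
  where
  lem : ∀ x → x ℤ.+ + 2 ≢ x ℤ.+ + 1
  lem x e = case +-cancel x {+ 2} {+ 1} e of λ ()
cr-wb c (p′ , q′) d2 = horizontal (origin c) (pos (W (ℤ.suc p′ , ℤ.suc q′))) (pos (B (ℤ.suc p′ , ℤ.suc q′))) λ e → ⊥-elim (+1≢ (sym e))

cr-link : ∀ c {t t′ d j} → Link t t′ d j → cr c (t , t′) ≡ isD0 j ∧ right c d
cr-link c (wb d j) = cr-wb c d j
cr-link c (bw d j) = trans (crosses-sym (origin c) (pos (B (bEnd d j))) (pos (W (wEnd d j)))) (cr-wb c d j)

isE : Cell → Dir → Cell → Dir → Bool
isE c k d j = ⌊ c ≟ᶜ d ⌋ ∧ ⌊ k ≟ᵈ j ⌋

isEdge : Cell → Dir → Vtx × Vtx → Bool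
isEdge c k (t , t′) = (⌊ t ≟ᵛ W (wEnd c k) ⌋ ∧ ⌊ t′ ≟ᵛ B (bEnd c k) ⌋) ∨ (⌊ t ≟ᵛ B (bEnd c k) ⌋ ∧ ⌊ t′ ≟ᵛ W (wEnd c k) ⌋)

ends-injective : ∀ c k d j → wEnd c k ≡ wEnd d j → bEnd c k ≡ bEnd d j → c ≡ d × k ≡ j
ends-injective c d0 d d0 e f = e , refl
ends-injective c d0 d d1 e f = ⊥-elim (suc≢ (trans (sym (cong proj₁ e)) (cong proj₁ f)))
ends-injective c d0 d d2 e f = ⊥-elim (suc≢ (trans (cong (ℤ.suc ∘ proj₂) (sym e)) (cong proj₂ f)))
ends-injective c d1 d d0 e f = ⊥-elim (suc≢ (trans (cong proj₁ e) (sym (cong proj₁ f))))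
ends-injective c d1 d d1 e f = f , refl
ends-injective c d1 d d2 e f = ⊥-elim (suc≢ (trans (cong (ℤ.suc ∘ proj₁) (sym f)) (cong proj₁ e)))
ends-injective c d2 d d0 e f = ⊥-elim (suc≢ (trans (cong (ℤ.suc ∘ proj₂) e) (sym (cong proj₂ f))))
ends-injective c d2 d d1 e f = ⊥-elim (suc≢ (trans (cong (ℤ.suc ∘ proj₁) f) (sym (cong proj₁ e))))
ends-injective c d2 d d2 e f = fw-injective true d2 f , refl

isEdge-link : ∀ c k {t t′ d j} → Link t t′ d j → isEdge c k (t , t′) ≡ isE c k d j
isEdge-link c k {t} {t′} {d} {j} l = bool-ext (to l) (from l)
  where
  from : ∀ {t t′ d j} → Link t t′ d j → isE c k d j ≡ true → isEdge c k (t , t′) ≡ true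
  from {d = d} {j} l h with ⌊⌋-true (c ≟ᶜ d) (∧-fst h) | ⌊⌋-true (k ≟ᵈ j) (∧-snd {⌊ c ≟ᶜ d ⌋} h)
  from (wb d j) h | refl | refl = cong (_∨ _) (∧-true (true-⌊⌋ (W (wEnd d j) ≟ᵛ W (wEnd d j)) refl) (true-⌊⌋ (B (bEnd d j) ≟ᵛ B (bEnd d j)) refl))
  from (bw d j) h | refl | refl = trans (cong ((⌊ B (bEnd d j) ≟ᵛ W (wEnd d j) ⌋ ∧ ⌊ W (wEnd d j) ≟ᵛ B (bEnd d j) ⌋) ∨_) (∧-true (true-⌊⌋ (B (bEnd d j) ≟ᵛ B (bEnd d j)) refl) (true-⌊⌋ (W (wEnd d j) ≟ᵛ W (wEnd d j)) refl))) (Boolₚ.∨-zeroʳ (⌊ B (bEnd d j) ≟ᵛ W (wEnd d j) ⌋ ∧ ⌊ W (wEnd d j) ≟ᵛ B (bEnd d j) ⌋))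
  conc : ∀ {d j} → wEnd d j ≡ wEnd c k → bEnd d j ≡ bEnd c k → isE c k d j ≡ true
  conc {d} {j} e f with ends-injective d j c k e f
  ... | refl , refl = ∧-true (true-⌊⌋ (c ≟ᶜ c) refl) (true-⌊⌋ (k ≟ᵈ k) refl)
  to : ∀ {t t′ d j} → Link t t′ d j → isEdge c k (t , t′) ≡ true → isE c k d j ≡ true
  to (wb d j) h = conc (W-injective (⌊⌋-true (W (wEnd d j) ≟ᵛ W (wEnd c k)) (∧-fst h′))) (B-injective (⌊⌋-true (B (bEnd d j) ≟ᵛ B (bEnd c k)) (∧-snd {⌊ W (wEnd d j) ≟ᵛ W (wEnd c k) ⌋} h′)))
    where h′ = trans (sym (Boolₚ.∨-identityʳ _)) h
  to (bw d j) h = conc (W-injective (⌊⌋-true (W (wEnd d j) ≟ᵛ W (wEnd c k)) (∧-snd {⌊ B (bEnd d j) ≟ᵛ B (bEnd c k) ⌋} h))) (B-injective (⌊⌋-true (B (bEnd d j) ≟ᵛ B (bEnd c k)) (∧-fst h)))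

-- The vertices to the right of the edge (c , k) on its horizontal line.
side : Cell → Dir → Vtx → Bool
side c d0 t     = false
side c d1 (W a) = right c a
side c d1 (B a) = right c a
side c d2 (W a) = right (fw true d2 c) a
side c d2 (B a) = right (fw false d1 c) a

private
  row↓ : ∀ q q′ → ⌊ ℤ.suc q′ ℤ.≟ q ⌋ ≡ ⌊ q′ ℤ.≟ ℤ.pred q ⌋
  row↓ q q′ = ⌊⌋-⇔ (ℤ.suc q′ ℤ.≟ q) (q′ ℤ.≟ ℤ.pred q)
    (λ e → trans (sym (ℤₚ.pred-suc q′)) (cong ℤ.pred e)) (λ e → trans (cong ℤ.suc e) (ℤₚ.suc-pred q))

  row-ss : ∀ q q′ → ⌊ ℤ.suc q′ ℤ.≟ ℤ.suc q ⌋ ≡ ⌊ q′ ℤ.≟ q ⌋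
  row-ss q q′ = ⌊⌋-⇔ (ℤ.suc q′ ℤ.≟ ℤ.suc q) (q′ ℤ.≟ q)
    (λ e → trans (sym (ℤₚ.pred-suc q′)) (trans (cong ℤ.pred e) (ℤₚ.pred-suc q))) (cong ℤ.suc)

  ∧-xor : ∀ a b c → (a ∧ b) xor (a ∧ c) ≡ a ∧ (b xor c)
  ∧-xor true  b c = refl
  ∧-xor false b c = refl

  absorb : ∀ a b → a xor (a xor b) ≡ b
  absorb true  true  = refl
  absorb true  false = refl
  absorb false b     = refl

  eqᶜ : ∀ p q p′ q′ → ⌊ (p , q) ≟ᶜ (p′ , q′) ⌋ ≡ ⌊ q′ ℤ.≟ q ⌋ ∧ ⌊ p ℤ.≟ p′ ⌋
  eqᶜ p q p′ q′ = bool-ext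
    (λ h → case ⌊⌋-true ((p , q) ≟ᶜ (p′ , q′)) h of λ { refl → ∧-true (true-⌊⌋ (q ℤ.≟ q) refl) (true-⌊⌋ (p ℤ.≟ p) refl) })
    (λ h → true-⌊⌋ ((p , q) ≟ᶜ (p′ , q′)) (cong₂ _,_ (⌊⌋-true (p ℤ.≟ p′) (∧-snd {⌊ q′ ℤ.≟ q ⌋} h)) (sym (⌊⌋-true (q′ ℤ.≟ q) (∧-fst h)))))

local-wb : ∀ c k d j → (isD0 j ∧ right c d) xor (isD0 j ∧ right (fw true k c) d) ≡
  isE c k d j xor (side c k (W (wEnd d j)) xor side c k (B (bEnd d j)))
local-wb (p , q) d0 (p′ , q′) d0 = trans (trans (∧-xor ⌊ q′ ℤ.≟ q ⌋ (lt p p′) (lt (ℤ.pred p) p′))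
    (cong (⌊ q′ ℤ.≟ q ⌋ ∧_) (trans (cong (lt p p′ xor_) (lt-pred p p′)) (absorb (lt p p′) _))))
  (sym (trans (Boolₚ.xor-identityʳ _) (trans (Boolₚ.∧-identityʳ _) (eqᶜ p q p′ q′))))
local-wb c d0 d d1 = sym (cong (λ b → b xor false) (Boolₚ.∧-zeroʳ ⌊ c ≟ᶜ d ⌋))
local-wb c d0 d d2 = sym (cong (λ b → b xor false) (Boolₚ.∧-zeroʳ ⌊ c ≟ᶜ d ⌋))
local-wb (p , q) d1 (p′ , q′) d0 = sym (trans (cong (λ b → b xor (right (p , q) (p′ , q′) xor right (p , q) (p′ , ℤ.suc q′))) (Boolₚ.∧-zeroʳ ⌊ (p , q) ≟ᶜ (p′ , q′) ⌋))
  (cong (λ b → right (p , q) (p′ , q′) xor (b ∧ lt p p′)) (row↓ q q′)))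
local-wb (p , q) d1 (p′ , q′) d1 = sym (trans (cong₂ _xor_ (trans (Boolₚ.∧-identityʳ _) (eqᶜ p q p′ q′))
  (trans (∧-xor ⌊ q′ ℤ.≟ q ⌋ (lt p (ℤ.suc p′)) (lt p p′)) (cong (⌊ q′ ℤ.≟ q ⌋ ∧_)
    (trans (cong (_xor lt p p′) (lt-suc p p′)) (trans (Boolₚ.xor-comm (lt p p′ xor _) (lt p p′)) (absorb (lt p p′) _))))))
  (xor-self (⌊ q′ ℤ.≟ q ⌋ ∧ ⌊ p ℤ.≟ p′ ⌋)))
local-wb (p , q) d1 (p′ , q′) d2 = sym (trans (cong₂ _xor_ (Boolₚ.∧-zeroʳ ⌊ (p , q) ≟ᶜ (p′ , q′) ⌋) (xor-self (right (p , q) (ℤ.suc p′ , ℤ.suc q′)))) refl)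
local-wb (p , q) d2 (p′ , q′) d0 = sym (trans (cong (λ b → b xor (right (ℤ.suc p , ℤ.suc q) (p′ , q′) xor right (p , ℤ.suc q) (p′ , ℤ.suc q′))) (Boolₚ.∧-zeroʳ ⌊ (p , q) ≟ᶜ (p′ , q′) ⌋))
  (trans (cong (right (ℤ.suc p , ℤ.suc q) (p′ , q′) xor_) (cong (_∧ lt p p′) (row-ss q q′))) (Boolₚ.xor-comm (right (ℤ.suc p , ℤ.suc q) (p′ , q′)) _)))
local-wb (p , q) d2 (p′ , q′) d1 = sym (trans (cong₂ _xor_ (Boolₚ.∧-zeroʳ ⌊ (p , q) ≟ᶜ (p′ , q′) ⌋)
  (trans (cong (_xor right (p , ℤ.suc q) (p′ , q′)) (cong (⌊ q′ ℤ.≟ ℤ.suc q ⌋ ∧_) (lt-ss p p′))) (xor-self (right (p , ℤ.suc q) (p′ , q′))))) refl)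
local-wb (p , q) d2 (p′ , q′) d2 = sym (trans (cong₂ _xor_ (trans (Boolₚ.∧-identityʳ _) (eqᶜ p q p′ q′))
  (trans (cong₂ _xor_ (cong₂ _∧_ (row-ss q q′) (lt-ss p p′)) (cong₂ _∧_ (row-ss q q′) (lt-suc p p′)))
    (trans (∧-xor ⌊ q′ ℤ.≟ q ⌋ (lt p p′) _) (cong (⌊ q′ ℤ.≟ q ⌋ ∧_) (absorb (lt p p′) _)))))
  (xor-self (⌊ q′ ℤ.≟ q ⌋ ∧ ⌊ p ℤ.≟ p′ ⌋)))

-- Moving the start of the ray from `c` to its neighbour changes the crossing with a given edge only
-- if that edge is `(c , k)`, up to a difference of the vertex function `side`, which cancels around
-- a cycle.
local : ∀ c k {t t′ d j} → Link t t′ d j →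
  cr c (t , t′) xor cr (fw true k c) (t , t′) ≡ isEdge c k (t , t′) xor (side c k t xor side c k t′)
local c k {t} {t′} l = trans (cong₂ _xor_ (cr-link c l) (cr-link (fw true k c) l)) (trans (go l) (cong (λ b → b xor (side c k t xor side c k t′)) (sym (isEdge-link c k l))))
  where
  go : ∀ {t t′ d j} → Link t t′ d j → (isD0 j ∧ right c d) xor (isD0 j ∧ right (fw true k c) d) ≡ isE c k d j xor (side c k t xor side c k t′)
  go (wb d j) = local-wb c k d j
  go (bw d j) = trans (local-wb c k d j) (cong (isE c k d j xor_) (Boolₚ.xor-comm (side c k (W (wEnd d j))) _))

Linked₂ : Vtx × Vtx → Set
Linked₂ (t , t′) = ∃[ d ] ∃[ j ] Link t t′ d j

record Cycle (D : List Vtx) : Set where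
  field
    long   : 3 ≤ length D
    unique : Unique D
    links  : All Linked₂ (cycPairs D)

inside : List Vtx → Region
inside D c = parity (cr c) (cycPairs D)

onEdge : List Vtx → Edges
onEdge D c k = parity (isEdge c k) (cycPairs D)

jordan : ∀ {D} → Cycle D → ∀ c k → inside D c xor inside D (fw true k c) ≡ onEdge D c k
jordan {D} cyc c k = trans (sym (parity-xor (cr c) (cr (fw true k c)) (cycPairs D)))
  (trans (parity-cong (All.map (λ (_ , _ , l) → local c k l) (Cycle.links cyc)))
  (trans (parity-xor (isEdge c k) (λ (t , t′) → side c k t xor side c k t′) (cycPairs D))
  (trans (cong (onEdge D c k xor_) (parity-cycle (side c k) D)) (Boolₚ.xor-identityʳ _))))

isEdge-true : ∀ {c k t t′} → isEdge c k (t , t′) ≡ true → Link t t′ c k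
isEdge-true {c} {k} {t} {t′} h with bool-cases (⌊ t ≟ᵛ W (wEnd c k) ⌋ ∧ ⌊ t′ ≟ᵛ B (bEnd c k) ⌋)
... | inj₁ e = subst₂ (λ x y → Link x y c k) (sym (⌊⌋-true (t ≟ᵛ W (wEnd c k)) (∧-fst e)))
                 (sym (⌊⌋-true (t′ ≟ᵛ B (bEnd c k)) (∧-snd {⌊ t ≟ᵛ W (wEnd c k) ⌋} e))) (wb c k)
... | inj₂ e = subst₂ (λ x y → Link x y c k) (sym (⌊⌋-true (t ≟ᵛ B (bEnd c k)) (∧-fst e′)))
                 (sym (⌊⌋-true (t′ ≟ᵛ W (wEnd c k)) (∧-snd {⌊ t ≟ᵛ B (bEnd c k) ⌋} e′))) (bw c k)
  where e′ = trans (cong (_∨ (⌊ t ≟ᵛ B (bEnd c k) ⌋ ∧ ⌊ t′ ≟ᵛ W (wEnd c k) ⌋)) (sym e)) h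

link-isEdge : ∀ {c k t t′} → Link t t′ c k → isEdge c k (t , t′) ≡ true
link-isEdge {c} {k} l = trans (isEdge-link c k l) (∧-true (true-⌊⌋ (c ≟ᶜ c) refl) (true-⌊⌋ (k ≟ᵈ k) refl))

onEdge-link : ∀ {D c k} → onEdge D c k ≡ true → ∃[ t ] ∃[ t′ ] ((t , t′) ∈ cycPairs D × Link t t′ c k)
onEdge-link {D} {c} {k} e with any-parity (isEdge c k) (cycPairs D) e
... | (t , t′) , i , h = t , t′ , i , isEdge-true {c} {k} h

link-onEdge : ∀ {D} → Cycle D → ∀ {c k t t′} → (t , t′) ∈ cycPairs D → Link t t′ c k → onEdge D c k ≡ true
link-onEdge {D} cyc {c} {k} i l = parity-any (isEdge c k)
  (AllPairs.map (λ ns (h₁ , h₂) → ns (same (isEdge-true {c} {k} h₁) (isEdge-true {c} {k} h₂)))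
    (cycle-distinct D (Cycle.long cyc) (Cycle.unique cyc))) i (link-isEdge l)
  where
  same : ∀ {e f} → Link (proj₁ e) (proj₂ e) c k → Link (proj₁ f) (proj₂ f) c k → Same e f
  same (wb _ _) (wb _ _) = inj₁ refl
  same (wb _ _) (bw _ _) = inj₂ refl
  same (bw _ _) (wb _ _) = inj₂ refl
  same (bw _ _) (bw _ _) = inj₁ refl

-- Closed walks and heights

vcell : Vtx → Cell
vcell (W a) = a
vcell (B a) = a

white-links : ∀ a → (∃[ t ] Link (W a) t a d0) × (∃[ t ] Link (W a) t (fw true d0 a) d1) × (∃[ t ] Link (W a) t (fw false d2 a) d2)
white-links a = (_ , wb a d0) ,
  (_ , subst (λ z → Link (W z) (B (bEnd (fw true d0 a) d1)) (fw true d0 a) d1) (fw-inv false d0 a) (wb (fw true d0 a) d1)) ,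
  (_ , subst (λ z → Link (W z) (B (bEnd (fw false d2 a) d2)) (fw false d2 a) d2) (fw-inv true d2 a) (wb (fw false d2 a) d2))

black-links : ∀ a → (∃[ t ] Link (B a) t a d1) × (∃[ t ] Link (B a) t (fw true d1 a) d0) × (∃[ t ] Link (B a) t (fw false d2 a) d2)
black-links a = (_ , bw a d1) ,
  (_ , subst (λ z → Link (B z) (W (wEnd (fw true d1 a) d0)) (fw true d1 a) d0) (fw-inv false d1 a) (bw (fw true d1 a) d0)) ,
  (_ , subst (λ z → Link (B z) (W (wEnd (fw false d2 a) d2)) (fw false d2 a) d2) (fw-inv true d2 a) (bw (fw false d2 a) d2))

module Inside {D : List Vtx} (cyc : Cycle D) where

  X : Region
  X = inside D
  inside-right : ∀ c → X c ≡ true → ∃[ d ] (W d ∈ D × proj₂ d ≡ proj₂ c × proj₁ c ℤ.< proj₁ d)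
  inside-right c@(p , q) h with any-parity (cr c) (cycPairs D) h
  ... | (t , t′) , i , e = go (All.lookup (Cycle.links cyc) i) i e
    where
    read : ∀ d → right c d ≡ true → proj₂ d ≡ q × p ℤ.< proj₁ d
    read (p′ , q′) e = ⌊⌋-true (q′ ℤ.≟ q) (∧-fst e) , ⌊⌋-true (p ℤ.<? p′) (∧-snd {⌊ q′ ℤ.≟ q ⌋} e)
    go : Linked₂ (t , t′) → (t , t′) ∈ cycPairs D → cr c (t , t′) ≡ true → ∃[ d ] (W d ∈ D × proj₂ d ≡ q × p ℤ.< proj₁ d)
    go (d , d0 , wb _ _) i e = d , proj₁ (pair-in D i) , read d (trans (sym (cr-link c (wb d d0))) e)
    go (d , d0 , bw _ _) i e = d , proj₂ (pair-in D i) , read d (trans (sym (cr-link c (bw d d0))) e)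
    go (d , d1 , l) i e = case trans (sym e) (cr-link c l) of λ ()
    go (d , d2 , l) i e = case trans (sym e) (cr-link c l) of λ ()

  sep⇒on : ∀ c k → X c ≢ X (fw true k c) → onEdge D c k ≡ true
  sep⇒on c k ne = trans (sym (jordan cyc c k)) (≢⇒xor ne)

  on⇒sep : ∀ c k → onEdge D c k ≡ true → X c ≢ X (fw true k c)
  on⇒sep c k h e = true≢false h (trans (sym (jordan cyc c k)) (trans (cong (_xor X (fw true k c)) e) (xor-self (X (fw true k c)))))
  link-on : ∀ {t t′ c k} → Link t t′ c k → X c ≢ X (fw true k c) → t ∈ D
  link-on {t} {t′} {c} {k} l ne with onEdge-link {D} {c} {k} (sep⇒on c k ne)
  ... | u , u′ , i , l′ = same l l′ (pair-in D i)
    where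
    same : ∀ {t t′ u u′} → Link t t′ c k → Link u u′ c k → u ∈ D × u′ ∈ D → t ∈ D
    same (wb _ _) (wb _ _) (x , y) = x
    same (wb _ _) (bw _ _) (x , y) = y
    same (bw _ _) (wb _ _) (x , y) = y
    same (bw _ _) (bw _ _) (x , y) = x

  Interior : Vtx → Set
  Interior t = ∀ c → Around t c → X c ≡ true

  Exterior : Vtx → Set
  Exterior t = ∀ c → Around t c → X c ≡ false

  data Place (t : Vtx) : Set where
    interior : Interior t → Place t
    exterior : Exterior t → Place t
    on-cycle : t ∈ D → Place t

  place : ∀ t → Place t
  place (W a) with X a in e₀ | X (fw true d0 a) in e₁ | X (fw false d2 a) in e₂
  ... | true  | true  | true  = interior λ { _ (w₀ _) → e₀ ; _ (w₁ _) → e₁ ; _ (w₂ _) → e₂ }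
  ... | false | false | false = exterior λ { _ (w₀ _) → e₀ ; _ (w₁ _) → e₁ ; _ (w₂ _) → e₂ }
  ... | true  | false | _     = on-cycle (link-on (proj₂ (proj₁ (white-links a))) λ e → true≢false (trans (sym e) e₀) e₁)
  ... | false | true  | _     = on-cycle (link-on (proj₂ (proj₁ (white-links a))) λ e → true≢false (trans e e₁) e₀)
  ... | true  | true  | false = on-cycle (link-on (proj₂ (proj₂ (proj₂ (white-links a)))) λ e →
        true≢false (trans e (trans (cong X (fw-inv true d2 a)) e₀)) e₂)
  ... | false | false | true  = on-cycle (link-on (proj₂ (proj₂ (proj₂ (white-links a)))) λ e →
        true≢false (trans (cong X (sym (fw-inv true d2 a))) (trans (sym e) e₂)) e₀)
  place (B a) with X a in e₀ | X (fw true d1 a) in e₁ | X (fw false d2 a) in e₂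
  ... | true  | true  | true  = interior λ { _ (b₀ _) → e₀ ; _ (b₁ _) → e₁ ; _ (b₂ _) → e₂ }
  ... | false | false | false = exterior λ { _ (b₀ _) → e₀ ; _ (b₁ _) → e₁ ; _ (b₂ _) → e₂ }
  ... | true  | false | _     = on-cycle (link-on (proj₂ (proj₁ (black-links a))) λ e → true≢false (trans (sym e) e₀) e₁)
  ... | false | true  | _     = on-cycle (link-on (proj₂ (proj₁ (black-links a))) λ e → true≢false (trans e e₁) e₀)
  ... | true  | true  | false = on-cycle (link-on (proj₂ (proj₂ (proj₂ (black-links a)))) λ e →
        true≢false (trans e (trans (cong X (fw-inv true d2 a)) e₀)) e₂)
  ... | false | false | true  = on-cycle (link-on (proj₂ (proj₂ (proj₂ (black-links a)))) λ e →
        true≢false (trans (cong X (sym (fw-inv true d2 a))) (trans (sym e) e₂)) e₀)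
  -- Induction along the cycle is anchored at a rightmost vertex, where the ray to the right leaves
  -- the system at once and `P` can be checked directly.
  spread-cycle : ∀ {P : Vtx → Set} →
    (∀ {t t′ c k} → Link t t′ c k → onEdge D c k ≡ true → P t → P t′) →
    (∀ t → t ∈ D → (∀ u → u ∈ D → proj₁ (vcell u) ℤ.≤ proj₁ (vcell t)) → P t) →
    ∀ t → t ∈ D → P t
  spread-cycle {P} pass top t t∈ = let t* , i , mx = maximum D t∈ in back i t∈ (top t* i mx)
    where
    maximum : ∀ D {t} → t ∈ D → ∃[ t* ] (t* ∈ D × (∀ u → u ∈ D → proj₁ (vcell u) ℤ.≤ proj₁ (vcell t*)))
    maximum (a ∷ []) i = a , here refl , λ { _ (here refl) → ℤₚ.≤-refl }
    maximum (a ∷ b ∷ D) i with maximum (b ∷ D) (here refl)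
    ... | m , j , mx with ℤₚ.≤-total (proj₁ (vcell a)) (proj₁ (vcell m))
    ... | inj₁ le = m , there j , λ { _ (here refl) → le ; u (there k) → mx u k }
    ... | inj₂ ge = a , here refl , λ { _ (here refl) → ℤₚ.≤-refl ; u (there k) → ℤₚ.≤-trans (mx u k) ge }
    Pass : List (Vtx × Vtx) → Set
    Pass = All (λ e → (P (proj₁ e) → P (proj₂ e)) × (P (proj₂ e) → P (proj₁ e)))
    passes : Pass (cycPairs D)
    passes = All.tabulate λ { {e} i → let d , j , l = All.lookup (Cycle.links cyc) i
                                          on = link-onEdge cyc i l in pass l on , pass (link-sym l) on }
    from-head : ∀ a as z → Pass (zip (a ∷ as) (as ++ [ z ])) → ∀ {u} → u ∈ (a ∷ as) → (P a → P u) × (P u → P a)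
    from-head a as       z h (here refl) = id , id
    from-head a (b ∷ bs) z ((f , g) ∷ h) (there i) = let f′ , g′ = from-head b bs z h i in f′ ∘ f , g ∘ g′
    back : ∀ {t* t} → t* ∈ D → t ∈ D → P t* → P t
    back = go D passes
      where
      go : ∀ D → Pass (cycPairs D) → ∀ {t* t} → t* ∈ D → t ∈ D → P t* → P t
      go (a ∷ as) h i j p = proj₁ (from-head a as a h j) (proj₂ (from-head a as a h i) p)

  Cochain : Set
  Cochain = Cell → Dir → ℤ

  data Walk (x : Cell) : Cell → Set where
    nil  : Walk x x
    snoc : ∀ {c} → Walk x c → ∀ s k → X c ≡ true → X (fw s k c) ≡ true → Walk x (fw s k c)

  value : Cochain → Bool → Cell → Dir → ℤ
  value θ true  c k = θ c k
  value θ false c k = ℤ.- θ (fw false k c) k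

  total : Cochain → ∀ {x c} → Walk x c → ℤ
  total θ nil = + 0
  total θ (snoc {c} w s k _ _) = total θ w ℤ.+ value θ s c k
  -- Path independence inside `X`. That it follows from vanishing circulation at the interior
  -- vertices is the statement that `X` has no holes.
  Exact : Cochain → Set
  Exact θ = ∀ {x c} (w w′ : Walk x c) → total θ w ≡ total θ w′

  gradient : (Cell → ℤ) → Cochain
  gradient G c k = G (fw true k c) ℤ.- G c

  total-gradient : ∀ {θ θ′} G → (∀ c k → X c ≡ true → X (fw true k c) ≡ true → θ c k ≡ θ′ c k ℤ.+ gradient G c k) →
    ∀ {x c} (w : Walk x c) → total θ w ≡ total θ′ w ℤ.+ (G c ℤ.- G x)
  total-gradient {θ} {θ′} G h {x} nil = sym (trans (ℤₚ.+-identityˡ _) (ℤₚ.+-inverseʳ (G x)))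
  total-gradient {θ} {θ′} G h {x} (snoc {c} w true k xc xd) = trans (cong₂ ℤ._+_ (total-gradient {θ} {θ′} G h w) (h c k xc xd))
    (solve 5 (λ t gc gx v gd → (t :+ (gc :- gx)) :+ (v :+ (gd :- gc)) := (t :+ v) :+ (gd :- gx)) refl
      (total θ′ w) (G c) (G x) (θ′ c k) (G (fw true k c)))
  total-gradient {θ} {θ′} G h {x} (snoc {c} w false k xc xd) = trans (cong₂ ℤ._+_ (total-gradient {θ} {θ′} G h w)
      (trans (cong ℤ.-_ (h c′ k xd (trans (cong X (fw-inv true k c)) xc))) (cong (λ z → ℤ.- (θ′ c′ k ℤ.+ (G z ℤ.- G c′))) (fw-inv true k c))))
    (solve 5 (λ t gc gx v gd → (t :+ (gc :- gx)) :+ (:- (v :+ (gc :- gd))) := (t :+ (:- v)) :+ (gd :- gx)) refl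
      (total θ′ w) (G c) (G x) (θ′ c′ k) (G c′))
    where c′ = fw false k c

  exact-gradient : ∀ {θ θ′} G → (∀ c k → X c ≡ true → X (fw true k c) ≡ true → θ c k ≡ θ′ c k ℤ.+ gradient G c k) →
    Exact θ′ → Exact θ
  exact-gradient {θ} {θ′} G h ex w w′ = trans (total-gradient {θ} {θ′} G h w)
    (trans (cong (ℤ._+ _) (ex w w′)) (sym (total-gradient {θ} {θ′} G h w′)))

  exact-cong : ∀ {θ θ′} → (∀ c k → X c ≡ true → X (fw true k c) ≡ true → θ c k ≡ θ′ c k) → Exact θ′ → Exact θ
  exact-cong {θ} {θ′} h = exact-gradient {θ} {θ′} (λ _ → + 0) (λ c k x y → trans (h c k x y) (sym (ℤₚ.+-identityʳ (θ′ c k))))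

  exact-zero : Exact (λ _ _ → + 0)
  exact-zero w w′ = trans (zero-total w) (sym (zero-total w′))
    where
    zero-total : ∀ {x c} (w : Walk x c) → total (λ _ _ → + 0) w ≡ + 0
    zero-total nil = refl
    zero-total (snoc w true  k _ _) = trans (ℤₚ.+-identityʳ _) (zero-total w)
    zero-total (snoc w false k _ _) = trans (ℤₚ.+-identityʳ _) (zero-total w)

  exact-combine : ∀ {θ θ′} J → Exact θ → Exact θ′ → Exact (λ c k → θ c k ℤ.+ J ℤ.* θ′ c k)
  exact-combine {θ} {θ′} J e e′ w w′ = trans (split w) (trans (cong₂ (λ a b → a ℤ.+ J ℤ.* b) (e w w′) (e′ w w′)) (sym (split w′)))
    where
    split : ∀ {x c} (w : Walk x c) → total (λ c k → θ c k ℤ.+ J ℤ.* θ′ c k) w ≡ total θ w ℤ.+ J ℤ.* total θ′ w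
    split nil = sym (trans (ℤₚ.+-identityˡ _) (ℤₚ.*-zeroʳ J))
    split (snoc {c} w true k _ _) = trans (cong (ℤ._+ (θ c k ℤ.+ J ℤ.* θ′ c k)) (split w))
      (solve 5 (λ t t′ j a b → (t :+ j :* t′) :+ (a :+ j :* b) := (t :+ a) :+ j :* (t′ :+ b)) refl (total θ w) (total θ′ w) J (θ c k) (θ′ c k))
    split (snoc {c} w false k _ _) = trans (cong (ℤ._+ (ℤ.- (θ c′ k ℤ.+ J ℤ.* θ′ c′ k))) (split w))
      (solve 5 (λ t t′ j a b → (t :+ j :* t′) :+ (:- (a :+ j :* b)) := (t :+ (:- a)) :+ j :* (t′ :+ (:- b))) refl (total θ w) (total θ′ w) J (θ c′ k) (θ′ c′ k))
      where c′ = fw false k c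

  -- A cochain on the horizontal edges: R a is its value on the edge to the right of W a, and L a on the one to
  -- the right of B a, both crossed upwards.
  line : (R L : Cell → ℤ) → Cochain
  line R L c d0 = + 0
  line R L c d1 = ℤ.- L c
  line R L c d2 = R (fw true d2 c)

  ind : Bool → ℤ
  ind true  = + 1
  ind false = + 0
  rayR rayL : Vtx → Cell → ℤ
  rayR (W a) c = ind (right a (fw false d0 c))
  rayR (B a) c = ind (right a c)
  rayL (W a) c = ind (right a (fw false d0 c))
  rayL (B a) c = ind (right a (fw false d0 c))

  -- Counts the upward crossings of the horizontal half-line to the right of `t`; its circulation
  -- vanishes at every vertex except `t`.
  ray : Vtx → Cochain
  ray t = line (rayR t) (rayL t)

  right-suc : ∀ a c → a ≢ c → right a (fw false d0 c) ≡ right a c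
  right-suc (p , q) (p′ , q′) ne = go (q′ ℤ.≟ q)
    where
    go : (d : Dec (q′ ≡ q)) → ⌊ d ⌋ ∧ lt p (ℤ.suc p′) ≡ ⌊ d ⌋ ∧ lt p p′
    go (no _) = refl
    go (yes refl) = trans (lt-suc p p′) (trans (cong (lt p p′ xor_) (false-⌊⌋ (p ℤ.≟ p′) λ { refl → ne refl })) (Boolₚ.xor-identityʳ (lt p p′)))

  right-self : ∀ a → right a (fw false d0 a) ≡ true
  right-self (p , q) = ∧-true (true-⌊⌋ (q ℤ.≟ q) refl) (true-⌊⌋ (p ℤ.<? ℤ.suc p) (ℤₚ.suc[i]≤j⇒i<j ℤₚ.≤-refl))

  right-irrefl : ∀ a → right a a ≡ false
  right-irrefl (p , q) = trans (cong (⌊ q ℤ.≟ q ⌋ ∧_) (false-⌊⌋ (p ℤ.<? p) (ℤₚ.<-irrefl refl))) (Boolₚ.∧-zeroʳ _)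

  fw-d0-inv : ∀ c → fw false d0 (fw true d0 c) ≡ c
  fw-d0-inv = fw-inv false d0

  none-suc : ∀ a c → proj₁ c ℤ.< proj₁ a → right a (fw false d0 c) ≡ false
  none-suc (p , q) (p′ , q′) l = trans (cong (⌊ q′ ℤ.≟ q ⌋ ∧_) (false-⌊⌋ (p ℤ.<? ℤ.suc p′)
    (λ g → ℤₚ.<⇒≱ l (ℤₚ.≤-trans (ℤₚ.i<j⇒i≤pred[j] g) (ℤₚ.≤-reflexive (ℤₚ.pred-suc p′)))))) (Boolₚ.∧-zeroʳ _)
  none : ∀ a c → proj₁ c ℤ.< proj₁ a → right a c ≡ false
  none (p , q) (p′ , q′) l = trans (cong (⌊ q′ ℤ.≟ q ⌋ ∧_) (false-⌊⌋ (p ℤ.<? p′) (ℤₚ.<-asym l))) (Boolₚ.∧-zeroʳ _)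

  ray-beyond : ∀ t → (∀ d → W d ∈ D → proj₁ d ℤ.≤ proj₁ (vcell t)) → Exact (ray t)
  ray-beyond t far = exact-cong {ray t} {λ _ _ → + 0} (zero′ t beyond) exact-zero
    where
    beyond : ∀ c → X c ≡ true → proj₁ c ℤ.< proj₁ (vcell t)
    beyond c x = let d , d∈ , _ , l = inside-right c x in ℤₚ.<-≤-trans l (far d d∈)
    zero′ : ∀ t → (∀ c → X c ≡ true → proj₁ c ℤ.< proj₁ (vcell t)) →
      ∀ c k → X c ≡ true → X (fw true k c) ≡ true → ray t c k ≡ + 0
    zero′ t     l c d0 x y = refl
    zero′ (W a) l c d1 x y = cong (ℤ.-_ ∘ ind) (none-suc a c (l c x))
    zero′ (B a) l c d1 x y = cong (ℤ.-_ ∘ ind) (none-suc a c (l c x))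
    zero′ (W a) l c d2 x y = cong ind (none-suc a (fw true d2 c) (l _ y))
    zero′ (B a) l c d2 x y = cong ind (none a (fw true d2 c) (l _ y))

  private
    row-pred : ∀ q q′ → ⌊ ℤ.pred q′ ℤ.≟ q ⌋ ≡ ⌊ q′ ℤ.≟ ℤ.suc q ⌋
    row-pred q q′ = ⌊⌋-⇔ (ℤ.pred q′ ℤ.≟ q) (q′ ℤ.≟ ℤ.suc q)
      (λ e → trans (sym (ℤₚ.suc-pred q′)) (cong ℤ.suc e)) (λ e → trans (cong ℤ.pred e) (ℤₚ.pred-suc q))

  -- Two vertices joined by an edge which no walk in X can cross: their rays differ by a gradient.
  ray-pass : ∀ {t t′ c k} → Link t t′ c k → (X c ≡ true → X (fw true k c) ≡ true → ⊥) → Exact (ray t) → Exact (ray t′)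
  ray-pass (wb c@(p , q) d0) blocked ex = exact-gradient {ray (B (p , ℤ.suc q))} {ray (W c)} G diff ex
    where
    G : Cell → ℤ
    G e = ℤ.- ind (right c (fw false d0 e))
    diff : ∀ e k → X e ≡ true → X (fw true k e) ≡ true → ray (B (p , ℤ.suc q)) e k ≡ ray (W c) e k ℤ.+ gradient G e k
    diff e d0 x y = sym (trans (ℤₚ.+-identityˡ _) (trans (cong (λ b → ℤ.- ind b ℤ.- G e)
        (trans (cong (right c) (fw-d0-inv e)) (sym (right-suc c e λ { refl → blocked x y })))) (ℤₚ.+-inverseʳ (G e))))
    diff e@(p′ , q′) d1 x y = trans (cong (λ b → ℤ.- ind (b ∧ lt p (ℤ.suc p′))) (sym (row-pred q q′)))
      (solve 2 (λ a b → :- b := :- a :+ (:- b :- :- a)) refl (ind (⌊ q′ ℤ.≟ q ⌋ ∧ lt p (ℤ.suc p′))) (ind (⌊ ℤ.pred q′ ℤ.≟ q ⌋ ∧ lt p (ℤ.suc p′))))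
    diff e@(p′ , q′) d2 x y = trans (cong (λ b → ind (b ∧ lt p (ℤ.suc p′))) (row-ss q q′))
      (solve 2 (λ a b → a := b :+ (:- b :- :- a)) refl (ind (⌊ q′ ℤ.≟ q ⌋ ∧ lt p (ℤ.suc p′))) (ind (⌊ ℤ.suc q′ ℤ.≟ q ⌋ ∧ lt p (ℤ.suc (ℤ.suc p′)))))
  ray-pass (bw c@(p , q) d0) blocked ex = exact-gradient {ray (W c)} {ray (B (p , ℤ.suc q))} G diff ex
    where
    G : Cell → ℤ
    G e = ind (right c (fw false d0 e))
    diff : ∀ e k → X e ≡ true → X (fw true k e) ≡ true → ray (W c) e k ≡ ray (B (p , ℤ.suc q)) e k ℤ.+ gradient G e k
    diff e d0 x y = sym (trans (ℤₚ.+-identityˡ _) (trans (cong (λ b → ind b ℤ.- G e)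
        (trans (cong (right c) (fw-d0-inv e)) (sym (right-suc c e λ { refl → blocked x y })))) (ℤₚ.+-inverseʳ (G e))))
    diff e@(p′ , q′) d1 x y = trans
      (solve 2 (λ a b → :- a := :- b :+ (b :- a)) refl (ind (⌊ q′ ℤ.≟ q ⌋ ∧ lt p (ℤ.suc p′))) (ind (⌊ ℤ.pred q′ ℤ.≟ q ⌋ ∧ lt p (ℤ.suc p′))))
      (cong (λ b → ℤ.- ind (b ∧ lt p (ℤ.suc p′)) ℤ.+ (ind (⌊ ℤ.pred q′ ℤ.≟ q ⌋ ∧ lt p (ℤ.suc p′)) ℤ.- ind (⌊ q′ ℤ.≟ q ⌋ ∧ lt p (ℤ.suc p′)))) (row-pred q q′))
    diff e@(p′ , q′) d2 x y = trans
      (solve 2 (λ a b → b := a :+ (b :- a)) refl (ind (⌊ q′ ℤ.≟ q ⌋ ∧ lt p (ℤ.suc p′))) (ind (⌊ ℤ.suc q′ ℤ.≟ q ⌋ ∧ lt p (ℤ.suc (ℤ.suc p′)))))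
      (cong (λ b → ind (b ∧ lt p (ℤ.suc p′)) ℤ.+ (ind (⌊ ℤ.suc q′ ℤ.≟ q ⌋ ∧ lt p (ℤ.suc (ℤ.suc p′))) ℤ.- ind (⌊ q′ ℤ.≟ q ⌋ ∧ lt p (ℤ.suc p′)))) (sym (row-ss q q′)))
  ray-pass (wb c d1) blocked ex = exact-cong {ray (B c)} {ray (W (fw false d0 c))} diff ex
    where
    diff : ∀ e k → X e ≡ true → X (fw true k e) ≡ true → ray (B c) e k ≡ ray (W (fw false d0 c)) e k
    diff e d0 x y = refl
    diff e d1 x y = cong (ℤ.-_ ∘ ind) (trans (right-suc c e λ { refl → blocked x y })
      (cong (⌊ proj₂ e ℤ.≟ proj₂ c ⌋ ∧_) (sym (lt-ss (proj₁ c) (proj₁ e)))))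
    diff e d2 x y = cong ind (cong (⌊ proj₂ (fw true d2 e) ℤ.≟ proj₂ c ⌋ ∧_) (sym (lt-ss (proj₁ c) (proj₁ (fw true d2 e)))))
  ray-pass (bw c d1) blocked ex = exact-cong {ray (W (fw false d0 c))} {ray (B c)} diff ex
    where
    diff : ∀ e k → X e ≡ true → X (fw true k e) ≡ true → ray (W (fw false d0 c)) e k ≡ ray (B c) e k
    diff e d0 x y = refl
    diff e d1 x y = sym (cong (ℤ.-_ ∘ ind) (trans (right-suc c e λ { refl → blocked x y })
      (cong (⌊ proj₂ e ℤ.≟ proj₂ c ⌋ ∧_) (sym (lt-ss (proj₁ c) (proj₁ e))))))
    diff e d2 x y = sym (cong ind (cong (⌊ proj₂ (fw true d2 e) ℤ.≟ proj₂ c ⌋ ∧_) (sym (lt-ss (proj₁ c) (proj₁ (fw true d2 e))))))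
  ray-pass (wb c d2) blocked ex = exact-cong {ray (B (fw true d2 c))} {ray (W (fw true d2 c))} diff ex
    where
    diff : ∀ e k → X e ≡ true → X (fw true k e) ≡ true → ray (B (fw true d2 c)) e k ≡ ray (W (fw true d2 c)) e k
    diff e d0 x y = refl
    diff e d1 x y = refl
    diff e d2 x y = sym (cong ind (right-suc (fw true d2 c) (fw true d2 e) λ q → case fw-injective true d2 {c} {e} q of λ { refl → blocked x y }))
  ray-pass (bw c d2) blocked ex = exact-cong {ray (W (fw true d2 c))} {ray (B (fw true d2 c))} diff ex
    where
    diff : ∀ e k → X e ≡ true → X (fw true k e) ≡ true → ray (W (fw true d2 c)) e k ≡ ray (B (fw true d2 c)) e k
    diff e d0 x y = refl
    diff e d1 x y = refl
    diff e d2 x y = cong ind (right-suc (fw true d2 c) (fw true d2 e) λ q → case fw-injective true d2 {c} {e} q of λ { refl → blocked x y })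

  ray-cycle : ∀ t → t ∈ D → Exact (ray t)
  ray-cycle = spread-cycle {λ t → Exact (ray t)}
    (λ {_} {_} {c} {k} l on → ray-pass l (λ x y → on⇒sep c k on (trans x (sym y))))
    (λ t _ mx → ray-beyond t (λ d d∈ → mx (W d) d∈))

  private
    M : ℤ
    M = ℤ.- proj₁ (lowerBound (λ t → ℤ.- proj₁ (vcell t)) D)

    ≤M : ∀ u → u ∈ D → proj₁ (vcell u) ℤ.≤ M
    ≤M u i = ℤₚ.≤-trans (ℤₚ.≤-reflexive (sym (ℤₚ.neg-involutive _)))
      (ℤₚ.neg-mono-≤ (proj₂ (lowerBound (λ t → ℤ.- proj₁ (vcell t)) D) u i))

  mutual
    -- An exterior vertex is moved to the right along edges which no walk in `X` crosses, until it
    -- meets the cycle or is beyond all of its vertices; `n` bounds the remaining columns.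
    ray-W : ∀ n a → M ℤ.≤ proj₁ a ℤ.+ + n → ¬ Interior (W a) → Exact (ray (W a))
    ray-W n a le ni with place (W a)
    ... | interior i = ⊥-elim (ni i)
    ... | on-cycle i = ray-cycle (W a) i
    ... | exterior x = ray-pass (subst (λ z → Link (B z) (W z) (fw false d2 a) d2) (fw-inv true d2 a) (bw (fw false d2 a) d2))
            (λ h _ → true≢false h (x _ (w₂ a))) (ray-B n a le λ i → true≢false (i _ (b₀ a)) (x _ (w₀ a)))

    ray-B : ∀ n a → M ℤ.≤ proj₁ a ℤ.+ + n → ¬ Interior (B a) → Exact (ray (B a))
    ray-B n a le ni with place (B a)
    ray-B n a le ni | interior i = ⊥-elim (ni i)
    ray-B n a le ni | on-cycle i = ray-cycle (B a) i
    ray-B zero a le ni | exterior x = ray-beyond (B a) λ d i →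
      ℤₚ.≤-trans (≤M (W d) i) (ℤₚ.≤-trans le (ℤₚ.≤-reflexive (ℤₚ.+-identityʳ (proj₁ a))))
    ray-B (suc n) a le ni | exterior x = ray-pass (wb a d1) (λ h _ → true≢false h (x _ (b₀ a)))
      (ray-W n (fw false d0 a) (ℤₚ.≤-trans le (ℤₚ.≤-reflexive
          (solve 2 (λ p n → p :+ (con (+ 1) :+ n) := (con (+ 1) :+ p) :+ n) refl (proj₁ a) (+ n))))
        λ i → true≢false (i a (subst (Around (W (fw false d0 a))) (fw-inv true d0 a) (w₁ _))) (x _ (b₀ a)))

  private
    fuel : ∀ p → M ℤ.≤ p ℤ.+ + ℤ.∣ M ℤ.- p ∣
    fuel p = ℤₚ.≤-trans (ℤₚ.≤-reflexive (solve 2 (λ m p → m := p :+ (m :- p)) refl M p)) (ℤₚ.+-monoʳ-≤ p (i≤∣i∣ (M ℤ.- p)))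
      where
      i≤∣i∣ : ∀ i → i ℤ.≤ + ℤ.∣ i ∣
      i≤∣i∣ (+ n)      = ℤₚ.≤-refl
      i≤∣i∣ (-[1+ n ]) = ℤ.-≤+

  ray-exact : ∀ t → ¬ Interior t → Exact (ray t)
  ray-exact (W a) = ray-W _ a (fuel (proj₁ a))
  ray-exact (B a) = ray-B _ a (fuel (proj₁ a))

  -- Up to sign the circulation of `line R L` around a vertex, since the vertical edge there
  -- contributes 0.
  jump : (R L : Cell → ℤ) → Vtx → ℤ
  jump R L (W a) = R a ℤ.- L (fw true d0 a)
  jump R L (B a) = L a ℤ.- R a

  jump-ray-self : ∀ t → jump (rayR t) (rayL t) t ≡ + 1
  jump-ray-self (W a) = cong₂ ℤ._-_ (cong ind (right-self a)) (cong ind (trans (cong (right a) (fw-d0-inv a)) (right-irrefl a)))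
  jump-ray-self (B a) = cong₂ ℤ._-_ (cong ind (right-self a)) (cong ind (right-irrefl a))

  jump-ray-other : ∀ t u → u ≢ t → jump (rayR t) (rayL t) u ≡ + 0
  jump-ray-other (W a) (W c) ne = trans (cong₂ ℤ._-_ (cong ind (right-suc a c λ { refl → ne refl })) (cong (ind ∘ right a) (fw-d0-inv c))) (ℤₚ.+-inverseʳ (ind (right a c)))
  jump-ray-other (W a) (B c) ne = ℤₚ.+-inverseʳ (ind (right a (fw false d0 c)))
  jump-ray-other (B a) (W c) ne = trans (cong (λ z → ind (right a c) ℤ.- ind (right a z)) (fw-d0-inv c)) (ℤₚ.+-inverseʳ (ind (right a c)))
  jump-ray-other (B a) (B c) ne = trans (cong (λ b → ind b ℤ.- ind (right a c)) (right-suc a c λ { refl → ne refl })) (ℤₚ.+-inverseʳ (ind (right a c)))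

  ray-left : ∀ t c → proj₁ c ℤ.< proj₁ (vcell t) → rayR t c ≡ + 0 × rayL t c ≡ + 0
  ray-left (W a) c l = cong ind (none-suc a c l) , cong ind (none-suc a c l)
  ray-left (B a) c l = cong ind (none a c l) , cong ind (none-suc a c l)

  -- Subtracting rays at exterior vertices removes the jumps of a horizontal cochain one by one.
  line-exact : ∀ p₀ VL R L → (∀ t → t ∉ VL ⊎ Interior t → jump R L t ≡ + 0) → (∀ t → t ∈ VL → p₀ ℤ.≤ proj₁ (vcell t)) →
    (∀ a → proj₁ a ℤ.< p₀ → R a ≡ + 0 × L a ≡ + 0) → Exact (line R L)
  line-exact p₀ [] R L nj _ left = exact-cong {line R L} {λ _ _ → + 0} zero′ exact-zero
    where
    R≡ : ∀ a → R a ≡ L (fw true d0 a)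
    R≡ a = ℤₚ.i-j≡0⇒i≡j (R a) _ (nj (W a) (inj₁ λ ()))
    L≡ : ∀ a → L a ≡ R a
    L≡ a = ℤₚ.i-j≡0⇒i≡j (L a) _ (nj (B a) (inj₁ λ ()))
    vanish : ∀ n p q → p ℤ.< p₀ ℤ.+ + n → R (p , q) ≡ + 0
    vanish zero p q l = proj₁ (left (p , q) (ℤₚ.<-≤-trans l (ℤₚ.≤-reflexive (ℤₚ.+-identityʳ p₀))))
    vanish (suc n) p q l = trans (R≡ (p , q)) (trans (L≡ _) (vanish n (ℤ.pred p) q
      (ℤₚ.<-≤-trans (ℤₚ.+-monoʳ-< -[1+ 0 ] l) (ℤₚ.≤-reflexive (solve 2 (λ p n → con -[1+ 0 ] :+ (p :+ (con (+ 1) :+ n)) := p :+ n) refl p₀ (+ n))))))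
    R0 : ∀ a → R a ≡ + 0
    R0 (p , q) = vanish (suc ℤ.∣ p ℤ.- p₀ ∣) p q (ℤₚ.≤-<-trans (ℤₚ.≤-reflexive (solve 2 (λ p p₀ → p := p₀ :+ (p :- p₀)) refl p p₀))
      (ℤₚ.+-monoʳ-< p₀ (ℤₚ.≤-<-trans (i≤∣i∣ (p ℤ.- p₀)) (ℤ.+<+ ℕₚ.≤-refl))))
      where
      i≤∣i∣ : ∀ i → i ℤ.≤ + ℤ.∣ i ∣
      i≤∣i∣ (+ n)      = ℤₚ.≤-refl
      i≤∣i∣ (-[1+ n ]) = ℤ.-≤+
    zero′ : ∀ c k → X c ≡ true → X (fw true k c) ≡ true → line R L c k ≡ + 0
    zero′ c d0 _ _ = refl
    zero′ c d1 _ _ = cong ℤ.-_ (trans (L≡ c) (R0 c))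
    zero′ c d2 _ _ = R0 (fw true d2 c)
  line-exact p₀ (t ∷ VL) R L nj bound left = restore (place t)
    where
    J = jump R L t
    R′ L′ : Cell → ℤ
    R′ c = R c ℤ.+ (ℤ.- J) ℤ.* rayR t c
    L′ c = L c ℤ.+ (ℤ.- J) ℤ.* rayL t c
    jump′ : ∀ u → jump R′ L′ u ≡ jump R L u ℤ.+ (ℤ.- J) ℤ.* jump (rayR t) (rayL t) u
    jump′ (W a) = solve 5 (λ r l j x y → (r :+ j :* x) :- (l :+ j :* y) := (r :- l) :+ j :* (x :- y)) refl
      (R a) (L (fw true d0 a)) (ℤ.- J) (rayR t a) (rayL t (fw true d0 a))
    jump′ (B a) = solve 5 (λ r l j x y → (r :+ j :* x) :- (l :+ j :* y) := (r :- l) :+ j :* (x :- y)) refl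
      (L a) (R a) (ℤ.- J) (rayL t a) (rayR t a)
    nj′ : ∀ u → u ∉ VL ⊎ Interior u → jump R′ L′ u ≡ + 0
    nj′ u h with u ≟ᵛ t
    ... | yes refl = trans (jump′ u) (trans (cong (λ z → J ℤ.+ (ℤ.- J) ℤ.* z) (jump-ray-self u))
                       (trans (cong (λ z → J ℤ.+ z) (ℤₚ.*-identityʳ (ℤ.- J))) (ℤₚ.+-inverseʳ J)))
    ... | no ne = trans (jump′ u) (trans (cong₂ (λ y z → y ℤ.+ (ℤ.- J) ℤ.* z)
                    (nj u ([ (λ n → inj₁ λ { (here e) → ne e ; (there i) → n i }) , inj₂ ]′ h)) (jump-ray-other t u ne))
                    (trans (ℤₚ.+-identityˡ _) (ℤₚ.*-zeroʳ (ℤ.- J))))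
    left′ : ∀ a → proj₁ a ℤ.< p₀ → R′ a ≡ + 0 × L′ a ≡ + 0
    left′ a l = let r , l′ = ray-left t a (ℤₚ.<-≤-trans l (bound t (here refl)))
                    x , y = left a l in
      trans (cong₂ (λ u v → u ℤ.+ (ℤ.- J) ℤ.* v) x r) (trans (ℤₚ.+-identityˡ _) (ℤₚ.*-zeroʳ (ℤ.- J))) ,
      trans (cong₂ (λ u v → u ℤ.+ (ℤ.- J) ℤ.* v) y l′) (trans (ℤₚ.+-identityˡ _) (ℤₚ.*-zeroʳ (ℤ.- J)))
    exact′ : Exact (line R′ L′)
    exact′ = line-exact p₀ VL R′ L′ nj′ (λ u i → bound u (there i)) left′
    split : ∀ c k → line R L c k ≡ line R′ L′ c k ℤ.+ J ℤ.* ray t c k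
    split c d0 = sym (trans (ℤₚ.+-identityˡ _) (ℤₚ.*-zeroʳ J))
    split c d1 = solve 3 (λ l j x → :- l := (:- (l :+ (:- j) :* x)) :+ j :* (:- x)) refl (L c) J (rayL t c)
    split c d2 = solve 3 (λ l j x → l := (l :+ (:- j) :* x) :+ j :* x) refl (R (fw true d2 c)) J (rayR t (fw true d2 c))
    add : Exact (ray t) → Exact (line R L)
    add ex = exact-cong {line R L} (λ c k _ _ → split c k) (exact-combine {line R′ L′} {ray t} J exact′ ex)
    restore : Place t → Exact (line R L)
    restore (on-cycle i) = add (ray-cycle t i)
    restore (exterior x) = add (ray-exact t (λ i → absurd t i x))
      where
      absurd : ∀ t → Interior t → Exterior t → ⊥
      absurd (W a) i x = true≢false (i a (w₀ a)) (x a (w₀ a))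
      absurd (B a) i x = true≢false (i a (b₀ a)) (x a (b₀ a))
    restore (interior i) = exact-cong {line R L} {line R′ L′} (λ c k _ _ → trans (split c k)
      (trans (cong (λ z → line R′ L′ c k ℤ.+ z ℤ.* ray t c k) (nj t (inj₂ i))) (ℤₚ.+-identityʳ (line R′ L′ c k)))) exact′

-- A signed sum of `f` from the origin; subtracting its gradient removes the increments along u₀.
antiderivative : (ℤ → ℤ) → ℤ → ℤ
antiderivative f (+ zero)       = + 0
antiderivative f (+ suc n)      = antiderivative f (+ n) ℤ.- f (+ suc n)
antiderivative f -[1+ zero ]    = f (+ 0)
antiderivative f -[1+ suc n ]   = antiderivative f -[1+ n ] ℤ.+ f -[1+ n ]

antiderivative-pred : ∀ f p → antiderivative f (ℤ.pred p) ≡ antiderivative f p ℤ.+ f p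
antiderivative-pred f (+ zero)    = sym (ℤₚ.+-identityˡ (f (+ 0)))
antiderivative-pred f (+ suc n)   = solve 2 (λ a b → a := (a :- b) :+ b) refl (antiderivative f (+ n)) (f (+ suc n))
antiderivative-pred f -[1+ n ]    = refl

module Heights {D : List Vtx} (cyc : Cycle D) {Hc : Region} {μ : Edges} (pm : IsMatching Hc μ)
  (Hl : List Cell) (fin : ∀ c → Hc c ≡ true → c ∈ Hl) (X⊆H : ∀ c → inside D c ≡ true → Hc c ≡ true) where

  open Inside cyc

  step : Cochain
  step c k = if μ c k then -[1+ 1 ] else + 1

  private
    sum3 : ∀ {a b c} → One a b c → (if a then -[1+ 1 ] else + 1) ℤ.+ (if b then -[1+ 1 ] else + 1) ℤ.+ (if c then -[1+ 1 ] else + 1) ≡ + 0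
    sum3 one₁ = refl
    sum3 one₂ = refl
    sum3 one₃ = refl

    G : Cell → ℤ
    G (p , q) = antiderivative (λ z → step (z , q) d0) p

    G-left : ∀ c → G (fw true d0 c) ≡ G c ℤ.+ step c d0
    G-left (p , q) = antiderivative-pred (λ z → step (z , q) d0) p

    κ : Cochain
    κ c k = step c k ℤ.- gradient G c k

    -- After subtracting the gradient of `G` only horizontal edges carry a value. Keeping it only on
    -- edges with both sides in `X` makes the support finite and leaves jumps only at vertices which
    -- are not interior.
    R L : Cell → ℤ
    R a = if X a ∧ X (fw false d2 a) then κ (fw false d2 a) d2 else + 0
    L a = if X a ∧ X (fw true d1 a) then ℤ.- κ a d1 else + 0

    VL : List Vtx
    VL = concatMap (λ c → W c ∷ B c ∷ W (fw false d0 c) ∷ []) Hl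

    in-VL : ∀ c t → X c ≡ true → t ∈ (W c ∷ B c ∷ W (fw false d0 c) ∷ []) → t ∈ VL
    in-VL c t x i = ∈-concat⁺′ i (∈-map⁺ (λ c → W c ∷ B c ∷ W (fw false d0 c) ∷ []) (fin c (X⊆H c x)))

    R-zero : ∀ a → X a ≡ false → R a ≡ + 0
    R-zero a e = cong (λ b → if b ∧ X (fw false d2 a) then κ (fw false d2 a) d2 else + 0) e

    L-zero : ∀ a → X a ≡ false → L a ≡ + 0
    L-zero a e = cong (λ b → if b ∧ X (fw true d1 a) then ℤ.- κ a d1 else + 0) e

    R-in : ∀ a → X a ≡ true → X (fw false d2 a) ≡ true → R a ≡ κ (fw false d2 a) d2
    R-in a e e′ = cong (if_then κ (fw false d2 a) d2 else + 0) (∧-true e e′)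

    L-in : ∀ a → X a ≡ true → X (fw true d1 a) ≡ true → L a ≡ ℤ.- κ a d1
    L-in a e e′ = cong (if_then ℤ.- κ a d1 else + 0) (∧-true e e′)

    flat : ∀ t → t ∉ VL ⊎ Interior t → jump R L t ≡ + 0
    flat (W a) (inj₁ n) = cong₂ ℤ._-_ (R-zero a (≢true λ x → n (in-VL a (W a) x (here refl))))
      (L-zero (fw true d0 a) (≢true λ x → n (in-VL (fw true d0 a) (W a) x (there (there (here (cong W (sym (fw-d0-inv a)))))))))
    flat (B a) (inj₁ n) = cong₂ ℤ._-_ (L-zero a nx) (R-zero a nx)
      where nx = ≢true λ x → n (in-VL a (B a) x (there (here refl)))
    flat (W a) (inj₂ i) = trans (cong₂ ℤ._-_ (R-in a (i _ (w₀ a)) (i _ (w₂ a))) (L-in x (i _ (w₁ a)) (i _ (w₂ a))))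
      (trans (cong₂ (λ u v → step y d2 ℤ.- (u ℤ.- G y) ℤ.- (ℤ.- (step x d1 ℤ.- (G y ℤ.- v)))) (cong G (fw-inv true d2 a)) (G-left a))
      (trans (solve 5 (λ s₀ s₁ s₂ ga gy → (s₂ :- (ga :- gy)) :- (:- (s₁ :- (gy :- (ga :+ s₀)))) := (s₀ :+ s₁) :+ s₂) refl
        (step a d0) (step x d1) (step y d2) (G a) (G y))
        (sum3 (IsMatching.white pm a (inj₁ (X⊆H a (i _ (w₀ a))))))))
      where x = fw true d0 a
            y = fw false d2 a
    flat (B a) (inj₂ i) = trans (cong₂ ℤ._-_ (L-in a (i _ (b₀ a)) (i _ (b₁ a))) (R-in a (i _ (b₀ a)) (i _ (b₂ a))))
      (trans (cong₂ (λ u v → ℤ.- (step a d1 ℤ.- (G x ℤ.- G a)) ℤ.- (step y d2 ℤ.- (u ℤ.- v))) (cong G (fw-inv true d2 a)) (G-left x))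
      (trans (solve 5 (λ s₀ s₁ s₂ ga gx → (:- (s₁ :- (gx :- ga))) :- (s₂ :- (ga :- (gx :+ s₀))) := :- ((s₁ :+ s₀) :+ s₂)) refl
        (step x d0) (step a d1) (step y d2) (G a) (G x))
        (cong ℤ.-_ (sum3 (IsMatching.black pm a (inj₁ (X⊆H a (i _ (b₀ a)))))))))
      where x = fw true d1 a
            y = fw false d2 a

    p₀ : ℤ
    p₀ = proj₁ (lowerBound (λ t → proj₁ (vcell t)) VL)

    bound : ∀ t → t ∈ VL → p₀ ℤ.≤ proj₁ (vcell t)
    bound = proj₂ (lowerBound (λ t → proj₁ (vcell t)) VL)

    left : ∀ a → proj₁ a ℤ.< p₀ → R a ≡ + 0 × L a ≡ + 0
    left a l = R-zero a nx , L-zero a nx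
      where nx = ≢true λ x → ℤₚ.<⇒≱ l (bound (W a) (in-VL a (W a) x (here refl)))

  step-exact : Exact step
  step-exact = exact-gradient {step} {line R L} G split (line-exact p₀ VL R L flat bound left)
    where
    split : ∀ c k → X c ≡ true → X (fw true k c) ≡ true → step c k ≡ line R L c k ℤ.+ gradient G c k
    split c d0 x y = sym (trans (ℤₚ.+-identityˡ _) (trans (cong (ℤ._- G c) (G-left c))
      (solve 2 (λ g s → (g :+ s) :- g := s) refl (G c) (step c d0))))
    split c d1 x y = trans (solve 2 (λ s g → s := (:- (:- (s :- g))) :+ g) refl (step c d1) (gradient G c d1))
      (cong (λ z → ℤ.- z ℤ.+ gradient G c d1) (sym (L-in c x y)))
    split c d2 x y = trans (solve 2 (λ s g → s := (s :- g) :+ g) refl (step c d2) (gradient G c d2))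
      (cong (ℤ._+ gradient G c d2) (sym (trans (R-in (fw true d2 c) y (trans (cong X (fw-inv′ true d2 c)) x)) (cong (λ z → κ z d2) (fw-inv′ true d2 c)))))

  open DecMembership _≟ᶜ_ using (_∈?_)

  private
    Reached : List Cell → Cell → Set
    Reached xs c = ∃[ x ] (x ∈ xs × Walk x c)

    Valid : List Cell → (Cell → ℤ) → Set
    Valid xs g = ∀ c k → Reached xs c → X c ≡ true → X (fw true k c) ≡ true → g (fw true k c) ≡ g c ℤ.+ step c k

    -- Heights are totals of walks from a base cell. Instead of one base for a region known to be
    -- connected, the listed cells are taken as bases one by one, each new one fixing the heights of
    -- the cells it reaches unless an earlier base reaches it.
    potential : ∀ xs → ¬ ¬ (∃[ g ] Valid xs g)
    potential [] k = k ((λ _ → + 0) , λ { c k (_ , () , _) })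
    potential (x ∷ xs) k = potential xs λ { (g , ok) → ¬¬-excluded-middle {A = Reached xs x} λ
      { (yes (y , i , via)) → k (g , λ c k r → ok c k (reroute y i via r))
      ; (no _) → ¬¬-decide (Walk x) Hl λ dec → k (new g ok dec , valid g ok dec) } }
      where
      append : ∀ {u v c} → Walk u v → Walk v c → Walk u c
      append w nil = w
      append w (snoc w′ s k a b) = snoc (append w w′) s k a b
      reroute : ∀ {c} y → y ∈ xs → Walk y x → Reached (x ∷ xs) c → Reached xs c
      reroute y i via (_ , here refl , w) = y , i , append via w
      reroute y i via (z , there j , w) = z , j , w
      module _ (g : Cell → ℤ) (ok : Valid xs g) (dec : ∀ c → c ∈ Hl → Dec (Walk x c)) where
        new : Cell → ℤ
        new c with c ∈? Hl
        ... | no _ = + 0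
        ... | yes i with dec c i
        ... | yes w = total step w
        ... | no _  = g c
        new-yes : ∀ c → X c ≡ true → (w : Walk x c) → new c ≡ total step w
        new-yes c xc w with c ∈? Hl
        ... | no n = ⊥-elim (n (fin c (X⊆H c xc)))
        ... | yes i with dec c i
        ... | yes w′ = step-exact w′ w
        ... | no n   = ⊥-elim (n w)
        new-no : ∀ c → X c ≡ true → ¬ Walk x c → new c ≡ g c
        new-no c xc nw with c ∈? Hl
        ... | no n = ⊥-elim (n (fin c (X⊆H c xc)))
        ... | yes i with dec c i
        ... | yes w′ = ⊥-elim (nw w′)
        ... | no n   = refl
        valid : Valid (x ∷ xs) new
        valid c k r xc xd with dec c (fin c (X⊆H c xc))
        ... | yes w = trans (new-yes _ xd (snoc w true k xc xd)) (cong (ℤ._+ step c k) (sym (new-yes c xc w)))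
        ... | no n = trans (new-no _ xd back) (trans (ok c k (old r) xc xd) (cong (ℤ._+ step c k) (sym (new-no c xc n))))
          where
          back : ¬ Walk x (fw true k c)
          back w = n (subst (Walk x) (fw-inv′ true k c) (snoc w false k xd (trans (cong X (fw-inv′ true k c)) xc)))
          old : Reached (x ∷ xs) c → Reached xs c
          old (_ , here refl , w) = ⊥-elim (n w)
          old (y , there i , w) = y , i , w

  height : ¬ ¬ (∃[ g ] (∀ c k → X c ≡ true → X (fw true k c) ≡ true →
    g (fw true k c) ≡ (if μ c k then ℤ.pred (ℤ.pred (g c)) else ℤ.suc (g c))))
  height k = potential Hl λ { (g , ok) → k (g , λ c j xc xd → trans (ok c j (c , fin c (X⊆H c xc) , nil) xc xd) (form (g c) (μ c j))) }
    where
    form : ∀ z b → z ℤ.+ (if b then -[1+ 1 ] else + 1) ≡ (if b then ℤ.pred (ℤ.pred z) else ℤ.suc z)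
    form z true  = solve 1 (λ z → z :+ con -[1+ 1 ] := con -[1+ 0 ] :+ (con -[1+ 0 ] :+ z)) refl z
    form z false = ℤₚ.+-comm z (+ 1)

-- Finiteness of an interior, and interiors contained in the system

i≤∣i∣ : ∀ i → i ℤ.≤ + ℤ.∣ i ∣
i≤∣i∣ (+ n)      = ℤₚ.≤-refl
i≤∣i∣ (-[1+ n ]) = ℤ.-≤+

upperBound : ∀ {A : Set} (g : A → ℤ) (xs : List A) → ∃[ m ] (∀ x → x ∈ xs → g x ℤ.≤ m)
upperBound g xs with lowerBound (ℤ.-_ ∘ g) xs
... | m , h = ℤ.- m , λ x i → ℤₚ.≤-trans (ℤₚ.≤-reflexive (sym (ℤₚ.neg-involutive (g x)))) (ℤₚ.neg-mono-≤ (h x i))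

module Listing {D : List Vtx} (cyc : Cycle D) where

  open Inside cyc

  private
    m = proj₁ (lowerBound (λ t → proj₁ (vcell t)) D)
    r = proj₁ (lowerBound (λ t → proj₂ (vcell t)) D)

    m≤ : ∀ t → t ∈ D → m ℤ.≤ proj₁ (vcell t)
    m≤ = proj₂ (lowerBound (λ t → proj₁ (vcell t)) D)

    r≤ : ∀ t → t ∈ D → r ℤ.≤ proj₂ (vcell t)
    r≤ = proj₂ (lowerBound (λ t → proj₂ (vcell t)) D)

    -- Left of all vertices of the cycle, no edge of it is met when going down along -u₂.
    off-left : ∀ n c → proj₁ c ℤ.< m → proj₂ c ℤ.< r ℤ.+ + n → X c ≡ false
    off-left zero c l l′ = ≢true λ x → let d , i , e , _ = inside-right c x in
      ℤₚ.<⇒≱ l′ (ℤₚ.≤-trans (ℤₚ.≤-reflexive (ℤₚ.+-identityʳ r)) (ℤₚ.≤-trans (r≤ (W d) i) (ℤₚ.≤-reflexive e)))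
    off-left (suc n) c@(p , q) l l′ = ≢true λ x → let c′ = fw false d2 c in
      true≢false (decidable-stable (X c′ Boolₚ.≟ true) λ nx → ℤₚ.<⇒≱ l (m≤ (W c)
          (link-on (subst (λ z → Link (W z) (B z) c′ d2) (fw-inv true d2 c) (wb c′ d2))
            λ e → nx (trans e (trans (cong X (fw-inv true d2 c)) x)))))
        (off-left n c′ (ℤₚ.≤-<-trans (ℤₚ.≤-trans (ℤₚ.i≤suc[i] (ℤ.pred p)) (ℤₚ.≤-reflexive (ℤₚ.suc-pred p))) l)
          (ℤₚ.<-≤-trans (ℤₚ.+-monoʳ-< -[1+ 0 ] l′) (ℤₚ.≤-reflexive
            (solve 2 (λ p n → con -[1+ 0 ] :+ (p :+ (con (+ 1) :+ n)) := p :+ n) refl r (+ n)))))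

  m≤inside : ∀ c → X c ≡ true → m ℤ.≤ proj₁ c
  m≤inside c x = ℤₚ.≮⇒≥ λ l → true≢false x (off-left (suc ℤ.∣ proj₂ c ℤ.- r ∣) c l
    (ℤₚ.≤-<-trans (ℤₚ.≤-reflexive (solve 2 (λ q r → q := r :+ (q :- r)) refl (proj₂ c) r))
      (ℤₚ.+-monoʳ-< r (ℤₚ.≤-<-trans (i≤∣i∣ (proj₂ c ℤ.- r)) (ℤ.+<+ ℕₚ.≤-refl)))))

  row : Vtx → List Cell
  row t = applyUpTo (λ i → m ℤ.+ + i , proj₂ (vcell t)) ℤ.∣ proj₁ (vcell t) ℤ.- m ∣

  cells : List Cell
  cells = concatMap row D

  inside⇒listed : ∀ c → X c ≡ true → c ∈ cells
  inside⇒listed c@(p , q) x with inside-right c x | m≤inside c x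
  ... | d , i , refl , l | le = ∈-concat⁺′ (subst (_∈ row (W d)) (cong (_, q) p≡) (∈-applyUpTo⁺ _ lt′)) (∈-map⁺ row i)
    where
    n≡ : + ℤ.∣ p ℤ.- m ∣ ≡ p ℤ.- m
    n≡ = ℤₚ.0≤i⇒+∣i∣≡i (ℤₚ.i≤j⇒0≤j-i le)
    p≡ : m ℤ.+ + ℤ.∣ p ℤ.- m ∣ ≡ p
    p≡ = trans (cong (λ z → m ℤ.+ z) n≡) (solve 2 (λ m p → m :+ (p :- m) := p) refl m p)
    lt′ : ℤ.∣ p ℤ.- m ∣ < ℤ.∣ proj₁ d ℤ.- m ∣
    lt′ = ℤₚ.drop‿+<+ (subst₂ ℤ._<_ (sym n≡) (sym (ℤₚ.0≤i⇒+∣i∣≡i (ℤₚ.i≤j⇒0≤j-i (ℤₚ.≤-trans le (ℤₚ.<⇒≤ l))))) (ℤₚ.+-monoˡ-< (ℤ.- m) l))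

successor : ∀ {A : Set} {x : A} {xs} → x ∈ xs → ∃[ y ] ((x , y) ∈ cycPairs xs)
successor {A} {x} {a ∷ as} i = first (a ∷ as) (as ++ [ a ]) i (ℕₚ.≤-reflexive (sym (trans (length-++ as) (ℕₚ.+-comm (length as) 1))))
  where
  first : (xs ys : List A) → x ∈ xs → length xs ≤ length ys → ∃[ y ] ((x , y) ∈ zip xs ys)
  first (z ∷ xs) (y ∷ ys) (here refl) _ = y , here refl
  first (z ∷ xs) (y ∷ ys) (there i) (s≤s le) = let t , j = first xs ys i le in t , there j

around-adjacent : ∀ {t c e} → Around t c → Around t e → c ≡ e ⊎ (∃[ s ] ∃[ k ] e ≡ fw s k c)
around-adjacent (w₀ a) (w₀ _) = inj₁ refl
around-adjacent (w₀ a) (w₁ _) = inj₂ (true , d0 , refl)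
around-adjacent (w₀ a) (w₂ _) = inj₂ (false , d2 , refl)
around-adjacent (w₁ a) (w₀ _) = inj₂ (false , d0 , sym (fw-inv false d0 a))
around-adjacent (w₁ a) (w₁ _) = inj₁ refl
around-adjacent (w₁ a) (w₂ _) = inj₂ (true , d1 , refl)
around-adjacent (w₂ a) (w₀ _) = inj₂ (true , d2 , sym (fw-inv true d2 a))
around-adjacent (w₂ a) (w₁ _) = inj₂ (false , d1 , sym (fw-inv false d1 (fw true d0 a)))
around-adjacent (w₂ a) (w₂ _) = inj₁ refl
around-adjacent (b₀ a) (b₀ _) = inj₁ refl
around-adjacent (b₀ a) (b₁ _) = inj₂ (true , d1 , refl)
around-adjacent (b₀ a) (b₂ _) = inj₂ (false , d2 , refl)
around-adjacent (b₁ a) (b₀ _) = inj₂ (false , d1 , sym (fw-inv false d1 a))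
around-adjacent (b₁ a) (b₁ _) = inj₁ refl
around-adjacent (b₁ a) (b₂ _) = inj₂ (true , d0 , refl)
around-adjacent (b₂ a) (b₀ _) = inj₂ (true , d2 , sym (fw-inv true d2 a))
around-adjacent (b₂ a) (b₁ _) = inj₂ (false , d0 , sym (fw-inv false d0 (fw true d1 a)))
around-adjacent (b₂ a) (b₂ _) = inj₁ refl

around-near : ∀ {t c} → Around t c → ℤ.pred (proj₁ (vcell t)) ℤ.≤ proj₁ c
around-near (w₀ a) = ℤₚ.i≤j⇒pred[i]≤j ℤₚ.≤-refl
around-near (w₁ a) = ℤₚ.≤-refl
around-near (w₂ a) = ℤₚ.≤-refl
around-near (b₀ a) = ℤₚ.i≤j⇒pred[i]≤j ℤₚ.≤-refl
around-near (b₁ a) = ℤₚ.i≤j⇒pred[i]≤j ℤₚ.≤-refl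
around-near (b₂ a) = ℤₚ.≤-refl
module Subsystem {B₀ D : List Vtx} (cycB : Cycle B₀) (cycD : Cycle D)
  (edges : ∀ c k → onEdge D c k ≡ true → inside B₀ c ≡ true ⊎ inside B₀ (fw true k c) ≡ true) where

  private
    module IB = Inside cycB
    module ID = Inside cycD
    H = inside B₀
    I = inside D

    M = proj₁ (upperBound (proj₁ ∘ vcell) B₀)

    ≤M : ∀ u → u ∈ B₀ → proj₁ (vcell u) ℤ.≤ M
    ≤M = proj₂ (upperBound (proj₁ ∘ vcell) B₀)

    H-below : ∀ c → H c ≡ true → ∀ N → (∀ u → u ∈ B₀ → proj₁ (vcell u) ℤ.≤ N) → proj₁ c ℤ.< N
    H-below c h N b = let d , i , _ , l = IB.inside-right c h in ℤₚ.<-≤-trans l (b (W d) i)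

    same : ∀ s k c → H c ≡ false → H (fw s k c) ≡ false → I (fw s k c) ≡ I c
    same true k c h h′ = decidable-stable (_ Boolₚ.≟ _) λ ne →
      [ (λ x → true≢false x h) , (λ x → true≢false x h′) ]′ (edges c k (ID.sep⇒on c k (ne ∘ sym)))
    same false k c h h′ = sym (trans (cong I (sym (fw-inv true k c)))
      (same true k (fw false k c) h′ (trans (cong H (fw-inv true k c)) h)))

    Out : Vtx → Set
    Out t = ∀ c → Around t c → H c ≡ false → I c ≡ false

    pass : ∀ {t t′ c k} → Link t t′ c k → onEdge B₀ c k ≡ true → Out t → Out t′
    pass {t} {t′} {c} {k} l on out e ar he with bool-cases (H c)
    ... | inj₂ hc = via c (link-tail l) (link-tail (link-sym l)) hc
      where
      via : ∀ d → Around t d → Around t′ d → H d ≡ false → I e ≡ false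
      via d a a′ hd with around-adjacent a′ ar
      ... | inj₁ refl = out d a hd
      ... | inj₂ (s , j , refl) = trans (same s j d hd he) (out d a hd)
    ... | inj₁ hc = via (fw true k c) (link-head l) (link-head (link-sym l)) (≢true λ h → IB.on⇒sep c k on (trans hc (sym h)))
      where
      via : ∀ d → Around t d → Around t′ d → H d ≡ false → I e ≡ false
      via d a a′ hd with around-adjacent a′ ar
      ... | inj₁ refl = out d a hd
      ... | inj₂ (s , j , refl) = trans (same s j d hd he) (out d a hd)

    white-on-D : ∀ d → W d ∈ D → ∃[ c ] (Around (W d) c × H c ≡ true)
    white-on-D d i = go (successor i)
      where
      go : ∃[ t ] ((W d , t) ∈ cycPairs D) → ∃[ c ] (Around (W d) c × H c ≡ true)
      go (t , j) with All.lookup (Cycle.links cycD) j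
      ... | c , k , l with edges c k (link-onEdge cycD j l)
      ... | inj₁ h = c , link-tail l , h
      ... | inj₂ h = _ , link-head l , h

    D-below : ∀ d → W d ∈ D → ∀ N → (∀ u → u ∈ B₀ → proj₁ (vcell u) ℤ.≤ N) → proj₁ d ℤ.≤ N
    D-below d i N b = let c , ar , h = white-on-D d i in
      ℤₚ.≤-trans (ℤₚ.≤-reflexive (sym (ℤₚ.suc-pred (proj₁ d)))) (ℤₚ.≤-trans (ℤₚ.+-monoʳ-≤ (+ 1) (around-near ar)) (ℤₚ.i<j⇒suc[i]≤j (H-below c h N b)))

    beyond : ∀ N → (∀ u → u ∈ B₀ → proj₁ (vcell u) ℤ.≤ N) → ∀ c → N ℤ.≤ proj₁ c → I c ≡ false
    beyond N b c le = ≢true λ x → let d , i , _ , l = ID.inside-right c x in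
      ℤₚ.<⇒≱ l (ℤₚ.≤-trans (D-below d i N b) le)

    top : ∀ t → t ∈ B₀ → (∀ u → u ∈ B₀ → proj₁ (vcell u) ℤ.≤ proj₁ (vcell t)) → Out t
    top t _ mx c ar hc = trans (sym (same false d0 c hc hc′)) (beyond N mx c′ le)
      where
      N = proj₁ (vcell t)
      c′ = fw false d0 c
      le : N ℤ.≤ proj₁ c′
      le = ℤₚ.≤-trans (ℤₚ.≤-reflexive (sym (ℤₚ.suc-pred N))) (ℤₚ.+-monoʳ-≤ (+ 1) (around-near ar))
      hc′ : H c′ ≡ false
      hc′ = ≢true λ h → ℤₚ.<⇒≱ (H-below c′ h N mx) le

    out-cycle : ∀ t → t ∈ B₀ → Out t
    out-cycle = IB.spread-cycle {Out} pass top

    outside : ∀ n c → M ℤ.≤ proj₁ c ℤ.+ + n → H c ≡ false → I c ≡ false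
    outside zero c le h = beyond M ≤M c (ℤₚ.≤-trans le (ℤₚ.≤-reflexive (ℤₚ.+-identityʳ (proj₁ c))))
    outside (suc n) c le h with bool-cases (H (fw false d0 c))
    ... | inj₂ h′ = trans (sym (same false d0 c h h′)) (outside n (fw false d0 c) (ℤₚ.≤-trans le (ℤₚ.≤-reflexive
          (solve 2 (λ p n → p :+ (con (+ 1) :+ n) := (con (+ 1) :+ p) :+ n) refl (proj₁ c) (+ n)))) h′)
    ... | inj₁ h′ = out-cycle (W c′) (IB.link-on (wb c′ d0) λ e → true≢false (trans (sym e) h′) (trans (cong H (fw-inv true d0 c)) h))
            c (subst (Around (W c′)) (fw-inv true d0 c) (w₁ c′)) h
      where c′ = fw false d0 c

  -- No edge of `D` separates two cells outside the system, so membership in the interior of `D`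
  -- does not change there. Moving right from such a cell ends either beyond all vertices of the
  -- boundary or at the boundary, around which `Out` carries the value from a rightmost vertex.
  inside⊆ : ∀ c → I c ≡ true → H c ≡ true
  inside⊆ c x = ≢false λ h → true≢false x (outside ℤ.∣ M ℤ.- proj₁ c ∣ c
    (ℤₚ.≤-trans (ℤₚ.≤-reflexive (solve 2 (λ m p → m := p :+ (m :- p)) refl M (proj₁ c))) (ℤₚ.+-monoʳ-≤ (proj₁ c) (i≤∣i∣ _))) h)

-- Matchings of a hexagonal system

Edge : Set
Edge = Cell × Dir

map² : ∀ {A C : Set} → (A → C) → A × A → C × C
map² f (x , y) = f x , f y

zip-map : ∀ {A C : Set} (f : A → C) xs ys → zip (map f xs) (map f ys) ≡ map (map² f) (zip xs ys)
zip-map f []       ys       = refl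
zip-map f (x ∷ xs) []       = refl
zip-map f (x ∷ xs) (y ∷ ys) = cong (_ ∷_) (zip-map f xs ys)

cycPairs-map : ∀ {A C : Set} (f : A → C) xs → cycPairs (map f xs) ≡ map (map² f) (cycPairs xs)
cycPairs-map f []       = refl
cycPairs-map f (x ∷ xs) = trans (cong (zip (f x ∷ map f xs)) (sym (map-++ f xs [ x ]))) (zip-map f (x ∷ xs) (xs ++ [ x ]))

countT-map : ∀ {A C : Set} (f : A → C) g xs → countT g (map f xs) ≡ countT (g ∘ f) xs
countT-map f g []       = refl
countT-map f g (x ∷ xs) with g (f x)
... | true  = cong suc (countT-map f g xs)
... | false = countT-map f g xs

toCycle : ∀ {E : V → V → Set} {C} → (∀ u v → E u v → LatEdge u v) → IsCycleIn E C → ∃[ D ] (C ≡ map pos D × Cycle D)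
toCycle {E} {C} lat (long , uniq , edges) = map decode C , C≡ , record
  { long   = subst (3 ≤_) (sym (length-map decode C)) long
  ; unique = AllPairs.map (λ ne e → ne (cong pos e)) (AllPairsₚ.map⁻ (subst Unique C≡ uniq))
  ; links  = All.tabulate λ { {t , t′} i → link (lat _ _ (All.lookup edges
      (subst ((pos t , pos t′) ∈_) (sym (trans (cong cycPairs C≡) (cycPairs-map pos (map decode C)))) (∈-map⁺ (map² pos) i)))) } }
  where
  at : ∀ {v} → v ∈ C → pos (decode v) ≡ v
  at {v} i with successor i
  ... | u , j with lat _ _ (All.lookup edges j)
  ... | c , ce with CellEdge⇒linked {c} ce
  ... | linked {t} l e₁ e₂ s = trans (cong (pos ∘ decode) e₁) (trans (cong pos (decode-pos t)) (sym e₁))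
  C≡ : C ≡ map pos (map decode C)
  C≡ = sym (trans (sym (map-∘ C)) (map-id-local (All.tabulate at)))
  link : ∀ {t t′} → LatEdge (pos t) (pos t′) → Linked₂ (t , t′)
  link (c , ce) with CellEdge⇒linked {c} ce
  ... | linked {cell = d} {dir = k} l e₁ e₂ s with pos-injective e₁ | pos-injective e₂
  ... | refl | refl = d , k , l

module _ {D : List Vtx} where

  private
    count-parity : ∀ c → not (even? (countT (crosses (origin c)) (cycEdges (map pos D)))) ≡ inside D c
    count-parity c = trans (cong (λ n → not (even? n)) (trans (cong (countT (crosses (origin c))) (cycPairs-map pos D))
      (countT-map (map² pos) (crosses (origin c)) (cycPairs D)))) (countT-parity (cr c) (cycPairs D))

  Inside⇒ : ∀ {c} → Inside (map pos D) c → inside D c ≡ true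
  Inside⇒ {c} h = trans (sym (count-parity c)) (1⇒odd (countT (crosses (origin c)) (cycEdges (map pos D))) h)

  ⇒Inside : ∀ {c} → inside D c ≡ true → Inside (map pos D) c
  ⇒Inside {c} h = odd⇒1 (countT (crosses (origin c)) (cycEdges (map pos D))) (trans (count-parity c) h)

  pairs⁻ : ∀ {t t′} → (pos t , pos t′) ∈ cycEdges (map pos D) → (t , t′) ∈ cycPairs D
  pairs⁻ i with ∈-map⁻ (map² pos) (subst (_ ∈_) (cycPairs-map pos D) i)
  ... | (u , u′) , j , e with pos-injective (cong proj₁ e) | pos-injective (cong proj₂ e)
  ... | refl | refl = j

  pairs⁺ : ∀ {t t′} → (t , t′) ∈ cycPairs D → (pos t , pos t′) ∈ cycEdges (map pos D)
  pairs⁺ i = subst (_ ∈_) (sym (cycPairs-map pos D)) (∈-map⁺ (map² pos) i)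

  OnCycle⇒ : Cycle D → ∀ {t t′ c k} → Link t t′ c k → OnCycle (map pos D) (pos t) (pos t′) → onEdge D c k ≡ true
  OnCycle⇒ cyc l (inj₁ i) = link-onEdge cyc (pairs⁻ i) l
  OnCycle⇒ cyc l (inj₂ i) = link-onEdge cyc (pairs⁻ i) (link-sym l)

  ⇒OnCycle : ∀ {t t′ c k} → Link t t′ c k → onEdge D c k ≡ true → OnCycle (map pos D) (pos t) (pos t′)
  ⇒OnCycle {t} {t′} {c} {k} l h with onEdge-link {D} {c} {k} h
  ... | u , u′ , i , l′ = go l l′ i
    where
    go : ∀ {t t′ u u′} → Link t t′ c k → Link u u′ c k → (u , u′) ∈ cycPairs D → OnCycle (map pos D) (pos t) (pos t′)
    go (wb _ _) (wb _ _) i = inj₁ (pairs⁺ i)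
    go (wb _ _) (bw _ _) i = inj₂ (pairs⁺ i)
    go (bw _ _) (wb _ _) i = inj₂ (pairs⁺ i)
    go (bw _ _) (bw _ _) i = inj₁ (pairs⁺ i)

link-unique : ∀ {t t′ c k d j} → Link t t′ c k → Link t t′ d j → (c , k) ≡ (d , j)
link-unique {c = c} {k} {d} {j} l l′ = go l l′ refl refl
  where
  go : ∀ {t t′ u u′ c k d j} → Link t t′ c k → Link u u′ d j → t ≡ u → t′ ≡ u′ → (c , k) ≡ (d , j)
  go (wb c k) (wb d j) e f with ends-injective c k d j (W-injective e) (B-injective f)
  ... | refl , refl = refl
  go (bw c k) (bw d j) e f with ends-injective c k d j (W-injective f) (B-injective e)
  ... | refl , refl = refl

link-end : ∀ {t t′ t″ c k} → Link t t′ c k → Link t t″ c k → t′ ≡ t″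
link-end l l′ = go l l′ refl
  where
  go : ∀ {t u t′ t″ c k} → Link t t′ c k → Link u t″ c k → t ≡ u → t′ ≡ t″
  go (wb _ _) (wb _ _) e = refl
  go (bw _ _) (bw _ _) e = refl

-- The three edges at a vertex; the i-th leads from the i-th to the next of the cells around it.
star₀ star₁ star₂ : Vtx → Edge
star₀ (W a) = a , d0
star₀ (B a) = a , d1
star₁ (W a) = fw true d0 a , d1
star₁ (B a) = fw true d1 a , d0
star₂ (W a) = fw false d2 a , d2
star₂ (B a) = fw false d2 a , d2

in-star : ∀ {t t′ c k} → Link t t′ c k → (c , k) ≡ star₀ t ⊎ (c , k) ≡ star₁ t ⊎ (c , k) ≡ star₂ t
in-star (wb c k) = white-edge c k refl
in-star (bw c k) = black-edge c k refl

Linkᵉ : Vtx → Vtx → Edge → Set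
Linkᵉ t t′ e = Link t t′ (proj₁ e) (proj₂ e)

star-links : ∀ t → (∃[ t′ ] Linkᵉ t t′ (star₀ t)) × (∃[ t′ ] Linkᵉ t t′ (star₁ t)) × (∃[ t′ ] Linkᵉ t t′ (star₂ t))
star-links (W a) = white-links a
star-links (B a) = black-links a

_$ᵉ_ : Edges → Edge → Bool
μ $ᵉ e = μ (proj₁ e) (proj₂ e)

Star : Edges → Vtx → Set
Star μ t = One (μ $ᵉ star₀ t) (μ $ᵉ star₁ t) (μ $ᵉ star₂ t)

matched : ∀ {Hc μ} → IsMatching Hc μ → ∀ {t c} → Around t c → Hc c ≡ true → Star μ t
matched pm (w₀ a) h = IsMatching.white pm a (inj₁ h)
matched pm (w₁ a) h = IsMatching.white pm a (inj₂ (inj₁ h))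
matched pm (w₂ a) h = IsMatching.white pm a (inj₂ (inj₂ h))
matched pm (b₀ a) h = IsMatching.black pm a (inj₁ h)
matched pm (b₁ a) h = IsMatching.black pm a (inj₂ (inj₁ h))
matched pm (b₂ a) h = IsMatching.black pm a (inj₂ (inj₂ h))

One-unique : ∀ {a b c} → One a b c → (a ≡ true → b ≡ true → ⊥) × (a ≡ true → c ≡ true → ⊥) × (b ≡ true → c ≡ true → ⊥)
One-unique one₁ = (λ _ ()) , (λ _ ()) , (λ ())
One-unique one₂ = (λ ()) , (λ ()) , (λ _ ())
One-unique one₃ = (λ _ ()) , (λ ()) , (λ ())

star-unique : ∀ {μ t t′ t″ e f} → Star μ t → Linkᵉ t t′ e → Linkᵉ t t″ f → μ $ᵉ e ≡ true → μ $ᵉ f ≡ true → e ≡ f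
star-unique {μ} {t} o l l′ h h′ = go (in-star l) (in-star l′) h h′
  where
  u = One-unique o
  go : ∀ {e f} → e ≡ star₀ t ⊎ e ≡ star₁ t ⊎ e ≡ star₂ t → f ≡ star₀ t ⊎ f ≡ star₁ t ⊎ f ≡ star₂ t → μ $ᵉ e ≡ true → μ $ᵉ f ≡ true → e ≡ f
  go (inj₁ refl)        (inj₁ refl)        _ _ = refl
  go (inj₁ refl)        (inj₂ (inj₁ refl)) h h′ = ⊥-elim (proj₁ u h h′)
  go (inj₁ refl)        (inj₂ (inj₂ refl)) h h′ = ⊥-elim (proj₁ (proj₂ u) h h′)
  go (inj₂ (inj₁ refl)) (inj₁ refl)        h h′ = ⊥-elim (proj₁ u h′ h)
  go (inj₂ (inj₁ refl)) (inj₂ (inj₁ refl)) _ _ = refl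
  go (inj₂ (inj₁ refl)) (inj₂ (inj₂ refl)) h h′ = ⊥-elim (proj₂ (proj₂ u) h h′)
  go (inj₂ (inj₂ refl)) (inj₁ refl)        h h′ = ⊥-elim (proj₁ (proj₂ u) h′ h)
  go (inj₂ (inj₂ refl)) (inj₂ (inj₁ refl)) h h′ = ⊥-elim (proj₂ (proj₂ u) h′ h)
  go (inj₂ (inj₂ refl)) (inj₂ (inj₂ refl)) _ _ = refl

star-exists : ∀ {μ t} → Star μ t → ∃[ t′ ] ∃[ e ] (Linkᵉ t t′ e × μ $ᵉ e ≡ true)
star-exists {μ} {t} o = pick o refl refl refl
  where
  pick : ∀ {a b c} → One a b c → a ≡ μ $ᵉ star₀ t → b ≡ μ $ᵉ star₁ t → c ≡ μ $ᵉ star₂ t → ∃[ t′ ] ∃[ e ] (Linkᵉ t t′ e × μ $ᵉ e ≡ true)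
  pick one₁ e _ _ = _ , _ , proj₂ (proj₁ (star-links t)) , sym e
  pick one₂ _ e _ = _ , _ , proj₂ (proj₁ (proj₂ (star-links t))) , sym e
  pick one₃ _ _ e = _ , _ , proj₂ (proj₂ (proj₂ (star-links t))) , sym e

Touches : Region → Edge → Set
Touches Hc (c , k) = Hc c ≡ true ⊎ Hc (fw true k c) ≡ true

touch-around : ∀ {Hc t t′ e} → Linkᵉ t t′ e → Touches Hc e → ∃[ c ] (Around t c × Hc c ≡ true)
touch-around l (inj₁ h) = _ , link-tail l , h
touch-around l (inj₂ h) = _ , link-head l , h

vEdge : Edge → V × V
vEdge (c , k) = pos (W (wEnd c k)) , pos (B (bEnd c k))

inE? : ∀ M u v → Dec (InE M u v)
inE? M u v = ((u , v) ∈? M) ⊎-dec ((v , u) ∈? M)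
  where
  open import Data.List.Membership.DecPropositional (Prodₚ.≡-dec (Prodₚ.≡-dec ℤ._≟_ ℤ._≟_) (Prodₚ.≡-dec ℤ._≟_ ℤ._≟_)) using (_∈?_)

InE-sym : ∀ {M u v} → InE M u v → InE M v u
InE-sym (inj₁ i) = inj₂ i
InE-sym (inj₂ i) = inj₁ i

edgesOf : EdgeSet → Edges
edgesOf M c k = ⌊ inE? M (pos (W (wEnd c k))) (pos (B (bEnd c k))) ⌋

edgesOf⇒ : ∀ {M t t′ c k} → Link t t′ c k → edgesOf M c k ≡ true → InE M (pos t) (pos t′)
edgesOf⇒ {M} (wb c k) h = ⌊⌋-true (inE? M _ _) h
edgesOf⇒ {M} (bw c k) h = InE-sym {M} (⌊⌋-true (inE? M _ _) h)

⇒edgesOf : ∀ {M t t′ c k} → Link t t′ c k → InE M (pos t) (pos t′) → edgesOf M c k ≡ true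
⇒edgesOf {M} (wb c k) h = true-⌊⌋ (inE? M _ _) h
⇒edgesOf {M} (bw c k) h = true-⌊⌋ (inE? M _ _) (InE-sym {M} h)

module System (H : HexSystem) (D₀ : List Vtx) (B≡ : bd H ≡ map pos D₀) (cyc₀ : Cycle D₀) where

  Hc : Region
  Hc = inside D₀

  Hl : List Cell
  Hl = Listing.cells cyc₀

  fin : ∀ c → Hc c ≡ true → c ∈ Hl
  fin = Listing.inside⇒listed cyc₀

  inH : ∀ {c} → Inside (bd H) c → Hc c ≡ true
  inH {c} h = Inside⇒ {D₀} {c} (subst (λ b → Inside b c) B≡ h)

  Hin : ∀ {c} → Hc c ≡ true → Inside (bd H) c
  Hin {c} h = subst (λ b → Inside b c) (sym B≡) (⇒Inside {D₀} {c} h)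

  HEdge⇒ : ∀ {u v} → HEdge H u v → ∃[ t ] ∃[ t′ ] ∃[ e ] (Linkᵉ t t′ e × Touches Hc e × u ≡ pos t × v ≡ pos t′)
  HEdge⇒ (c , h , ce) with CellEdge⇒linked {c} ce
  ... | linked l e₁ e₂ (inj₁ refl) = _ , _ , _ , l , inj₁ (inH {c} h) , e₁ , e₂
  ... | linked l e₁ e₂ (inj₂ refl) = _ , _ , _ , l , inj₂ (inH {c} h) , e₁ , e₂

  HEdge-link : ∀ {t t′} → HEdge H (pos t) (pos t′) → ∃[ e ] (Linkᵉ t t′ e × Touches Hc e)
  HEdge-link h with HEdge⇒ h
  ... | _ , _ , e , l , tch , p , q with pos-injective p | pos-injective q
  ... | refl | refl = e , l , tch

  ⇒HEdge : ∀ {t t′ e} → Linkᵉ t t′ e → Touches Hc e → HEdge H (pos t) (pos t′)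
  ⇒HEdge {e = c , k} l (inj₁ h) = c , Hin {c} h , link⇒CellEdge l {c} (inj₁ refl)
  ⇒HEdge {e = c , k} l (inj₂ h) = fw true k c , Hin {fw true k c} h , link⇒CellEdge l {fw true k c} (inj₂ refl)

  HEdge-sym : ∀ {u v} → HEdge H u v → HEdge H v u
  HEdge-sym (c , h , ce) = c , h , CellEdge-sym {c} ce

  HEdge⇒Lat : ∀ u v → HEdge H u v → LatEdge u v
  HEdge⇒Lat u v (c , _ , ce) = c , ce

  module _ {E : V → V → Set} (sub : ∀ {u v} → E u v → HEdge H u v) {M : EdgeSet} (pm : IsPM (HVert H) E M) where

    InE-HEdge : ∀ {u v} → InE M u v → HEdge H u v
    InE-HEdge (inj₁ i) = sub (All.lookup (proj₁ pm) i)
    InE-HEdge (inj₂ i) = HEdge-sym (sub (All.lookup (proj₁ pm) i))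

    toMatching : IsMatching Hc (edgesOf M)
    toMatching = record
      { white = λ a tch → star (W a) ([ (λ h → a , w₀ a , h) , [ (λ h → _ , w₁ a , h) , (λ h → _ , w₂ a , h) ]′ ]′ tch)
      ; black = λ a tch → star (B a) ([ (λ h → a , b₀ a , h) , [ (λ h → _ , b₁ a , h) , (λ h → _ , b₂ a , h) ]′ ]′ tch)
      ; support = supp }
      where
      μ = edgesOf M
      supp : ∀ c k → μ c k ≡ true → Hc c ≡ true ⊎ Hc (fw true k c) ≡ true
      supp c k h with HEdge-link {W (wEnd c k)} {B (bEnd c k)} (InE-HEdge (edgesOf⇒ {M} (wb c k) h))
      ... | (d , j) , l , tch with link-unique l (wb c k)
      ... | refl = tch
      star : ∀ t → (∃[ c ] (Around t c × Hc c ≡ true)) → Star μ t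
      star t (c , ar , h) with proj₁ (proj₂ pm) (pos t) (c , Hin {c} h , around⇒cellVertex ar)
      ... | u , m with HEdge⇒ (InE-HEdge m)
      ... | t₁ , t′ , e , l , tch , p , refl with pos-injective {t} {t₁} p
      ... | refl = go (in-star l) (⇒edgesOf {M} l m)
        where
        clash : ∀ {s s′ f g} → Linkᵉ t s f → Linkᵉ t s′ g → f ≢ g → μ $ᵉ f ≡ true → μ $ᵉ g ≡ false
        clash {f = f} {g} l₁ l₂ ne h₁ = ≢true λ h₂ → ne (link-unique l₁ (subst (λ z → Linkᵉ t z g)
          (sym (pos-injective (proj₂ (proj₂ pm) _ _ _ (edgesOf⇒ {M} l₁ h₁) (edgesOf⇒ {M} l₂ h₂)))) l₂))
        n01 : ∀ t → star₀ t ≢ star₁ t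
        n01 (W a) e = case cong proj₂ e of λ ()
        n01 (B a) e = case cong proj₂ e of λ ()
        n02 : ∀ t → star₀ t ≢ star₂ t
        n02 (W a) e = case cong proj₂ e of λ ()
        n02 (B a) e = case cong proj₂ e of λ ()
        n12 : ∀ t → star₁ t ≢ star₂ t
        n12 (W a) e = case cong proj₂ e of λ ()
        n12 (B a) e = case cong proj₂ e of λ ()
        L₀ = proj₂ (proj₁ (star-links t))
        L₁ = proj₂ (proj₁ (proj₂ (star-links t)))
        L₂ = proj₂ (proj₂ (proj₂ (star-links t)))
        mk₁ : ∀ {a b c} → a ≡ true → b ≡ false → c ≡ false → One a b c
        mk₁ refl refl refl = one₁
        mk₂ : ∀ {a b c} → a ≡ false → b ≡ true → c ≡ false → One a b c
        mk₂ refl refl refl = one₂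
        mk₃ : ∀ {a b c} → a ≡ false → b ≡ false → c ≡ true → One a b c
        mk₃ refl refl refl = one₃
        go : ∀ {f} → f ≡ star₀ t ⊎ f ≡ star₁ t ⊎ f ≡ star₂ t → μ $ᵉ f ≡ true → Star μ t
        go (inj₁ refl) h = mk₁ h (clash L₀ L₁ (n01 t) h) (clash L₀ L₂ (n02 t) h)
        go (inj₂ (inj₁ refl)) h = mk₂ (clash L₁ L₀ (≢-sym (n01 t)) h) h (clash L₁ L₂ (n12 t) h)
        go (inj₂ (inj₂ refl)) h = mk₃ (clash L₂ L₀ (≢-sym (n02 t)) h) (clash L₂ L₁ (≢-sym (n12 t)) h) h
  candidates : List Edge
  candidates = concatMap (λ c → (c , d0) ∷ (c , d1) ∷ (c , d2) ∷ (fw false d0 c , d0) ∷ (fw false d1 c , d1) ∷ (fw false d2 c , d2) ∷ []) Hl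

  candidate : ∀ e → Touches Hc e → e ∈ candidates
  candidate (c , k) (inj₁ h) = ∈-concat⁺′ (own k) (∈-map⁺ _ (fin c h))
    where
    own : ∀ k → (c , k) ∈ ((c , d0) ∷ (c , d1) ∷ (c , d2) ∷ (fw false d0 c , d0) ∷ (fw false d1 c , d1) ∷ (fw false d2 c , d2) ∷ [])
    own d0 = here refl
    own d1 = there (here refl)
    own d2 = there (there (here refl))
  candidate (c , k) (inj₂ h) = ∈-concat⁺′ (own k) (∈-map⁺ _ (fin (fw true k c) h))
    where
    own : ∀ k → (c , k) ∈ ((fw true k c , d0) ∷ (fw true k c , d1) ∷ (fw true k c , d2) ∷ (fw false d0 (fw true k c) , d0) ∷ (fw false d1 (fw true k c) , d1) ∷ (fw false d2 (fw true k c) , d2) ∷ [])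
    own d0 = there (there (there (here (cong (_, d0) (sym (fw-inv false d0 c))))))
    own d1 = there (there (there (there (here (cong (_, d1) (sym (fw-inv false d1 c)))))))
    own d2 = there (there (there (there (there (here (cong (_, d2) (sym (fw-inv false d2 c))))))))

  listOf : Edges → EdgeSet
  listOf ν = map vEdge (filter (λ e → ν $ᵉ e Boolₚ.≟ true) candidates)

  module _ {ν : Edges} (pm : IsMatching Hc ν) where

    listOf⇒ : ∀ {u v} → InE (listOf ν) u v → ∃[ t ] ∃[ t′ ] ∃[ e ] (Linkᵉ t t′ e × ν $ᵉ e ≡ true × u ≡ pos t × v ≡ pos t′)
    listOf⇒ (inj₁ i) with ∈-map⁻ vEdge i
    ... | (c , k) , j , refl = _ , _ , _ , wb c k , proj₂ (∈-filter⁻ (λ e → ν $ᵉ e Boolₚ.≟ true) {xs = candidates} j) , refl , refl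
    listOf⇒ (inj₂ i) with ∈-map⁻ vEdge i
    ... | (c , k) , j , refl = _ , _ , _ , bw c k , proj₂ (∈-filter⁻ (λ e → ν $ᵉ e Boolₚ.≟ true) {xs = candidates} j) , refl , refl

    ⇒listOf : ∀ {t t′ e} → Linkᵉ t t′ e → ν $ᵉ e ≡ true → InE (listOf ν) (pos t) (pos t′)
    ⇒listOf {e = c , k} l h = go l (∈-map⁺ vEdge (∈-filter⁺ (λ e → ν $ᵉ e Boolₚ.≟ true) (candidate (c , k) (IsMatching.support pm c k h)) h))
      where
      go : ∀ {t t′ c k} → Link t t′ c k → vEdge (c , k) ∈ listOf ν → InE (listOf ν) (pos t) (pos t′)
      go (wb c k) i = inj₁ i
      go (bw c k) i = inj₂ i

    listOf-link : ∀ {t t′ e} → Linkᵉ t t′ e → InE (listOf ν) (pos t) (pos t′) → ν $ᵉ e ≡ true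
    listOf-link l i with listOf⇒ i
    ... | _ , _ , f , l′ , h , p , q with pos-injective p | pos-injective q
    ... | refl | refl with link-unique l l′
    ... | refl = h

    fromMatching : ∀ {E : V → V → Set} → (∀ {t t′ e} → Linkᵉ t t′ e → ν $ᵉ e ≡ true → E (pos t) (pos t′)) → IsPM (HVert H) E (listOf ν)
    fromMatching {E} inE = All.tabulate edge , cover , uniq
      where
      edge : ∀ {e} → e ∈ listOf ν → E (proj₁ e) (proj₂ e)
      edge i with ∈-map⁻ vEdge i
      ... | (c , k) , j , refl = inE (wb c k) (proj₂ (∈-filter⁻ (λ e → ν $ᵉ e Boolₚ.≟ true) {xs = candidates} j))
      cover : ∀ v → HVert H v → ∃[ u ] InE (listOf ν) v u
      cover v (c , h , cv) with cellVertex⇒around c cv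
      ... | t , refl , ar with star-exists {ν} (matched pm ar (inH {c} h))
      ... | t′ , e , l , m = pos t′ , ⇒listOf l m
      uniq : ∀ v u w → InE (listOf ν) v u → InE (listOf ν) v w → u ≡ w
      uniq v u w i j with listOf⇒ i | listOf⇒ j
      ... | t , t′ , e , l , h , refl , refl | s , s′ , f , l′ , h′ , p , refl with pos-injective {t} {s} p
      ... | refl with touch-around {Hc} l (IsMatching.support pm _ _ h)
      ... | c , ar , hc with star-unique {ν} (matched pm ar hc) l l′ h h′
      ... | refl = cong pos (link-end l l′)

-- Alternating cycles

private
  tail′ : ∀ {A : Set} → List A → List A
  tail′ []       = []
  tail′ (_ ∷ xs) = xs

  path-chain : ∀ {A : Set} (a : A) as z w {x y u v} →
    ((x , y) , (u , v)) ∈ zip (zip (a ∷ as) (as ++ [ z ])) (tail′ (zip (a ∷ as) (as ++ [ z ])) ++ [ z , w ]) → y ≡ u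
  path-chain a []            z w (here refl)  = refl
  path-chain a (b ∷ [])      z w (here refl)  = refl
  path-chain a (b ∷ [])      z w (there i)    = path-chain b [] z w i
  path-chain a (b ∷ c ∷ cs)  z w (here refl)  = refl
  path-chain a (b ∷ c ∷ cs)  z w (there i)    = path-chain b (c ∷ cs) z w i

pairs-chain : ∀ {A : Set} (D : List A) {x y u v : A} → ((x , y) , (u , v)) ∈ cycPairs (cycPairs D) → y ≡ u
pairs-chain (a ∷ [])     i = path-chain a [] a a i
pairs-chain (a ∷ b ∷ as) i = path-chain a (b ∷ as) a b i
cyclic-spread : ∀ {A : Set} {P : A → Set} (L : List A) → (∀ {x y} → (x , y) ∈ cycPairs L → P x → P y) →
  ∀ {x y} → x ∈ L → y ∈ L → P x → P y
cyclic-spread {A} {P} (a ∷ as) pass i j p = onward a as a pass j (wrap a as a pass i p)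
  where
  onward : ∀ a as z → (∀ {x y} → (x , y) ∈ zip (a ∷ as) (as ++ [ z ]) → P x → P y) → ∀ {y} → y ∈ (a ∷ as) → P a → P y
  onward a as       z h (here refl) p = p
  onward a (b ∷ bs) z h (there i)   p = onward b bs z (h ∘ there) i (h (here refl) p)
  wrap : ∀ a as z → (∀ {x y} → (x , y) ∈ zip (a ∷ as) (as ++ [ z ]) → P x → P y) → ∀ {x} → x ∈ (a ∷ as) → P x → P z
  wrap a []       z h (here refl) p = h (here refl) p
  wrap a (b ∷ bs) z h (here refl) p = wrap b bs z (h ∘ there) (here refl) (h (here refl) p)
  wrap a (b ∷ bs) z h (there i)   p = wrap b bs z (h ∘ there) i p

module Alternating {Hc : Region} {μ : Edges} (pm : IsMatching Hc μ) {D : List Vtx} (cyc : Cycle D)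
  (edges : ∀ c k → onEdge D c k ≡ true → Touches Hc (c , k))
  (X⊆H : ∀ c → inside D c ≡ true → Hc c ≡ true)
  (alt : ∀ {t t′ v e f} → ((t , t′) , (t′ , v)) ∈ cycPairs (cycPairs D) → Linkᵉ t t′ e → Linkᵉ t′ v f → μ $ᵉ e ≡ not (μ $ᵉ f))
  where

  open Inside cyc

  -- The value of X on the lower side of an edge.
  low : Edge → Bool
  low (c , k) = if μ c k then X (fw true k c) else X c

  private
    Table : (a b c x y z : Bool) → Set
    Table a b c x y z =
      (x ≢ y → y ≢ z → a ≡ not b → (if a then y else x) ≡ (if b then z else y)) ×
      (y ≢ z → z ≢ x → b ≡ not c → (if b then z else y) ≡ (if c then x else z)) ×
      (z ≢ x → x ≢ y → c ≡ not a → (if c then x else z) ≡ (if a then y else x))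

    table : ∀ {a b c} → One a b c → ∀ x y z → Table a b c x y z
    table one₁ x y z = (λ _ _ _ → refl) , (λ _ _ ()) , (λ n m _ → two n m)
      where
      two : ∀ {x y z : Bool} → z ≢ x → x ≢ y → z ≡ y
      two {true}  {true}  n m = ⊥-elim (m refl)
      two {true}  {false} {true}  n m = ⊥-elim (n refl)
      two {true}  {false} {false} n m = refl
      two {false} {true}  {true}  n m = refl
      two {false} {true}  {false} n m = ⊥-elim (n refl)
      two {false} {false} n m = ⊥-elim (m refl)
    table one₂ x y z = (λ n m _ → two n m) , (λ _ _ _ → refl) , (λ _ _ ())
      where
      two : ∀ {x y z : Bool} → x ≢ y → y ≢ z → x ≡ z
      two {x} {true}  {true}  n m = ⊥-elim (m refl)
      two {true}  {true}  {false} n m = ⊥-elim (n refl)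
      two {false} {true}  {false} n m = refl
      two {true}  {false} {true}  n m = refl
      two {false} {false} {true}  n m = ⊥-elim (n refl)
      two {x} {false} {false} n m = ⊥-elim (m refl)
    table one₃ x y z = (λ _ _ ()) , (λ n m _ → two n m) , (λ _ _ _ → refl)
      where
      two : ∀ {x y z : Bool} → y ≢ z → z ≢ x → y ≡ x
      two {true}  {true}  n m = refl
      two {true}  {false} {true}  n m = ⊥-elim (m refl)
      two {true}  {false} {false} n m = ⊥-elim (n refl)
      two {false} {true}  {true}  n m = ⊥-elim (n refl)
      two {false} {true}  {false} n m = ⊥-elim (m refl)
      two {false} {false} n m = refl

    Sep : Edge → Set
    Sep (c , k) = X c ≢ X (fw true k c)

    cells : ∀ t → Cell × Cell × Cell
    cells t = proj₁ (star₀ t) , proj₁ (star₁ t) , proj₁ (star₂ t)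

    end₀ : ∀ t → fw true (proj₂ (star₀ t)) (proj₁ (star₀ t)) ≡ proj₁ (star₁ t)
    end₀ (W a) = refl
    end₀ (B a) = refl
    end₁ : ∀ t → fw true (proj₂ (star₁ t)) (proj₁ (star₁ t)) ≡ proj₁ (star₂ t)
    end₁ (W a) = refl
    end₁ (B a) = refl
    end₂ : ∀ t → fw true (proj₂ (star₂ t)) (proj₁ (star₂ t)) ≡ proj₁ (star₀ t)
    end₂ (W a) = fw-inv true d2 a
    end₂ (B a) = fw-inv true d2 a

    low-eq : ∀ {e c} → fw true (proj₂ e) (proj₁ e) ≡ c → low e ≡ (if μ $ᵉ e then X c else X (proj₁ e))
    low-eq {e} q = cong (λ z → if μ $ᵉ e then X z else X (proj₁ e)) q

    sep-eq : ∀ {e c} → fw true (proj₂ e) (proj₁ e) ≡ c → Sep e → X (proj₁ e) ≢ X c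
    sep-eq q s r = s (trans r (cong X (sym q)))

    -- The two cycle edges at `t` have a common cell, the head of one and the tail of the other. As
    -- exactly one of them is matched, either this cell is the lower side of both, or their lower
    -- sides are the two other cells, where `X` agrees.
    meet : ∀ t → Star μ t → ∀ {e f} → (e ≡ star₀ t ⊎ e ≡ star₁ t ⊎ e ≡ star₂ t) → (f ≡ star₀ t ⊎ f ≡ star₁ t ⊎ f ≡ star₂ t) →
      Sep e → Sep f → μ $ᵉ e ≡ not (μ $ᵉ f) → low e ≡ low f
    meet t o i j s s′ m = go i j s s′ m
      where
      T : Table (μ $ᵉ star₀ t) (μ $ᵉ star₁ t) (μ $ᵉ star₂ t) (X (proj₁ (star₀ t))) (X (proj₁ (star₁ t))) (X (proj₁ (star₂ t)))
      T = table o (X (proj₁ (star₀ t))) (X (proj₁ (star₁ t))) (X (proj₁ (star₂ t)))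
      flip′ : ∀ {a b} → a ≡ not b → b ≡ not a
      flip′ {a} {b} e = trans (sym (not-not b)) (cong not (sym e))
      self : ∀ {a} → a ≡ not a → ⊥
      self {true} ()
      self {false} ()
      l₀ = low-eq {star₀ t} (end₀ t)
      l₁ = low-eq {star₁ t} (end₁ t)
      l₂ = low-eq {star₂ t} (end₂ t)
      go : ∀ {e f} → (e ≡ star₀ t ⊎ e ≡ star₁ t ⊎ e ≡ star₂ t) → (f ≡ star₀ t ⊎ f ≡ star₁ t ⊎ f ≡ star₂ t) →
        Sep e → Sep f → μ $ᵉ e ≡ not (μ $ᵉ f) → low e ≡ low f
      go (inj₁ refl) (inj₁ refl) s s′ m = refl
      go (inj₂ (inj₁ refl)) (inj₂ (inj₁ refl)) s s′ m = refl
      go (inj₂ (inj₂ refl)) (inj₂ (inj₂ refl)) s s′ m = refl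
      go (inj₁ refl) (inj₂ (inj₁ refl)) s s′ m = trans l₀ (trans (proj₁ T (sep-eq {star₀ t} (end₀ t) s) (sep-eq {star₁ t} (end₁ t) s′) m) (sym l₁))
      go (inj₂ (inj₁ refl)) (inj₁ refl) s s′ m = trans l₁ (trans (sym (proj₁ T (sep-eq {star₀ t} (end₀ t) s′) (sep-eq {star₁ t} (end₁ t) s) (flip′ m))) (sym l₀))
      go (inj₂ (inj₁ refl)) (inj₂ (inj₂ refl)) s s′ m = trans l₁ (trans (proj₁ (proj₂ T) (sep-eq {star₁ t} (end₁ t) s) (sep-eq {star₂ t} (end₂ t) s′) m) (sym l₂))
      go (inj₂ (inj₂ refl)) (inj₂ (inj₁ refl)) s s′ m = trans l₂ (trans (sym (proj₁ (proj₂ T) (sep-eq {star₁ t} (end₁ t) s′) (sep-eq {star₂ t} (end₂ t) s) (flip′ m))) (sym l₁))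
      go (inj₂ (inj₂ refl)) (inj₁ refl) s s′ m = trans l₂ (trans (proj₂ (proj₂ T) (sep-eq {star₂ t} (end₂ t) s) (sep-eq {star₀ t} (end₀ t) s′) m) (sym l₀))
      go (inj₁ refl) (inj₂ (inj₂ refl)) s s′ m = trans l₀ (trans (sym (proj₂ (proj₂ T) (sep-eq {star₂ t} (end₂ t) s′) (sep-eq {star₀ t} (end₀ t) s) (flip′ m))) (sym l₂))

    Low : Bool → Vtx × Vtx → Set
    Low s (t , t′) = ∀ e → Linkᵉ t t′ e → low e ≡ s

    pass : ∀ s {p q} → (p , q) ∈ cycPairs (cycPairs D) → Low s p → Low s q
    pass s {t , t′} {u , v} i h f lf with pairs-chain D i
    ... | refl with All.lookup (Cycle.links cyc) (proj₁ (pair-in (cycPairs D) i))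
    ... | c , k , le = trans (sym (meet t′ star {c , k} {f} (in-star (link-sym le)) (in-star lf) (on⇒sep c k on-e) (on⇒sep (proj₁ f) (proj₂ f) on-f) (alt i le lf))) (h (c , k) le)
      where
      on-e = link-onEdge cyc (proj₁ (pair-in (cycPairs D) i)) le
      on-f = link-onEdge cyc (proj₂ (pair-in (cycPairs D) i)) lf
      star : Star μ t′
      star = let d , ar , h′ = touch-around {Hc} (link-sym le) (edges c k on-e) in matched pm ar h′

    nonempty : ∃[ p ] (p ∈ cycPairs D)
    nonempty = go D (Cycle.long cyc)
      where
      go : ∀ D → 3 ≤ length D → ∃[ p ] (p ∈ cycPairs D)
      go (a ∷ as) _ = let _ , j = successor {xs = a ∷ as} (here refl) in _ , j

  private
    p₀ = proj₁ nonempty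
    e₀ : Edge
    e₀ = let c , k , _ = All.lookup (Cycle.links cyc) (proj₂ nonempty) in c , k
  sign : Bool
  sign = low e₀

  low≡ : ∀ c k → onEdge D c k ≡ true → low (c , k) ≡ sign
  low≡ c k h = let t , t′ , i , l = onEdge-link {D} {c} {k} h in
    cyclic-spread {P = Low sign} (cycPairs D) (pass sign) (proj₂ nonempty) i
      (λ e l′ → cong low (link-unique l′ (proj₂ (proj₂ (All.lookup (Cycle.links cyc) (proj₂ nonempty)))))) (c , k) l

  isCut : IsCut Hc μ (sign , X)
  isCut = record { inside = X⊆H ; closed = closed ; inhabited = inhab }
    where
    tail-low : ∀ s c k → across μ s c k ≡ false → X c ≢ X (fw s k c) → (if s then X c else X (fw s k c)) ≡ sign
    tail-low true  c k e ne = trans (cong (if_then X (fw true k c) else X c) (sym e)) (low≡ c k (sep⇒on c k ne))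
    tail-low false c k e ne = trans (cong (if_then X (fw true k c′) else X c′) (sym e))
      (low≡ c′ k (sep⇒on c′ k λ q → ne (sym (trans q (cong X (fw-inv true k c))))))
      where c′ = fw false k c
    closed : ∀ c k → across μ sign c k ≡ false → X (fw sign k c) ≡ true → X c ≡ true
    closed c k e x = decidable-stable (X c Boolₚ.≟ true) λ nx →
      bad sign (tail-low sign c k e (λ q → nx (trans q x))) x nx
      where
      bad : ∀ s → (if s then X c else X (fw s k c)) ≡ s → X (fw s k c) ≡ true → ¬ X c ≡ true → ⊥
      bad true  q x nx = nx q
      bad false q x nx = true≢false x q
    inhab : ∃[ c ] X c ≡ true
    inhab = pick (proj₁ e₀) (proj₂ e₀) (link-onEdge cyc (proj₂ nonempty) (proj₂ (proj₂ (All.lookup (Cycle.links cyc) (proj₂ nonempty)))))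
      where
      pick : ∀ c k → onEdge D c k ≡ true → ∃[ d ] X d ≡ true
      pick c k on with bool-cases (X c)
      ... | inj₁ x = c , x
      ... | inj₂ n = fw true k c , ≢false λ n′ → on⇒sep c k on (trans n (sym n′))

data Zag (μ ν : Edges) : Vtx × Vtx → Set where
  rise : ∀ {a b e} → Linkᵉ (W a) (B b) e → ν $ᵉ e ≡ true → μ $ᵉ e ≡ false → Zag μ ν (W a , B b)
  fall : ∀ {a b e} → Linkᵉ (B b) (W a) e → μ $ᵉ e ≡ true → ν $ᵉ e ≡ false → Zag μ ν (B b , W a)

-- Following ν from white to black and μ from black to white closes up in the symmetric difference.
module Difference {Hc : Region} (Hl : List Cell) (fin : ∀ c → Hc c ≡ true → c ∈ Hl) {μ ν : Edges}
  (pm : IsMatching Hc μ) (pn : IsMatching Hc ν) where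

  record Diff : Set where
    field
      a b  : Cell
      e    : Edge
      link : Linkᵉ (W a) (B b) e
      in-ν : ν $ᵉ e ≡ true
      ∉-μ  : μ $ᵉ e ≡ false

  record Fall (b : Cell) : Set where
    field
      a    : Cell
      f    : Edge
      link : Linkᵉ (B b) (W a) f
      in-μ : μ $ᵉ f ≡ true
      ∉-ν  : ν $ᵉ f ≡ false

  private
    starᵘ : ∀ {κ} → IsMatching Hc κ → ∀ {t t′ e} → Linkᵉ t t′ e → κ $ᵉ e ≡ true → ∀ {κ′} → IsMatching Hc κ′ → Star κ′ t
    starᵘ pk l h pk′ = let c , ar , hc = touch-around {Hc} l (IsMatching.support pk _ _ h) in matched pk′ ar hc

    black-partner : ∀ {b} → ∃[ t′ ] ∃[ e ] (Linkᵉ (B b) t′ e × μ $ᵉ e ≡ true) → ∃[ a ] ∃[ e ] (Linkᵉ (B b) (W a) e × μ $ᵉ e ≡ true)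
    black-partner (W a , e , l , h) = a , e , l , h

    white-partner : ∀ {a} → ∃[ t′ ] ∃[ e ] (Linkᵉ (W a) t′ e × ν $ᵉ e ≡ true) → ∃[ b ] ∃[ e ] (Linkᵉ (W a) (B b) e × ν $ᵉ e ≡ true)
    white-partner (B b , e , l , h) = b , e , l , h

  down : (d : Diff) → Fall (Diff.b d)
  down d with black-partner (star-exists {μ} (starᵘ pn (link-sym (Diff.link d)) (Diff.in-ν d) pm))
  ... | a , f , l , h = record { a = a ; f = f ; link = l ; in-μ = h ; ∉-ν = ≢true λ h′ → true≢false h
          (subst (λ z → μ $ᵉ z ≡ false) (star-unique {ν} (starᵘ pn (link-sym (Diff.link d)) (Diff.in-ν d) pn) (link-sym (Diff.link d)) l (Diff.in-ν d) h′) (Diff.∉-μ d)) }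

  up : ∀ {b} (w : Fall b) → ∃[ b′ ] ∃[ e ] (Linkᵉ (W (Fall.a w)) (B b′) e × ν $ᵉ e ≡ true)
  up w = white-partner (star-exists {ν} (starᵘ pm (link-sym (Fall.link w)) (Fall.in-μ w) pn))

  next : Diff → Diff
  next d = record { a = Fall.a w ; b = proj₁ u ; e = proj₁ (proj₂ u) ; link = proj₁ (proj₂ (proj₂ u)) ; in-ν = proj₂ (proj₂ (proj₂ u))
                  ; ∉-μ = ≢true λ h → true≢false (proj₂ (proj₂ (proj₂ u)))
                      (subst (λ z → ν $ᵉ z ≡ false) (star-unique {μ} (starᵘ pm (link-sym (Fall.link w)) (Fall.in-μ w) pm) (link-sym (Fall.link w))
                        (proj₁ (proj₂ (proj₂ u))) (Fall.in-μ w) h) (Fall.∉-ν w)) }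
    where
    w = down d
    u = up w

  whites : List Cell
  whites = concatMap (λ c → c ∷ fw false d0 c ∷ fw true d2 c ∷ []) Hl

  white-listed : (d : Diff) → Diff.a d ∈ whites
  white-listed d = let c , ar , h = touch-around {Hc} (Diff.link d) (IsMatching.support pn _ _ (Diff.in-ν d)) in
    ∈-concat⁺′ (own ar) (∈-map⁺ (λ c → c ∷ fw false d0 c ∷ fw true d2 c ∷ []) (fin c h))
    where
    own : ∀ {a c} → Around (W a) c → a ∈ (c ∷ fw false d0 c ∷ fw true d2 c ∷ [])
    own (w₀ a) = here refl
    own (w₁ a) = there (here (sym (fw-inv false d0 a)))
    own (w₂ a) = there (there (here (sym (fw-inv true d2 a))))

  module From (start : Diff) where

    orbit : ℕ → Diff
    orbit zero    = start
    orbit (suc n) = next (orbit n)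

    A B′ : ℕ → Cell
    A n = Diff.a (orbit n)
    B′ n = Diff.b (orbit n)

    Repeat : ℕ → Set
    Repeat j = ∃[ i ] (i < j × A i ≡ A j)

    repeat : ∃[ j ] Repeat j
    repeat with Finₚ.pigeonhole (ℕₚ.n<1+n (length whites)) (λ (i : Fin (suc (length whites))) → index (white-listed (orbit (toℕ i))))
    ... | i , j , lt , eq = toℕ j , toℕ i , lt , trans (lookup-index (white-listed (orbit (toℕ i))))
            (trans (cong (lookup whites) eq) (sym (lookup-index (white-listed (orbit (toℕ j))))))

    fall-edge : ∀ n → Linkᵉ (B (B′ n)) (W (A (suc n))) (Fall.f (down (orbit n)))
    fall-edge n = Fall.link (down (orbit n))

    seg : ℕ → ℕ → List Vtx
    seg m zero    = []
    seg m (suc l) = W (A m) ∷ B (B′ m) ∷ seg (suc m) l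

    seg-mem : ∀ m l {v} → v ∈ seg m l → ∃[ x ] (m ≤ x × x < m ℕ.+ l × (v ≡ W (A x) ⊎ v ≡ B (B′ x)))
    seg-mem m (suc l) (here e) = m , ℕₚ.≤-refl , ℕₚ.m<m+n m (s≤s z≤n) , inj₁ e
    seg-mem m (suc l) (there (here e)) = m , ℕₚ.≤-refl , ℕₚ.m<m+n m (s≤s z≤n) , inj₂ e
    seg-mem m (suc l) (there (there i)) = let x , p , q , r = seg-mem (suc m) l i in
      x , ℕₚ.<⇒≤ p , subst (x <_) (sym (ℕₚ.+-suc m l)) q , r

    zigzag : ∀ m l z → z ≡ W (A (m ℕ.+ suc l)) →
      All (Zag μ ν) (zip (seg m (suc l)) ((B (B′ m) ∷ seg (suc m) l) ++ [ z ]))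
    zigzag m zero    z e = rise (Diff.link (orbit m)) (Diff.in-ν (orbit m)) (Diff.∉-μ (orbit m))
      ∷ subst (λ t → Zag μ ν (B (B′ m) , t)) (sym (trans e (cong (W ∘ A) (ℕₚ.+-comm m 1))))
          (fall (fall-edge m) (Fall.in-μ (down (orbit m))) (Fall.∉-ν (down (orbit m)))) ∷ []
    zigzag m (suc l) z e = rise (Diff.link (orbit m)) (Diff.in-ν (orbit m)) (Diff.∉-μ (orbit m))
      ∷ fall (fall-edge m) (Fall.in-μ (down (orbit m))) (Fall.∉-ν (down (orbit m)))
      ∷ zigzag (suc m) l z (trans e (cong (W ∘ A) (ℕₚ.+-suc m (suc l))))

    zag-link : ∀ {p} → Zag μ ν p → Linked₂ p
    zag-link (rise {e = c , k} l _ _) = c , k , l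
    zag-link (fall {e = c , k} l _ _) = c , k , l

    closed : ∀ i l → A i ≡ A (i ℕ.+ suc l) →
      (∀ x y → i ≤ x → x < y → y < i ℕ.+ suc l → A x ≢ A y) →
      ∃[ D ] (Cycle D × All (Zag μ ν) (cycPairs D))
    -- In a period of length one the rising and the falling edge would coincide, although only the
    -- latter is in `μ`.
    closed i zero eq dist = ⊥-elim (true≢false (Fall.in-μ (down (orbit i)))
      (subst (λ z → μ $ᵉ z ≡ false)
        (link-unique (subst (λ z → Linkᵉ (W z) (B (B′ i)) (Diff.e (orbit i))) (trans eq (cong A (ℕₚ.+-comm i 1))) (Diff.link (orbit i)))
                     (link-sym (fall-edge i))) (Diff.∉-μ (orbit i))))
    closed i (suc l) eq dist = seg i (suc (suc l)) , cyc , zz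
      where
      zz : All (Zag μ ν) (cycPairs (seg i (suc (suc l))))
      zz = zigzag i (suc l) (W (A i)) (cong W eq)
      -- Equal black vertices have equal successors, their partners in `μ` being unique. At the end
      -- of the period the successor is the first white vertex again, which gives the second case.
      distB : ∀ x y → i ≤ x → x < y → y < i ℕ.+ suc (suc l) → B′ x ≢ B′ y
      distB x y i≤x x<y y< e = by (ℕₚ.m≤n⇒m<n∨m≡n y<)
        where
        A≡ : A (suc x) ≡ A (suc y)
        A≡ = W-injective (link-end (fall-edge x) (subst₂ (λ b f → Linkᵉ (B b) (W (A (suc y))) f) (sym e) (sym f≡) (fall-edge y)))
          where
          f≡ : Fall.f (down (orbit x)) ≡ Fall.f (down (orbit y))
          f≡ = star-unique {μ} (starᵘ pm (fall-edge x) (Fall.in-μ (down (orbit x))) pm) (fall-edge x)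
                 (subst (λ b → Linkᵉ (B b) (W (A (suc y))) (Fall.f (down (orbit y)))) (sym e) (fall-edge y))
                 (Fall.in-μ (down (orbit x))) (Fall.in-μ (down (orbit y)))
        by : suc y < i ℕ.+ suc (suc l) ⊎ suc y ≡ i ℕ.+ suc (suc l) → ⊥
        by (inj₁ lt) = dist (suc x) (suc y) (ℕₚ.m≤n⇒m≤1+n i≤x) (s≤s x<y) lt A≡
        by (inj₂ q)  = dist i (suc x) ℕₚ.≤-refl (s≤s i≤x) (ℕₚ.<-≤-trans (s≤s x<y) (ℕₚ.≤-reflexive q))
                         (trans eq (trans (cong A (sym q)) (sym A≡)))
      uniq : ∀ m l′ → i ≤ m → m ℕ.+ l′ ≤ i ℕ.+ suc (suc l) → Unique (seg m l′)
      uniq m zero im le = []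
      uniq m (suc l′) im le =
        ((λ ()) ∷ All.tabulate λ j e → let x , p , q , r = seg-mem (suc m) l′ j in
            [ (λ r → dist m x im p (ℕₚ.<-≤-trans q (ℕₚ.≤-trans (ℕₚ.≤-reflexive (sym (ℕₚ.+-suc m l′))) le)) (W-injective (trans e r)))
            , (λ r → case trans e r of λ ()) ]′ r)
        ∷ (All.tabulate λ j e → let x , p , q , r = seg-mem (suc m) l′ j in
            [ (λ r → case trans e r of λ ())
            , (λ r → distB m x im p (ℕₚ.<-≤-trans q (ℕₚ.≤-trans (ℕₚ.≤-reflexive (sym (ℕₚ.+-suc m l′))) le)) (B-injective (trans e r))) ]′ r)
        ∷ uniq (suc m) l′ (ℕₚ.m≤n⇒m≤1+n im) (ℕₚ.≤-trans (ℕₚ.≤-reflexive (sym (ℕₚ.+-suc m l′))) le)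
      cyc : Cycle (seg i (suc (suc l)))
      cyc = record
        { long   = s≤s (s≤s (s≤s z≤n))
        ; unique = uniq i (suc (suc l)) ℕₚ.≤-refl ℕₚ.≤-refl
        ; links  = All.map zag-link zz }

    alternating-cycle : ¬ ¬ (∃[ D ] (Cycle D × All (Zag μ ν) (cycPairs D)))
    alternating-cycle k = let j , r = repeat in ¬¬-least {P = Repeat} j r λ { (j , (i , lt , eq) , least) → at i j lt eq least }
      where
      at : ∀ i j → i < j → A i ≡ A j → (∀ m → Repeat m → j ≤ m) → ⊥
      at i j lt eq least = go (j ℕ.∸ suc i) (sym (trans (ℕₚ.+-suc i (j ℕ.∸ suc i)) (ℕₚ.m+[n∸m]≡n lt)))
        where
        go : ∀ l → j ≡ i ℕ.+ suc l → ⊥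
        go l refl = k (closed i l eq λ x y _ x<y y< e → ℕₚ.<⇒≱ y< (least y (x , x<y , e)))

  alternating : (∃[ e ] (ν $ᵉ e ≡ true × μ $ᵉ e ≡ false)) → ¬ ¬ (∃[ D ] (Cycle D × All (Zag μ ν) (cycPairs D)))
  alternating ((c , k) , h , n) = From.alternating-cycle (record { a = wEnd c k ; b = bEnd c k ; e = c , k ; link = wb c k ; in-ν = h ; ∉-μ = n })

  zag-alternates : ∀ {D} → Cycle D → All (Zag μ ν) (cycPairs D) →
    ∀ {t t′ v e f} → ((t , t′) , (t′ , v)) ∈ cycPairs (cycPairs D) → Linkᵉ t t′ e → Linkᵉ t′ v f → μ $ᵉ e ≡ not (μ $ᵉ f)
  zag-alternates {D} cyc zs i l l′ = let p , q = pair-in (cycPairs D) i in go (All.lookup zs p) (All.lookup zs q) l l′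
    where
    go : ∀ {t t′ v e f} → Zag μ ν (t , t′) → Zag μ ν (t′ , v) → Linkᵉ t t′ e → Linkᵉ t′ v f → μ $ᵉ e ≡ not (μ $ᵉ f)
    go (rise l₁ _ n) (fall l₂ h _) l l′ with link-unique l₁ l | link-unique l₂ l′
    ... | refl | refl = trans n (cong not (sym h))
    go (fall l₁ h _) (rise l₂ _ n) l l′ with link-unique l₁ l | link-unique l₂ l′
    ... | refl | refl = trans h (cong not (sym n))

  zag-edge : ∀ {D} → All (Zag μ ν) (cycPairs D) → ∀ c k → onEdge D c k ≡ true →
    (ν c k ≡ true × μ c k ≡ false) ⊎ (μ c k ≡ true × ν c k ≡ false)
  zag-edge {D} zs c k on = let t , t′ , i , l = onEdge-link {D} {c} {k} on in go (All.lookup zs i) l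
    where
    go : ∀ {t t′} → Zag μ ν (t , t′) → Link t t′ c k → (ν c k ≡ true × μ c k ≡ false) ⊎ (μ c k ≡ true × ν c k ≡ false)
    go (rise l₁ h n) l with link-unique l₁ l
    ... | refl = inj₁ (h , n)
    go (fall l₁ h n) l with link-unique l₁ l
    ... | refl = inj₂ (h , n)

-- Anti-forcing sets

¬¬-∀Fin : ∀ {p} n {P : Fin n → Set p} → (∀ i → ¬ ¬ P i) → ¬ ¬ (∀ i → P i)
¬¬-∀Fin zero    f k = k λ ()
¬¬-∀Fin (suc n) f k = f Fin.zero λ p → ¬¬-∀Fin n (f ∘ Fin.suc) λ ps → k λ { Fin.zero → p ; (Fin.suc i) → ps i }

_≟ᵉ_ : (e f : Edge) → Dec (e ≡ f)
_≟ᵉ_ = Prodₚ.≡-dec _≟ᶜ_ _≟ᵈ_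

closed⁺ : ∀ {Hc μ s Y} → IsCut Hc μ (s , Y) → ∀ c k → μ c k ≡ false →
  (s ≡ true → Y (fw true k c) ≡ true → Y c ≡ true) × (s ≡ false → Y c ≡ true → Y (fw true k c) ≡ true)
closed⁺ {μ = μ} {true} cut c k e = (λ _ → IsCut.closed cut c k e) , (λ ())
closed⁺ {μ = μ} {false} {Y} cut c k e = (λ ()) , λ _ y → IsCut.closed cut (fw true k c) k
  (trans (across-fw μ true c k) e) (trans (cong Y (fw-inv′ true k c)) y)
-- The symmetric difference of `μ` and the boundary of `Y`.
rotate : Edges → Region → Edges
rotate μ Y c k = μ c k xor (Y c xor Y (fw true k c))

module _ {Hc : Region} {μ : Edges} (pm : IsMatching Hc μ) {s : Bool} {Y : Region} (cut : IsCut Hc μ (s , Y)) where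

  private
    Arc : Bool → Bool → Bool → Bool → Set
    Arc s a x y = a ≡ false → (s ≡ true → y ≡ true → x ≡ true) × (s ≡ false → x ≡ true → y ≡ true)

    table : ∀ s {a b c} → One a b c → ∀ x y z → Arc s a x y → Arc s b y z → Arc s c z x →
      One (a xor (x xor y)) (b xor (y xor z)) (c xor (z xor x))
    table s one₁ true  true  true  _ _ _ = one₁
    table s one₁ false false false _ _ _ = one₁
    table s one₂ true  true  true  _ _ _ = one₂
    table s one₂ false false false _ _ _ = one₂
    table s one₃ true  true  true  _ _ _ = one₃
    table s one₃ false false false _ _ _ = one₃
    table s one₁ true  false true  f g h = one₂
    table s one₁ false true  false f g h = one₂
    table s one₁ false true  true  f g h = one₃
    table s one₁ true  false false f g h = one₃
    table true  one₁ true  true  false f g h = case proj₁ (h refl) refl refl of λ ()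
    table false one₁ true  true  false f g h = case proj₂ (g refl) refl refl of λ ()
    table true  one₁ false false true  f g h = case proj₁ (g refl) refl refl of λ ()
    table false one₁ false false true  f g h = case proj₂ (h refl) refl refl of λ ()
    table s one₂ false true  false f g h = one₁
    table s one₂ true  false true  f g h = one₁
    table s one₂ true  true  false f g h = one₃
    table s one₂ false false true  f g h = one₃
    table true  one₂ false true  true  f g h = case proj₁ (f refl) refl refl of λ ()
    table false one₂ false true  true  f g h = case proj₂ (h refl) refl refl of λ ()
    table true  one₂ true  false false f g h = case proj₁ (h refl) refl refl of λ ()
    table false one₂ true  false false f g h = case proj₂ (f refl) refl refl of λ ()
    table s one₃ true  true  false f g h = one₂
    table s one₃ false false true  f g h = one₂
    table s one₃ false true  true  f g h = one₁
    table s one₃ true  false false f g h = one₁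
    table true  one₃ true  false true  f g h = case proj₁ (g refl) refl refl of λ ()
    table false one₃ true  false true  f g h = case proj₂ (f refl) refl refl of λ ()
    table true  one₃ false true  false f g h = case proj₁ (f refl) refl refl of λ ()
    table false one₃ false true  false f g h = case proj₂ (g refl) refl refl of λ ()

    arc : ∀ c k → Arc s (μ c k) (Y c) (Y (fw true k c))
    arc c k e = closed⁺ cut c k e

  -- Around a vertex the boundary has no edge or two, and these two are crossed in opposite senses.
  -- The sign allows only one sense for unmatched edges, so exactly one of the two is matched, and
  -- they are exchanged.
  rotate-matching : IsMatching Hc (rotate μ Y)
  rotate-matching = record { white = wh ; black = bl ; support = supp }
    where
    wh : ∀ c → Touched Hc true d0 d2 c → One (rotate μ Y c d0) (rotate μ Y (fw true d0 c) d1) (rotate μ Y (fw false d2 c) d2)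
    wh c t = subst (λ z → One (rotate μ Y c d0) (rotate μ Y x d1) (μ y d2 xor (Y y xor Y z))) (sym (fw-inv true d2 c))
      (table s (IsMatching.white pm c t) (Y c) (Y x) (Y y) (arc c d0) (arc x d1) (subst (λ z → Arc s (μ y d2) (Y y) (Y z)) (fw-inv true d2 c) (arc y d2)))
      where x = fw true d0 c
            y = fw false d2 c
    bl : ∀ c → Touched Hc true d1 d2 c → One (rotate μ Y c d1) (rotate μ Y (fw true d1 c) d0) (rotate μ Y (fw false d2 c) d2)
    bl c t = subst (λ z → One (rotate μ Y c d1) (rotate μ Y x d0) (μ y d2 xor (Y y xor Y z))) (sym (fw-inv true d2 c))
      (table s (IsMatching.black pm c t) (Y c) (Y x) (Y y) (arc c d1) (arc x d0) (subst (λ z → Arc s (μ y d2) (Y y) (Y z)) (fw-inv true d2 c) (arc y d2)))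
      where x = fw true d1 c
            y = fw false d2 c
    supp : ∀ c k → rotate μ Y c k ≡ true → Hc c ≡ true ⊎ Hc (fw true k c) ≡ true
    supp c k e with μ c k in m | Y c in y | Y (fw true k c) in y′
    ... | true  | _     | _     = IsMatching.support pm c k m
    ... | false | true  | _     = inj₁ (IsCut.inside cut c y)
    ... | false | false | true  = inj₂ (IsCut.inside cut _ y′)

rotate-sep : ∀ {μ Y c k} → μ c k ≡ false → Y c ≢ Y (fw true k c) → rotate μ Y c k ≡ true
rotate-sep {μ} {Y} {c} {k} e ne = trans (cong (_xor (Y c xor Y (fw true k c))) e) (≢⇒xor ne)

sep-rotate : ∀ {μ Y c k} → rotate μ Y c k ≡ true → μ c k ≡ false → Y c ≢ Y (fw true k c)
sep-rotate {μ} {Y} {c} {k} h e q = true≢false h (trans (cong₂ (λ a b → a xor (b xor Y (fw true k c))) e q) (xor-self (Y (fw true k c))))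

module _ {M : EdgeSet} {L : List Edge} (nonM : ∀ e → e ∈ L → edgesOf M $ᵉ e ≡ false) where

  private
    clash : ∀ {c k} → (c , k) ∈ L → ∀ {t t′} → Link t t′ c k → InE M (pos t) (pos t′) → ⊥
    clash j l m = true≢false (⇒edgesOf {M} l m) (nonM _ j)

    meets : ∀ {u v} → (u , v) ∈ map vEdge L → InE M u v → ⊥
    meets i m = go (∈-map⁻ vEdge i) m
      where
      go : ∀ {u v} → ∃[ e ] (e ∈ L × (u , v) ≡ vEdge e) → InE M u v → ⊥
      go ((c , k) , j , refl) m = clash j (wb c k) m

  avoids : ∀ {u v} → InE M u v → ¬ InE (map vEdge L) u v
  avoids m (inj₁ i) = meets i m
  avoids m (inj₂ i) = meets i (InE-sym {M} m)

∉-listed : ∀ {M′ L} {E : V → V → Set} {P : V → Set} → IsPM P (λ u v → E u v × ¬ InE (map vEdge L) u v) M′ →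
  ∀ c k → (c , k) ∈ L → edgesOf M′ c k ≡ true → ⊥
∉-listed {M′} {L} pm′ c k i h = clash (edgesOf⇒ {M′} (wb c k) h)
  where
  clash : InE M′ (pos (W (wEnd c k))) (pos (B (bEnd c k))) → ⊥
  clash (inj₁ j) = proj₂ (All.lookup (proj₁ pm′) j) (inj₁ (∈-map⁺ vEdge i))
  clash (inj₂ j) = proj₂ (All.lookup (proj₁ pm′) j) (inj₂ (∈-map⁺ vEdge i))

module Forcing (H : HexSystem) (D₀ : List Vtx) (B≡ : bd H ≡ map pos D₀) (cyc₀ : Cycle D₀) where

  open System H D₀ B≡ cyc₀ public
  module Cycles {μ ν : Edges} (pm : IsMatching Hc μ) (pn : IsMatching Hc ν) where
    open Difference Hl fin pm pn public using (alternating; zag-alternates; zag-edge)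

    module _ {D : List Vtx} (cyc : Cycle D) (zs : All (Zag μ ν) (cycPairs D)) where

      zag-touches : ∀ c k → onEdge D c k ≡ true → Touches Hc (c , k)
      zag-touches c k on = [ (λ h → IsMatching.support pn c k (proj₁ h)) , (λ h → IsMatching.support pm c k (proj₁ h)) ]′ (zag-edge {D} zs c k on)

      zag-inside : ∀ c → inside D c ≡ true → Hc c ≡ true
      zag-inside = Subsystem.inside⊆ cyc₀ cyc zag-touches

      module Alt = Alternating pm cyc zag-touches zag-inside (zag-alternates cyc zs)

  module _ {M M′ : EdgeSet} (imp : ∀ e → edgesOf M′ $ᵉ e ≡ true → edgesOf M $ᵉ e ≡ true) where

    private
      LinkForm : V → V → Set
      LinkForm u v = ∃[ t ] ∃[ t′ ] ∃[ e ] (Linkᵉ t t′ e × Touches Hc e × u ≡ pos t × v ≡ pos t′)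

    ⊆-edges : (∀ {u v} → InE M′ u v → HEdge H u v) → ∀ {u v} → InE M′ u v → InE M u v
    ⊆-edges sub m = go (HEdge⇒ (sub m)) m
      where
      go : ∀ {u v} → LinkForm u v → InE M′ u v → InE M u v
      go (t , t′ , e , l , _ , refl , refl) m = edgesOf⇒ {M} l (imp e (⇒edgesOf {M′} l m))

    module _ (pμ : IsMatching Hc (edgesOf M)) (pν : IsMatching Hc (edgesOf M′)) where

      ⊇-edges : (∀ {u v} → InE M u v → HEdge H u v) → ∀ {u v} → InE M u v → InE M′ u v
      ⊇-edges sub m = go (HEdge⇒ (sub m)) m
        where
        go : ∀ {u v} → LinkForm u v → InE M u v → InE M′ u v
        go (t , t′ , e , l , tch , refl , refl) m = around (touch-around {Hc} l tch)
          where
          around : ∃[ c ] (Around t c × Hc c ≡ true) → InE M′ (pos t) (pos t′)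
          around (c , ar , h) = found (star-exists {edgesOf M′} (matched pν ar h))
            where
            found : ∃[ t″ ] ∃[ f ] (Linkᵉ t t″ f × edgesOf M′ $ᵉ f ≡ true) → InE M′ (pos t) (pos t′)
            found (t″ , f , l′ , h′) = edgesOf⇒ {M′} l (subst (λ z → edgesOf M′ $ᵉ z ≡ true)
              (sym (star-unique {edgesOf M} (matched pμ ar h) l l′ (⇒edgesOf {M} l m) (imp f h′))) h′)

  module _ {μ ν : Edges} (pμ : IsMatching Hc μ) (pν : IsMatching Hc ν) (L : List Edge)
    (nonM : ∀ e → e ∈ L → μ $ᵉ e ≡ false) (nonN : ∀ c k → (c , k) ∈ L → ν c k ≡ true → ⊥)
    (hit : ∀ Y → IsCut Hc μ Y → ∃[ e ] (e ∈ L × proj₂ Y (proj₁ e) ≢ proj₂ Y (fw true (proj₂ e) (proj₁ e)))) where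

    private module C = Cycles pμ pν

    -- An edge of `ν` outside `μ` yields a cycle alternating between the two, whose interior is a
    -- cut of `μ`. An edge of `L` on it is not in `μ`, so it would be in `ν`.
    no-difference : ∀ e → ν $ᵉ e ≡ true → μ $ᵉ e ≡ true
    no-difference e h = ≢false λ n → C.alternating (e , h , n) absurd
      where
      absurd : ∃[ D ] (Σ (Cycle D) λ _ → All (Zag μ ν) (cycPairs D)) → ⊥
      absurd (D , cyc , zs) = sep (hit (A.sign , inside D) A.isCut)
        where
        module A = C.Alt cyc zs
        sep : ∃[ e ] (e ∈ L × inside D (proj₁ e) ≢ inside D (fw true (proj₂ e) (proj₁ e))) → ⊥
        sep ((c , k) , i , ne) = edge (C.zag-edge {D} zs c k (Inside.sep⇒on cyc c k ne))
          where
          edge : (ν c k ≡ true × μ c k ≡ false) ⊎ (μ c k ≡ true × ν c k ≡ false) → ⊥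
          edge (inj₁ x) = nonN c k i (proj₁ x)
          edge (inj₂ x) = true≢false (proj₁ x) (nonM _ i)
  module _ (M : EdgeSet) (pm : PerfectMatching H M) where

    μ : Edges
    μ = edgesOf M

    pμ : IsMatching Hc μ
    pμ = toMatching (λ h → h) {M} pm

    antiforcing : (L : List Edge) → (∀ e → e ∈ L → μ $ᵉ e ≡ false × Touches Hc e) →
      (∀ Y → IsCut Hc μ Y → ∃[ e ] (e ∈ L × proj₂ Y (proj₁ e) ≢ proj₂ Y (fw true (proj₂ e) (proj₁ e)))) →
      AntiForcing H M (map vEdge L)
    antiforcing L free hit = Allₚ.map⁺ (All.tabulate outside) ,
        (All.tabulate (λ i → All.lookup (proj₁ pm) i , avoids {M} {L} nonM (inj₁ i)) , proj₁ (proj₂ pm) , proj₂ (proj₂ pm)) ,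
        unique
      where
      nonM : ∀ e → e ∈ L → μ $ᵉ e ≡ false
      nonM e i = proj₁ (free e i)
      outside : ∀ {e} → e ∈ L → HEdge H (proj₁ (vEdge e)) (proj₂ (vEdge e)) × ¬ InE M (proj₁ (vEdge e)) (proj₂ (vEdge e))
      outside {c , k} i = ⇒HEdge (wb c k) (proj₂ (free _ i)) , λ m → avoids {M} {L} nonM m (inj₁ (∈-map⁺ vEdge i))
      unique : ∀ M′ → IsPM (HVert H) (λ u v → HEdge H u v × ¬ InE (map vEdge L) u v) M′ → ∀ u v → (InE M′ u v → InE M u v) × (InE M u v → InE M′ u v)
      unique M′ pm′ u v = ⊆-edges {M} {M′} imp (InE-HEdge proj₁ {M′} pm′) {u} {v} ,
                          ⊇-edges {M} {M′} imp pμ pν (InE-HEdge (λ h → h) {M} pm) {u} {v}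
        where
        pν : IsMatching Hc (edgesOf M′)
        pν = toMatching proj₁ {M′} pm′
        imp : ∀ e → edgesOf M′ $ᵉ e ≡ true → edgesOf M $ᵉ e ≡ true
        imp = no-difference pμ pν L nonM (∉-listed {M′} {L} pm′) hit
    -- If `S` missed the cut, rotating `μ` along it would give another perfect matching avoiding
    -- `S`; it differs from `M`, since some boundary edge is unmatched.
    hits : ∀ S → AntiForcing H M S → ∀ Y → IsCut Hc μ Y →
      ¬ ¬ (∃[ i ] ∃[ e ] (InE [ lookup S i ] (proj₁ (vEdge e)) (proj₂ (vEdge e)) × μ $ᵉ e ≡ false × proj₂ Y (proj₁ e) ≢ proj₂ Y (fw true (proj₂ e) (proj₁ e))))
    hits S (_ , pmS , uniq) (s , Y) cut k = Finite.boundary-edge pμ Hl fin (IsCut.inside cut) (IsCut.inhabited cut) λ { (c , j , m , sep) →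
        true≢false (⇒edgesOf {M} (wb c j) (proj₁ (uniq N pmN _ _) (⇒listOf pmν (wb c j) (rotate-sep {μ} {Y} m sep)))) m }
      where
      ν = rotate μ Y
      pmν : IsMatching Hc ν
      pmν = rotate-matching pμ {s} {Y} cut
      N = listOf ν
      index-of : ∀ {u v} → InE S u v → ∃[ i ] InE [ lookup S i ] u v
      index-of (inj₁ j) = index j , inj₁ (here (lookup-index j))
      index-of (inj₂ j) = index j , inj₂ (here (lookup-index j))
      free : ∀ {t t′ e} → Linkᵉ t t′ e → ν $ᵉ e ≡ true → ¬ InE S (pos t) (pos t′)
      free {t} {t′} {e} l h inS with bool-cases (μ $ᵉ e)
      ... | inj₂ m = let i , q = index-of (canon l inS) in k (i , e , q , m , sep-rotate {μ} {Y} h m)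
        where
        canon : ∀ {t t′ e} → Linkᵉ t t′ e → InE S (pos t) (pos t′) → InE S (proj₁ (vEdge e)) (proj₂ (vEdge e))
        canon (wb c k) x = x
        canon (bw c k) x = InE-sym {S} x
      ... | inj₁ m = clash (edgesOf⇒ {M} l m) inS
        where
        clash : InE M (pos t) (pos t′) → InE S (pos t) (pos t′) → ⊥
        clash (inj₁ j) x = proj₂ (All.lookup (proj₁ pmS) j) x
        clash (inj₂ j) x = proj₂ (All.lookup (proj₁ pmS) j) (InE-sym {S} x)
      pmN : IsPM (HVert H) (λ u v → HEdge H u v × ¬ InE S u v) N
      pmN = fromMatching pmν (λ l h → ⇒HEdge l (IsMatching.support pmν _ _ h) , free l h)

    packing≤ : ∀ S → AntiForcing H M S → ∀ n (F : Fin n → Member) → Packing Hc μ F → n ≤ length S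
    packing≤ S af n F pk = decidable-stable (n ℕₚ.≤? length S) λ ¬le →
      ¬¬-∀Fin n (λ i → hits S af (F i) (Packing.cut pk i)) λ h → ¬le (Finₚ.injective⇒≤ {f = λ i → proj₁ (h i)} λ {i} {j} q → inj h i j q)
      where
      Hit : Fin n → Set
      Hit i = ∃[ a ] ∃[ e ] (InE [ lookup S a ] (proj₁ (vEdge e)) (proj₂ (vEdge e)) × μ $ᵉ e ≡ false × proj₂ (F i) (proj₁ e) ≢ proj₂ (F i) (fw true (proj₂ e) (proj₁ e)))
      same : ∀ {p e f} → InE [ p ] (proj₁ (vEdge e)) (proj₂ (vEdge e)) → InE [ p ] (proj₁ (vEdge f)) (proj₂ (vEdge f)) → e ≡ f
      same {p} {e} {f} x y = ends (go x y)
        where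
        ends : (W (wEnd (proj₁ e) (proj₂ e)) ≡ W (wEnd (proj₁ f) (proj₂ f)) × B (bEnd (proj₁ e) (proj₂ e)) ≡ B (bEnd (proj₁ f) (proj₂ f))) → e ≡ f
        ends (a , b) = let q , r = ends-injective (proj₁ e) (proj₂ e) (proj₁ f) (proj₂ f) (W-injective a) (B-injective b) in cong₂ _,_ q r
        go : InE [ p ] (proj₁ (vEdge e)) (proj₂ (vEdge e)) → InE [ p ] (proj₁ (vEdge f)) (proj₂ (vEdge f)) →
          (W (wEnd (proj₁ e) (proj₂ e)) ≡ W (wEnd (proj₁ f) (proj₂ f)) × B (bEnd (proj₁ e) (proj₂ e)) ≡ B (bEnd (proj₁ f) (proj₂ f)))
        go (inj₁ (here a)) (inj₁ (here b)) = pos-injective (cong proj₁ (trans a (sym b))) , pos-injective (cong proj₂ (trans a (sym b)))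
        go (inj₂ (here a)) (inj₂ (here b)) = pos-injective (cong proj₂ (trans a (sym b))) , pos-injective (cong proj₁ (trans a (sym b)))
        go (inj₁ (here a)) (inj₂ (here b)) = case pos-injective {W (wEnd (proj₁ e) (proj₂ e))} {B (bEnd (proj₁ f) (proj₂ f))} (cong proj₁ (trans a (sym b))) of λ ()
        go (inj₂ (here a)) (inj₁ (here b)) = case pos-injective {B (bEnd (proj₁ e) (proj₂ e))} {W (wEnd (proj₁ f) (proj₂ f))} (cong proj₁ (trans a (sym b))) of λ ()
      inj : (h : ∀ i → Hit i) → ∀ i j → proj₁ (h i) ≡ proj₁ (h j) → i ≡ j
      inj h i j q with i Finₚ.≟ j
      ... | yes p = p
      ... | no ne with h i | h j
      ... | a , e , x , m , sp | b , f , y , m′ , sp′ = ⊥-elim (clash (same {lookup S a} {e} {f} x (subst (λ z → InE [ lookup S z ] _ _) (sym q) y)))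
        where
        clash : e ≡ f → ⊥
        clash refl = Packing.disjoint pk i j ne (proj₁ e) (proj₂ e) m sp sp′

  distinct : ∀ {L} → Unique L → DistinctEdges (map vEdge L)
  distinct {L} u = pairs (λ {e} {f} n x → n (vEdge-inj e f x)) (λ {e} {f} n x → n (sym (vEdge-inj f e x))) L u
    where
    vEdge-inj : ∀ e f → InE [ vEdge e ] (proj₁ (vEdge f)) (proj₂ (vEdge f)) → e ≡ f
    vEdge-inj (c , k) (d , j) (inj₁ (here q)) = sym (let a , b = ends-injective d j c k (W-injective (pos-injective (cong proj₁ q))) (B-injective (pos-injective (cong proj₂ q))) in cong₂ _,_ a b)
    vEdge-inj (c , k) (d , j) (inj₂ (here q)) = case pos-injective {B (bEnd d j)} {W (wEnd c k)} (cong proj₁ q) of λ ()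
    pairs : (∀ {e f} → e ≢ f → ¬ InE [ vEdge e ] (proj₁ (vEdge f)) (proj₂ (vEdge f))) →
            (∀ {e f} → e ≢ f → ¬ InE [ vEdge f ] (proj₁ (vEdge e)) (proj₂ (vEdge e))) →
            ∀ L → Unique L → DistinctEdges (map vEdge L)
    pairs f g (e ∷ L) (n ∷ u) Fin.zero Fin.zero ne = ⊥-elim (ne refl)
    pairs f g (e ∷ L) (n ∷ u) Fin.zero (Fin.suc j) ne = All.lookup {P = λ v → ¬ InE [ vEdge e ] (proj₁ v) (proj₂ v)} (Allₚ.map⁺ (All.map f n)) (∈-lookup j)
    pairs f g (e ∷ L) (n ∷ u) (Fin.suc i) Fin.zero ne = All.lookup {P = λ v → ¬ InE [ v ] (proj₁ (vEdge e)) (proj₂ (vEdge e))} (Allₚ.map⁺ (All.map g n)) (∈-lookup i)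
    pairs f g (e ∷ L) (n ∷ u) (Fin.suc i) (Fin.suc j) ne = pairs f g L u i j (ne ∘ cong Fin.suc)

  touches? : ∀ e → Dec (Touches Hc e)
  touches? (c , k) = (Hc c Boolₚ.≟ true) ⊎-dec (Hc (fw true k c) Boolₚ.≟ true)
  free : Edges → List Edge
  free ν = deduplicate _≟ᵉ_ (filter touches? (filter (λ e → ν $ᵉ e Boolₚ.≟ false) candidates))

  module _ (ν : Edges) where
    free-unique : Unique (free ν)
    free-unique = DecUniqueₚ.deduplicate-! _≟ᵉ_ _

    free-in : ∀ e → ν $ᵉ e ≡ false → Touches Hc e → e ∈ free ν
    free-in e m t = ∈-deduplicate⁺ _≟ᵉ_ (∈-filter⁺ touches? (∈-filter⁺ (λ e → ν $ᵉ e Boolₚ.≟ false) (candidate e t) m) t)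

    free-out : ∀ e → e ∈ free ν → ν $ᵉ e ≡ false × Touches Hc e
    free-out e i with ∈-filter⁻ touches? {xs = filter (λ e → ν $ᵉ e Boolₚ.≟ false) candidates} (∈-deduplicate⁻ _≟ᵉ_ _ i)
    ... | j , t = proj₂ (∈-filter⁻ (λ e → ν $ᵉ e Boolₚ.≟ false) {xs = candidates} j) , t

-- Disjoint directed cuts and the reduction of a packing

AllPairs-lookup : ∀ {A : Set} {R : A → A → Set} → (∀ {x y} → R x y → R y x) → ∀ {xs} → AllPairs R xs →
  (i j : Fin (length xs)) → i ≢ j → R (lookup xs i) (lookup xs j)
AllPairs-lookup sy (h ∷ ap) Fin.zero    Fin.zero    ne = ⊥-elim (ne refl)
AllPairs-lookup sy (h ∷ ap) Fin.zero    (Fin.suc j) ne = All.lookup h (∈-lookup j)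
AllPairs-lookup sy (h ∷ ap) (Fin.suc i) Fin.zero    ne = sy (All.lookup h (∈-lookup i))
AllPairs-lookup sy (h ∷ ap) (Fin.suc i) (Fin.suc j) ne = AllPairs-lookup sy ap i j (ne ∘ cong Fin.suc)

AllPairs-tabulate : ∀ {A : Set} {R : A → A → Set} {n} {f : Fin n → A} → (∀ i j → i ≢ j → R (f i) (f j)) → AllPairs R (tabulate f)
AllPairs-tabulate {n = zero}  h = []
AllPairs-tabulate {n = suc n} h = Allₚ.tabulate⁺ (λ i → h Fin.zero (Fin.suc i) λ ()) ∷ AllPairs-tabulate (λ i j ne → h (Fin.suc i) (Fin.suc j) (ne ∘ Finₚ.suc-injective))

Unique-lookup : ∀ {A : Set} {xs : List A} → Unique xs → ∀ {i j} → lookup xs i ≡ lookup xs j → i ≡ j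
Unique-lookup (h ∷ u) {Fin.zero}  {Fin.zero}  e = refl
Unique-lookup (h ∷ u) {Fin.zero}  {Fin.suc j} e = ⊥-elim (All.lookup h (∈-lookup j) e)
Unique-lookup (h ∷ u) {Fin.suc i} {Fin.zero}  e = ⊥-elim (All.lookup h (∈-lookup i) (sym e))
Unique-lookup (h ∷ u) {Fin.suc i} {Fin.suc j} e = cong Fin.suc (Unique-lookup u e)

∧-not : ∀ {a b} → (b ≡ true → a ≡ true) → a ≢ b → a ∧ not b ≡ true
∧-not {true}  {true}  h n = ⊥-elim (n refl)
∧-not {true}  {false} h n = refl
∧-not {false} {true}  h n = case h refl of λ ()
∧-not {false} {false} h n = ⊥-elim (n refl)

module Packings {N m : ℕ} (tl hd : Fin m → Fin N) where
  open Cuts tl hd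

  NoCommon : Cut → Cut → Set
  NoCommon Z Y = ∀ e → cross Z e ≡ true → cross Y e ≡ true → ⊥

  load-zero : ∀ e {F} → All (λ Y → cross Y e ≡ false) F → load e F ≡ 0
  load-zero e []       = refl
  load-zero e (h ∷ hs) = cong₂ ℕ._+_ (cong b2n h) (load-zero e hs)

  load≤1 : ∀ {F} → AllPairs NoCommon F → ∀ e → load e F ≤ 1
  load≤1 [] e = z≤n
  load≤1 {Z ∷ F} (h ∷ ap) e with cross Z e in eq
  ... | true  = ℕₚ.≤-reflexive (cong suc (load-zero e (All.map (λ nc → ≢true (nc e eq)) h)))
  ... | false = load≤1 ap e

  noCommon : ∀ {F} → (∀ e → load e F ≤ 1) → AllPairs NoCommon F
  noCommon {[]}    h = []
  noCommon {Z ∷ F} h = All.tabulate (λ {Y} i e z w → ℕₚ.<⇒≱ (s≤s (pos-load e i w)) (subst (λ b → b2n b ℕ.+ load e F ≤ 1) z (h e)))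
      ∷ noCommon (λ e → ℕₚ.≤-trans (ℕₚ.m≤n+m _ (b2n (cross Z e))) (h e))
    where
    pos-load : ∀ e {Y F} → Y ∈ F → cross Y e ≡ true → 0 < load e F
    pos-load e {Y} {_ ∷ F} (here refl) w = subst (λ b → 0 < b2n b ℕ.+ load e F) (sym w) (s≤s z≤n)
    pos-load e {Y} {Z′ ∷ F} (there i) w = ℕₚ.≤-trans (pos-load e i w) (ℕₚ.m≤n+m _ (b2n (cross Z′ e)))

  totalLoad : List Cut → ℕ
  totalLoad F = sum (map (λ Z → count (cross Z)) F)

  sumF : ∀ {n} → (Fin n → ℕ) → ℕ
  sumF {zero}  f = 0
  sumF {suc n} f = f Fin.zero ℕ.+ sumF (f ∘ Fin.suc)

  sumF-cong : ∀ {n} {f g : Fin n → ℕ} → (∀ i → f i ≡ g i) → sumF f ≡ sumF g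
  sumF-cong {zero}  h = refl
  sumF-cong {suc n} h = cong₂ ℕ._+_ (h Fin.zero) (sumF-cong (h ∘ Fin.suc))

  totalLoad-sum : ∀ F → totalLoad F ≡ sumF (λ e → load e F)
  totalLoad-sum []      = sym (zeros m)
    where
    zeros : ∀ n → sumF {n} (λ _ → 0) ≡ 0
    zeros zero    = refl
    zeros (suc n) = zeros n
  totalLoad-sum (Z ∷ F) = trans (cong (count (cross Z) ℕ.+_) (totalLoad-sum F)) (add (cross Z) (λ e → load e F))
    where
    add : ∀ {n} (f : Fin n → Bool) (g : Fin n → ℕ) → count f ℕ.+ sumF g ≡ sumF (λ e → b2n (f e) ℕ.+ g e)
    add {zero}  f g = refl
    add {suc n} f g = trans (ℕ-interchange (b2n (f Fin.zero)) (count (f ∘ Fin.suc)) (g Fin.zero) (sumF (g ∘ Fin.suc)))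
      (cong (b2n (f Fin.zero) ℕ.+ g Fin.zero ℕ.+_) (add (f ∘ Fin.suc) (g ∘ Fin.suc)))
      where
      ℕ-interchange : ∀ a b c d → (a ℕ.+ b) ℕ.+ (c ℕ.+ d) ≡ (a ℕ.+ c) ℕ.+ (b ℕ.+ d)
      ℕ-interchange a b c d = trans (ℕₚ.+-assoc a b _) (trans (cong (a ℕ.+_) (trans (sym (ℕₚ.+-assoc b c d))
        (trans (cong (ℕ._+ d) (ℕₚ.+-comm b c)) (ℕₚ.+-assoc c b d)))) (sym (ℕₚ.+-assoc a c _)))

  -- Counted arc by arc, the total depends on the loads alone; so uncrossing keeps it, and only
  -- shrinking lowers it.
  totalLoad-cong : ∀ {F G} → (∀ e → load e F ≡ load e G) → totalLoad F ≡ totalLoad G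
  totalLoad-cong {F} {G} h = trans (totalLoad-sum F) (trans (sumF-cong h) (sym (totalLoad-sum G)))

  Shrink : Cut → Set
  Shrink Z = ∃[ Z′ ] (Dicut Z′ × (∀ e → cross Z′ e ≡ true → cross Z e ≡ true) × count (cross Z′) < count (cross Z))

  module Reduce (Tight : Cut → Set) (tighten : ∀ {Z} → Dicut Z → ¬ ¬ (Tight Z ⊎ Shrink Z)) where

    Split : List Cut → Set
    Split G = All Tight G ⊎ (∃[ Z ] ∃[ G′ ] (G ↭ Z ∷ G′ × Shrink Z))

    split : ∀ {G} → All Dicut G → ¬ ¬ Split G
    split {G} dG k = ¬¬-∀∈ G (λ Z i → tighten (All.lookup dG i)) λ f → k (search G f)
      where
      search : ∀ G → (∀ Z → Z ∈ G → Tight Z ⊎ Shrink Z) → Split G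
      search [] f = inj₁ []
      search (Z ∷ G) f with f Z (here refl) | search G (λ Y i → f Y (there i))
      ... | inj₂ s | _ = inj₂ (Z , G , _↭_.refl , s)
      ... | inj₁ t | inj₁ ts = inj₁ (t ∷ ts)
      ... | inj₁ t | inj₂ (Y , G′ , p , s) = inj₂ (Y , Z ∷ G′ , ↭-trans (prep Z p) (↭-swap Z Y _↭_.refl) , s)

    record Lighter (F : List Cut) : Set where
      field
        family  : List Cut
        dicuts  : All Dicut family
        packed  : ∀ e → load e family ≤ 1
        same-size : length family ≡ length F
        lighter : totalLoad family < totalLoad F

    shrink : ∀ {F G} → (∀ e → load e F ≤ 1) → All Dicut G → (∀ e → load e G ≡ load e F) → length G ≡ length F →
      ∃[ Z ] ∃[ G′ ] (G ↭ Z ∷ G′ × Shrink Z) → Lighter F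
    shrink {F} {G} lF dG loads lenG (Z , G′ , p , Z′ , dZ′ , sub , less) = record
      { family  = Z′ ∷ G′
      ; dicuts  = dZ′ ∷ All.tail (Permₚ.All-resp-↭ p dG)
      ; packed  = λ e → ℕₚ.≤-trans (ℕₚ.+-monoˡ-≤ (load e G′) (b2n-mono (sub e))) (subst (_≤ 1) (trans (sym (loads e)) (load-↭ e p)) (lF e))
      ; same-size = trans (sym (Permₚ.↭-length p)) lenG
      ; lighter = ℕₚ.<-≤-trans (ℕₚ.+-monoˡ-< (totalLoad G′) less)
          (ℕₚ.≤-reflexive (trans (totalLoad-cong {Z ∷ G′} {G} (λ e → sym (load-↭ e p))) (totalLoad-cong {G} {F} loads))) }

    Reduced : List Cut → Set
    Reduced F = ∃[ G ] (All Tight G × AllPairs CrossFree G × AllPairs NoCommon G × length G ≡ length F)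

    simplify : ∀ {F} → All Dicut F → (∀ e → load e F ≤ 1) → ¬ ¬ (Reduced F ⊎ Lighter F)
    simplify {F} dF lF k = go (uncross F dF)
      where
      go : ∃[ G ] (All Dicut G × AllPairs CrossFree G × (∀ e → load e G ≡ load e F) × length G ≡ length F) → ⊥
      go (G , dG , cf , loads , lenG) = split dG (k ∘ finish)
        where
        finish : Split G → Reduced F ⊎ Lighter F
        finish (inj₂ s)  = inj₂ (shrink lF dG loads lenG s)
        finish (inj₁ ts) = inj₁ (G , ts , cf , noCommon (λ e → subst (_≤ 1) (sym (loads e)) (lF e)) , lenG)

    -- Uncrossing a packing, and shrinking its members to the cuts bounded by single cycles, lowers the total load.
    reduce : ∀ fuel F → totalLoad F ≤ fuel → All Dicut F → (∀ e → load e F ≤ 1) → ¬ ¬ Reduced F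
    reduce fuel F le dF lF k = simplify dF lF (finish fuel le)
      where
      finish : ∀ fuel → totalLoad F ≤ fuel → Reduced F ⊎ Lighter F → ⊥
      finish fuel le (inj₁ c) = k c
      finish zero le (inj₂ l) = ℕₚ.n≮0 (ℕₚ.<-≤-trans (Lighter.lighter l) le)
      finish (suc fuel) le (inj₂ l) = reduce fuel (Lighter.family l) (ℕₚ.≤-pred (ℕₚ.<-≤-trans (Lighter.lighter l) le))
        (Lighter.dicuts l) (Lighter.packed l) λ { (G , ts , cf , nc , len) → k (G , ts , cf , nc , trans len (Lighter.same-size l)) }

    reduced : ∀ F → All Dicut F → (∀ e → load e F ≤ 1) → ¬ ¬ Reduced F
    reduced F = reduce (totalLoad F) F ℕₚ.≤-refl

-- Cuts of a matching as directed cuts of a finite digraph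

module Model (H : HexSystem) (D₀ : List Vtx) (B≡ : bd H ≡ map pos D₀) (cyc₀ : Cycle D₀)
  (M : EdgeSet) (pm : PerfectMatching H M) where

  open Forcing H D₀ B≡ cyc₀ public

  m̂ : Edges
  m̂ = edgesOf M

  p̂ : IsMatching Hc m̂
  p̂ = toMatching (λ h → h) {M} pm

  U : List Cell
  U = deduplicate _≟ᶜ_ (filter (λ c → Hc c Boolₚ.≟ true) Hl)

  U-unique : Unique U
  U-unique = DecUniqueₚ.deduplicate-! _≟ᶜ_ _

  U-in : ∀ c → Hc c ≡ true → c ∈ U
  U-in c h = ∈-deduplicate⁺ _≟ᶜ_ (∈-filter⁺ (λ c → Hc c Boolₚ.≟ true) (fin c h) h)

  U-H : ∀ j → Hc (lookup U j) ≡ true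
  U-H j = proj₂ (∈-filter⁻ (λ c → Hc c Boolₚ.≟ true) {xs = Hl} (∈-deduplicate⁻ _≟ᶜ_ _ (∈-lookup {xs = U} j)))

  -- The point 0 stands for the cells outside H.
  pt : Cell → Fin (suc (length U))
  pt c with Hc c Boolₚ.≟ true
  ... | yes h = Fin.suc (index (U-in c h))
  ... | no _  = Fin.zero

  pt-out : ∀ c → Hc c ≡ false → pt c ≡ Fin.zero
  pt-out c e with Hc c Boolₚ.≟ true
  ... | yes h = ⊥-elim (true≢false h e)
  ... | no _  = refl

  pt-in : ∀ c → Hc c ≡ true → ∃[ j ] (pt c ≡ Fin.suc j × lookup U j ≡ c)
  pt-in c e with Hc c Boolₚ.≟ true
  ... | yes h = index (U-in c h) , refl , sym (lookup-index (U-in c h))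
  ... | no n  = ⊥-elim (n e)

  pt-lookup : ∀ j → pt (lookup U j) ≡ Fin.suc j
  pt-lookup j with pt-in (lookup U j) (U-H j)
  ... | i , e , q = trans e (cong Fin.suc (Unique-lookup U-unique q))

  arcs : List Edge
  arcs = free m̂

  tail head : Fin (length arcs) → Fin (suc (length U))
  tail e = pt (proj₁ (lookup arcs e))
  head e = pt (fw true (proj₂ (lookup arcs e)) (proj₁ (lookup arcs e)))

  open Cuts tail head public
  open Packings tail head public

  -- A set containing the outer point is replaced by its complement, with sign `false`; taking `xor`
  -- with the value at the outer point treats both cases at once.
  member : Cut → Member
  member Z = not (Z Fin.zero) , λ c → Z (pt c) xor Z Fin.zero

  cutOf : Member → Cut
  cutOf (s , Y) Fin.zero    = not s
  cutOf (s , Y) (Fin.suc j) = Y (lookup U j) xor not s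

  arc : ∀ c k → m̂ c k ≡ false → Hc c ≡ true ⊎ Hc (fw true k c) ≡ true → ∃[ e ] lookup arcs e ≡ (c , k)
  arc c k e t = let i = free-in m̂ (c , k) e t in index i , sym (lookup-index i)

  arc-free : ∀ e → m̂ $ᵉ lookup arcs e ≡ false
  arc-free e = proj₁ (free-out m̂ _ (∈-lookup {xs = arcs} e))

  xor-zero : ∀ b → b xor false ≡ b
  xor-zero true  = refl
  xor-zero false = refl

  xor-cancel : ∀ a b → (a xor b) xor b ≡ a
  xor-cancel true  true  = refl
  xor-cancel true  false = refl
  xor-cancel false true  = refl
  xor-cancel false false = refl

  xor-inj : ∀ {a b} c → a xor c ≡ b xor c → a ≡ b
  xor-inj {a} {b} c e = trans (sym (xor-cancel a c)) (trans (cong (_xor c) e) (xor-cancel b c))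

  member-out : ∀ Z c → Hc c ≡ false → proj₂ (member Z) c ≡ false
  member-out Z c e = trans (cong (λ i → Z i xor Z Fin.zero) (pt-out c e)) (xor-self (Z Fin.zero))

  closed-at : ∀ {Z} → Closed Z → ∀ c k → m̂ c k ≡ false → Z (pt (fw true k c)) ≡ true → Z (pt c) ≡ true
  closed-at {Z} cl c k e z with bool-cases (Hc c) | bool-cases (Hc (fw true k c))
  ... | inj₂ n | inj₂ n′ = trans (cong Z (trans (pt-out c n) (sym (pt-out _ n′)))) z
  ... | inj₁ h | _ = go (arc c k e (inj₁ h))
    where
    go : ∃[ e ] lookup arcs e ≡ (c , k) → Z (pt c) ≡ true
    go (i , q) = trans (cong (λ f → Z (pt (proj₁ f))) (sym q)) (cl i (trans (cong (λ f → Z (pt (fw true (proj₂ f) (proj₁ f)))) q) z))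
  ... | inj₂ _ | inj₁ h = go (arc c k e (inj₂ h))
    where
    go : ∃[ e ] lookup arcs e ≡ (c , k) → Z (pt c) ≡ true
    go (i , q) = trans (cong (λ f → Z (pt (proj₁ f))) (sym q)) (cl i (trans (cong (λ f → Z (pt (fw true (proj₂ f) (proj₁ f)))) q) z))

  dicut⇒cut : ∀ {Z} → Dicut Z → IsCut Hc m̂ (member Z)
  dicut⇒cut {Z} (cl , (i , zi) , (j , zj)) = record
    { inside = λ c y → ≢false λ n → true≢false y (member-out Z c n)
    ; closed = closed′ (Z Fin.zero)
    ; inhabited = witness (Z Fin.zero) refl }
    where
    closed′ : ∀ o c k → across m̂ (not o) c k ≡ false → Z (pt (fw (not o) k c)) xor o ≡ true → Z (pt c) xor o ≡ true
    closed′ false c k e y = trans (xor-zero _) (closed-at {Z} cl c k e (trans (sym (xor-zero _)) y))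
    closed′ true  c k e y with bool-cases (Z (pt c))
    ... | inj₂ n = cong (_xor true) n
    ... | inj₁ z = ⊥-elim (true≢false y (cong (_xor true) (closed-at {Z} cl (fw false k c) k e (trans (cong (Z ∘ pt) (fw-inv true k c)) z))))
    at : ∀ i → Z i ≢ Z Fin.zero → ∃[ c ] (Z (pt c) xor Z Fin.zero ≡ true)
    at Fin.zero ne = ⊥-elim (ne refl)
    at (Fin.suc i) ne = lookup U i , trans (cong (λ p → Z p xor Z Fin.zero) (pt-lookup i)) (≢⇒xor ne)
    witness : ∀ o → Z Fin.zero ≡ o → ∃[ c ] (Z (pt c) xor Z Fin.zero ≡ true)
    witness true  e = at j λ q → true≢false (trans q e) zj
    witness false e = at i λ q → true≢false zi (trans q e)

  cutOf-pt : ∀ {Y} → IsCut Hc m̂ Y → ∀ c → cutOf Y (pt c) ≡ proj₂ Y c xor not (proj₁ Y)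
  cutOf-pt {s , Y} cut c with bool-cases (Hc c)
  ... | inj₂ n = trans (cong (cutOf (s , Y)) (pt-out c n)) (cong (_xor not s) (sym (≢true λ y → true≢false (IsCut.inside cut c y) n)))
  ... | inj₁ h with pt-in c h
  ... | j , e , q = trans (cong (cutOf (s , Y)) e) (cong (λ z → Y z xor not s) q)

  cut⇒dicut : ∀ {Y} → IsCut Hc m̂ Y → Dicut (cutOf Y)
  cut⇒dicut {s , Y} cut = cl , nontrivial s refl
    where
    cl : Closed (cutOf (s , Y))
    cl e h = trans (cutOf-pt cut _) (go s (proj₁ (closed⁺ cut c k (arc-free e))) (proj₂ (closed⁺ cut c k (arc-free e))) (trans (sym (cutOf-pt cut _)) h))
      where
      c = proj₁ (lookup arcs e)
      k = proj₂ (lookup arcs e)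
      go : ∀ s′ → (s′ ≡ true → Y (fw true k c) ≡ true → Y c ≡ true) → (s′ ≡ false → Y c ≡ true → Y (fw true k c) ≡ true) →
        Y (fw true k c) xor not s′ ≡ true → Y c xor not s′ ≡ true
      go true  f g h = trans (xor-zero _) (f refl (trans (sym (xor-zero _)) h))
      go false f g h with bool-cases (Y c)
      ... | inj₂ n = cong (_xor true) n
      ... | inj₁ y = ⊥-elim (true≢false h (cong (_xor true) (g refl y)))
    w = proj₁ (IsCut.inhabited cut)
    zw : cutOf (s , Y) (pt w) ≡ s
    zw = trans (cutOf-pt cut w) (trans (cong (_xor not s) (proj₂ (IsCut.inhabited cut))) (not-not s))
    nontrivial : ∀ s′ → s ≡ s′ → Nontrivial (cutOf (s , Y))
    nontrivial true  e = (pt w , trans zw e) , (Fin.zero , cong not e)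
    nontrivial false e = (Fin.zero , cong not e) , (pt w , trans zw e)

  cross-sep : ∀ {Z} e → cross Z e ≡ true → let c , k = lookup arcs e in proj₂ (member Z) c ≢ proj₂ (member Z) (fw true k c)
  cross-sep {Z} e x q = true≢false (trans (sym (xor-inj (Z Fin.zero) q)) (∧-fst {Z (tail e)} x)) (not-true (∧-snd {Z (tail e)} x))

  sep-cross : ∀ {Z} → Closed Z → ∀ e → let c , k = lookup arcs e in
    proj₂ (member Z) c ≢ proj₂ (member Z) (fw true k c) → cross Z e ≡ true
  sep-cross {Z} cl e ne = ∧-not (cl e) (λ q → ne (cong (_xor Z Fin.zero) q))

  cutOf-cross : ∀ {Y} (cut : IsCut Hc m̂ Y) e → let c , k = lookup arcs e in
    (cross (cutOf Y) e ≡ true → proj₂ Y c ≢ proj₂ Y (fw true k c)) × (proj₂ Y c ≢ proj₂ Y (fw true k c) → cross (cutOf Y) e ≡ true)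
  cutOf-cross {s , Y} cut e =
    (λ x q → true≢false (trans (sym (trans (cutOf-pt cut _) (trans (cong (_xor not s) q) (sym (cutOf-pt cut _))))) (∧-fst {cutOf (s , Y) (tail e)} x)) (not-true (∧-snd {cutOf (s , Y) (tail e)} x))) ,
    (λ ne → ∧-not (proj₁ (cut⇒dicut cut) e)
        (λ q → ne (xor-inj (not s) (trans (sym (cutOf-pt cut _)) (trans q (cutOf-pt cut _))))))

  conn : ∀ Z → Dicut Z → ∃[ e ] cross Z e ≡ true
  conn Z d = decidable-stable (Finₚ.any? λ e → cross Z e Boolₚ.≟ true) λ none →
    Finite.boundary-edge p̂ Hl fin (IsCut.inside (dicut⇒cut d)) (IsCut.inhabited (dicut⇒cut d)) λ { (c , k , e , sep) →
      none (found c k e sep) }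
    where
    touch : ∀ c k → proj₂ (member Z) c ≢ proj₂ (member Z) (fw true k c) → Hc c ≡ true ⊎ Hc (fw true k c) ≡ true
    touch c k sep with bool-cases (Hc c) | bool-cases (Hc (fw true k c))
    ... | inj₁ h | _      = inj₁ h
    ... | inj₂ _ | inj₁ h = inj₂ h
    ... | inj₂ n | inj₂ n′ = ⊥-elim (sep (trans (member-out Z c n) (sym (member-out Z _ n′))))
    found : ∀ c k → m̂ c k ≡ false → proj₂ (member Z) c ≢ proj₂ (member Z) (fw true k c) → ∃[ e ] cross Z e ≡ true
    found c k e sep with arc c k e (touch c k sep)
    ... | i , q = i , sep-cross {Z} (proj₁ d) i (subst (λ f → proj₂ (member Z) (proj₁ f) ≢ proj₂ (member Z) (fw true (proj₂ f) (proj₁ f))) (sym q) sep)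
  -- The difference `Δ` agrees at the two ends of every arc, hence is constant by `conn`. If the
  -- sets were complementary, an arc crossing both would have its tail in both.
  determined : ∀ {Z Y} → Dicut Z → Dicut Y → (∀ e → cross Z e ≡ cross Y e) → ∀ i → Z i ≡ Y i
  determined {Z} {Y} dZ dY eq i = decide (all-equal-or Fin.zero) i
    where
    Δ : Cut
    Δ i = Z i xor Y i
    constant : ∀ e → Δ (tail e) ≡ Δ (head e)
    constant e = go (Z (tail e)) (Z (head e)) (Y (tail e)) (Y (head e)) (proj₁ dZ e) (proj₁ dY e) (eq e)
      where
      go : ∀ a b c d → (b ≡ true → a ≡ true) → (d ≡ true → c ≡ true) → a ∧ not b ≡ c ∧ not d → a xor c ≡ b xor d
      go false true  c d f g h = case f refl of λ ()
      go a b false true  f g h = case g refl of λ ()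
      go true  true  true  true  f g h = refl
      go true  true  false false f g h = refl
      go true  false true  false f g h = refl
      go false false true  true  f g h = refl
      go false false false false f g h = refl
    no-split : ¬ Nontrivial Δ
    no-split nt = let e , x = conn Δ ((λ e h → trans (constant e) h) , nt) in
      true≢false (trans (sym (constant e)) (∧-fst {Δ (tail e)} x)) (not-true (∧-snd {Δ (tail e)} x))
    all-equal-or : ∀ i → (Δ i ≡ true) ⊎ (Δ i ≡ false)
    all-equal-or i = bool-cases (Δ i)
    decide : (Δ Fin.zero ≡ true) ⊎ (Δ Fin.zero ≡ false) → ∀ i → Z i ≡ Y i
    decide (inj₂ f) i = xor-false (Z i) (Y i) (≢true λ t → no-split ((i , t) , (Fin.zero , f)))
      where
      xor-false : ∀ a b → a xor b ≡ false → a ≡ b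
      xor-false true  true  e = refl
      xor-false false false e = refl
    decide (inj₁ t) i = ⊥-elim (let e , x = conn Z dZ in
      opposite (Z (tail e)) (Y (tail e)) (≢false λ f → no-split ((Fin.zero , t) , (tail e , f))) (∧-fst {Z (tail e)} x) (∧-fst {Y (tail e)} (trans (sym (eq e)) x)))
      where
      opposite : ∀ a b → a xor b ≡ true → a ≡ true → b ≡ true → ⊥
      opposite true true () _ _

predecessor : ∀ {A : Set} {x : A} {xs} → x ∈ xs → ∃[ y ] ((y , x) ∈ cycPairs xs)
predecessor {A} {x} {a ∷ as} (here refl) = last a as a
  where
  last : ∀ (a : A) as z → ∃[ y ] ((y , z) ∈ zip (a ∷ as) (as ++ [ z ]))
  last a []       z = a , here refl
  last a (b ∷ bs) z = let y , i = last b bs z in y , there i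
predecessor {A} {x} {a ∷ as} (there i) = go a as a i
  where
  go : ∀ (a : A) as z → x ∈ as → ∃[ y ] ((y , x) ∈ zip (a ∷ as) (as ++ [ z ]))
  go a (b ∷ bs) z (here refl) = a , here refl
  go a (b ∷ bs) z (there i)   = let y , j = go b bs z i in y , there j

toList-fst : ∀ {A : Set} {P : A → Set} {xs} (h : All P xs) → map proj₁ (All.toList h) ≡ xs
toList-fst []       = refl
toList-fst (p ∷ ps) = cong (_ ∷_) (toList-fst ps)

length-toList : ∀ {A : Set} {P : A → Set} {xs} (h : All P xs) → length (All.toList h) ≡ length xs
length-toList []       = refl
length-toList (p ∷ ps) = cong suc (length-toList ps)

packing-cong : ∀ {Hc μ ν n} {F : Fin n → Member} → (∀ c k → μ c k ≡ ν c k) → Packing Hc μ F → Packing Hc ν F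
packing-cong {μ = μ} {ν} {F = F} eq pk = record
  { cut = λ i → record
      { inside    = IsCut.inside (Packing.cut pk i)
      ; closed    = λ c k e → IsCut.closed (Packing.cut pk i) c k (trans (across-eq (proj₁ (F i)) c k) e)
      ; inhabited = IsCut.inhabited (Packing.cut pk i) }
  ; disjoint = λ i j ne c k e → Packing.disjoint pk i j ne c k (trans (eq c k) e) }
  where
  across-eq : ∀ s c k → across μ s c k ≡ across ν s c k
  across-eq true  c k = eq c k
  across-eq false c k = eq (fw false k c) k

Compatible-sym : ∀ {M C E} → Compatible M C E → Compatible M E C
Compatible-sym (inj₁ h)       = inj₁ λ v i j → h v j i
Compatible-sym (inj₂ (h , g)) = inj₂ ((λ u v a b → h u v b a) , λ v i j → let u , a , b = g v j i in u , b , a)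

NonCrossing-sym : ∀ {C E} → NonCrossingPair C E → NonCrossingPair E C
NonCrossing-sym (inj₁ h)        = inj₁ λ c a b → h c b a
NonCrossing-sym (inj₂ (inj₁ h)) = inj₂ (inj₂ h)
NonCrossing-sym (inj₂ (inj₂ h)) = inj₂ (inj₁ h)

-- A region I of sign s stands for the set of points whose indicator is I for s = true, and its complement for s = false.
module _ {n : ℕ} {Z Z′ : Fin (suc n) → Bool} {I J : Region} {p : Cell → Fin (suc n)} where

  private
    id≡ : ∀ {a b} → a ≡ b xor false → b ≡ true → a ≡ true
    id≡ {b = true} e refl = e
    id⁻ : ∀ {a b} → a ≡ b xor false → a ≡ true → b ≡ true
    id⁻ {b = true}  e h = refl
    id⁻ {b = false} e h = ⊥-elim (true≢false h e)
    id⁰ : ∀ {a b} → a ≡ b xor false → a ≡ false → b ≡ true → ⊥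
    id⁰ e h b = true≢false (id≡ e b) h
    no≡ : ∀ {a b} → a ≡ b xor true → b ≡ true → a ≡ false
    no≡ {b = true} e refl = e
    no⁻ : ∀ {a b} → a ≡ b xor true → a ≡ false → b ≡ true
    no⁻ {b = true}  e h = refl
    no⁻ {b = false} e h = ⊥-elim (true≢false e h)
    no⁰ : ∀ {a b} → a ≡ b xor true → b ≡ true → a ≡ true → ⊥
    no⁰ e b h = true≢false h (no≡ e b)

  nested : ∀ s s′ → (∀ c → Z (p c) ≡ I c xor not s) → (∀ c → Z′ (p c) ≡ J c xor not s′) →
    Z Fin.zero ≡ not s → Z′ Fin.zero ≡ not s′ →
    ((∀ i → Z i ≡ true → Z′ i ≡ true) ⊎ (∀ i → Z′ i ≡ true → Z i ≡ true)) ⊎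
    ((∀ i → Z i ≡ true → Z′ i ≡ false) ⊎ (∀ i → Z i ≡ false → Z′ i ≡ true)) →
    (∀ c → I c ≡ true → J c ≡ true → ⊥) ⊎ (∀ c → I c ≡ true → J c ≡ true) ⊎ (∀ c → J c ≡ true → I c ≡ true)
  nested true true z z′ o o′ (inj₁ (inj₁ h)) = inj₂ (inj₁ λ c i → id⁻ (z′ c) (h (p c) (id≡ (z c) i)))
  nested true true z z′ o o′ (inj₁ (inj₂ h)) = inj₂ (inj₂ λ c i → id⁻ (z c) (h (p c) (id≡ (z′ c) i)))
  nested true true z z′ o o′ (inj₂ (inj₁ h)) = inj₁ λ c i j → id⁰ (z′ c) (h (p c) (id≡ (z c) i)) j
  nested true true z z′ o o′ (inj₂ (inj₂ h)) = ⊥-elim (true≢false (h Fin.zero o) o′)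
  nested true false z z′ o o′ (inj₁ (inj₁ h)) = inj₁ λ c i j → no⁰ (z′ c) j (h (p c) (id≡ (z c) i))
  nested true false z z′ o o′ (inj₁ (inj₂ h)) = ⊥-elim (true≢false (h Fin.zero o′) o)
  nested true false z z′ o o′ (inj₂ (inj₁ h)) = inj₂ (inj₁ λ c i → no⁻ (z′ c) (h (p c) (id≡ (z c) i)))
  nested true false z z′ o o′ (inj₂ (inj₂ h)) = inj₂ (inj₂ λ c j → ≢false λ i → no⁰ (z′ c) j (h (p c) (trans (z c) (cong (_xor false) i))))
  nested false true z z′ o o′ (inj₁ (inj₁ h)) = ⊥-elim (true≢false (h Fin.zero o) o′)
  nested false true z z′ o o′ (inj₁ (inj₂ h)) = inj₁ λ c i j → no⁰ (z c) i (h (p c) (id≡ (z′ c) j))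
  nested false true z z′ o o′ (inj₂ (inj₁ h)) = inj₂ (inj₂ λ c j → ≢false λ i → id⁰ (z′ c) (h (p c) (trans (z c) (cong (_xor true) i))) j)
  nested false true z z′ o o′ (inj₂ (inj₂ h)) = inj₂ (inj₁ λ c i → id⁻ (z′ c) (h (p c) (no≡ (z c) i)))
  nested false false z z′ o o′ (inj₁ (inj₁ h)) = inj₂ (inj₂ λ c j → ≢false λ i → no⁰ (z′ c) j (h (p c) (trans (z c) (cong (_xor true) i))))
  nested false false z z′ o o′ (inj₁ (inj₂ h)) = inj₂ (inj₁ λ c i → ≢false λ j → no⁰ (z c) i (h (p c) (trans (z′ c) (cong (_xor true) j))))
  nested false false z z′ o o′ (inj₂ (inj₁ h)) = ⊥-elim (true≢false o′ (h Fin.zero o))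
  nested false false z z′ o o′ (inj₂ (inj₂ h)) = inj₁ λ c i j → no⁰ (z′ c) j (h (p c) (no≡ (z c) i))

-- From packings of cuts to non-crossing sets of alternating cycles

module Families (H : HexSystem) (D₀ : List Vtx) (B≡ : bd H ≡ map pos D₀) (cyc₀ : Cycle D₀)
  (M : EdgeSet) (pm : PerfectMatching H M) where

  open Model H D₀ B≡ cyc₀ M pm public

  record AltCycle : Set where
    field
      D   : List Vtx
      cyc : Cycle D
      ν   : Edges
      pν  : IsMatching Hc ν
      zs  : All (Zag m̂ ν) (cycPairs D)

    module C = Cycles p̂ pν
    module A = C.Alt cyc zs

    signed : Member
    signed = A.sign , inside D

    cut : IsCut Hc m̂ signed
    cut = A.isCut
    matching-edge : ∀ t → t ∈ D → ∃[ t′ ] ∃[ e ] (Linkᵉ t t′ e × m̂ $ᵉ e ≡ true × onEdge D (proj₁ e) (proj₂ e) ≡ true)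
    matching-edge (W a) i = let y , j = predecessor i in go j (All.lookup zs j)
      where
      go : ∀ {y} → (y , W a) ∈ cycPairs D → Zag m̂ ν (y , W a) → ∃[ t′ ] ∃[ e ] (Linkᵉ (W a) t′ e × m̂ $ᵉ e ≡ true × onEdge D (proj₁ e) (proj₂ e) ≡ true)
      go j (fall l h _) = _ , _ , link-sym l , h , link-onEdge cyc j l
    matching-edge (B b) i = let y , j = successor i in go j (All.lookup zs j)
      where
      go : ∀ {y} → (B b , y) ∈ cycPairs D → Zag m̂ ν (B b , y) → ∃[ t′ ] ∃[ e ] (Linkᵉ (B b) t′ e × m̂ $ᵉ e ≡ true × onEdge D (proj₁ e) (proj₂ e) ≡ true)
      go j (fall l h _) = _ , _ , l , h , link-onEdge cyc j l

    malt : MAltCycle H M (map pos D)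
    malt = (subst (3 ≤_) (sym (length-map pos D)) (Cycle.long cyc) , Uniqueₚ.map⁺ pos-injective (Cycle.unique cyc) ,
        subst (All _) (sym (cycPairs-map pos D)) (Allₚ.map⁺ (All.map hedge zs))) ,
      subst (All (ExactlyOne M)) (sym (trans (cong cycPairs (cycPairs-map pos D)) (cycPairs-map (map² pos) (cycPairs D))))
        (Allₚ.map⁺ (All.tabulate one))
      where
      hedge : ∀ {p} → Zag m̂ ν p → HEdge H (pos (proj₁ p)) (pos (proj₂ p))
      hedge (rise {e = c , k} l h _) = ⇒HEdge {e = c , k} l (IsMatching.support pν c k h)
      hedge (fall {e = c , k} l h _) = ⇒HEdge {e = c , k} l (IsMatching.support p̂ c k h)
      one : ∀ {p} → p ∈ cycPairs (cycPairs D) → ExactlyOne M (map² (map² pos) p)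
      one {(t , t′) , (u , v)} i = go i (pairs-chain D i) (pair-in (cycPairs D) i)
        where
        go : ∀ {t t′ u v} → ((t , t′) , (u , v)) ∈ cycPairs (cycPairs D) → t′ ≡ u → (t , t′) ∈ cycPairs D × (u , v) ∈ cycPairs D →
          ExactlyOne M ((pos t , pos t′) , (pos u , pos v))
        go {t} {t′} {u} {v} i refl (j , j′) = split (All.lookup (Cycle.links cyc) j) (All.lookup (Cycle.links cyc) j′)
          where
          split : Linked₂ (t , t′) → Linked₂ (u , v) → ExactlyOne M ((pos t , pos t′) , (pos u , pos v))
          split (c , k , l) (d , r , l′) = (λ m m′ → true≢false (⇒edgesOf {M} l m) (trans alt (cong not (⇒edgesOf {M} l′ m′)))) ,
              (λ nm → edgesOf⇒ {M} l′ (≢false λ f → nm (edgesOf⇒ {M} l (trans alt (cong not f)))))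
            where
            alt : m̂ c k ≡ not (m̂ d r)
            alt = C.zag-alternates cyc zs {e = c , k} {f = d , r} i l l′

  open AltCycle using (D; cyc; zs; signed; cut; malt; matching-edge; module A; module C)

  -- Comparing the crossed arcs suffices, since by `determined` they determine the set.
  Tight : Cut → Set
  Tight Z = Dicut Z × ∃[ α ] (∀ e → cross (cutOf (signed α)) e ≡ cross Z e)

  -- The boundary of a cut contains an alternating cycle.
  tighten : ∀ {Z} → Dicut Z → ¬ ¬ (Tight Z ⊎ Shrink Z)
  tighten {Z} dZ k = Cycles.alternating p̂ pν start λ { (D , cyc , zs) → k (use (record { D = D ; cyc = cyc ; ν = ν ; pν = pν ; zs = zs })
                       (λ c j on m → [ proj₁ , (λ h → ⊥-elim (true≢false (proj₁ h) m)) ]′ (Cycles.zag-edge p̂ pν {D} zs c j on))) }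
    where
    Y = proj₂ (member Z)
    ν : Edges
    ν = rotate m̂ Y
    pν : IsMatching Hc ν
    pν = rotate-matching p̂ {proj₁ (member Z)} {Y} (dicut⇒cut dZ)
    start : ∃[ e ] (ν $ᵉ e ≡ true × m̂ $ᵉ e ≡ false)
    start = let e , x = conn Z dZ in lookup arcs e , rotate-sep {m̂} {Y} (arc-free e) (cross-sep {Z} e x) , arc-free e
    use : (α : AltCycle) → (∀ c j → onEdge (D α) c j ≡ true → m̂ c j ≡ false → ν c j ≡ true) → Tight Z ⊎ Shrink Z
    use α in-ν = decide (Finₚ.all? λ e → (cross Z e Boolₚ.≟ true) →-dec (cross Z′ e Boolₚ.≟ true))
      where
      Z′ = cutOf (signed α)
      dZ′ : Dicut Z′
      dZ′ = cut⇒dicut (cut α)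
      sub : ∀ e → cross Z′ e ≡ true → cross Z e ≡ true
      sub e x = let c , j = lookup arcs e in sep-cross {Z} (proj₁ dZ) e (sep-rotate {m̂} {Y}
        (in-ν c j (Inside.sep⇒on (cyc α) c j (proj₁ (cutOf-cross (cut α) e) x)) (arc-free e)) (arc-free e))
      decide : Dec (∀ e → cross Z e ≡ true → cross Z′ e ≡ true) → Tight Z ⊎ Shrink Z
      decide (yes h) = inj₁ (dZ , α , λ e → bool-ext (sub e) (h e))
      decide (no n) = inj₂ (Z′ , dZ′ , sub , strict (Finₚ.¬∀⟶∃¬ _ _ (λ e → (cross Z e Boolₚ.≟ true) →-dec (cross Z′ e Boolₚ.≟ true)) n))
        where
        strict : ∃[ e ] (¬ (cross Z e ≡ true → cross Z′ e ≡ true)) → count (cross Z′) < count (cross Z)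
        strict (e , ne) = count-strict sub e (≢true λ x → ne λ _ → x) (≢false λ f → ne λ x → ⊥-elim (true≢false x f))

  tight-value : ∀ {Z} (t : Tight Z) c → Z (pt c) ≡ inside (D (proj₁ (proj₂ t))) c xor not (A.sign (proj₁ (proj₂ t)))
  tight-value {Z} (dZ , α , eq) c = trans (sym (determined (cut⇒dicut (cut α)) dZ eq (pt c))) (cutOf-pt (cut α) c)

  tight-outer : ∀ {Z} (t : Tight Z) → Z Fin.zero ≡ not (A.sign (proj₁ (proj₂ t)))
  tight-outer {Z} (dZ , α , eq) = sym (determined (cut⇒dicut (cut α)) dZ eq Fin.zero)

  -- A common unmatched edge would be an arc crossed by both cuts. At a common vertex both cycles
  -- run along the matched edge there, so they share an edge.
  compatible : ∀ {Z Z′} (t : Tight Z) (t′ : Tight Z′) → NoCommon Z Z′ →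
    Compatible M (map pos (D (proj₁ (proj₂ t)))) (map pos (D (proj₁ (proj₂ t′))))
  compatible {Z} {Z′} (dZ , α , eq) (dZ′ , β , eq′) nc = inj₂ (shared , vertex)
    where
    both : ∀ c k → onEdge (D α) c k ≡ true → onEdge (D β) c k ≡ true → m̂ c k ≡ true
    both c k on on′ = ≢false λ m → let e , q = arc c k m (C.zag-touches α (cyc α) (zs α) c k on) in
      nc e (trans (sym (eq e)) (proj₂ (cutOf-cross (cut α) e) (at (D α) q (Inside.on⇒sep (cyc α) c k on))))
           (trans (sym (eq′ e)) (proj₂ (cutOf-cross (cut β) e) (at (D β) q (Inside.on⇒sep (cyc β) c k on′))))
      where
      at : ∀ E {c k e} → lookup arcs e ≡ (c , k) → inside E c ≢ inside E (fw true k c) →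
        inside E (proj₁ (lookup arcs e)) ≢ inside E (fw true (proj₂ (lookup arcs e)) (proj₁ (lookup arcs e)))
      at E q ne = subst (λ f → inside E (proj₁ f) ≢ inside E (fw true (proj₂ f) (proj₁ f))) (sym q) ne
    LinkForm : V → V → Set
    LinkForm u v = ∃[ t ] ∃[ t′ ] ∃[ e ] (Linkᵉ t t′ e × u ≡ pos t × v ≡ pos t′)
    link-of : ∀ {u v} → OnCycle (map pos (D α)) u v → LinkForm u v
    link-of (inj₁ i) = go (∈-map⁻ (map² pos) (subst (_ ∈_) (cycPairs-map pos (D α)) i))
      where
      go : ∀ {u v} → ∃[ p ] (p ∈ cycPairs (D α) × (u , v) ≡ map² pos p) → LinkForm u v
      go ((t , t′) , j , refl) = let c , k , l = All.lookup (Cycle.links (cyc α)) j in t , t′ , (c , k) , l , refl , refl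
    link-of (inj₂ i) = go (∈-map⁻ (map² pos) (subst (_ ∈_) (cycPairs-map pos (D α)) i))
      where
      go : ∀ {u v} → ∃[ p ] (p ∈ cycPairs (D α) × (v , u) ≡ map² pos p) → LinkForm u v
      go ((t , t′) , j , refl) = let c , k , l = All.lookup (Cycle.links (cyc α)) j in t′ , t , (c , k) , link-sym l , refl , refl
    shared : ∀ u v → OnCycle (map pos (D α)) u v → OnCycle (map pos (D β)) u v → InE M u v
    shared u v o o′ = go (link-of o) o o′
      where
      go : ∀ {u v} → LinkForm u v → OnCycle (map pos (D α)) u v → OnCycle (map pos (D β)) u v → InE M u v
      go (t , t′ , (c , k) , l , refl , refl) o o′ = edgesOf⇒ {M} l (both c k (OnCycle⇒ (cyc α) l o) (OnCycle⇒ (cyc β) l o′))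
    Common : V → Set
    Common v = ∃[ u ] (OnCycle (map pos (D α)) v u × OnCycle (map pos (D β)) v u)
    Partner : AltCycle → Vtx → Set
    Partner γ t = ∃[ t′ ] ∃[ e ] (Linkᵉ t t′ e × m̂ $ᵉ e ≡ true × onEdge (D γ) (proj₁ e) (proj₂ e) ≡ true)
    meet : ∀ {t} → Partner α t → Partner β t → Common (pos t)
    meet {t} (u , e , l , h , on) (u′ , f , l′ , h′ , on′) = around (touch-around {Hc} l (IsMatching.support p̂ (proj₁ e) (proj₂ e) h))
      where
      around : ∃[ c ] (Around t c × Hc c ≡ true) → Common (pos t)
      around (c , ar , hc) = pos u , ⇒OnCycle {D α} l on , ⇒OnCycle {D β} l
        (subst (λ g → onEdge (D β) (proj₁ g) (proj₂ g) ≡ true) (sym (star-unique {m̂} (matched p̂ ar hc) l l′ h h′)) on′)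
    vertex : ∀ v → v ∈ map pos (D α) → v ∈ map pos (D β) → Common v
    vertex v i i′ = go (∈-map⁻ pos i) (∈-map⁻ pos i′)
      where
      go : ∀ {v} → ∃[ t ] (t ∈ D α × v ≡ pos t) → ∃[ t ] (t ∈ D β × v ≡ pos t) → Common v
      go (t , j , refl) (t₁ , j′ , q) = meet (matching-edge α t j) (matching-edge β t (subst (_∈ D β) (sym (pos-injective {t} {t₁} q)) j′))

  nonCrossing : ∀ {Z Z′} (t : Tight Z) (t′ : Tight Z′) → CrossFree Z Z′ →
    NonCrossingPair (map pos (D (proj₁ (proj₂ t)))) (map pos (D (proj₁ (proj₂ t′))))
  nonCrossing t t′ cf = translate (nested (A.sign α) (A.sign β) (tight-value t) (tight-value t′) (tight-outer t) (tight-outer t′) cf)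
    where
    α = proj₁ (proj₂ t)
    β = proj₁ (proj₂ t′)
    I J : Region
    I = inside (D α)
    J = inside (D β)
    translate : (∀ c → I c ≡ true → J c ≡ true → ⊥) ⊎ (∀ c → I c ≡ true → J c ≡ true) ⊎ (∀ c → J c ≡ true → I c ≡ true) →
      NonCrossingPair (map pos (D α)) (map pos (D β))
    translate (inj₁ h)        = inj₁ λ c a b → h c (Inside⇒ {D α} {c} a) (Inside⇒ {D β} {c} b)
    translate (inj₂ (inj₁ h)) = inj₂ (inj₁ λ c a → ⇒Inside {D β} {c} (h c (Inside⇒ {D α} {c} a)))
    translate (inj₂ (inj₂ h)) = inj₂ (inj₂ λ c a → ⇒Inside {D α} {c} (h c (Inside⇒ {D β} {c} a)))

  NCSet : List (List V) → Set
  NCSet = NCCompatibleAltSet H M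

  tight-cycles : ∀ {G} → All Tight G → AllPairs CrossFree G → AllPairs NoCommon G → ∃[ A′ ] (NCSet A′ × length A′ ≡ length G)
  tight-cycles {G} ts cf nc = map cycle xs , (Allₚ.map⁺ (All.universal (λ x → malt (proj₁ (proj₂ (proj₂ x)))) xs) ,
      AllPairs-lookup {R = R} (λ {C} {E} (a , b) → Compatible-sym {M} {C} {E} a , NonCrossing-sym {C} {E} b)
        (AllPairsₚ.map⁺ (AllPairs.zipWith (λ {x} {y} (a , b) → compatible (proj₂ x) (proj₂ y) b , nonCrossing (proj₂ x) (proj₂ y) a)
          (AllPairsₚ.map⁻ (subst (AllPairs CrossFree) (sym (toList-fst ts)) cf) , AllPairsₚ.map⁻ (subst (AllPairs NoCommon) (sym (toList-fst ts)) nc))))) ,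
    trans (length-map cycle xs) (length-toList ts)
    where
    xs : List (∃ Tight)
    xs = All.toList ts
    cycle : ∃ Tight → List V
    cycle (Z , _ , α , _) = map pos (D α)
    R : List V → List V → Set
    R C E = Compatible M C E × NonCrossingPair C E

  cycles-from : ∀ F → All Dicut F → (∀ e → load e F ≤ 1) → ¬ ¬ (∃[ A′ ] (NCSet A′ × length A′ ≡ length F))
  cycles-from F dF lF k = Reduce.reduced Tight tighten F dF lF λ { (G , ts , cf , nc , len) →
    let A′ , ncA , lenA = tight-cycles ts cf nc in k (A′ , ncA , trans lenA len) }

  module Maximal (a : ℕ) (max : ∀ A′ → NCSet A′ → length A′ ≤ a) where

    cuts≤ : ∀ F → All Dicut F → (∀ e → load e F ≤ 1) → length F ≤ a
    cuts≤ F dF lF = decidable-stable (length F ℕₚ.≤? a) λ n → cycles-from F dF lF λ { (A′ , nc , len) →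
      n (subst (_≤ a) len (max A′ nc)) }

    max₀ : ∀ n (G : Fin n → Member) → Packing Hc m̂ G → n ≤ a
    max₀ n G pk = subst (_≤ a) (length-tabulate (cutOf ∘ G)) (cuts≤ (tabulate (cutOf ∘ G))
      (Allₚ.tabulate⁺ (λ i → cut⇒dicut (Packing.cut pk i)))
      (load≤1 (AllPairs-tabulate λ i j ne e x y → Packing.disjoint pk i j ne _ _ (arc-free e)
        (proj₁ (cutOf-cross (Packing.cut pk i) e) x) (proj₁ (cutOf-cross (Packing.cut pk j) e) y))))

    -- As `a + 1` disjoint cuts do not exist, the minimax theorem supplies at most `a` arcs meeting
    -- all cuts, and their edges form an anti-forcing set.
    af≤ : ∀ k → AfValue H M k → k ≤ a
    af≤ k (_ , least) = decidable-stable (k ℕₚ.≤? a) λ n →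
      LucchesiYounger.transversal conn _ (λ _ → true) ℕₚ.≤-refl a no-more λ { (S , uS , lS , _ , hit) →
        n (ℕₚ.≤-trans (least (map vEdge (map (lookup arcs) S))
            (antiforcing M pm (map (lookup arcs) S) nonM (λ Y c → met S hit Y c))
            (distinct (Uniqueₚ.map⁺ (Unique-lookup (free-unique m̂)) uS)))
          (ℕₚ.≤-trans (ℕₚ.≤-reflexive (trans (length-map vEdge (map (lookup arcs) S)) (length-map (lookup arcs) S))) lS)) }
      where
      no-more : ¬ HasPacking (LucchesiYounger.cap conn (λ _ → true)) (suc a)
      no-more (F , dF , le , len) = ℕₚ.<⇒≱ len (cuts≤ F dF le)
      nonM : ∀ {S} e → e ∈ map (lookup arcs) S → m̂ $ᵉ e ≡ false × Touches Hc e
      nonM e i = go (∈-map⁻ (lookup arcs) i)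
        where
        go : ∀ {e} → ∃[ j ] (j ∈ _ × e ≡ lookup arcs j) → m̂ $ᵉ e ≡ false × Touches Hc e
        go (j , _ , refl) = free-out m̂ _ (∈-lookup {xs = arcs} j)
      met : ∀ S → (∀ Z → Dicut Z → (∀ e → cross Z e ≡ true → true ≡ true) → ∃[ e ] (e ∈ S × cross Z e ≡ true)) →
        ∀ Y → IsCut Hc m̂ Y → ∃[ e ] (e ∈ map (lookup arcs) S × proj₂ Y (proj₁ e) ≢ proj₂ Y (fw true (proj₂ e) (proj₁ e)))
      met S hit Y c = let e , i , x = hit (cutOf Y) (cut⇒dicut c) (λ _ _ → refl) in
        lookup arcs e , ∈-map⁺ (lookup arcs) i , proj₁ (cutOf-cross c e) x
  -- The bound speaks of an attained minimum, which has to be exhibited: the set of all unmatched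
  -- edges is anti-forcing, so a smallest anti-forcing set exists, and it has a separate edge for
  -- every cut of the packing.
  packing≤af : ∀ K → (∀ k → AfValue H M k → k ≤ K) → ∀ n (F : Fin n → Member) → Packing Hc m̂ F → n ≤ K
  packing≤af K af n F pk = decidable-stable (n ℕₚ.≤? K) λ ¬le →
    ¬¬-least {P = Size} (length (map vEdge arcs)) (map vEdge arcs , all-free , distinct (free-unique m̂) , refl) λ { (k , (S , aS , dS , refl) , least) →
      ¬le (ℕₚ.≤-trans (packing≤ M pm S aS n F pk) (af k ((S , aS , dS , refl) , λ S′ a′ d′ → least _ (S′ , a′ , d′ , refl)))) }
    where
    Size : ℕ → Set
    Size k = ∃[ S ] (AntiForcing H M S × DistinctEdges S × length S ≡ k)
    all-free : AntiForcing H M (map vEdge arcs)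
    all-free = antiforcing M pm arcs (free-out m̂) λ Y c → let e , x = conn (cutOf Y) (cut⇒dicut c) in
      lookup arcs e , ∈-lookup e , proj₁ (cutOf-cross c e) x

module _ (H : HexSystem) (D₀ : List Vtx) (B≡ : bd H ≡ map pos D₀) (cyc₀ : Cycle D₀) where

  open Forcing H D₀ B≡ cyc₀

  packing≤AfMax : ∀ K → AfMax H K → ∀ μ′ → IsMatching Hc μ′ → ∀ n (F : Fin n → Member) → Packing Hc μ′ F → n ≤ K
  packing≤AfMax K (_ , af) μ′ pm′ n F pk = Families.packing≤af H D₀ B≡ cyc₀ M′ pmM′ K (λ k → af M′ k pmM′) n F
      (packing-cong (λ c k → bool-ext (λ h → ⇒edgesOf {M′} (wb c k) (⇒listOf pm′ (wb c k) h))
                                      (λ h → listOf-link pm′ (wb c k) (edgesOf⇒ {M′} (wb c k) h))) pk)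
    where
    M′ = listOf μ′
    pmM′ : PerfectMatching H M′
    pmM′ = fromMatching pm′ (λ l h → ⇒HEdge l (IsMatching.support pm′ _ _ h))

-- Straight chains

-- A linear form whose level sets are the lines of cells in the direction `k`.
φ : Dir → Cell → ℤ
φ d0 (p , q) = q
φ d1 (p , q) = p
φ d2 (p , q) = p ℤ.- q

φ-fw : ∀ s k c → φ k (fw s k c) ≡ φ k c
φ-fw true  d0 c = refl
φ-fw false d0 c = refl
φ-fw true  d1 c = refl
φ-fw false d1 c = refl
φ-fw true  d2 (p , q) = solve 2 (λ p q → (con (+ 1) :+ p) :- (con (+ 1) :+ q) := p :- q) refl p q
  where open +-*-Solver
φ-fw false d2 (p , q) = solve 2 (λ p q → (con -[1+ 0 ] :+ p) :- (con -[1+ 0 ] :+ q) := p :- q) refl p q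
  where open +-*-Solver

φ-≢ : ∀ s {i k} → i ≢ k → ∀ c → φ k (fw s i c) ≢ φ k c
φ-≢ s     {d0} {d0} ne c e = ne refl
φ-≢ true  {d0} {d1} ne c e = pred≢ e
φ-≢ false {d0} {d1} ne c e = suc≢ e
φ-≢ true  {d0} {d2} ne (p , q) e = pred≢ (trans (sym (ℤₚ.+-assoc -[1+ 0 ] p (ℤ.- q))) e)
φ-≢ false {d0} {d2} ne (p , q) e = suc≢ (trans (sym (ℤₚ.+-assoc (+ 1) p (ℤ.- q))) e)
φ-≢ true  {d1} {d0} ne c e = pred≢ e
φ-≢ false {d1} {d0} ne c e = suc≢ e
φ-≢ s     {d1} {d1} ne c e = ne refl
φ-≢ true  {d1} {d2} ne (p , q) e = suc≢ (trans (solve 2 (λ p q → con (+ 1) :+ (p :- q) := p :- (con -[1+ 0 ] :+ q)) refl p q) e)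
  where open +-*-Solver
φ-≢ false {d1} {d2} ne (p , q) e = pred≢ (trans (solve 2 (λ p q → con -[1+ 0 ] :+ (p :- q) := p :- (con (+ 1) :+ q)) refl p q) e)
  where open +-*-Solver
φ-≢ true  {d2} {d0} ne c e = suc≢ e
φ-≢ false {d2} {d0} ne c e = pred≢ e
φ-≢ true  {d2} {d1} ne c e = suc≢ e
φ-≢ false {d2} {d1} ne c e = pred≢ e
φ-≢ s     {d2} {d2} ne c e = ne refl

φ-iter : ∀ s k n c → φ k (iter n (fw s k) c) ≡ φ k c
φ-iter s k zero    c = refl
φ-iter s k (suc n) c = trans (φ-fw s k (iter n (fw s k) c)) (φ-iter s k n c)

Straight : Dir → Region → Set
Straight k X = ∀ c d → X c ≡ true → X d ≡ true → φ k c ≡ φ k d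

chain-straight : ∀ {μ s X} (ch : Chain μ s X) → Straight (Chain.dir ch) X
chain-straight {s = s} {X} ch c d x y = trans (on-line c x) (sym (on-line d y))
  where
  on-line : ∀ c → X c ≡ true → φ (Chain.dir ch) c ≡ φ (Chain.dir ch) (Chain.start ch)
  on-line c x = let n , e = Chain.line ch c x in
    trans (cong (φ (Chain.dir ch)) e) (φ-iter s (Chain.dir ch) n (Chain.start ch))

straight-collinear : ∀ k {X} → Straight k X → ∀ c₁ c₂ c₃ → X c₁ ≡ true → X c₂ ≡ true → X c₃ ≡ true → Collinear c₁ c₂ c₃
straight-collinear k {X} st c₁ c₂ c₃ x₁ x₂ x₃ = go k c₁ c₂ c₃ (st c₂ c₁ x₂ x₁) (st c₃ c₁ x₃ x₁)
  where
  open +-*-Solver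
  go : ∀ k c₁ c₂ c₃ → φ k c₂ ≡ φ k c₁ → φ k c₃ ≡ φ k c₁ → Collinear c₁ c₂ c₃
  go d0 (p₁ , q) (p₂ , _) (p₃ , _) refl refl =
    solve 4 (λ p₁ p₂ p₃ q → (p₂ :- p₁) :* (q :- q) :- (q :- q) :* (p₃ :- p₁) := con (+ 0)) refl p₁ p₂ p₃ q
  go d1 (p , q₁) (_ , q₂) (_ , q₃) refl refl =
    solve 4 (λ p q₁ q₂ q₃ → (p :- p) :* (q₃ :- q₁) :- (q₂ :- q₁) :* (p :- p) := con (+ 0)) refl p q₁ q₂ q₃
  go d2 (p₁ , q₁) (p₂ , q₂) (p₃ , q₃) e e′ = trans
    (solve 6 (λ p₁ q₁ p₂ q₂ p₃ q₃ → (p₂ :- p₁) :* (q₃ :- q₁) :- (q₂ :- q₁) :* (p₃ :- p₁) :=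
       ((p₂ :- q₂) :- (p₁ :- q₁)) :* (q₃ :- q₁) :- (q₂ :- q₁) :* ((p₃ :- q₃) :- (p₁ :- q₁))) refl p₁ q₁ p₂ q₂ p₃ q₃)
    (trans (cong₂ (λ a b → (a ℤ.- (p₁ ℤ.- q₁)) ℤ.* (q₃ ℤ.- q₁) ℤ.- (q₂ ℤ.- q₁) ℤ.* (b ℤ.- (p₁ ℤ.- q₁))) e e′)
      (solve 4 (λ p₁ q₁ q₂ q₃ → ((p₁ :- q₁) :- (p₁ :- q₁)) :* (q₃ :- q₁) :- (q₂ :- q₁) :* ((p₁ :- q₁) :- (p₁ :- q₁)) := con (+ 0)) refl p₁ q₁ q₂ q₃))

adjacent : ∀ {c d} → AdjCell c d → ∃[ s ] ∃[ k ] d ≡ fw s k c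
adjacent {c} {d} (ne , u , v , e , e′) = go (CellEdge⇒linked {c} e) (CellEdge⇒linked {d} e′)
  where
  Result : Set
  Result = ∃[ s ] ∃[ k ] d ≡ fw s k c
  sides : ∀ {e k} → e ≡ c ⊎ fw true k e ≡ c → e ≡ d ⊎ fw true k e ≡ d → Result
  sides (inj₁ p) (inj₁ q) = ⊥-elim (ne (trans (sym p) q))
  sides {k = k} (inj₁ p) (inj₂ q) = true , k , trans (sym q) (cong (fw true k) p)
  sides {e} {k} (inj₂ p) (inj₁ q) = false , k , trans (sym q) (trans (sym (fw-inv′ true k e)) (cong (fw false k) p))
  sides (inj₂ p) (inj₂ q) = ⊥-elim (ne (trans (sym p) q))
  go : Linked c u v → Linked d u v → Result
  go (linked {t} {t′} l p q side) (linked {t₁} {t₁′} {cell} {dir} l₁ p₁ q₁ side₁) = sides side (same (link-unique l l₁′) side₁)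
    where
    l₁′ : Link t t′ cell dir
    l₁′ = subst₂ (λ a b → Link a b cell dir) (sym (pos-injective {t} {t₁} (trans (sym p) p₁))) (sym (pos-injective {t′} {t₁′} (trans (sym q) q₁))) l₁
    same : ∀ {x y} → x ≡ y → (proj₁ y ≡ d ⊎ fw true (proj₂ y) (proj₁ y) ≡ d) → proj₁ x ≡ d ⊎ fw true (proj₂ x) (proj₁ x) ≡ d
    same refl s = s

straight-degree : ∀ k {X} → Straight k X → ∀ c → X c ≡ true → ∀ d₁ d₂ d₃ → X d₁ ≡ true → X d₂ ≡ true → X d₃ ≡ true →
  AdjCell c d₁ → AdjCell c d₂ → AdjCell c d₃ → d₁ ≢ d₂ → d₁ ≢ d₃ → d₂ ≢ d₃ → ⊥
straight-degree k {X} st c x d₁ d₂ d₃ x₁ x₂ x₃ a₁ a₂ a₃ n₁₂ n₁₃ n₂₃ = pigeon (along d₁ x₁ a₁) (along d₂ x₂ a₂) (along d₃ x₃ a₃)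
  where
  along : ∀ d → X d ≡ true → AdjCell c d → ∃[ s ] d ≡ fw s k c
  along d y a with adjacent {c} {d} a
  ... | s , i , e with i ≟ᵈ k
  ... | yes refl = s , e
  ... | no ne    = ⊥-elim (φ-≢ s ne c (trans (cong (φ k) (sym e)) (st d c y x)))
  pigeon : ∃[ s ] d₁ ≡ fw s k c → ∃[ s ] d₂ ≡ fw s k c → ∃[ s ] d₃ ≡ fw s k c → ⊥
  pigeon (true  , e) (true  , f) _           = n₁₂ (trans e (sym f))
  pigeon (false , e) (false , f) _           = n₁₂ (trans e (sym f))
  pigeon (true  , e) (false , f) (true  , g) = n₁₃ (trans e (sym g))
  pigeon (true  , e) (false , f) (false , g) = n₂₃ (trans f (sym g))
  pigeon (false , e) (true  , f) (true  , g) = n₂₃ (trans f (sym g))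
  pigeon (false , e) (true  , f) (false , g) = n₁₃ (trans e (sym g))

module _ {D : List Vtx} (cyc : Cycle D) where

  open Inside cyc

  -- The three cells around a vertex are not in line, so no vertex is interior.
  straight-vertex : ∀ k → Straight k X → ∀ {t c} → Around t c → X c ≡ true → t ∈ D
  straight-vertex k st {t} {c} ar x = go (place t)
    where
    bent : ∀ k → Straight k X → ∀ t → ¬ Interior t
    bent k st (W a) int = two (d0 ≟ᵈ k)
      where
      at : ∀ {c d} → Around (W a) c → Around (W a) d → φ k c ≡ φ k d
      at {c} {d} x y = st c d (int c x) (int d y)
      two : Dec (d0 ≡ k) → ⊥
      two (yes refl) = φ-≢ false {d2} {k} (λ ()) a (at (w₂ a) (w₀ a))
      two (no ne)    = φ-≢ true ne a (at (w₁ a) (w₀ a))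
    bent k st (B a) int = two (d1 ≟ᵈ k)
      where
      at : ∀ {c d} → Around (B a) c → Around (B a) d → φ k c ≡ φ k d
      at {c} {d} x y = st c d (int c x) (int d y)
      two : Dec (d1 ≡ k) → ⊥
      two (yes refl) = φ-≢ false {d2} {k} (λ ()) a (at (b₂ a) (b₀ a))
      two (no ne)    = φ-≢ true ne a (at (b₁ a) (b₀ a))
    go : Place t → t ∈ D
    go (interior int) = ⊥-elim (bent k st t int)
    go (exterior ext) = ⊥-elim (true≢false x (ext c ar))
    go (on-cycle i)   = i

  straight-linear : ∀ k → Straight k X → LinearChainI (map pos D)
  straight-linear k st =
    (λ c v i cv → on-boundary (cellVertex⇒around c cv) (Inside⇒ {D} {c} i)) ,
    (λ { c i (d₁ , d₂ , d₃ , i₁ , i₂ , i₃ , a₁ , a₂ , a₃ , n₁₂ , n₁₃ , n₂₃) →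
      straight-degree k st c (Inside⇒ {D} {c} i) d₁ d₂ d₃ (Inside⇒ {D} {d₁} i₁) (Inside⇒ {D} {d₂} i₂) (Inside⇒ {D} {d₃} i₃) a₁ a₂ a₃ n₁₂ n₁₃ n₂₃ }) ,
    (λ c₁ c₂ c₃ i₁ i₂ i₃ → straight-collinear k st c₁ c₂ c₃ (Inside⇒ {D} {c₁} i₁) (Inside⇒ {D} {c₂} i₂) (Inside⇒ {D} {c₃} i₃))
    where
    on-boundary : ∀ {c v} → ∃[ t ] (v ≡ pos t × Around t c) → X c ≡ true → v ∈ map pos D
    on-boundary (t , refl , ar) x = ∈-map⁺ pos (straight-vertex k st ar x)

-- Two nested chains

module _ {Hc : Region} {μ : Edges} (pm : IsMatching Hc μ) where

  open Hexes pm

  chains-not-nested : ∀ {s s′ X X′} → IsCut Hc μ (s , X) → Chain μ s X → Chain μ s′ X′ →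
    (∀ c → X′ c ≡ true → X c ≡ true) → NoConflict μ X X′ → ⊥
  chains-not-nested {s} {s′} {X} {X′} cut ch ch′ X′⊆X nc = go (sgn s′ s) (another k (Chain.dir ch′))
    where
    k  = Chain.dir ch
    b′ = Chain.start ch′
    x′ : X b′ ≡ true
    x′ = X′⊆X b′ (Chain.inY ch′)
    h′ : Hc b′ ≡ true
    h′ = IsCut.inside cut b′ x′
    go : s′ ≡ s ⊎ s′ ≡ not s → ∃[ i ] (i ≢ k × i ≢ Chain.dir ch′) → ⊥
    -- For equal signs both chains start at the same cell. The direction `i` avoids both chain
    -- directions, so the side there is unmatched and bounds both regions.
    go (inj₁ refl) (i , n , n′) = noConflict {μ} {X} {X′} nc s b′ i (hex-fwd {s} h′ (Chain.hex ch′) i)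
        (λ e → true≢false x′ (trans e (trans (cong (λ z → X (fw s i z)) same) (Chain.flanks ch i n))))
        (λ e → true≢false (Chain.inY ch′) (trans e (Chain.flanks ch′ i n′)))
      where
      same : b′ ≡ Chain.start ch
      same = Chain.unique ch b′ x′ (Chain.hex ch′)
    -- For opposite signs the sides of `b′` along `not s` are unmatched, and closedness of the outer
    -- cut puts the cells behind them into `X`; one of them is off the line of the outer chain.
    go (inj₂ refl) (i , n , _) = φ-≢ (not s) n b′ (chain-straight ch (fw (not s) i b′) b′ below x′)
      where
      below : X (fw (not s) i b′) ≡ true
      below = IsCut.closed cut (fw (not s) i b′) i
        (trans (across-back μ s b′ i) (hex-fwd {not s} h′ (Chain.hex ch′) i))
        (trans (cong X (fw-inv s i b′)) x′)

-- The three conditions end in a membership, an absurdity and an equation of integers, all stable,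
-- so it suffices to find the chain under double negation.
linear-stable : ∀ {C} → ¬ ¬ LinearChainI C → LinearChainI C
linear-stable {C} nn =
  (λ c v i cv → decidable-stable (Any.any? (v ≟ᶜ_) C) λ n → nn λ l → n (proj₁ l c v i cv)) ,
  (λ c i h → nn λ l → proj₁ (proj₂ l) c i h) ,
  (λ c₁ c₂ c₃ i₁ i₂ i₃ → decidable-stable (_ ℤ.≟ + 0) λ n → nn λ l → n (proj₂ (proj₂ l) c₁ c₂ c₃ i₁ i₂ i₃))

-- From the given alternating set to chains

module AltCycles (H : HexSystem) (D₀ : List Vtx) (B≡ : bd H ≡ map pos D₀) (cyc₀ : Cycle D₀)
  (M : EdgeSet) (pm : PerfectMatching H M) where

  open System H D₀ B≡ cyc₀ public

  m̂ : Edges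
  m̂ = edgesOf M

  p̂ : IsMatching Hc m̂
  p̂ = toMatching (λ h → h) {M} pm

  record Bounded (C : List V) : Set where
    field
      D    : List Vtx
      C≡   : C ≡ map pos D
      cyc  : Cycle D
      sign : Bool
      cut  : IsCut Hc m̂ (sign , inside D)

  bounded : ∀ {C} → MAltCycle H M C → Bounded C
  bounded {C} (isC , ones) = go (toCycle {HEdge H} HEdge⇒Lat isC) (proj₂ (proj₂ isC)) ones
    where
    go : ∃[ D ] (C ≡ map pos D × Cycle D) → All (λ e → HEdge H (proj₁ e) (proj₂ e)) (cycPairs C) →
      All (ExactlyOne M) (cycPairs (cycEdges C)) → Bounded C
    go (D , refl , cyc) edges ones = record { D = D ; C≡ = refl ; cyc = cyc ; sign = A.sign ; cut = A.isCut }
      where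
      touches : ∀ c k → onEdge D c k ≡ true → Touches Hc (c , k)
      touches c k on = found (onEdge-link {D} {c} {k} on)
        where
        found : ∃[ t ] ∃[ t′ ] ((t , t′) ∈ cycPairs D × Link t t′ c k) → Touches Hc (c , k)
        found (t , t′ , i , l) = let e , l′ , tch = HEdge-link {t} {t′} (All.lookup edges (pairs⁺ {D} i)) in
          subst (Touches Hc) (link-unique l′ l) tch
      alternates : ∀ {t t′ v e f} → ((t , t′) , (t′ , v)) ∈ cycPairs (cycPairs D) → Linkᵉ t t′ e → Linkᵉ t′ v f → m̂ $ᵉ e ≡ not (m̂ $ᵉ f)
      alternates {t} {t′} {v} {e} {f} i l l′ = decide (bool-cases (m̂ $ᵉ e))
        where
        one : ExactlyOne M ((pos t , pos t′) , (pos t′ , pos v))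
        one = All.lookup ones (subst (((pos t , pos t′) , (pos t′ , pos v)) ∈_)
          (sym (trans (cong cycPairs (cycPairs-map pos D)) (cycPairs-map (map² pos) (cycPairs D)))) (∈-map⁺ (map² (map² pos)) i))
        decide : m̂ $ᵉ e ≡ true ⊎ m̂ $ᵉ e ≡ false → m̂ $ᵉ e ≡ not (m̂ $ᵉ f)
        decide (inj₁ m) = trans m (sym (cong not (≢true λ m′ →
          proj₁ one (edgesOf⇒ {M} {c = proj₁ e} {proj₂ e} l m) (edgesOf⇒ {M} {c = proj₁ f} {proj₂ f} l′ m′))))
        decide (inj₂ n) = trans n (sym (cong not (⇒edgesOf {M} {c = proj₁ f} {proj₂ f} l′
          (proj₂ one λ m → true≢false (⇒edgesOf {M} {c = proj₁ e} {proj₂ e} l m) n))))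
      module A = Alternating p̂ cyc touches (Subsystem.inside⊆ cyc₀ cyc touches) alternates

  region : ∀ {C} → Bounded C → Region
  region b = inside (Bounded.D b)

  Inside⇔ : ∀ {C} (b : Bounded C) c → (Inside C c → region b c ≡ true) × (region b c ≡ true → Inside C c)
  Inside⇔ b c = subst (λ C → (Inside C c → inside D c ≡ true) × (inside D c ≡ true → Inside C c)) (sym (Bounded.C≡ b))
      ((λ h → Inside⇒ {D} {c} h) , (λ h → ⇒Inside {D} {c} h))
    where D = Bounded.D b

  compatible⇒noConflict : ∀ {C C′} (b : Bounded C) (b′ : Bounded C′) → Compatible M C C′ → NoConflict m̂ (region b) (region b′)
  compatible⇒noConflict b b′ = go (Bounded.C≡ b) (Bounded.C≡ b′)
    where
    D  = Bounded.D b
    D′ = Bounded.D b′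
    go : ∀ {C C′} → C ≡ map pos D → C′ ≡ map pos D′ → Compatible M C C′ → NoConflict m̂ (inside D) (inside D′)
    go refl refl (inj₁ apart) c k m sep sep′ = apart _
      (∈-map⁺ pos (Inside.link-on (Bounded.cyc b) (wb c k) sep)) (∈-map⁺ pos (Inside.link-on (Bounded.cyc b′) (wb c k) sep′))
    go refl refl (inj₂ (shared , _)) c k m sep sep′ = true≢false (⇒edgesOf {M} (wb c k) (shared _ _
      (⇒OnCycle {D} (wb c k) (Inside.sep⇒on (Bounded.cyc b) c k sep))
      (⇒OnCycle {D′} (wb c k) (Inside.sep⇒on (Bounded.cyc b′) c k sep′)))) m

  nonCrossing⇒laminar : ∀ {C C′} (b : Bounded C) (b′ : Bounded C′) → NonCrossingPair C C′ → Laminar (region b) (region b′)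
  nonCrossing⇒laminar b b′ (inj₁ h) = inj₂ (inj₂ λ c x → ≢true λ x′ → h c (proj₂ (Inside⇔ b c) x) (proj₂ (Inside⇔ b′ c) x′))
  nonCrossing⇒laminar b b′ (inj₂ (inj₁ h)) = inj₁ λ c x → proj₁ (Inside⇔ b′ c) (h c (proj₂ (Inside⇔ b c) x))
  nonCrossing⇒laminar b b′ (inj₂ (inj₂ h)) = inj₂ (inj₁ λ c x → proj₁ (Inside⇔ b c) (h c (proj₂ (Inside⇔ b′ c) x)))

  module Family (A : List (List V)) (cycle : ∀ i → Bounded (lookup A i))
    (pairwise : ∀ i j → i ≢ j → Compatible M (lookup A i) (lookup A j) × NonCrossingPair (lookup A i) (lookup A j)) where

    F : Fin (length A) → Member
    F i = Bounded.sign (cycle i) , region (cycle i)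

    conflict-free : ∀ i j → i ≢ j → NoConflict m̂ (proj₂ (F i)) (proj₂ (F j))
    conflict-free i j ne = compatible⇒noConflict (cycle i) (cycle j) (proj₁ (pairwise i j ne))

    packing : Packing Hc m̂ F
    packing = record { cut = λ i → Bounded.cut (cycle i) ; disjoint = conflict-free }

    laminar : ∀ i j → Laminar (proj₂ (F i)) (proj₂ (F j))
    laminar i j with i Finₚ.≟ j
    ... | yes refl = inj₁ λ c x → x
    ... | no ne    = nonCrossing⇒laminar (cycle i) (cycle j) (proj₂ (pairwise i j ne))

    module _ (max₀ : ∀ n (G : Fin n → Member) → Packing Hc m̂ G → n ≤ length A)
      (max₁ : ∀ μ′ → IsMatching Hc μ′ → ∀ n (G : Fin n → Member) → Packing Hc μ′ G → n ≤ suc (length A)) where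

      chain : ∀ i → ¬ ¬ Chain m̂ (proj₁ (F i)) (proj₂ (F i))
      chain i k = Heights.height (Bounded.cyc (cycle i)) p̂ Hl fin (IsCut.inside (Bounded.cut (cycle i))) λ { (g , ht) →
        Finite.Improvement.improvement p̂ Hl fin max₀ max₁ (F i) g ht i F packing laminar refl k }

      nested⇒⊥ : ∀ i j → i ≢ j → (∀ c → proj₂ (F j) c ≡ true → proj₂ (F i) c ≡ true) → ⊥
      nested⇒⊥ i j ne sub = chain i λ ch → chain j λ ch′ →
        chains-not-nested p̂ (Bounded.cut (cycle i)) ch ch′ sub (conflict-free i j ne)

      disjoint-interiors : ∀ i j → i ≢ j → DisjointInteriors (lookup A i) (lookup A j)
      disjoint-interiors i j ne c h h′ = go (laminar i j)
        where
        go : Laminar (proj₂ (F i)) (proj₂ (F j)) → ⊥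
        go (inj₁ sub)        = nested⇒⊥ j i (ne ∘ sym) sub
        go (inj₂ (inj₁ sub)) = nested⇒⊥ i j ne sub
        go (inj₂ (inj₂ dis)) = true≢false (proj₁ (Inside⇔ (cycle j) c) h′) (dis c (proj₁ (Inside⇔ (cycle i) c) h))

      linear : ∀ i → LinearChainI (lookup A i)
      linear i = linear-stable λ n → chain i λ ch → n (subst LinearChainI (sym (Bounded.C≡ (cycle i)))
        (straight-linear (Bounded.cyc (cycle i)) (Chain.dir ch) (chain-straight ch)))

theorem3p1 : (H : HexSystem) (M : EdgeSet) → PerfectMatching H M →
    (k K : ℕ) → AfValue H M k → AfMax H K → (k ≡ K ⊎ k ≡ K ℕ.∸ 1) →
    (A : List (List V)) → NCCompatibleAltSet H M A →
    (∀ A′ → NCCompatibleAltSet H M A′ → length A′ ≤ length A) →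
    ((i j : Fin (length A)) → i ≢ j → DisjointInteriors (lookup A i) (lookup A j)) ×
    ((i : Fin (length A)) → LinearChainI (lookup A i))
theorem3p1 H M pm k K af afMax k≈K A nc max = go (toCycle (λ _ _ e → e) (proj₂ H))
  where
  -- The truncated difference makes `K = 0` a case of its own; otherwise `K` is `k` or `k + 1`.
  near : ∀ K → k ≤ length A → k ≡ K ⊎ k ≡ K ℕ.∸ 1 → K ≤ suc (length A)
  near K       le (inj₁ refl) = ℕₚ.m≤n⇒m≤1+n le
  near zero    le (inj₂ e)    = z≤n
  near (suc K) le (inj₂ refl) = s≤s le
  Goal : Set
  Goal = ((i j : Fin (length A)) → i ≢ j → DisjointInteriors (lookup A i) (lookup A j)) ×
    ((i : Fin (length A)) → LinearChainI (lookup A i))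
  go : ∃[ D₀ ] (bd H ≡ map pos D₀ × Cycle D₀) → Goal
  go (D₀ , B≡ , cyc₀) = disjoint-interiors max₀ max₁ , linear max₀ max₁
    where
    open AltCycles H D₀ B≡ cyc₀ M pm
    open Family A (λ i → bounded (All.lookup (proj₁ nc) (∈-lookup {xs = A} i))) (proj₂ nc)
    module Max = Families.Maximal H D₀ B≡ cyc₀ M pm (length A) max
    max₀ : ∀ n (G : Fin n → Member) → Packing Hc m̂ G → n ≤ length A
    max₀ = Max.max₀
    max₁ : ∀ μ′ → IsMatching Hc μ′ → ∀ n (G : Fin n → Member) → Packing Hc μ′ G → n ≤ suc (length A)
    max₁ μ′ pm′ n G pk = ℕₚ.≤-trans (packing≤AfMax H D₀ B≡ cyc₀ K afMax μ′ pm′ n G pk) (near K (Max.af≤ k af) k≈K)
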